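{- Let $\mathbb F$ be a subfield of $\mathbb R$ and let $d\ge3$. Then $\mathrm{SAT}_{\mathrm L(\mathbb F^d)}$ is $\mathrm{BP}(\mathcal{NP}^0_{\mathbb F})$-complete, and $\mathrm{SAT}_{\mathrm L(\mathbb F^d),\mathrm L(\mathbb F^d)}$ (strong satisfiability with constants) is $\mathcal{NP}_{\mathbb F}$-complete.
   Context: $\mathrm L(\mathbb F^d)$ is the ortholattice of all linear subspaces of $\mathbb F^d$ with $U\wedge V=U\cap V$, $U\vee V=U+V$, $\neg U=U^\perp$ (with respect to the standard scalar product), $0=\{\vec 0\}$, $1=\mathbb F^d$. An ortholattice term is built from variables with $\wedge,\vee,\neg,0,1$; $t_L(\bar a)$ is its value in the ortholattice $L$. $\mathrm{SAT}_L=\{\langle t\rangle:\exists\bar a\ t_L(\bar a)=1\}\subseteq\{0,1\}^*$, with $\langle t\rangle$ a standard binary encoding. $\mathrm{SAT}_{\mathrm L(\mathbb F^d),\mathrm L(\mathbb F^d)}$ is the set of $\langle t(x_1,\ldots,x_n,y_1,\ldots,y_m),C_1,\ldots,C_m\rangle$, with $t$ a term and $C_j\in\mathbb F^{d\times d}$ (encoded as $d^2$-element sequences over $\mathbb F$), for which there are $A_1,\ldots,A_n\in\mathbb F^{d\times d}$ with $t_{\mathrm L(\mathbb F^d)}(\mathrm{range}\,A_1,\ldots,\mathrm{range}\,A_n,\mathrm{range}\,C_1,\ldots,\mathrm{range}\,C_m)=1$, where range denotes the column span. A Blum-Shub-Smale (BSS) machine over a commutative ring $R$ stores, operates on ($+,-,\times$,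 and $\div$ if $R$ is a field) and compares ($=$, and also $<$ in the ordered case) elements of $R$ at unit cost, starting from an input tuple in $R^*=\bigcup_n R^n$ and finitely many constants from $R$. $\mathcal{NP}_R$ is the class of $\mathcal L\subseteq R^*$ decidable by nondeterministic polynomial-time BSS machines over $R$ (guessing elements of $R$); $\mathcal{NP}^0_R$ is the class obtained from machines without constants. For a class $\mathcal C$, $\mathrm{BP}(\mathcal C)=\{\mathcal L\cap\{0,1\}^*:\mathcal L\in\mathcal C\}$. Completeness for $\mathrm{BP}(\cdot)$ is under polynomial-time Turing-machine many-one reductions; completeness for $\mathcal{NP}_R$ is under polynomial-time many-one reductions by BSS machines over $R$.
   Formalization: BSS machines over the field compare elements only by =, not by <: with order tests the claim fails for some subfields of the reals; where < can be replaced by guessing squares, as over the reals and the rationals, the ordered classes coincide with those used here. -}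

module Defs where

open import Level using (Lift; 0ℓ) renaming (suc to lsuc)
open import Algebra.Bundles using (CommutativeRing; RawRing)
open import Algebra.Definitions using (Congruent₁; Congruent₂)
open import Algebra.Structures using (IsCommutativeRing)
open import Algebra.Morphism.Structures using (IsRingMonomorphism)
import Algebra.Morphism.RingMonomorphism as RingMonomorphism
import Algebra.Properties.CommutativeMonoid.Sum as CommutativeMonoidSum
import Algebra.Properties.Ring as RingProperties
import Algebra.Properties.Semiring.Sum as SemiringSum
open import Data.Bool using (Bool; true; false; if_then_else_)
open import Data.Fin using (Fin; toℕ) renaming (zero to fzero; suc to fsuc; _≟_ to _≟ᶠ_)
open import Data.List using (List; []; _∷_; _++_; length; map; concat; applyUpTo)
import Data.List.Relation.Binary.Equality.Setoid as ListEquality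
open import Data.Maybe using (Maybe; just; nothing)
import Data.Maybe as Maybe
open import Data.Nat as ℕ using (ℕ; zero; suc; pred)
import Data.Nat.Properties as ℕₚ
open import Data.Nat.Binary using (ℕᵇ; 2[1+_]; 1+[2_]; fromℕ)
import Data.Nat.Binary as ℕᵇ
open import Data.Product using (Σ; _×_; _,_; proj₁; proj₂; ∃-syntax)
open import Data.Rational as ℚ using (ℚ; 0ℚ; 1ℚ; ½)
import Data.Rational.Properties as ℚₚ
open import Data.Rational.Solver using (module +-*-Solver)
open import Data.Sum using (_⊎_; inj₁; inj₂)
open import Data.Vec using (Vec; _∷_)
import Data.Vec as Vec
open import Data.Vec.Functional using (Vector)
import Data.Vec.Functional as Vector
open import Function using (_∘_; _⇔_; id)
open import Relation.Binary.Core using (Rel)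
open import Relation.Binary.PropositionalEquality
  using (_≡_; refl; sym; trans; cong; cong₂; subst; subst₂)
open import Relation.Binary.Structures using (IsEquivalence)
open import Relation.Nullary using (¬_; does)
open import Relation.Unary using (Pred)

------------------------------------------------------------------------
-- The real numbers, as Cauchy sequences of rationals

module Real where

  open import Data.Rational using (∣_∣; _<_; _≤_)

  IsCauchy : (ℕ → ℚ) → Set
  IsCauchy x = ∀ ε → 0ℚ < ε →
    ∃[ N ] ∀ m n → N ℕ.≤ m → N ℕ.≤ n → ∣ x m ℚ.- x n ∣ < ε

  record ℝ : Set where
    constructor cauchy
    field
      seq      : ℕ → ℚ
      isCauchy : IsCauchy seq

  open ℝ public

  infix 4 _≈_ _∼_

  _∼_ : Rel (ℕ → ℚ) 0ℓ
  x ∼ y = ∀ ε → 0ℚ < ε → ∃[ N ] ∀ n → N ℕ.≤ n → ∣ x n ℚ.- y n ∣ < ε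

  _≈_ : Rel ℝ 0ℓ
  x ≈ y = seq x ∼ seq y

  private
    half : ∀ {ε} → 0ℚ < ε → 0ℚ < ½ ℚ.* ε
    half {ε} 0<ε =
      subst (_< ½ ℚ.* ε) (ℚₚ.*-zeroʳ ½) (ℚₚ.*-monoʳ-<-pos ½ 0<ε)

    halves : ∀ ε → ½ ℚ.* ε ℚ.+ ½ ℚ.* ε ≡ ε
    halves ε = trans (sym (ℚₚ.*-distribʳ-+ ε ½ ½)) (ℚₚ.*-identityˡ ε)

    -- |p| < ½ε and |q| < ½ε give |p + q| < ε
    small-+ : ∀ {p q} ε → ∣ p ∣ < ½ ℚ.* ε → ∣ q ∣ < ½ ℚ.* ε → ∣ p ℚ.+ q ∣ < ε
    small-+ {p} {q} ε p< q< = ℚₚ.≤-<-trans (ℚₚ.∣p+q∣≤∣p∣+∣q∣ p q)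
      (subst (∣ p ∣ ℚ.+ ∣ q ∣ <_) (halves ε) (ℚₚ.+-mono-< p< q<))

    open +-*-Solver

    telescope : ∀ a b c → (a ℚ.- b) ℚ.+ (b ℚ.- c) ≡ a ℚ.- c
    telescope = solve 3 (λ a b c → (a :- b) :+ (b :- c) := a :- c) refl

    regroup-+ : ∀ a b c d → (a ℚ.- c) ℚ.+ (b ℚ.- d) ≡ (a ℚ.+ b) ℚ.- (c ℚ.+ d)
    regroup-+ = solve 4 (λ a b c d → (a :- c) :+ (b :- d) := (a :+ b) :- (c :+ d)) refl

    regroup-* : ∀ a b c d →
      a ℚ.* (b ℚ.- d) ℚ.+ (a ℚ.- c) ℚ.* d ≡ a ℚ.* b ℚ.- c ℚ.* d
    regroup-* =
      solve 4 (λ a b c d → a :* (b :- d) :+ (a :- c) :* d := a :* b :- c :* d) refl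

    flip-neg : ∀ a b → ℚ.- (a ℚ.- b) ≡ b ℚ.- a
    flip-neg = solve 2 (λ a b → :- (a :- b) := b :- a) refl

    neg-sub : ∀ a b → ℚ.- (a ℚ.- b) ≡ (ℚ.- a) ℚ.- (ℚ.- b)
    neg-sub = solve 2 (λ a b → :- (a :- b) := (:- a) :- (:- b)) refl

    recover : ∀ a b → (a ℚ.- b) ℚ.+ b ≡ a
    recover = solve 2 (λ a b → (a :- b) :+ b := a) refl

    flip-< : ∀ a b {ε} → ∣ a ℚ.- b ∣ < ε → ∣ b ℚ.- a ∣ < ε
    flip-< a b {ε} = subst (_< ε)
      (trans (sym (ℚₚ.∣-p∣≡∣p∣ (a ℚ.- b))) (cong ∣_∣ (flip-neg a b)))

    neg-< : ∀ a b {ε} → ∣ a ℚ.- b ∣ < ε → ∣ (ℚ.- a) ℚ.- (ℚ.- b) ∣ < ε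
    neg-< a b {ε} = subst (_< ε)
      (trans (sym (ℚₚ.∣-p∣≡∣p∣ (a ℚ.- b))) (cong ∣_∣ (neg-sub a b)))

    +-close : ∀ ε a b c d → ∣ a ℚ.- c ∣ < ½ ℚ.* ε → ∣ b ℚ.- d ∣ < ½ ℚ.* ε →
              ∣ (a ℚ.+ b) ℚ.- (c ℚ.+ d) ∣ < ε
    +-close ε a b c d p q =
      subst (λ z → ∣ z ∣ < ε) (regroup-+ a b c d) (small-+ ε p q)

    *-small : ∀ {B δ} p q → 0ℚ < B → ∣ p ∣ < B → ∣ q ∣ < δ → ∣ p ℚ.* q ∣ < B ℚ.* δ
    *-small {B} {δ} p q 0<B p< q< =
      subst (_< B ℚ.* δ) (sym (ℚₚ.∣p*q∣≡∣p∣*∣q∣ p q))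
        (ℚₚ.≤-<-trans
          (ℚₚ.*-monoʳ-≤-nonNeg ∣ q ∣ {{ℚₚ.∣-∣-nonNeg q}} (ℚₚ.<⇒≤ p<))
          (ℚₚ.*-monoʳ-<-pos B {{ℚ.positive 0<B}} q<))

    *-close : ∀ B ε → 0ℚ < B → 0ℚ < ε → ∃[ δ ] 0ℚ < δ ×
      (∀ a b c d → ∣ a ∣ < B → ∣ d ∣ < B → ∣ a ℚ.- c ∣ < δ → ∣ b ℚ.- d ∣ < δ →
       ∣ a ℚ.* b ℚ.- c ℚ.* d ∣ < ε)
    *-close B ε 0<B 0<ε = δ , 0<δ , close
      where
      instance
        B-pos : ℚ.Positive B
        B-pos = ℚ.positive 0<B
        B≢0 : ℚ.NonZero B
        B≢0 = ℚₚ.pos⇒nonZero B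
        1/B-pos : ℚ.Positive (ℚ.1/ B)
        1/B-pos = ℚₚ.1/pos⇒pos B
      δ : ℚ
      δ = ℚ.1/ B ℚ.* (½ ℚ.* ε)
      0<δ : 0ℚ < δ
      0<δ = subst (_< δ) (ℚₚ.*-zeroʳ (ℚ.1/ B)) (ℚₚ.*-monoʳ-<-pos (ℚ.1/ B) (half 0<ε))
      Bδ : B ℚ.* δ ≡ ½ ℚ.* ε
      Bδ = trans (sym (ℚₚ.*-assoc B (ℚ.1/ B) (½ ℚ.* ε)))
          (trans (cong (ℚ._* (½ ℚ.* ε)) (ℚₚ.*-inverseʳ B)) (ℚₚ.*-identityˡ _))
      close : ∀ a b c d → ∣ a ∣ < B → ∣ d ∣ < B → ∣ a ℚ.- c ∣ < δ → ∣ b ℚ.- d ∣ < δ →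
              ∣ a ℚ.* b ℚ.- c ℚ.* d ∣ < ε
      close a b c d a< d< ac bd = subst (λ z → ∣ z ∣ < ε) (regroup-* a b c d)
        (small-+ ε
          (subst (_ <_) Bδ (*-small a (b ℚ.- d) 0<B a< bd))
          (subst₂ (λ u v → ∣ u ∣ < v) (ℚₚ.*-comm d (a ℚ.- c)) Bδ
            (*-small d (a ℚ.- c) 0<B d< ac)))

    0<1 : 0ℚ < 1ℚ
    0<1 = ℚₚ.positive⁻¹ 1ℚ

    bounded : ∀ x → IsCauchy x →
      ∃[ B ] 0ℚ < B × ∃[ N ] ∀ n → N ℕ.≤ n → ∣ x n ∣ < B
    bounded x cx with cx 1ℚ 0<1
    ... | N , h = 1ℚ ℚ.+ ∣ x N ∣
      , subst (_< 1ℚ ℚ.+ ∣ x N ∣) (ℚₚ.+-identityʳ 0ℚ)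
          (ℚₚ.+-mono-<-≤ 0<1 (ℚₚ.0≤∣p∣ (x N)))
      , N , λ n N≤n → ℚₚ.≤-<-trans
          (subst (λ z → ∣ z ∣ ≤ ∣ x n ℚ.- x N ∣ ℚ.+ ∣ x N ∣) (recover (x n) (x N))
            (ℚₚ.∣p+q∣≤∣p∣+∣q∣ (x n ℚ.- x N) (x N)))
          (ℚₚ.+-mono-<-≤ (h n N N≤n ℕₚ.≤-refl) (ℚₚ.≤-refl {∣ x N ∣}))

    ⊔₁ : ∀ {m n k} → m ℕ.⊔ n ℕ.≤ k → m ℕ.≤ k
    ⊔₁ = ℕₚ.m⊔n≤o⇒m≤o _ _

    ⊔₂ : ∀ {m n k} → m ℕ.⊔ n ℕ.≤ k → n ℕ.≤ k
    ⊔₂ {m} = ℕₚ.m⊔n≤o⇒n≤o m _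

    enlarge : ∀ a b p → a ≤ b → p < a → p < b
    enlarge _ _ _ a≤b p<a = ℚₚ.<-≤-trans p<a a≤b

    common : ∀ x y → IsCauchy x → IsCauchy y →
      ∃[ B ] 0ℚ < B × ∃[ N ] ∀ n → N ℕ.≤ n → ∣ x n ∣ < B × ∣ y n ∣ < B
    common x y cx cy = join (bounded x cx) (bounded y cy)
      where
      join : (∃[ B ] 0ℚ < B × ∃[ N ] ∀ n → N ℕ.≤ n → ∣ x n ∣ < B) →
             (∃[ B ] 0ℚ < B × ∃[ N ] ∀ n → N ℕ.≤ n → ∣ y n ∣ < B) →
             ∃[ B ] 0ℚ < B × ∃[ N ] ∀ n → N ℕ.≤ n → ∣ x n ∣ < B × ∣ y n ∣ < B
      join (B₁ , p₁ , N₁ , h₁) (B₂ , p₂ , N₂ , h₂) =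
        B₁ ℚ.⊔ B₂ , enlarge B₁ (B₁ ℚ.⊔ B₂) 0ℚ (ℚₚ.p≤p⊔q B₁ B₂) p₁ , N₁ ℕ.⊔ N₂ , λ n N≤n →
          enlarge B₁ (B₁ ℚ.⊔ B₂) (∣ x n ∣) (ℚₚ.p≤p⊔q B₁ B₂) (h₁ n (⊔₁ N≤n)) ,
          enlarge B₂ (B₁ ℚ.⊔ B₂) (∣ y n ∣) (ℚₚ.p≤q⊔p B₁ B₂) (h₂ n (⊔₂ {N₁} N≤n))

    abstract

      const-cauchy : ∀ q → IsCauchy (λ _ → q)
      const-cauchy q ε 0<ε =
        0 , λ _ _ _ _ → subst (λ z → ∣ z ∣ < ε) (sym (ℚₚ.+-inverseʳ q)) 0<ε

      +-cauchy : ∀ x y → IsCauchy x → IsCauchy y → IsCauchy (λ n → x n ℚ.+ y n)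
      +-cauchy x y cx cy ε 0<ε
        with cx (½ ℚ.* ε) (half 0<ε) | cy (½ ℚ.* ε) (half 0<ε)
      ... | M , h | N , k = M ℕ.⊔ N , λ m n p q →
        +-close ε (x m) (y m) (x n) (y n)
          (h m n (⊔₁ p) (⊔₁ q)) (k m n (⊔₂ {M} p) (⊔₂ {M} q))

      neg-cauchy : ∀ x → IsCauchy x → IsCauchy (λ n → ℚ.- x n)
      neg-cauchy x cx ε 0<ε with cx ε 0<ε
      ... | N , h = N , λ m n p q → neg-< (x m) (x n) (h m n p q)

      *-cauchy : ∀ x y → IsCauchy x → IsCauchy y → IsCauchy (λ n → x n ℚ.* y n)
      *-cauchy x y cx cy ε 0<ε =
        let B , 0<B , K , b = common x y cx cy
            δ , 0<δ , close = *-close B ε 0<B 0<ε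
            M , h           = cx δ 0<δ
            N , k           = cy δ 0<δ
        in K ℕ.⊔ (M ℕ.⊔ N) , λ m n p q →
          close (x m) (y m) (x n) (y n)
            (proj₁ (b m (⊔₁ p))) (proj₂ (b n (⊔₁ q)))
            (h m n (⊔₁ (⊔₂ {K} p)) (⊔₁ (⊔₂ {K} q)))
            (k m n (⊔₂ {M} (⊔₂ {K} p)) (⊔₂ {M} (⊔₂ {K} q)))

  0ℝ 1ℝ : ℝ
  0ℝ = cauchy (λ _ → 0ℚ) (const-cauchy 0ℚ)
  1ℝ = cauchy (λ _ → 1ℚ) (const-cauchy 1ℚ)

  infixl 6 _+_
  infixl 7 _*_
  infix  8 -_

  _+_ _*_ : ℝ → ℝ → ℝ
  cauchy x cx + cauchy y cy = cauchy (λ n → x n ℚ.+ y n) (+-cauchy x y cx cy)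
  cauchy x cx * cauchy y cy = cauchy (λ n → x n ℚ.* y n) (*-cauchy x y cx cy)

  -_ : ℝ → ℝ
  - cauchy x cx = cauchy (λ n → ℚ.- x n) (neg-cauchy x cx)

  private
    pointwise : ∀ {x y : ℕ → ℚ} → (∀ n → x n ≡ y n) → x ∼ y
    pointwise {x} {y} eq ε 0<ε = 0 , λ n _ →
      subst (λ z → ∣ z ∣ < ε)
        (sym (trans (cong (ℚ._- y n) (eq n)) (ℚₚ.+-inverseʳ (y n)))) 0<ε

    ≈-isEquivalence : IsEquivalence _≈_
    ≈-isEquivalence = record
      { refl  = λ {x} → pointwise {seq x} {seq x} (λ _ → refl)
      ; sym   = λ {x} {y} p ε 0<ε →
          proj₁ (p ε 0<ε) , λ n q → flip-< (seq x n) (seq y n) (proj₂ (p ε 0<ε) n q)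
      ; trans = λ {x} {y} {z} p q ε 0<ε →
          let M , h = p (½ ℚ.* ε) (half 0<ε)
              N , k = q (½ ℚ.* ε) (half 0<ε)
          in M ℕ.⊔ N , λ n r →
            subst (λ w → ∣ w ∣ < ε) (telescope (seq x n) (seq y n) (seq z n))
              (small-+ ε (h n (⊔₁ r)) (k n (⊔₂ {M} r)))
      }

    +-cong : Congruent₂ _≈_ _+_
    +-cong {x} {x′} {y} {y′} p q ε 0<ε =
      let M , h = p (½ ℚ.* ε) (half 0<ε)
          N , k = q (½ ℚ.* ε) (half 0<ε)
      in M ℕ.⊔ N , λ n r →
        +-close ε (seq x n) (seq y n) (seq x′ n) (seq y′ n)
          (h n (⊔₁ r)) (k n (⊔₂ {M} r))

    -‿cong : Congruent₁ _≈_ -_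
    -‿cong {x} {y} p ε 0<ε =
      let N , h = p ε 0<ε in N , λ n r → neg-< (seq x n) (seq y n) (h n r)

    *-cong : Congruent₂ _≈_ _*_
    *-cong {x} {x′} {y} {y′} p q ε 0<ε =
      let B , 0<B , K , b   = common (seq x) (seq y′) (isCauchy x) (isCauchy y′)
          δ , 0<δ , close   = *-close B ε 0<B 0<ε
          M , h             = p δ 0<δ
          N , k             = q δ 0<δ
      in K ℕ.⊔ (M ℕ.⊔ N) , λ n r →
        close (seq x n) (seq y n) (seq x′ n) (seq y′ n)
          (proj₁ (b n (⊔₁ r))) (proj₂ (b n (⊔₁ r)))
          (h n (⊔₁ (⊔₂ {K} r))) (k n (⊔₂ {M} (⊔₂ {K} r)))

  isCommutativeRing : IsCommutativeRing _≈_ _+_ _*_ -_ 0ℝ 1ℝ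
  isCommutativeRing = record
    { isRing = record
      { +-isAbelianGroup = record
        { isGroup = record
          { isMonoid = record
            { isSemigroup = record
              { isMagma = record
                { isEquivalence = ≈-isEquivalence
                ; ∙-cong        = λ {x} {x′} {y} {y′} → +-cong {x} {x′} {y} {y′}
                }
              ; assoc = λ x y z → pointwise λ n → ℚₚ.+-assoc (seq x n) (seq y n) (seq z n)
              }
            ; identity = (λ x → pointwise λ n → ℚₚ.+-identityˡ (seq x n))
                       , (λ x → pointwise λ n → ℚₚ.+-identityʳ (seq x n))
            }
          ; inverse = (λ x → pointwise λ n → ℚₚ.+-inverseˡ (seq x n))
                    , (λ x → pointwise λ n → ℚₚ.+-inverseʳ (seq x n))
          ; ⁻¹-cong = λ {x} {y} → -‿cong {x} {y}
          }
        ; comm = λ x y → pointwise λ n → ℚₚ.+-comm (seq x n) (seq y n)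
        }
      ; *-cong     = λ {x} {x′} {y} {y′} → *-cong {x} {x′} {y} {y′}
      ; *-assoc    = λ x y z → pointwise λ n → ℚₚ.*-assoc (seq x n) (seq y n) (seq z n)
      ; *-identity = (λ x → pointwise λ n → ℚₚ.*-identityˡ (seq x n))
                   , (λ x → pointwise λ n → ℚₚ.*-identityʳ (seq x n))
      ; distrib    =
          (λ x y z → pointwise λ n → ℚₚ.*-distribˡ-+ (seq x n) (seq y n) (seq z n))
        , (λ x y z → pointwise λ n → ℚₚ.*-distribʳ-+ (seq x n) (seq y n) (seq z n))
      }
    ; *-comm = λ x y → pointwise λ n → ℚₚ.*-comm (seq x n) (seq y n)
    }

------------------------------------------------------------------------
-- Subfields of ℝ

module _ where

  open Real

  record Subfield : Set₁ where
    field
      member   : Pred ℝ 0ℓ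
      resp     : ∀ {x y} → x ≈ y → member x → member y
      0∈       : member 0ℝ
      1∈       : member 1ℝ
      +-closed : ∀ {x y} → member x → member y → member (x + y)
      *-closed : ∀ {x y} → member x → member y → member (x * y)
      neg-closed : ∀ {x} → member x → member (- x)
      inv-closed : ∀ {x y} → member x → x * y ≈ 1ℝ → member y

  module _ (F : Subfield) where

    open Subfield F

    subfieldRawRing : RawRing 0ℓ 0ℓ
    subfieldRawRing = record
      { Carrier = Σ ℝ member
      ; _≈_ = λ x y → proj₁ x ≈ proj₁ y
      ; _+_ = λ x y → proj₁ x + proj₁ y , +-closed {proj₁ x} {proj₁ y} (proj₂ x) (proj₂ y)
      ; _*_ = λ x y → proj₁ x * proj₁ y , *-closed {proj₁ x} {proj₁ y} (proj₂ x) (proj₂ y)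
      ; -_  = λ x → - proj₁ x , neg-closed {proj₁ x} (proj₂ x)
      ; 0#  = 0ℝ , 0∈
      ; 1#  = 1ℝ , 1∈
      }

    private
      module ℝ-ring = IsCommutativeRing isCommutativeRing

      ℝ-raw : RawRing 0ℓ 0ℓ
      ℝ-raw = record
        { Carrier = ℝ ; _≈_ = _≈_ ; _+_ = _+_ ; _*_ = _*_ ; -_ = -_ ; 0# = 0ℝ ; 1# = 1ℝ }

      inclusion : IsRingMonomorphism subfieldRawRing ℝ-raw proj₁
      inclusion = record
        { isRingHomomorphism = record
          { isSemiringHomomorphism = record
            { isNearSemiringHomomorphism = record
              { +-isMonoidHomomorphism = record
                { isMagmaHomomorphism = record
                  { isRelHomomorphism = record { cong = id }
                  ; homo = λ x y → ℝ-ring.refl {proj₁ x + proj₁ y}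
                  }
                ; ε-homo = ℝ-ring.refl {0ℝ}
                }
              ; *-homo = λ x y → ℝ-ring.refl {proj₁ x * proj₁ y}
              }
            ; 1#-homo = ℝ-ring.refl {1ℝ}
            }
          ; -‿homo = λ x → ℝ-ring.refl { - proj₁ x }
          }
        ; injective = id
        }

    subfieldRing : CommutativeRing 0ℓ 0ℓ
    subfieldRing = record
      { isCommutativeRing = RingMonomorphism.isCommutativeRing inclusion isCommutativeRing }

------------------------------------------------------------------------
-- Languages and polynomial bounds

Language : Set → Set₂
Language A = Pred (List A) (lsuc 0ℓ)

-- Every polynomial in n is dominated by  bound c n  for some c, and
-- conversely  bound c  is itself a polynomial.
bound : ℕ → ℕ → ℕ
bound c n = c ℕ.* n ℕ.^ c ℕ.+ c

------------------------------------------------------------------------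
-- Turing machines

module Turing where

  data Symbol (s : ℕ) : Set where
    blank : Symbol s
    bit   : Bool → Symbol s
    extra : Fin s → Symbol s

  data Move : Set where
    left right stay : Move

  -- A two-way infinite tape; cells beyond the ends of the lists are blank,
  -- and the head of each list is the cell next to the scanned one.
  record Tape (s : ℕ) : Set where
    constructor tape
    field
      before  : List (Symbol s)
      scanned : Symbol s
      after   : List (Symbol s)

  open Tape

  write : ∀ {s} → Symbol s × Move → Tape s → Tape s
  write (x , left)  (tape []       _ rs)       = tape [] blank (x ∷ rs)
  write (x , left)  (tape (l ∷ ls) _ rs)       = tape ls l (x ∷ rs)
  write (x , right) (tape ls       _ [])       = tape (x ∷ ls) blank []
  write (x , right) (tape ls       _ (r ∷ rs)) = tape (x ∷ ls) r rs
  write (x , stay)  (tape ls       _ rs)       = tape ls x rs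

  -- Deterministic machines with  suc workTapes  tapes, started in state zero;
  -- the machine halts where the transition function is  nothing .
  record Machine : Set where
    field
      workTapes extraStates extraSymbols : ℕ

    State : Set
    State = Fin (suc extraStates)

    Sym : Set
    Sym = Symbol extraSymbols

    field
      transition : State → Vec Sym (suc workTapes) →
                   Maybe (State × Vec (Sym × Move) (suc workTapes))

    Config : Set
    Config = State × Vec (Tape extraSymbols) (suc workTapes)

    step : Config → Maybe Config
    step (q , ts) =
      Maybe.map (λ (q′ , as) → q′ , Vec.zipWith write as ts)
                (transition q (Vec.map scanned ts))

    emptyTape : Tape extraSymbols
    emptyTape = tape [] blank []

    load : List Bool → Tape extraSymbols
    load []       = emptyTape
    load (b ∷ bs) = tape [] (bit b) (map bit bs)

    bits : List Sym → List Bool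
    bits (bit b ∷ xs) = b ∷ bits xs
    bits _            = []

    -- The first tape carries the input, and also the output: the word of bits
    -- starting at the head and extending to the first symbol that is not a bit.
    init : List Bool → Config
    init w = fzero , load w ∷ Vec.replicate workTapes emptyTape

    output : Config → List Bool
    output (_ , t ∷ _) = bits (scanned t ∷ after t)

    data HaltsAfter : ℕ → Config → Config → Set where
      halted : ∀ {c} → step c ≡ nothing → HaltsAfter 0 c c
      next   : ∀ {k c c′ e} → step c ≡ just c′ → HaltsAfter k c′ e → HaltsAfter (suc k) c e

  PolynomialTime : (List Bool → List Bool) → Set
  PolynomialTime f = Σ Machine λ M → let open Machine M in
    ∃[ b ] ∀ w → ∃[ k ] ∃[ e ]
      k ℕ.≤ bound b (length w) × HaltsAfter k (init w) e × output e ≡ f w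

  infix 4 _≤ᵖ_

  _≤ᵖ_ : Language Bool → Language Bool → Set₁
  A ≤ᵖ B = ∃[ f ] PolynomialTime f × (∀ w → A w ⇔ B (f w))

------------------------------------------------------------------------
-- Blum-Shub-Smale machines
--
-- Memory cells, addressed by ℕ, hold ring elements; finitely many address
-- registers hold natural numbers and give indirect access to the memory.
-- Addresses can only be copied, incremented and decremented, so they stay
-- below input length plus running time.

module BSS (R : CommutativeRing 0ℓ 0ℓ) where

  open CommutativeRing R hiding (zero)
  open ListEquality setoid using (_≋_)

  data Operation : Set where
    add sub mul div : Operation

  -- The division of x by y exists only for y ≉ 0, and is only meaningful when
  -- R is a field; a machine dividing by zero is stuck.
  Result : Operation → Carrier → Carrier → Carrier → Set
  Result add x y z = z ≈ x + y
  Result sub x y z = z ≈ x - y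
  Result mul x y z = z ≈ x * y
  Result div x y z = ¬ (y ≈ 0#) × z * y ≈ x

  data Address (r : ℕ) : Set where
    copy incr decr : Fin r → Address r

  address : ∀ {r} → Address r → (Fin r → ℕ) → ℕ
  address (copy j) a = a j
  address (incr j) a = suc (a j)
  address (decr j) a = pred (a j)

  -- Operands of type  Fin r  are address registers; those of  compute ,
  -- constant ,  guess  and  test  refer to the memory cell they point to.
  --
  -- The only test on ring elements is equality.  An order test cannot be
  -- allowed for arbitrary subfields F of ℝ: satisfiability over L(F^d) depends
  -- only on the isomorphism type of the field F, whereas a real cubic with
  -- three real roots may have exactly one of them in F, and which one is not
  -- an invariant of the field.  Where every nonnegative element is a sum of
  -- boundedly many squares, as in ℝ and ℚ, guessing the squares replaces an
  -- order test.
  data Node (r q : ℕ) : Set where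
    compute       : Operation → (target x y : Fin r) (next : Fin q) → Node r q
    constant      : Carrier → (target : Fin r) (next : Fin q) → Node r q
    guess         : (target : Fin r) (next : Fin q) → Node r q
    test          : (x y : Fin r) (equal unequal : Fin q) → Node r q
    move          : Address r → (target : Fin r) (next : Fin q) → Node r q
    testAddress   : (i j : Fin r) (equal unequal : Fin q) → Node r q
    accept reject : Node r q

  record Machine : Set where
    field
      extraAddresses extraNodes : ℕ
      code : Fin (suc extraNodes) → Node (suc extraAddresses) (suc extraNodes)

  module Semantics (M : Machine) where

    open Machine M

    #addresses #nodes : ℕ
    #addresses = suc extraAddresses
    #nodes     = suc extraNodes

    record Config : Set where
      constructor config
      field
        node      : Fin #nodes
        addresses : Fin #addresses → ℕ
        memory    : ℕ → Carrier

    open Config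

    load : List Carrier → ℕ → Carrier
    load []       _       = 0#
    load (x ∷ xs) zero    = x
    load (x ∷ xs) (suc n) = load xs n

    _[_≔_] : (ℕ → Carrier) → ℕ → Carrier → ℕ → Carrier
    (m [ i ≔ z ]) j = if does (j ℕ.≟ i) then z else m j

    _[_≔ᵃ_] : (Fin #addresses → ℕ) → Fin #addresses → ℕ → Fin #addresses → ℕ
    (a [ i ≔ᵃ n ]) j = if does (j ≟ᶠ i) then n else a j

    -- Inputs and outputs occupy the cells 0, 1, …; their length is held by
    -- address register zero.
    init : List Carrier → Config
    init w = config fzero ((λ _ → 0) [ fzero ≔ᵃ length w ]) (load w)

    output : Config → List Carrier
    output c = applyUpTo (memory c) (addresses c fzero)

    infix 4 _⟶_

    data _⟶_ : Config → Config → Set where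
      compute : ∀ {p a m o t x y n z} → code p ≡ compute o t x y n →
                Result o (m (a x)) (m (a y)) z →
                config p a m ⟶ config n a (m [ a t ≔ z ])
      constant : ∀ {p a m t n z} → code p ≡ constant z t n →
                config p a m ⟶ config n a (m [ a t ≔ z ])
      guess   : ∀ {p a m t n} z → code p ≡ guess t n →
                config p a m ⟶ config n a (m [ a t ≔ z ])
      equal   : ∀ {p a m x y n n′} → code p ≡ test x y n n′ →
                m (a x) ≈ m (a y) → config p a m ⟶ config n a m
      unequal : ∀ {p a m x y n n′} → code p ≡ test x y n n′ →
                ¬ (m (a x) ≈ m (a y)) → config p a m ⟶ config n′ a m
      move    : ∀ {p a m e t n} → code p ≡ move e t n →
                config p a m ⟶ config n (a [ t ≔ᵃ address e a ]) m
      equalAddress   : ∀ {p a m i j n n′} → code p ≡ testAddress i j n n′ →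
                a i ≡ a j → config p a m ⟶ config n a m
      unequalAddress : ∀ {p a m i j n n′} → code p ≡ testAddress i j n n′ →
                ¬ (a i ≡ a j) → config p a m ⟶ config n′ a m

    data Run : ℕ → Config → Config → Set where
      done : ∀ {c} → Run 0 c c
      next : ∀ {k c c′ e} → c ⟶ c′ → Run k c′ e → Run (suc k) c e

    Accepting : Config → Set
    Accepting c = code (node c) ≡ accept

    Accepts : List Carrier → Set
    Accepts w = ∃[ k ] ∃[ e ] Run k (init w) e × Accepting e

    -- No computation, whatever is guessed, is longer than the bound.
    RunsWithin : (ℕ → ℕ) → Set
    RunsWithin b = ∀ {w k e} → Run k (init w) e → k ℕ.≤ b (length w)

    Deterministic : Set
    Deterministic = ∀ p {t n} → ¬ (code p ≡ guess t n)

    -- 0 and 1 remain available to machines without constants.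
    ConstantFree : Set
    ConstantFree = ∀ p {z t n} → code p ≡ constant z t n → z ≈ 0# ⊎ z ≈ 1#

  DecidedBy : Language Carrier → Machine → Set₁
  DecidedBy L M = let open Semantics M in
    (∃[ b ] RunsWithin (bound b)) × (∀ w → L w ⇔ Accepts w)

  NP : Language Carrier → Set₁
  NP L = ∃[ M ] DecidedBy L M

  NP⁰ : Language Carrier → Set₁
  NP⁰ L = ∃[ M ] Semantics.ConstantFree M × DecidedBy L M

  PolynomialTime : (List Carrier → List Carrier) → Set
  PolynomialTime f = Σ Machine λ M → let open Semantics M in
    Deterministic × (∃[ b ] RunsWithin (bound b)) ×
    (∀ w → ∃[ k ] ∃[ e ] Run k (init w) e × Accepting e × output e ≋ f w)

  infix 4 _≤ᵖ_

  _≤ᵖ_ : Language Carrier → Language Carrier → Set₁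
  A ≤ᵖ B = ∃[ f ] PolynomialTime f × (∀ w → A w ⇔ B (f w))

  NP-Complete : Language Carrier → Set₂
  NP-Complete L = NP L × (∀ A → NP A → A ≤ᵖ L)

  embed : List Bool → List Carrier
  embed = map (λ b → if b then 1# else 0#)

  BP : (Language Carrier → Set₁) → Language Bool → Set₂
  BP C B = ∃[ L ] C L × (∀ w → B w ⇔ L (embed w))

  BP-Complete : (Language Carrier → Set₁) → Language Bool → Set₂
  BP-Complete C B = BP C B × (∀ A → BP C A → A Turing.≤ᵖ B)

------------------------------------------------------------------------
-- Ortholattice terms and their satisfiability

data Term (X : Set) : Set where
  var     : X → Term X
  _∧ᵗ_ _∨ᵗ_ : Term X → Term X → Term X
  ¬ᵗ_     : Term X → Term X
  0ᵗ 1ᵗ     : Term X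

-- The binary encoding of terms is Polish notation over a prefix code, given a
-- prefix code for the variables.
⟨_⟩ : {X : Set} → Term X → (X → List Bool) → List Bool
⟨ var x ⟩ v = true  ∷ true  ∷ v x
⟨ ¬ᵗ t  ⟩ v = true  ∷ false ∷ ⟨ t ⟩ v
⟨ s ∧ᵗ t ⟩ v = false ∷ true  ∷ true  ∷ ⟨ s ⟩ v ++ ⟨ t ⟩ v
⟨ s ∨ᵗ t ⟩ v = false ∷ true  ∷ false ∷ ⟨ s ⟩ v ++ ⟨ t ⟩ v
⟨ 1ᵗ     ⟩ v = false ∷ false ∷ true  ∷ []
⟨ 0ᵗ     ⟩ v = false ∷ false ∷ false ∷ []

-- A prefix code of logarithmic length for indices: the bijective base-2 digits,
-- each preceded by a continuation bit.
indexCode : ∀ {n} → Fin n → List Bool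
indexCode = digits ∘ fromℕ ∘ toℕ
  where
  digits : ℕᵇ → List Bool
  digits ℕᵇ.zero    = false ∷ []
  digits 2[1+ b ]   = true ∷ false ∷ digits b
  digits 1+[2 b ]   = true ∷ true  ∷ digits b

sumCode : ∀ {n m} → Fin n ⊎ Fin m → List Bool
sumCode (inj₁ i) = false ∷ indexCode i
sumCode (inj₂ j) = true  ∷ indexCode j

-- The operations of an ortholattice; evaluating terms does not need its laws.
record RawOrtholattice : Set₂ where
  field
    Carrier : Set₁
    _≈_     : Rel Carrier 0ℓ
    _∧_ _∨_ : Carrier → Carrier → Carrier
    _ᶜ      : Carrier → Carrier
    0# 1#   : Carrier

eval : ∀ {X} (L : RawOrtholattice) → Term X →
       (X → RawOrtholattice.Carrier L) → RawOrtholattice.Carrier L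
eval L = go
  where
  module L = RawOrtholattice L
  go : ∀ {X} → Term X → (X → L.Carrier) → L.Carrier
  go (var x) a = a x
  go (s ∧ᵗ t) a = go s a L.∧ go t a
  go (s ∨ᵗ t) a = go s a L.∨ go t a
  go (¬ᵗ t)  a = go t a L.ᶜ
  go 0ᵗ       a = L.0#
  go 1ᵗ       a = L.1#

SAT : RawOrtholattice → Language Bool
SAT L w = ∃[ n ] Σ (Term (Fin n)) λ t →
  w ≡ ⟨ t ⟩ indexCode × ∃[ a ] eval L t a L.≈ L.1#
  where module L = RawOrtholattice L

------------------------------------------------------------------------
-- The ortholattice of linear subspaces

module Subspaces (R : CommutativeRing 0ℓ 0ℓ) (d : ℕ) where

  open CommutativeRing R hiding (zero)
    renaming (refl to ≈-refl; sym to ≈-sym; trans to ≈-trans)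
  open RingProperties ring using (-‿distribˡ-*)
  open CommutativeMonoidSum +-commutativeMonoid
    using (sum; sum-cong-≋; ∑-distrib-+; sum-replicate-zero)
  open SemiringSum semiring using (*-distribˡ-sum)
  open import Relation.Binary.Reasoning.Setoid setoid

  V : Set
  V = Vector Carrier d

  infix 4 _≈ᵛ_

  _≈ᵛ_ : Rel V 0ℓ
  u ≈ᵛ v = ∀ i → u i ≈ v i

  infixl 6 _+ᵛ_
  infixr 7 _∙ᵛ_

  0ᵛ : V
  0ᵛ _ = 0#

  _+ᵛ_ : V → V → V
  (u +ᵛ v) i = u i + v i

  _∙ᵛ_ : Carrier → V → V
  (c ∙ᵛ v) i = c * v i

  infix 8 _·_

  _·_ : V → V → Carrier
  u · v = sum (λ i → u i * v i)

  Matrix : Set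
  Matrix = Fin d → Fin d → Carrier

  private
    ·-cong : ∀ {u u′ v v′} → u ≈ᵛ u′ → v ≈ᵛ v′ → u · v ≈ u′ · v′
    ·-cong p q = sum-cong-≋ (λ i → *-cong (p i) (q i))

    ·-zeroʳ : ∀ u → u · 0ᵛ ≈ 0#
    ·-zeroʳ u = ≈-trans (sum-cong-≋ (λ i → zeroʳ (u i))) (sum-replicate-zero d)

    ·-distribˡ : ∀ u v w → u · (v +ᵛ w) ≈ u · v + u · w
    ·-distribˡ u v w = ≈-trans (sum-cong-≋ (λ i → distribˡ (u i) (v i) (w i)))
      (∑-distrib-+ (λ i → u i * v i) (λ i → u i * w i))

    ·-scaleʳ : ∀ c u v → u · (c ∙ᵛ v) ≈ c * u · v
    ·-scaleʳ c u v = ≈-trans (sum-cong-≋ λ i → begin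
        u i * (c * v i)  ≈⟨ *-assoc (u i) c (v i) ⟨
        u i * c * v i    ≈⟨ *-congʳ (*-comm (u i) c) ⟩
        c * u i * v i    ≈⟨ *-assoc c (u i) (v i) ⟩
        c * (u i * v i)  ∎)
      (≈-sym (*-distribˡ-sum c (λ i → u i * v i)))

    interchange : ∀ a b c e → (a + b) + (c + e) ≈ (a + c) + (b + e)
    interchange a b c e = begin
      (a + b) + (c + e)  ≈⟨ +-assoc a b (c + e) ⟩
      a + (b + (c + e))  ≈⟨ +-congˡ (+-assoc b c e) ⟨
      a + ((b + c) + e)  ≈⟨ +-congˡ (+-congʳ (+-comm b c)) ⟩
      a + ((c + b) + e)  ≈⟨ +-congˡ (+-assoc c b e) ⟩
      a + (c + (b + e))  ≈⟨ +-assoc a c (b + e) ⟨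
      (a + c) + (b + e)  ∎

  record Subspace : Set₁ where
    field
      member   : Pred V 0ℓ
      resp     : ∀ {u v} → u ≈ᵛ v → member u → member v
      0∈       : member 0ᵛ
      +-closed : ∀ {u v} → member u → member v → member (u +ᵛ v)
      ∙-closed : ∀ c {v} → member v → member (c ∙ᵛ v)

  open Subspace

  infix 4 _∈_

  _∈_ : V → Subspace → Set
  v ∈ U = member U v

  ⊥ ⊤ : Subspace
  ⊥ = record
    { member   = _≈ᵛ 0ᵛ
    ; resp     = λ p q i → ≈-trans (≈-sym (p i)) (q i)
    ; 0∈       = λ _ → ≈-refl
    ; +-closed = λ p q i → ≈-trans (+-cong (p i) (q i)) (+-identityˡ 0#)
    ; ∙-closed = λ c p i → ≈-trans (*-congˡ (p i)) (zeroʳ c)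
    }
  ⊤ = record
    { member   = λ v → v ≈ᵛ v
    ; resp     = λ _ _ _ → ≈-refl
    ; 0∈       = λ _ → ≈-refl
    ; +-closed = λ _ _ _ → ≈-refl
    ; ∙-closed = λ _ _ _ → ≈-refl
    }

  _∩_ _⊕_ : Subspace → Subspace → Subspace
  U ∩ W = record
    { member   = λ v → v ∈ U × v ∈ W
    ; resp     = λ p (u , w) → resp U p u , resp W p w
    ; 0∈       = 0∈ U , 0∈ W
    ; +-closed = λ (u , w) (u′ , w′) → +-closed U u u′ , +-closed W w w′
    ; ∙-closed = λ c (u , w) → ∙-closed U c u , ∙-closed W c w
    }
  U ⊕ W = record
    { member   = λ v → ∃[ u ] ∃[ w ] u ∈ U × w ∈ W × v ≈ᵛ u +ᵛ w
    ; resp     = λ p (u , w , u∈ , w∈ , q) →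
        u , w , u∈ , w∈ , λ i → ≈-trans (≈-sym (p i)) (q i)
    ; 0∈       = 0ᵛ , 0ᵛ , 0∈ U , 0∈ W , λ _ → ≈-sym (+-identityˡ 0#)
    ; +-closed = λ (u , w , u∈ , w∈ , p) (u′ , w′ , u′∈ , w′∈ , q) →
        u +ᵛ u′ , w +ᵛ w′ , +-closed U u∈ u′∈ , +-closed W w∈ w′∈ ,
        λ i → ≈-trans (+-cong (p i) (q i)) (interchange (u i) (w i) (u′ i) (w′ i))
    ; ∙-closed = λ c (u , w , u∈ , w∈ , p) →
        c ∙ᵛ u , c ∙ᵛ w , ∙-closed U c u∈ , ∙-closed W c w∈ ,
        λ i → ≈-trans (*-congˡ (p i)) (distribˡ c (u i) (w i))
    }

  _^⊥ : Subspace → Subspace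
  U ^⊥ = record
    { member   = λ v → ∀ u → u ∈ U → u · v ≈ 0#
    ; resp     = λ p h u u∈ → ≈-trans (·-cong (λ _ → ≈-refl) (λ i → ≈-sym (p i))) (h u u∈)
    ; 0∈       = λ u _ → ·-zeroʳ u
    ; +-closed = λ {v} {w} h k u u∈ →
        ≈-trans (·-distribˡ u v w)
          (≈-trans (+-cong (h u u∈) (k u u∈)) (+-identityˡ 0#))
    ; ∙-closed = λ c {v} h u u∈ →
        ≈-trans (·-scaleʳ c u v) (≈-trans (*-congˡ (h u u∈)) (zeroʳ c))
    }

  range : Matrix → Subspace
  range A = record
    { member   = λ v → ∃[ x ] v ≈ᵛ (λ i → A i · x)
    ; resp     = λ p (x , q) → x , λ i → ≈-trans (≈-sym (p i)) (q i)
    ; 0∈       = 0ᵛ , λ i → ≈-sym (·-zeroʳ (A i))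
    ; +-closed = λ (x , p) (y , q) → x +ᵛ y ,
        λ i → ≈-trans (+-cong (p i) (q i)) (≈-sym (·-distribˡ (A i) x y))
    ; ∙-closed = λ c (x , p) → c ∙ᵛ x ,
        λ i → ≈-trans (*-congˡ (p i)) (≈-sym (·-scaleʳ c (A i) x))
    }

  𝐋 : RawOrtholattice
  𝐋 = record
    { Carrier = Subspace
    ; _≈_ = λ U W → ∀ v → v ∈ U ⇔ v ∈ W
    ; _∧_ = _∩_
    ; _∨_ = _⊕_
    ; _ᶜ  = _^⊥
    ; 0#  = ⊥
    ; 1#  = ⊤
    }

  open ListEquality setoid using (_≋_)

  encodeMatrix : Matrix → List Carrier
  encodeMatrix C = Vector.toList (Vector.concat C)

  encodeInstance : ∀ {n m} → Term (Fin n ⊎ Fin m) → (Fin m → Matrix) → List Carrier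
  encodeInstance t C =
    BSS.embed R (⟨ t ⟩ sumCode) ++ concat (Vector.toList (encodeMatrix ∘ C))

  SAT-constants : Language Carrier
  SAT-constants w = Lift (lsuc 0ℓ) (
    ∃[ n ] ∃[ m ] Σ (Term (Fin n ⊎ Fin m)) λ t → Σ (Fin m → Matrix) λ C →
      w ≋ encodeInstance t C ×
      Σ (Fin n → Matrix) λ A →
        RawOrtholattice._≈_ 𝐋
          (eval 𝐋 t λ { (inj₁ i) → range (A i) ; (inj₂ j) → range (C j) }) ⊤)

{-# OPTIONS --safe #-}

module Submission where

-- Von Staudt: relative to an orthogonal frame with links, the scalar r is the line
-- spanned by v₀ - r v₁, and the sum and product of scalars are lattice terms. Every assignment is
-- first normalised to a frame or to zero, so that a formula over the field is equivalent
-- to a term. For hardness the formula describes the run of a machine;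
-- for membership it parses the input and guesses a projection onto the complement of the value
-- of every subterm. Both are counter programs, compiled to Turing and BSS machines.

open import Defs
open import Level using (0ℓ; Lift; lift; lower) renaming (suc to lsuc)
open import Axiom.ExcludedMiddle using (ExcludedMiddle)
open import Algebra.Bundles using (CommutativeRing; RawRing)
open import Data.Bool using (Bool; true; false; if_then_else_)
open import Data.Empty using (⊥; ⊥-elim)
open import Data.Fin using (Fin; toℕ) renaming (zero to fzero; suc to fsuc; _≟_ to _≟ᶠ_)
open import Data.Fin.Patterns using (0F; 1F; 2F; 3F; 4F; 5F; 6F)
import Data.Fin.Properties as Fin
open import Data.List using (List; []; _∷_; _++_; length; map; concat; tabulate; applyUpTo)
import Data.List.Properties as List
open import Data.Maybe using (Maybe; just; nothing)
open import Data.Nat as N using (ℕ; zero; suc; pred; _≤_; _<_; z≤n; s≤s)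
import Data.Nat.Properties as N
open import Data.Nat.Tactic.RingSolver using (solve-∀)
open import Data.Product using (Σ; _×_; _,_; ∃-syntax) renaming (proj₁ to fst; proj₂ to snd)
open import Data.Sum using (_⊎_) renaming (inj₁ to inl; inj₂ to inr)
open import Data.Unit using (⊤; tt)
open import Data.Vec using (Vec; []; _∷_; lookup)
import Data.Vec as Vec
import Data.Vec.Properties as Vec
open import Function using (_∘_; _⇔_; id; mk⇔)
open import Function.Bundles using (module Equivalence)
open Equivalence using () renaming (to to fwd; from to bwd)
open import Relation.Binary.Core using (Rel)
open import Relation.Binary.PropositionalEquality using (_≡_; _≢_; refl; sym; trans; cong; cong₂; subst; subst₂)
open import Relation.Nullary using (¬_; Dec; yes; no; does)
open import Relation.Nullary.Decidable using (dec-true; dec-false)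
open import Relation.Binary.PropositionalEquality using () renaming (trans to infixr 5 _~>_)
open import Data.Nat.Properties using () renaming (≤-trans to infixr 5 _▹_)

Ring : Set₁
Ring = CommutativeRing 0ℓ 0ℓ

module RingLaws (R : Ring) where

 open CommutativeRing R public
  hiding (zero) renaming (refl to rfl; sym to symm; trans to infixr 5 _>>_; reflexive to eq≈)

EM : Set₂
EM = ExcludedMiddle (lsuc 0ℓ)

module Classical (em : EM) where

 dec : (A : Set) -> Dec A
 dec A with em {Lift (lsuc 0ℓ) A}
 ... | yes p = yes (lower p)
 ... | no ¬p = no (¬p ∘ lift)

 dne : {A : Set} -> ¬ ¬ A -> A
 dne {A} h with dec A
 ... | yes p = p
 ... | no ¬p = ⊥-elim (h ¬p)

module RealField (em : EM) (F : Subfield) where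

 open Classical em
 open Subfield F
 open Real using (ℝ; cauchy; seq; isCauchy; IsCauchy; _∼_)
 open import Data.Rational as ℚ using (ℚ; 0ℚ; 1ℚ; ½; ∣_∣)
 import Data.Rational.Properties as ℚ
 open import Data.Rational.Solver using (module +-*-Solver)
 open CommutativeRing (subfieldRing F)
  using (Carrier; _≈_; _+_; _*_; 0#; 1#; +-commutativeMonoid)
 open import Algebra.Properties.CommutativeMonoid.Sum +-commutativeMonoid using (sum)

 module R = CommutativeRing (subfieldRing F)

 halves : ∀ ε -> ½ ℚ.* ε ℚ.+ ½ ℚ.* ε ≡ ε
 halves ε = sym (ℚ.*-distribʳ-+ ε ½ ½) ~> ℚ.*-identityˡ ε

 0<½ε : ∀ {ε} -> 0ℚ ℚ.< ε -> 0ℚ ℚ.< ½ ℚ.* ε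
 0<½ε {ε} p = subst (ℚ._< ½ ℚ.* ε) (ℚ.*-zeroʳ ½) (ℚ.*-monoʳ-<-pos ½ p)

 minus0 : ∀ q -> q ℚ.- 0ℚ ≡ q
 minus0 = solve 1 (\ q -> q :- con 0ℚ := q) refl
  where open +-*-Solver

 inv : ℚ -> ℚ
 inv q with q ℚ.≟ 0ℚ
 ... | yes _ = 0ℚ
 ... | no q≢0 = ℚ.1/_ q {{ℚ.≢-nonZero q≢0}}

 inv-* : ∀ {c} q -> 0ℚ ℚ.< c -> c ℚ.≤ ∣ q ∣ -> q ℚ.* inv q ≡ 1ℚ
 inv-* q 0<c c≤ with q ℚ.≟ 0ℚ
 ... | yes refl = ⊥-elim (ℚ.<-irrefl refl (ℚ.<-≤-trans 0<c c≤))
 ... | no q≢0 = ℚ.*-inverseʳ q {{ℚ.≢-nonZero q≢0}}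

 nonneg : ∀ q -> ℚ.NonNegative ∣ q ∣
 nonneg q = ℚ.nonNegative (ℚ.0≤∣p∣ q)

 apart : ∀ x -> IsCauchy x -> ¬ (x ∼ (\ _ -> 0ℚ)) -> ∃[ c ] 0ℚ ℚ.< c × ∃[ N ] ∀ n -> N ≤ n -> c ℚ.≤ ∣ x n ∣
 apart x cx x≁0 = dne \ none -> x≁0 \ ε 0<ε -> near none ε 0<ε where
  near : ¬ _ -> ∀ ε -> 0ℚ ℚ.< ε -> ∃[ N ] ∀ n -> N ≤ n -> ∣ x n ℚ.- 0ℚ ∣ ℚ.< ε
  near none ε 0<ε with cx (½ ℚ.* ε) (0<½ε 0<ε)
  ... | N , close with dec (∃[ m ] N ≤ m × ∣ x m ∣ ℚ.< ½ ℚ.* ε)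
  ... | no ¬small = ⊥-elim (none (½ ℚ.* ε , 0<½ε 0<ε , N , \ n N≤n -> ℚ.≮⇒≥ \ small -> ¬small (n , N≤n , small)))
  ... | yes (m , N≤m , small) = N , \ n N≤n -> subst₂ (\ a b -> ∣ a ∣ ℚ.< b)
   (regroup (x n) (x m) ~> sym (minus0 (x n))) (halves ε)
   (ℚ.≤-<-trans (ℚ.∣p+q∣≤∣p∣+∣q∣ (x n ℚ.- x m) (x m))
   (ℚ.+-mono-< (close n m N≤n N≤m) small)) where
   regroup : ∀ a b -> (a ℚ.- b) ℚ.+ b ≡ a
   regroup = solve 2 (\ a b -> (a :- b) :+ b := a) refl
    where open +-*-Solver

 module Inverse (x : ℕ -> ℚ) (cx : IsCauchy x) (c : ℚ) (0<c : 0ℚ ℚ.< c) (N : ℕ)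
  (far : ∀ n -> N ≤ n -> c ℚ.≤ ∣ x n ∣) where
  instance
   c-pos : ℚ.Positive c
   c-pos = ℚ.positive 0<c
   c≢0 : ℚ.NonZero c
   c≢0 = ℚ.pos⇒nonZero c
   d-pos : ℚ.Positive (ℚ.1/ c)
   d-pos = ℚ.1/pos⇒pos c
   d-nonNeg : ℚ.NonNegative (ℚ.1/ c)
   d-nonNeg = ℚ.pos⇒nonNeg (ℚ.1/ c)
  d : ℚ
  d = ℚ.1/ c
  inv≤d : ∀ n -> N ≤ n -> ∣ inv (x n) ∣ ℚ.≤ d
  inv≤d n N≤n = subst₂ ℚ._≤_ lhs rhs
   (ℚ.*-monoʳ-≤-nonNeg d (ℚ.*-monoˡ-≤-nonNeg ∣ y ∣ {{nonneg y}} (far n N≤n))) where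
   y = inv (x n)
   lhs : ∣ y ∣ ℚ.* c ℚ.* d ≡ ∣ y ∣
   lhs = (ℚ.*-assoc ∣ y ∣ c d) ~> cong (∣ y ∣ ℚ.*_) (ℚ.*-inverseʳ c) ~> (ℚ.*-identityʳ ∣ y ∣)
   rhs : ∣ y ∣ ℚ.* ∣ x n ∣ ℚ.* d ≡ d
   rhs = cong (ℚ._* d) ((ℚ.*-comm ∣ y ∣ ∣ x n ∣) ~> sym (ℚ.∣p*q∣≡∣p∣*∣q∣ (x n) y) ~> (cong ∣_∣ (inv-* (x n) 0<c (far n N≤n)))) ~> ℚ.*-identityˡ d
  inverseSeq : IsCauchy (\ n -> inv (x n))
  inverseSeq ε 0<ε with cx (c ℚ.* (c ℚ.* ε)) 0<δ where
   0<δ : 0ℚ ℚ.< c ℚ.* (c ℚ.* ε)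
   0<δ = subst (ℚ._< c ℚ.* (c ℚ.* ε)) (ℚ.*-zeroʳ c) (ℚ.*-monoʳ-<-pos c
    (subst (ℚ._< c ℚ.* ε) (ℚ.*-zeroʳ c) (ℚ.*-monoʳ-<-pos c 0<ε)))
  ... | M , close = M N.⊔ N , \ m n p q -> let
    N≤m = N.m⊔n≤o⇒n≤o M N p
    N≤n = N.m⊔n≤o⇒n≤o M N q
    a = x m ; b = x n ; a' = inv a ; b' = inv b
    diff : a' ℚ.- b' ≡ a' ℚ.* b' ℚ.* (b ℚ.- a)
    diff = (cong₂ ℚ._-_
     (sym (cong (a' ℚ.*_) (inv-* b 0<c (far n N≤n)) ~> ℚ.*-identityʳ a'))
     (sym (cong (b' ℚ.*_) (inv-* a 0<c (far m N≤m)) ~> ℚ.*-identityʳ b'))) ~> expand a b a' b'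
    size : ∣ a' ℚ.* b' ∣ ℚ.≤ d ℚ.* d
    size = subst (ℚ._≤ d ℚ.* d) (sym (ℚ.∣p*q∣≡∣p∣*∣q∣ a' b'))
     (ℚ.≤-trans (ℚ.*-monoˡ-≤-nonNeg ∣ a' ∣ {{nonneg a'}} (inv≤d n N≤n))
     (ℚ.*-monoʳ-≤-nonNeg d (inv≤d m N≤m)))
   in subst (\ z -> ∣ z ∣ ℚ.< ε) (sym diff)
   (subst₂ ℚ._<_ (sym (ℚ.∣p*q∣≡∣p∣*∣q∣ (a' ℚ.* b') (b ℚ.- a))) cancel
   (ℚ.≤-<-trans
   (ℚ.*-monoʳ-≤-nonNeg ∣ b ℚ.- a ∣ {{nonneg (b ℚ.- a)}} size)
   (ℚ.*-monoʳ-<-pos (d ℚ.* d) {{ℚ.pos*pos⇒pos d d}}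
   (close n m (N.m⊔n≤o⇒m≤o M N q) (N.m⊔n≤o⇒m≤o M N p))))) where
   expand : ∀ a b a' b' -> a' ℚ.* (b ℚ.* b') ℚ.- b' ℚ.* (a ℚ.* a') ≡ a' ℚ.* b' ℚ.* (b ℚ.- a)
   expand = solve 4 (\ a b a' b' -> a' :* (b :* b') :- b' :* (a :* a') := a' :* b' :* (b :- a)) refl
    where open +-*-Solver
   swap : ∀ c d e -> d ℚ.* d ℚ.* (c ℚ.* (c ℚ.* e)) ≡ (c ℚ.* d) ℚ.* ((c ℚ.* d) ℚ.* e)
   swap = solve 3 (\ c d e -> d :* d :* (c :* (c :* e)) := (c :* d) :* ((c :* d) :* e)) refl
    where open +-*-Solver
   cancel : d ℚ.* d ℚ.* (c ℚ.* (c ℚ.* ε)) ≡ ε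
   cancel = swap c d ε ~> cong (\ u -> u ℚ.* (u ℚ.* ε)) (ℚ.*-inverseʳ c) ~> ℚ.*-identityˡ (1ℚ ℚ.* ε) ~> ℚ.*-identityˡ ε

 inverse : ∀ x -> ¬ x ≈ 0# -> ∃[ y ] x * y ≈ 1#
 inverse x x≉0 with apart (seq (fst x)) (isCauchy (fst x)) x≉0
 ... | c , 0<c , N , far = (y , inv-closed {fst x} {y} (snd x) xy≈1) , xy≈1 where
  y : ℝ
  y = cauchy _ (Inverse.inverseSeq (seq (fst x)) (isCauchy (fst x)) c 0<c N far)
  xy≈1 : fst x Real.* y Real.≈ Real.1ℝ
  xy≈1 ε 0<ε = N , \ n N≤n -> subst (\ z -> ∣ z ∣ ℚ.< ε)
   (sym (cong (ℚ._- 1ℚ) (inv-* (seq (fst x) n) 0<c (far n N≤n)) ~> ℚ.+-inverseʳ 1ℚ)) 0<ε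

 1≉0 : ¬ 1# ≈ 0#
 1≉0 eq with eq 1ℚ (ℚ.positive⁻¹ 1ℚ)
 ... | N , small = ℚ.<-irrefl refl (small N N.≤-refl)

 NonNeg : Carrier -> Set
 NonNeg x = ∀ n -> 0ℚ ℚ.≤ seq (fst x) n

 nonNeg-* : ∀ x -> NonNeg (x * x)
 nonNeg-* x n = subst (0ℚ ℚ.≤_)
  (ℚ.∣p*q∣≡∣p∣*∣q∣ q q ~> square q) (ℚ.0≤∣p∣ (q ℚ.* q)) where
  q = seq (fst x) n
  square : ∀ q -> ∣ q ∣ ℚ.* ∣ q ∣ ≡ q ℚ.* q
  square q with ℚ.∣p∣≡p∨∣p∣≡-p q
  ... | inl e rewrite e = refl
  ... | inr e rewrite e = sym (ℚ.neg-distribˡ-* q (ℚ.- q)) ~> (cong ℚ.-_ (sym (ℚ.neg-distribʳ-* q q))) ~> neg-neg (q ℚ.* q) where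
   neg-neg : ∀ p -> ℚ.- (ℚ.- p) ≡ p
   neg-neg = solve 1 (\ p -> :- (:- p) := p) refl
    where open +-*-Solver

 nonNeg-sum : ∀ {n} {f : Fin n -> Carrier} -> (∀ i -> NonNeg (f i)) -> NonNeg (sum f)
 nonNeg-sum {zero} 0≤ n = ℚ.≤-refl
 nonNeg-sum {suc m} {f} 0≤ n = subst (ℚ._≤ seq (fst (sum f)) n) (ℚ.+-identityˡ 0ℚ)
  (ℚ.+-mono-≤ (0≤ 0F n) (nonNeg-sum (0≤ ∘ fsuc) n))

 +-zeroˡ : ∀ x y -> NonNeg x -> NonNeg y -> x + y ≈ 0# -> x ≈ 0#
 +-zeroˡ x y 0≤x 0≤y eq ε 0<ε with eq ε 0<ε
 ... | N , small = N , \ n N≤n -> ℚ.≤-<-trans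
  (subst₂ ℚ._≤_ (abs (0≤x n)) (abs (ℚ.≤-trans (0≤x n) (x≤x+y n))) (x≤x+y n))
  (small n N≤n) where
  x≤x+y : ∀ n -> seq (fst x) n ℚ.≤ seq (fst x) n ℚ.+ seq (fst y) n
  x≤x+y n = subst (ℚ._≤ seq (fst (x + y)) n) (ℚ.+-identityʳ _)
   (ℚ.+-monoʳ-≤ (seq (fst x) n) (0≤y n))
  abs : ∀ {q} -> 0ℚ ℚ.≤ q -> q ≡ ∣ q ℚ.- 0ℚ ∣
  abs {q} 0≤q = sym (ℚ.0≤p⇒∣p∣≡p 0≤q) ~> (cong ∣_∣ (sym (minus0 q)))

 square-zero : ∀ x -> x * x ≈ 0# -> x ≈ 0#
 square-zero x xx≈0 = dne \ x≉0 -> let y , xy≈1 = inverse x x≉0 in x≉0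
  (R.trans {x} {x * 1#} {0#} (R.sym {x * 1#} {x} (R.*-identityʳ x))
  (R.trans {x * 1#} {x * (x * y)} {0#} (R.*-congˡ {x} {1#} {x * y} (R.sym {x * y} {1#} xy≈1))
  (R.trans {x * (x * y)} {x * x * y} {0#} (R.sym {x * x * y} {x * (x * y)} (R.*-assoc x x y))
  (R.trans {x * x * y} {0# * y} {0#} (R.*-congʳ {y} {x * x} {0#} xx≈0) (R.zeroˡ y)))))

 sum-zero : ∀ {n} (f : Fin n -> Carrier) -> (∀ i -> NonNeg (f i)) -> sum f ≈ 0# -> ∀ i -> f i ≈ 0#
 sum-zero f 0≤ eq 0F = +-zeroˡ (f 0F) (sum (f ∘ fsuc)) (0≤ 0F) (nonNeg-sum (0≤ ∘ fsuc)) eq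
 sum-zero f 0≤ eq (fsuc i) = sum-zero (f ∘ fsuc) (0≤ ∘ fsuc)
  (+-zeroˡ S s (nonNeg-sum (0≤ ∘ fsuc)) (0≤ 0F) (R.trans {S + s} {s + S} {0#} (R.+-comm S s) eq)) i where
  s = f 0F
  S = sum (f ∘ fsuc)

 sumOfSquares : ∀ {m n} (f : Fin m -> Fin n -> Carrier) -> sum (\ i -> sum (\ j -> f i j * f i j)) ≈ 0# -> ∀ i j -> f i j ≈ 0#
 sumOfSquares f eq i j = square-zero (f i j)
  (sum-zero _ (\ j -> nonNeg-* (f i j))
  (sum-zero _ (\ i -> nonNeg-sum (\ j -> nonNeg-* (f i j))) eq i) j)

-- Ring identities are decided with formal differences of naturals as coefficients, so that
-- cancellation is recognised although equality in the ring itself is undecidable.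
module RingSolver (R : Ring) where

 open CommutativeRing R hiding (zero)
  renaming (refl to rfl; sym to symm; trans to infixr 5 _>>_)
 open import Algebra.Solver.Ring.AlmostCommutativeRing
  using (fromCommutativeRing; _-Raw-AlmostCommutative⟶_)
 open import Algebra.Properties.Semiring.Mult semiring
  using (×1-homo-*) renaming (_×_ to _⊗_; ×-homo-+ to ⊗-homo-+)
 open import Algebra.Properties.Ring ring using (-‿distribˡ-*; -‿distribʳ-*; -‿+-comm; -‿involutive)
 open import Relation.Binary.Reasoning.Setoid setoid

 private
  reduce : ℕ × ℕ -> ℕ × ℕ
  reduce (suc m , suc n) = reduce (m , n)
  reduce x = x
  Differences : RawRing 0ℓ 0ℓ
  Differences = record
   { Carrier = ℕ × ℕ
   ; _≈_ = \ x y -> fst x N.+ snd y ≡ fst y N.+ snd x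
   ; _+_ = \ x y -> reduce (fst x N.+ fst y , snd x N.+ snd y)
   ; _*_ = \ x y -> reduce (fst x N.* fst y N.+ snd x N.* snd y , fst x N.* snd y N.+ snd x N.* fst y)
   ; -_ = \ x -> snd x , fst x
   ; 0# = 0 , 0
   ; 1# = 1 , 0
   }
  difference value : ℕ × ℕ -> Carrier
  difference (m , n) = m ⊗ 1# - n ⊗ 1#
  -- 0 and 1 have to denote 0# and 1# definitionally.
  value (zero , zero) = 0#
  value (suc zero , zero) = 1#
  value x = difference x
  neg-zero : - 0# ≈ 0#
  neg-zero = symm (+-identityˡ _) >> -‿inverseʳ 0#
  value≈ : ∀ x -> value x ≈ difference x
  value≈ (zero , zero) = symm (-‿inverseʳ 0#)
  value≈ (suc zero , zero) = symm (+-congʳ (+-identityʳ 1#) >> +-congˡ neg-zero >> +-identityʳ 1#)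
  value≈ (zero , suc n) = rfl
  value≈ (suc zero , suc n) = rfl
  value≈ (suc (suc m) , n) = rfl

  regroup : ∀ a b c e -> (a + b) - (c + e) ≈ (a - c) + (b - e)
  regroup a b c e = begin
   (a + b) - (c + e)        ≈⟨ +-congˡ (-‿+-comm c e) ⟨
   (a + b) + (- c + - e)    ≈⟨ +-assoc a b _ ⟩
   a + (b + (- c + - e))    ≈⟨ +-congˡ (+-assoc b _ _) ⟨
   a + ((b + - c) + - e)    ≈⟨ +-congˡ (+-congʳ (+-comm b _)) ⟩
   a + ((- c + b) + - e)    ≈⟨ +-congˡ (+-assoc _ b _) ⟩
   a + (- c + (b + - e))    ≈⟨ +-assoc a _ _ ⟨
   (a - c) + (b - e)        ∎
  reduce≈ : ∀ m n -> value (reduce (m , n)) ≈ difference (m , n)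
  reduce≈ (suc m) (suc n) = reduce≈ m n >> symm (regroup 1# (m ⊗ 1#) 1# (n ⊗ 1#) >> +-congʳ (-‿inverseʳ 1#) >> +-identityˡ _)
  reduce≈ zero n = value≈ (zero , n)
  reduce≈ (suc m) zero = value≈ (suc m , zero)
  value-* : ∀ a b c e -> (a * c + b * e) - (a * e + b * c) ≈ (a - b) * (c - e)
  value-* a b c e = begin
   (a * c + b * e) - (a * e + b * c)      ≈⟨ regroup _ _ _ _ ⟩
   (a * c - a * e) + (b * e - b * c)      ≈⟨ +-cong (+-congˡ (-‿distribʳ-* a e)) (+-comm _ _) ⟩
   (a * c + a * - e) + (- (b * c) + b * e) ≈⟨ +-cong (symm (distribˡ a c (- e))) (+-cong (-‿distribˡ-* b c) bb) ⟩
   a * (c - e) + (- b * c + - b * - e)    ≈⟨ +-congˡ (distribˡ (- b) c (- e)) ⟨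
   a * (c - e) + - b * (c - e)            ≈⟨ distribʳ (c - e) a (- b) ⟨
   (a - b) * (c - e)                      ∎ where
   bb : b * e ≈ - b * - e
   bb = begin
    b * e          ≈⟨ -‿involutive (b * e) ⟨
    - - (b * e)    ≈⟨ -‿cong (-‿distribˡ-* b e) ⟩
    - (- b * e)    ≈⟨ -‿distribʳ-* (- b) e ⟩
    - b * - e      ∎
  morphism : Differences -Raw-AlmostCommutative⟶ fromCommutativeRing R
  morphism = record
   { ⟦_⟧ = value
   ; +-homo = \ x@(a , b) y@(c , e) -> reduce≈ (a N.+ c) (b N.+ e) >> +-cong (⊗-homo-+ 1# a c) (-‿cong (⊗-homo-+ 1# b e)) >> regroup _ _ _ _ >> symm (+-cong (value≈ x) (value≈ y))
   ; *-homo = \ x@(a , b) y@(c , e) -> reduce≈ (a N.* c N.+ b N.* e) (a N.* e N.+ b N.* c) >> +-cong (⊗-homo-+ 1# (a N.* c) (b N.* e) >> +-cong (×1-homo-* a c) (×1-homo-* b e))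
   (-‿cong (⊗-homo-+ 1# (a N.* e) (b N.* c) >> +-cong (×1-homo-* a e) (×1-homo-* b c))) >> value-* _ _ _ _ >> symm (*-cong (value≈ x) (value≈ y))
   ; -‿homo = \ x@(a , b) -> value≈ (b , a) >> (begin
   b ⊗ 1# - a ⊗ 1#            ≈⟨ +-comm _ _ ⟩
   - (a ⊗ 1#) + b ⊗ 1#        ≈⟨ +-congˡ (-‿involutive _) ⟨
   - (a ⊗ 1#) - - (b ⊗ 1#)    ≈⟨ -‿+-comm _ _ ⟩
   - (a ⊗ 1# - b ⊗ 1#)        ≈⟨ -‿cong (value≈ x) ⟨
   - value x                  ∎)
   ; 0-homo = rfl
   ; 1-homo = rfl
   }
  equal? : ∀ x y -> Maybe (value x ≈ value y)
  equal? (a , b) (c , e) with a N.+ e N.≟ c N.+ b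
  ... | no _ = nothing
  ... | yes eq = just (value≈ (a , b) >> (begin
   a ⊗ 1# - b ⊗ 1#      ≈⟨ shift a b e ⟨
   (a N.+ e) ⊗ 1# - (b N.+ e) ⊗ 1#    ≡⟨ cong₂ (\ m n -> m ⊗ 1# - n ⊗ 1#) eq (N.+-comm b e) ⟩
   (c N.+ b) ⊗ 1# - (e N.+ b) ⊗ 1#    ≈⟨ shift c e b ⟩
   c ⊗ 1# - e ⊗ 1#      ∎) >> symm (value≈ (c , e))) where
   shift : ∀ a b e -> (a N.+ e) ⊗ 1# - (b N.+ e) ⊗ 1# ≈ a ⊗ 1# - b ⊗ 1#
   shift a b e = +-cong (⊗-homo-+ 1# a e) (-‿cong (⊗-homo-+ 1# b e)) >> regroup _ _ _ _ >> +-congˡ (-‿inverseʳ _) >> +-identityʳ _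

 open import Algebra.Solver.Ring Differences (fromCommutativeRing R) morphism equal? public
  using (solve; _:=_; _:+_; _:*_; _:-_; :-_; con; Polynomial)

 :0 :1 : ∀ {n} -> Polynomial n
 :0 = con (0 , 0)
 :1 = con (1 , 0)

module _ (R : Ring) where

 open CommutativeRing R using (Carrier; _≈_; _+_; _*_; 0#; 1#; +-commutativeMonoid)
 open import Algebra.Properties.CommutativeMonoid.Sum +-commutativeMonoid using (sum)

 record FormallyReal : Set where
  field
   1≉0 : ¬ 1# ≈ 0#
   inverse : ∀ x -> ¬ x ≈ 0# -> ∃[ y ] x * y ≈ 1#
   sumOfSquares : ∀ {m n} (f : Fin m -> Fin n -> Carrier) -> sum (\ i -> sum (\ j -> f i j * f i j)) ≈ 0# -> ∀ i j -> f i j ≈ 0#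

module Naturals (R : Ring) (real : FormallyReal R) where

 open FormallyReal real
 open CommutativeRing R hiding (zero; refl; sym) renaming (trans to infixr 5 _>>_)
 private module R = CommutativeRing R
 open import Algebra.Properties.CommutativeMonoid.Sum +-commutativeMonoid using (sum)
 open import Algebra.Properties.Ring ring using (+-cancelˡ)

 nat : ℕ -> Carrier
 nat zero = 0#
 nat (suc n) = 1# + nat n

 private
  nat≉0 : ∀ n -> ¬ nat (suc n) ≈ 0#
  nat≉0 n p = 1≉0 (sumOfSquares {1} {suc n} (\ _ _ -> 1#) (+-identityʳ _ >> ones (suc n) >> p) 0F 0F) where
   ones : ∀ n -> sum {n} (\ _ -> 1# * 1#) ≈ nat n
   ones zero = R.refl
   ones (suc n) = +-cong (*-identityˡ 1#) (ones n)

 nat-inj : ∀ {m n} -> nat m ≈ nat n -> m ≡ n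
 nat-inj {zero} {zero} p = refl
 nat-inj {zero} {suc n} p = ⊥-elim (nat≉0 n (R.sym p))
 nat-inj {suc m} {zero} p = ⊥-elim (nat≉0 m p)
 nat-inj {suc m} {suc n} p = cong suc (nat-inj (+-cancelˡ 1# _ _ p))

module Euclidean
 (em : EM) (R : Ring) (real : FormallyReal R) (d : ℕ) where
 open Classical em
 open FormallyReal real
 open Naturals R real using (nat)
 open Subspaces R d renaming (⊥ to 0ᴸ; ⊤ to 1ᴸ)
 open Subspace
 open RingLaws R
 open import Algebra.Properties.CommutativeMonoid.Sum +-commutativeMonoid
  using (sum; sum-cong-≋; ∑-distrib-+; sum-replicate-zero; ∑-comm)
 open import Algebra.Properties.Semiring.Sum semiring using (*-distribˡ-sum)
 open import Algebra.Properties.Ring ring using (-0#≈0#)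
 open RingSolver R
 open import Relation.Binary.Reasoning.Setoid setoid

 ·-cong : ∀ {u u' v v' : V} -> u ≈ᵛ u' -> v ≈ᵛ v' -> u · v ≈ u' · v'
 ·-cong p q = sum-cong-≋ (\ i -> *-cong (p i) (q i))

 ·-comm : ∀ (u v : V) -> u · v ≈ v · u
 ·-comm u v = sum-cong-≋ (\ i -> *-comm (u i) (v i))

 ·-zeroʳ : ∀ (u : V) -> u · 0ᵛ ≈ 0#
 ·-zeroʳ u = sum-cong-≋ (\ i -> zeroʳ (u i)) >> sum-replicate-zero d

 ·-+ʳ : ∀ (u v w : V) -> u · (v +ᵛ w) ≈ u · v + u · w
 ·-+ʳ u v w = sum-cong-≋ (\ i -> distribˡ (u i) (v i) (w i)) >> ∑-distrib-+ (\ i -> u i * v i) (\ i -> u i * w i)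

 ·-∙ʳ : ∀ c (u v : V) -> u · (c ∙ᵛ v) ≈ c * u · v
 ·-∙ʳ c u v = (sum-cong-≋ \ i -> solve 3 (\ c u v -> u :* (c :* v) := c :* (u :* v)) rfl c (u i) (v i)) >> symm (*-distribˡ-sum c (\ i -> u i * v i))

 ·-linearʳ : ∀ a b (u v w : V) -> u · ((a ∙ᵛ v) +ᵛ (b ∙ᵛ w)) ≈ a * u · v + b * u · w
 ·-linearʳ a b u v w = ·-+ʳ u (a ∙ᵛ v) (b ∙ᵛ w) >> +-cong (·-∙ʳ a u v) (·-∙ʳ b u w)

 ·-linearˡ : ∀ a b (u v w : V) -> ((a ∙ᵛ v) +ᵛ (b ∙ᵛ w)) · u ≈ a * v · u + b * w · u
 ·-linearˡ a b u v w = ·-comm _ u >> ·-linearʳ a b u v w >> +-cong (*-congˡ (·-comm u v)) (*-congˡ (·-comm u w))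

 ·-definite : ∀ (u : V) -> u · u ≈ 0# -> u ≈ᵛ 0ᵛ
 ·-definite u eq i = sumOfSquares {1} (\ _ -> u) (+-identityʳ _ >> eq) 0F i

 infixr 8 _$_

 _$_ : Matrix -> V -> V
 (A $ x) i = A i · x

 Symmetric Idempotent : Matrix -> Set
 Symmetric A = ∀ i j -> A i j ≈ A j i
 Idempotent A = ∀ i j -> sum (\ k -> A i k * A k j) ≈ A i j

 trace : Matrix -> Carrier
 trace A = sum (\ i -> A i i)

 δ : ∀ {n} -> Fin n -> Fin n -> Carrier
 δ i j = if does (i ≟ᶠ j) then 1# else 0#

 sum-δ : ∀ {n} (i : Fin n) (x : Fin n -> Carrier) -> sum (\ k -> δ i k * x k) ≈ x i
 sum-δ {suc n} 0F x = begin
  1# * x 0F + sum (\ k -> 0# * x (fsuc k))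
  ≈⟨ +-cong (*-identityˡ _) ((sum-cong-≋ \ k -> zeroˡ (x (fsuc k))) >> sum-replicate-zero n) ⟩
  x 0F + 0#  ≈⟨ +-identityʳ _ ⟩
  x 0F  ∎
 sum-δ (fsuc i) x = +-cong (zeroˡ _) (sum-δ i (x ∘ fsuc)) >> +-identityˡ _

 δ-sym : ∀ {n} (i j : Fin n) -> δ i j ≈ δ j i
 δ-sym 0F 0F = rfl
 δ-sym 0F (fsuc j) = rfl
 δ-sym (fsuc i) 0F = rfl
 δ-sym (fsuc i) (fsuc j) = δ-sym i j

 δ-refl : ∀ {n} (i : Fin n) -> δ i i ≈ 1#
 δ-refl 0F = rfl
 δ-refl (fsuc i) = δ-refl i

 δ-≢ : ∀ {n} {i j : Fin n} -> i ≢ j -> δ i j ≈ 0#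
 δ-≢ {i = i} {j} i≢j with i ≟ᶠ j
 ... | yes eq = ⊥-elim (i≢j eq)
 ... | no _ = rfl

 trace-δ : ∀ n -> sum (\ (i : Fin n) -> δ i i) ≈ nat n
 trace-δ zero = rfl
 trace-δ (suc n) = +-congˡ (trace-δ n)

 $-cong : ∀ A {x y : V} -> x ≈ᵛ y -> A $ x ≈ᵛ A $ y
 $-cong A p i = ·-cong {A i} (\ _ -> rfl) p

 symmetric-· : ∀ {A} -> Symmetric A -> ∀ x y -> (A $ x) · y ≈ x · (A $ y)
 symmetric-· {A} s x y = begin
  sum (\ i -> A i · x * y i)                  ≈⟨ sum-cong-≋ (\ i -> *-comm _ _ >> *-distribˡ-sum (y i) (\ k -> A i k * x k)) ⟩
  sum (\ i -> sum (\ k -> y i * (A i k * x k)))  ≈⟨ ∑-comm (\ i k -> y i * (A i k * x k)) ⟩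
  sum (\ k -> sum (\ i -> y i * (A i k * x k)))  ≈⟨ sum-cong-≋ (\ k -> sum-cong-≋ (\ i -> *-congˡ (*-congʳ (s i k)) >> solve 3 (\ a x y -> y :* (a :* x) := x :* (a :* y)) rfl (A k i) (x k) (y i)) >> symm (*-distribˡ-sum (x k) (\ i -> A k i * y i))) ⟩
  sum (\ k -> x k * A k · y)                  ∎

 ⊗-$ : ∀ A B x -> (\ i -> (\ j -> sum (\ k -> A i k * B k j)) · x) ≈ᵛ A $ (B $ x)
 ⊗-$ A B x i = symm (begin
  sum (\ j -> A i j * B j · x)                  ≈⟨ sum-cong-≋ (\ j -> *-distribˡ-sum (A i j) (\ k -> B j k * x k)) ⟩
  sum (\ j -> sum (\ k -> A i j * (B j k * x k)))  ≈⟨ ∑-comm (\ j k -> A i j * (B j k * x k)) ⟩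
  sum (\ k -> sum (\ j -> A i j * (B j k * x k)))  ≈⟨ sum-cong-≋ (\ k -> (sum-cong-≋ \ j -> solve 3 (\ a b c -> a :* (b :* c) := c :* (a :* b)) rfl (A i j) (B j k) (x k)) >> symm (*-distribˡ-sum (x k) (\ j -> A i j * B j k)) >> *-comm _ _) ⟩
  sum (\ k -> sum (\ j -> A i j * B j k) * x k)    ∎)

 idempotent-$ : ∀ {A} -> Idempotent A -> ∀ x -> A $ (A $ x) ≈ᵛ A $ x
 idempotent-$ {A} e x i = symm (⊗-$ A A x i) >> ·-cong {v = x} (e i) (\ _ -> rfl)

 traceless : ∀ {A} -> Symmetric A -> Idempotent A -> trace A ≈ 0# -> ∀ i j -> A i j ≈ 0#
 traceless {A} s e t = sumOfSquares A ((sum-cong-≋ \ i -> (sum-cong-≋ \ j -> *-congˡ (s i j)) >> e i i) >> t)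

 module Deflation (A : Matrix) (s : Symmetric A) (e : Idempotent A) (u : V) (fixed : A $ u ≈ᵛ u)
  (t : Carrier) (norm : u · u * t ≈ 1#) where
  A' : Matrix
  A' i j = A i j - t * (u i * u j)
  symmetric : Symmetric A'
  symmetric i j = +-cong (s i j) (-‿cong (*-congˡ (*-comm (u i) (u j))))
  $-A' : ∀ x -> A' $ x ≈ᵛ (A $ x) +ᵛ ((- (t * u · x)) ∙ᵛ u)
  $-A' x i = begin
   sum (\ j -> (A i j - t * (u i * u j)) * x j)
   ≈⟨ sum-cong-≋ (\ j -> solve 5 (\ a t u v x -> (a :- t :* (u :* v)) :* x := a :* x :+ (:- (t :* u)) :* (v :* x))
   rfl (A i j) t (u i) (u j) (x j)) ⟩
   sum (\ j -> A i j * x j + (- (t * u i)) * (u j * x j))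
   ≈⟨ ∑-distrib-+ (\ j -> A i j * x j) _ ⟩
   A i · x + sum (\ j -> (- (t * u i)) * (u j * x j))
   ≈⟨ +-congˡ (*-distribˡ-sum (- (t * u i)) (\ j -> u j * x j)) ⟨
   A i · x + (- (t * u i)) * u · x
   ≈⟨ +-congˡ (solve 3 (\ t u x -> (:- (t :* u)) :* x := (:- (t :* x)) :* u) rfl t (u i) (u · x)) ⟩
   A i · x + (- (t * u · x)) * u i  ∎
  fixes : ∀ {x} -> A $ x ≈ᵛ x -> u · x ≈ 0# -> A' $ x ≈ᵛ x
  fixes {x} Ax≈x ux≈0 i = $-A' x i >> +-cong (Ax≈x i) (*-congʳ (-‿cong (*-congˡ ux≈0))) >> solve 3 (\ x t u -> x :+ (:- (t :* :0)) :* u := x) rfl (x i) t (u i)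
  idempotent : Idempotent A'
  idempotent i j = begin
   A' i · (\ k -> A' k j)                              ≈⟨ $-A' (\ k -> A' k j) i ⟩
   A i · (\ k -> A' k j) + (- (t * u · (\ k -> A' k j))) * u i
   ≈⟨ +-cong A·A' (*-congʳ (-‿cong (*-congˡ u·A'))) ⟩
   A' i j + (- (t * 0#)) * u i                        ≈⟨ solve 3 (\ x t u -> x :+ (:- (t :* :0)) :* u := x) rfl (A' i j) t (u i) ⟩
   A' i j                                             ∎ where
   column : ∀ (w : V) -> w · (\ k -> A' k j) ≈ w · (\ k -> A k j) + (- (t * u j)) * w · u
   column w = ·-cong {w} (\ _ -> rfl) (\ k -> solve 4 (\ a t u v -> a :- t :* (u :* v) := a :+ (:- (t :* v)) :* u) rfl (A k j) t (u k) (u j)) >> ·-+ʳ w (\ k -> A k j) ((- (t * u j)) ∙ᵛ u) >> +-congˡ (·-∙ʳ _ w u)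
   A·A' : A i · (\ k -> A' k j) ≈ A' i j
   A·A' = column (A i) >> +-cong (e i j) (*-congˡ (fixed i)) >> solve 4 (\ a t u v -> a :+ (:- (t :* v)) :* u := a :- t :* (u :* v)) rfl (A i j) t (u i) (u j)
   u·A' : u · (\ k -> A' k j) ≈ 0#
   u·A' = column u >> +-cong (·-comm u _ >> ·-cong {v = u} (\ k -> s k j) (\ _ -> rfl) >> fixed j)
    (solve 3 (\ t v n -> (:- (t :* v)) :* n := :- ((n :* t) :* v)) rfl t (u j) (u · u)) >> +-congˡ (-‿cong (*-congʳ norm)) >> solve 1 (\ v -> v :- :1 :* v := :0) rfl (u j)
  trace-A' : trace A ≈ 1# + trace A'
  trace-A' = symm (begin
   1# + trace A'                                  ≈⟨ +-congˡ (∑-distrib-+ (\ i -> A i i) _) ⟩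
   1# + (trace A + sum (\ i -> - (t * (u i * u i))))
   ≈⟨ +-congˡ (+-congˡ ((sum-cong-≋ \ i -> solve 2 (\ t u -> :- (t :* (u :* u)) := (:- t) :* (u :* u)) rfl t (u i)) >> symm (*-distribˡ-sum (- t) (\ i -> u i * u i)))) ⟩
   1# + (trace A + (- t) * u · u)                 ≈⟨ solve 3 (\ a t n -> :1 :+ (a :+ (:- t) :* n) := a :+ (:1 :- n :* t)) rfl (trace A) t (u · u) ⟩
   trace A + (1# - u · u * t)                     ≈⟨ +-congˡ (+-congˡ (-‿cong norm) >> -‿inverseʳ 1#) ⟩
   trace A + 0#                                   ≈⟨ +-identityʳ _ ⟩
   trace A                                        ∎)

 normSquare⁻¹ : ∀ {u : V} -> ¬ u ≈ᵛ 0ᵛ -> ∃[ t ] u · u * t ≈ 1#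
 normSquare⁻¹ {u} u≉0 = inverse (u · u) (u≉0 ∘ ·-definite u)

 1+-cancel : ∀ {x y} -> 1# + x ≈ 1# + y -> x ≈ y
 1+-cancel {x} {y} eq = solve 1 (\ x -> x := (:1 :+ x) :- :1) rfl x >> +-congʳ eq >> solve 1 (\ y -> (:1 :+ y) :- :1 := y) rfl y

 -- The kernel of the projection is U; its trace is at first d and drops with each vector of U
 -- that it does not yet annihilate.
 record Annihilator (U : Subspace) : Set where
  field
   matrix     : Matrix
   symmetric  : Symmetric matrix
   idempotent : Idempotent matrix
   kernel     : ∀ x -> x ∈ U ⇔ matrix $ x ≈ᵛ 0ᵛ

 annihilator : ∀ U -> Annihilator U
 annihilator U = go d (\ i j -> δ i j) δ-sym (\ i j -> sum-δ i (\ k -> δ k j))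
  (trace-δ d) (\ x -> resp U (\ i -> symm (+-congˡ (-‿cong (sum-δ i x)) >> -‿inverseʳ (x i))) (0∈ U)) where
  finish : ∀ A -> Symmetric A -> Idempotent A -> (∀ x -> (\ i -> x i - (A $ x) i) ∈ U) -> (∀ x -> x ∈ U -> A $ x ≈ᵛ 0ᵛ) -> Annihilator U
  finish A s e r h = record { matrix = A ; symmetric = s ; idempotent = e ; kernel = \ x -> mk⇔ (h x) \ z -> resp U (\ i -> +-congˡ (-‿cong (z i) >> -0#≈0#) >> +-identityʳ (x i)) (r x) }
  go : ∀ k A -> Symmetric A -> Idempotent A -> trace A ≈ nat k -> (∀ x -> (\ i -> x i - (A $ x) i) ∈ U) -> Annihilator U
  go zero A s e tr r = finish A s e r \ x _ i -> ·-cong {v = x} (traceless s e tr i) (\ _ -> rfl) >> ·-comm 0ᵛ x >> ·-zeroʳ x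
  go (suc k) A s e tr r with dec (∃[ x ] x ∈ U × ¬ A $ x ≈ᵛ 0ᵛ)
  ... | no done = finish A s e r \ x x∈U -> dne \ h -> done (x , x∈U , h)
  ... | yes (x , x∈U , u≉0) = go k A' symmetric idempotent
   (1+-cancel (symm trace-A' >> tr)) \ y -> resp U (\ i -> solve 4 (\ y a c u -> (y :- a) :+ c :* u := y :- (a :+ (:- c) :* u)) rfl (y i) ((A $ y) i) (t * u · y) (u i) >> +-congˡ (-‿cong (symm ($-A' y i))))
   (+-closed U (r y) (∙-closed U (t * u · y) u∈U)) where
   u = A $ x
   t = fst (normSquare⁻¹ u≉0)
   open Deflation A s e u (idempotent-$ e x) t (snd (normSquare⁻¹ u≉0))
   u∈U : u ∈ U
   u∈U = resp U (\ i -> solve 2 (\ x a -> x :+ (:- :1) :* (x :- a) := a) rfl (x i) (u i))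
    (+-closed U x∈U (∙-closed U (- 1#) (r x)))

 -- d nonzero pairwise orthogonal vectors span: deflating the identity by each of them leaves trace 0.
 orthogonalBasis : (v : Fin d -> V) -> (∀ k -> ¬ v k ≈ᵛ 0ᵛ) -> (∀ j k -> j ≢ k -> v j · v k ≈ 0#) -> ∀ y -> (∀ k -> v k · y ≈ 0#) -> y ≈ᵛ 0ᵛ
 orthogonalBasis v v≉0 orth y v⊥y = go d (\ i j -> δ i j) δ-sym (\ i j -> sum-δ i (\ k -> δ k j)) (trace-δ d)
  v v≉0 orth v⊥y (\ k i -> sum-δ i (v k)) (\ i -> sum-δ i y) where
  go : ∀ n A -> Symmetric A -> Idempotent A -> trace A ≈ nat n -> (v : Fin n -> V) -> (∀ k -> ¬ v k ≈ᵛ 0ᵛ) -> (∀ j k -> j ≢ k -> v j · v k ≈ 0#) -> (∀ k -> v k · y ≈ 0#) -> (∀ k -> A $ v k ≈ᵛ v k) -> A $ y ≈ᵛ y -> y ≈ᵛ 0ᵛ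
  go zero A s e tr v _ _ _ _ fy i = symm (fy i) >> ·-cong {v = y} (traceless s e tr i) (\ _ -> rfl) >> ·-comm 0ᵛ y >> ·-zeroʳ y
  go (suc n) A s e tr v v≉0 orth v⊥y fv fy = go n A' symmetric idempotent (1+-cancel (symm trace-A' >> tr))
   (v ∘ fsuc) (v≉0 ∘ fsuc) (\ j k j≢k -> orth (fsuc j) (fsuc k) (j≢k ∘ Fin.suc-injective)) (v⊥y ∘ fsuc)
   (\ k -> fixes (fv (fsuc k)) (orth 0F (fsuc k) \ ())) (fixes fy (v⊥y 0F))
   where open Deflation A s e (v 0F) (fv 0F) _ (snd (normSquare⁻¹ (v≉0 0F)))

 ⊕-complement : ∀ U x -> x ∈ (U ⊕ (U ^⊥))
 ⊕-complement U x = (\ i -> x i - (A $ x) i) , A $ x , bwd (kernel _) killed , orthogonal , \ i -> solve 2 (\ x a -> x := (x :- a) :+ a) rfl (x i) ((A $ x) i) where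
  open Annihilator (annihilator U) renaming (matrix to A)
  killed : A $ (\ i -> x i - (A $ x) i) ≈ᵛ 0ᵛ
  killed i = ·-cong {A i} (\ _ -> rfl) (\ j -> solve 2 (\ x a -> x :- a := :1 :* x :+ (:- :1) :* a) rfl (x j) ((A $ x) j)) >> ·-linearʳ 1# (- 1#) (A i) x (A $ x) >> +-congˡ (*-congˡ (idempotent-$ idempotent x i)) >> solve 1 (\ a -> :1 :* a :+ (:- :1) :* a := :0) rfl ((A $ x) i)
  orthogonal : A $ x ∈ (U ^⊥)
  orthogonal u u∈U = symm (symmetric-· symmetric u x) >> ·-cong {v = x} (fwd (kernel u) u∈U) (\ _ -> rfl) >> ·-comm 0ᵛ x >> ·-zeroʳ x

module Formula where

 infixl 6 _⊹_
 infixl 7 _✶_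

 data Ex (k : ℕ) : Set where
  lit     : ℕ -> Ex k
  #_      : Fin k -> Ex k
  _⊹_ _✶_ : Ex k -> Ex k -> Ex k

 ⟦_⟧e : ∀ {k} -> Ex k -> Vec ℕ k -> ℕ
 ⟦ lit n ⟧e ρ = n
 ⟦ # i ⟧e ρ = lookup ρ i
 ⟦ a ⊹ b ⟧e ρ = ⟦ a ⟧e ρ N.+ ⟦ b ⟧e ρ
 ⟦ a ✶ b ⟧e ρ = ⟦ a ⟧e ρ N.* ⟦ b ⟧e ρ

 ⟦_⟧ⁿ : ∀ {k} -> List (Ex k) -> Vec ℕ k -> List ℕ
 ⟦ es ⟧ⁿ ρ = map (\ e -> ⟦ e ⟧e ρ) es

 -- Uniform quantifier-free formulas over a field: the unknowns are indexed by tuples of natural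
 -- numbers, and  all  is a conjunction over an initial segment of ℕ.
 data Tm (K k : ℕ) : Set where
  var     : List (Ex k) -> Tm K k
  inp     : Ex k -> Tm K k
  con     : Fin K -> Tm K k
  zero one : Tm K k
  add mul : Tm K k -> Tm K k -> Tm K k

 data Fm (K k : ℕ) : Set where
  equ : Tm K k -> Tm K k -> Fm K k
  and : Fm K k -> Fm K k -> Fm K k
  not : Fm K k -> Fm K k
  all : Ex k -> Fm K (suc k) -> Fm K k

 TmInputs : (ℕ -> Set) -> ∀ {K k} -> Tm K k -> Vec ℕ k -> Set
 TmInputs P (inp e) ρ = P (⟦ e ⟧e ρ)
 TmInputs P (add s t) ρ = TmInputs P s ρ × TmInputs P t ρ
 TmInputs P (mul s t) ρ = TmInputs P s ρ × TmInputs P t ρ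
 TmInputs P _ ρ = ⊤

 FmInputs : (ℕ -> Set) -> ∀ {K k} -> Fm K k -> Vec ℕ k -> Set
 FmInputs P (equ s t) ρ = TmInputs P s ρ × TmInputs P t ρ
 FmInputs P (and φ ψ) ρ = FmInputs P φ ρ × FmInputs P ψ ρ
 FmInputs P (not φ) ρ = FmInputs P φ ρ
 FmInputs P (all e φ) ρ = ∀ j -> j < ⟦ e ⟧e ρ -> FmInputs P φ (j ∷ ρ)

 module FormulaSemantics (R : Ring) where
  open CommutativeRing R using (Carrier; _≈_; _+_; _*_; 0#; 1#)
  nth : List Carrier -> ℕ -> Carrier
  nth []       _       = 0#
  nth (x ∷ xs) zero    = x
  nth (x ∷ xs) (suc n) = nth xs n
  module _ {K : ℕ} (κ : Fin K -> Carrier) (w : ℕ -> Carrier) (v : List ℕ -> Carrier) where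
   ⟦_⟧ᵗ : ∀ {k} -> Tm K k -> Vec ℕ k -> Carrier
   ⟦ var es ⟧ᵗ ρ = v (⟦ es ⟧ⁿ ρ)
   ⟦ inp e ⟧ᵗ ρ = w (⟦ e ⟧e ρ)
   ⟦ con c ⟧ᵗ ρ = κ c
   ⟦ zero ⟧ᵗ ρ = 0#
   ⟦ one ⟧ᵗ ρ = 1#
   ⟦ add s t ⟧ᵗ ρ = ⟦ s ⟧ᵗ ρ + ⟦ t ⟧ᵗ ρ
   ⟦ mul s t ⟧ᵗ ρ = ⟦ s ⟧ᵗ ρ * ⟦ t ⟧ᵗ ρ
   Holds : ∀ {k} -> Fm K k -> Vec ℕ k -> Set
   Holds (equ s t) ρ = ⟦ s ⟧ᵗ ρ ≈ ⟦ t ⟧ᵗ ρ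
   Holds (and φ ψ) ρ = Holds φ ρ × Holds ψ ρ
   Holds (not φ) ρ = ¬ Holds φ ρ
   Holds (all e φ) ρ = ∀ j -> j < ⟦ e ⟧e ρ -> Holds φ (j ∷ ρ)
  Solvable : ∀ {K} -> (Fin K -> Carrier) -> Fm K 1 -> List Carrier -> Set
  Solvable κ φ w = ∃[ v ] Holds κ (nth w) v φ (length w ∷ [])

module Gadgets
 (em : EM) (R : Ring) (real : FormallyReal R) (d : ℕ) where
 open Classical em
 open FormallyReal real
 open Subspaces R d renaming (⊥ to 0ᴸ; ⊤ to 1ᴸ)
 open Subspace
 open Euclidean em R real d
 open RingLaws R
 open RingSolver R

 infix 4 _≐_

 record _≐_ (U W : Subspace) : Set where
  constructor ext
  field members : ∀ x -> x ∈ U ⇔ x ∈ W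
  to : ∀ {x} -> x ∈ U -> x ∈ W
  to = fwd (members _)
  from : ∀ {x} -> x ∈ W -> x ∈ U
  from = bwd (members _)

 open _≐_ public

 ≐-refl : ∀ {U} -> U ≐ U
 ≐-refl = ext \ x -> mk⇔ id id


 ≐-trans : ∀ {U W X} -> U ≐ W -> W ≐ X -> U ≐ X
 ≐-trans p q = ext \ x -> mk⇔ (to q ∘ to p) (from p ∘ from q)

 ∩-cong : ∀ {U U' W W'} -> U ≐ U' -> W ≐ W' -> U ∩ W ≐ U' ∩ W'
 ∩-cong p q = ext \ x -> mk⇔ (\ (u , w) -> to p u , to q w) (\ (u , w) -> from p u , from q w)

 ⊕-cong : ∀ {U U' W W'} -> U ≐ U' -> W ≐ W' -> U ⊕ W ≐ U' ⊕ W'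
 ⊕-cong p q = ext \ x -> mk⇔ (\ (u , w , u∈ , w∈ , e) -> u , w , to p u∈ , to q w∈ , e)
  (\ (u , w , u∈ , w∈ , e) -> u , w , from p u∈ , from q w∈ , e)

 ^⊥-cong : ∀ {U U'} -> U ≐ U' -> (U ^⊥) ≐ (U' ^⊥)
 ^⊥-cong p = ext \ x -> mk⇔ (\ h u u∈ -> h u (from p u∈)) (\ h u u∈ -> h u (to p u∈))

 line : V -> Subspace
 line w = record
  { member   = \ x -> ∃[ c ] x ≈ᵛ c ∙ᵛ w
  ; resp     = \ p (c , q) -> c , \ i -> symm (p i) >> q i
  ; 0∈       = 0# , \ i -> symm (zeroˡ (w i))
  ; +-closed = \ (a , p) (b , q) -> a + b , \ i -> +-cong (p i) (q i) >> symm (distribʳ (w i) a b)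
  ; ∙-closed = \ c (a , p) -> c * a , \ i -> *-congˡ (p i) >> symm (*-assoc c a (w i))
  }

 module Coordinates (v : Fin d -> V) (v≉0 : ∀ k -> ¬ v k ≈ᵛ 0ᵛ) (orth : ∀ j k -> j ≢ k -> v j · v k ≈ 0#) where
  coord : Fin d -> V -> Carrier
  coord k x = fst (normSquare⁻¹ (v≉0 k)) * v k · x
  coord-≈ : ∀ k {x y} -> x ≈ᵛ y -> coord k x ≈ coord k y
  coord-≈ k p = *-congˡ (·-cong {v k} (\ _ -> rfl) p)
  coord-linear : ∀ k a b (x y : V) -> coord k ((a ∙ᵛ x) +ᵛ (b ∙ᵛ y)) ≈ a * coord k x + b * coord k y
  coord-linear k a b x y = *-congˡ (·-linearʳ a b (v k) x y) >> solve 5 (\ t a b x y -> t :* (a :* x :+ b :* y) := a :* (t :* x) :+ b :* (t :* y)) rfl _ a b (v k · x) (v k · y)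
  coord-self : ∀ k -> coord k (v k) ≈ 1#
  coord-self k = *-comm _ _ >> snd (normSquare⁻¹ (v≉0 k))
  coord-other : ∀ {j k} -> j ≢ k -> coord j (v k) ≈ 0#
  coord-other j≢k = *-congˡ (orth _ _ j≢k) >> zeroʳ _
  v∙≈0 : ∀ {k a} -> (a ∙ᵛ v k) ≈ᵛ 0ᵛ -> a ≈ 0#
  v∙≈0 {k} {a} eq = symm (*-congˡ (coord-self k) >> *-identityʳ a) >> solve 3 (\ a t x -> a :* (t :* x) := t :* (a :* x)) rfl a _ (v k · v k) >> *-congˡ (symm (·-∙ʳ a (v k) (v k)) >> ·-cong {v k} (\ _ -> rfl) eq >> ·-zeroʳ (v k)) >> zeroʳ _
  dir : Fin d -> Fin d -> Carrier -> V
  dir i j r = (1# ∙ᵛ v i) +ᵛ ((- r) ∙ᵛ v j)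
  point : Fin d -> Fin d -> Carrier -> Subspace
  point i j r = line (dir i j r)
  direction1 : ∀ {i j} r -> i ≢ j -> coord i (dir i j r) ≈ 1#
  direction1 r i≢j = coord-linear _ _ _ _ _ >> +-cong (*-congˡ (coord-self _)) (*-congˡ (coord-other i≢j)) >> solve 1 (\ r -> :1 :* :1 :+ (:- r) :* :0 := :1) rfl r
  direction2 : ∀ {i j} r -> i ≢ j -> coord j (dir i j r) ≈ - r
  direction2 r i≢j = coord-linear _ _ _ _ _ >> +-cong (*-congˡ (coord-other (i≢j ∘ sym))) (*-congˡ (coord-self _)) >> solve 1 (\ r -> :1 :* :0 :+ (:- r) :* :1 := :- r) rfl r
  direction0 : ∀ {i j k} r -> k ≢ i -> k ≢ j -> coord k (dir i j r) ≈ 0#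
  direction0 r k≢i k≢j = coord-linear _ _ _ _ _ >> +-cong (*-congˡ (coord-other k≢i)) (*-congˡ (coord-other k≢j)) >> solve 1 (\ r -> :1 :* :0 :+ (:- r) :* :0 := :0) rfl r
  coord-sum : ∀ k {x u w a b p q y} -> x ≈ᵛ u +ᵛ w -> u ≈ᵛ a ∙ᵛ p -> w ≈ᵛ b ∙ᵛ q -> a * coord k p + b * coord k q ≈ y -> coord k x ≈ y
  coord-sum k x≈ u≈ w≈ eq = coord-≈ k (\ i -> x≈ i >> +-cong (u≈ i) (w≈ i)) >> coord-linear k _ _ _ _ >> eq
  coord-∙ : ∀ k α {u p y} -> u ≈ᵛ α ∙ᵛ p -> coord k p ≈ y -> coord k u ≈ α * y
  coord-∙ k α {p = p} u≈ eq = coord-≈ k u≈ >> *-congˡ (·-∙ʳ α (v k) p) >> solve 3 (\ t α n -> t :* (α :* n) := α :* (t :* n)) rfl _ α _ >> *-congˡ eq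
  ⊕-intro : ∀ {x p q} a b -> x ≈ᵛ (a ∙ᵛ p) +ᵛ (b ∙ᵛ q) -> x ∈ (line p ⊕ line q)
  ⊕-intro a b eq = _ , _ , (a , \ _ -> rfl) , (b , \ _ -> rfl) , eq
  point-cong : ∀ {i j r s} -> r ≈ s -> point i j r ≐ point i j s
  point-cong eq = ext \ x -> mk⇔ (\ (a , p) -> a , \ i -> p i >> *-congˡ (+-congˡ (*-congʳ (-‿cong eq))))
   (\ (a , p) -> a , \ i -> p i >> *-congˡ (+-congˡ (*-congʳ (-‿cong (symm eq)))))
  point-flip : ∀ i j -> point i j 1# ≐ point j i 1#
  point-flip i j = ext \ x -> mk⇔ (flip i j) (flip j i) where
   flip : ∀ {x} i j -> x ∈ point i j 1# -> x ∈ point j i 1#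
   flip {x} i j (a , p) = - a , \ m -> p m >> solve 3 (\ a u w -> a :* (:1 :* u :+ (:- :1) :* w) := (:- a) :* (:1 :* w :+ (:- :1) :* u)) rfl a (v i m) (v j m)
  point-* : ∀ {i j k} r s -> i ≢ j -> j ≢ k -> i ≢ k -> (point i j r ⊕ point j k s) ∩ (line (v i) ⊕ line (v k)) ≐ point i k (r * s)
  point-* {i} {j} {k} r s i≢j j≢k i≢k = ext \ x -> mk⇔
   (\ { ((_ , _ , (α , p) , (β , q) , e) , (_ , _ , (γ , p') , (ε , q') , e')) -> let
    β≈αr : β ≈ α * r
    β≈αr = solve 3 (\ α β r -> β := (α :* (:- r) :+ β :* :1) :+ α :* r) rfl α β r >> +-congʳ (symm (coord-sum j e p q (+-cong (*-congˡ (direction2 r i≢j)) (*-congˡ (direction1 s j≢k)))) >>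
     coord-sum j e' p' q' (+-cong (*-congˡ (coord-other (i≢j ∘ sym))) (*-congˡ (coord-other j≢k)) >> solve 2 (\ γ ε -> γ :* :0 :+ ε :* :0 := :0) rfl γ ε)) >> +-identityˡ _
   in α , \ m -> e m >> +-cong (p m) (q m >> *-congʳ β≈αr) >> solve 6 (\ α r s a b c -> α :* (:1 :* a :+ (:- r) :* b) :+ (α :* r) :* (:1 :* b :+ (:- s) :* c)
   := α :* (:1 :* a :+ (:- (r :* s)) :* c)) rfl α r s (v i m) (v j m) (v k m) })
   (\ (α , p) -> ⊕-intro α (α * r) (\ m -> p m >> solve 6 (\ α r s a b c -> α :* (:1 :* a :+ (:- (r :* s)) :* c)
   := α :* (:1 :* a :+ (:- r) :* b) :+ (α :* r) :* (:1 :* b :+ (:- s) :* c))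
   rfl α r s (v i m) (v j m) (v k m)) , ⊕-intro α (- (α * (r * s))) (\ m -> p m >> solve 5 (\ α r s a c -> α :* (:1 :* a :+ (:- (r :* s)) :* c) := α :* a :+ (:- (α :* (r :* s))) :* c)
   rfl α r s (v i m) (v k m)))
  point-+ : ∀ {i j k} r s -> i ≢ j -> j ≢ k -> i ≢ k -> (((point i j r ⊕ line (v k)) ∩ (point i k 1# ⊕ line (v j))) ⊕ point k j s) ∩ (line (v i) ⊕ line (v j))
   ≐ point i j (r + s)
  point-+ {i} {j} {k} r s i≢j j≢k i≢k = ext \ x -> mk⇔
   (\ { ((_ , _ , ((_ , _ , (α , p) , (β , q) , e) , (_ , _ , (γ , p') , (ε , q') , e')) , (μ , p″) , e″) , (_ , _ , (ζ , f) , (η , g) , h)) -> let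
    α≈γ : α ≈ γ
    α≈γ = symm (coord-sum i e p q (+-cong (*-congˡ (direction1 r i≢j)) (*-congˡ (coord-other i≢k)) >> solve 2 (\ α β -> α :* :1 :+ β :* :0 := α) rfl α β)) >> coord-sum i e' p' q' (+-cong (*-congˡ (direction1 1# i≢k)) (*-congˡ (coord-other i≢j)) >>
     solve 2 (\ γ ε -> γ :* :1 :+ ε :* :0 := γ) rfl γ ε)
    β≈-γ : β ≈ - γ
    β≈-γ = symm (coord-sum k e p q (+-cong (*-congˡ (direction0 r (i≢k ∘ sym) (j≢k ∘ sym))) (*-congˡ (coord-self k)) >> solve 2 (\ α β -> α :* :0 :+ β :* :1 := β) rfl α β)) >> coord-sum k e' p' q' (+-cong (*-congˡ (direction2 1# i≢k)) (*-congˡ (coord-other (j≢k ∘ sym))) >>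
     solve 2 (\ γ ε -> γ :* (:- :1) :+ ε :* :0 := :- γ) rfl γ ε)
    middle = \ m -> e m >> +-cong (p m >> *-congʳ α≈γ) (q m >> *-congʳ β≈-γ) >> solve 5 (\ γ r a b c -> γ :* (:1 :* a :+ (:- r) :* b) :+ (:- γ) :* c
     := γ :* (:1 :* (:1 :* a :+ (:- r) :* b) :+ (:- :1) :* c)) rfl γ r (v i m) (v j m) (v k m)
    μ≈γ : μ ≈ γ
    μ≈γ = solve 2 (\ γ μ -> μ := (γ :* (:- :1) :+ μ :* :1) :+ γ) rfl γ μ >> +-congʳ (symm (coord-sum k {p = w} e″ middle p″ (+-cong (*-congˡ coord-w) (*-congˡ (direction1 s (j≢k ∘ sym))))) >>
     coord-sum k h f g (+-cong (*-congˡ (coord-other (i≢k ∘ sym))) (*-congˡ (coord-other (j≢k ∘ sym))) >> solve 2 (\ ζ η -> ζ :* :0 :+ η :* :0 := :0) rfl ζ η)) >> +-identityˡ _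
   in γ , \ m -> e″ m >> +-cong (middle m) (p″ m >> *-congʳ μ≈γ) >> solve 6 (\ γ r s a b c -> γ :* (:1 :* (:1 :* a :+ (:- r) :* b) :+ (:- :1) :* c) :+ γ :* (:1 :* c :+ (:- s) :* b)
   := γ :* (:1 :* a :+ (:- (r :+ s)) :* b)) rfl γ r s (v i m) (v j m) (v k m) })
   (\ (α , p) -> (_ , _ , (⊕-intro {x = α ∙ᵛ w} α (- α) (\ m -> solve 5 (\ α r a b c -> α :* (:1 :* (:1 :* a :+ (:- r) :* b) :+ (:- :1) :* c)
   := α :* (:1 :* a :+ (:- r) :* b) :+ (:- α) :* c) rfl α r (v i m) (v j m) (v k m)) , ⊕-intro α (- (α * r)) (\ m -> solve 5 (\ α r a b c -> α :* (:1 :* (:1 :* a :+ (:- r) :* b) :+ (:- :1) :* c)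
   := α :* (:1 :* a :+ (:- :1) :* c) :+ (:- (α :* r)) :* b) rfl α r (v i m) (v j m) (v k m))) , (α , \ _ -> rfl) , \ m -> p m >> solve 6 (\ α r s a b c -> α :* (:1 :* a :+ (:- (r :+ s)) :* b)
   := α :* (:1 :* (:1 :* a :+ (:- r) :* b) :+ (:- :1) :* c) :+ α :* (:1 :* c :+ (:- s) :* b))
   rfl α r s (v i m) (v j m) (v k m)) , ⊕-intro α (- (α * (r + s))) (\ m -> p m >> solve 5 (\ α r s a b -> α :* (:1 :* a :+ (:- (r :+ s)) :* b) := α :* a :+ (:- (α :* (r :+ s))) :* b)
   rfl α r s (v i m) (v j m))) where
   w : V
   w = (1# ∙ᵛ dir i j r) +ᵛ ((- 1#) ∙ᵛ v k)
   coord-w : coord k w ≈ - 1#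
   coord-w = coord-linear k 1# (- 1#) (dir i j r) (v k) >> +-cong (*-congˡ (direction0 r (i≢k ∘ sym) (j≢k ∘ sym))) (*-congˡ (coord-self k)) >> solve 1 (\ z -> :1 :* :0 :+ (:- :1) :* :1 := :- :1) rfl 0#
  module _ {i j : Fin d} (i≢j : i ≢ j) where
   equality : Carrier -> Carrier -> Subspace
   equality r s = ((point i j r ∩ point i j s) ⊕ line (v j)) ∩ line (v i)
   equality-≈ : ∀ {r s} -> r ≈ s -> equality r s ≐ line (v i)
   equality-≈ {r} {s} r≈s = ext \ x -> mk⇔ snd \ (a , p) -> (a ∙ᵛ dir i j r , (a * r) ∙ᵛ v j , ((a , \ _ -> rfl) , to (point-cong r≈s) (a , \ _ -> rfl)) , (a * r , \ _ -> rfl) , \ m -> p m >> solve 4 (\ a r u w -> a :* u := a :* (:1 :* u :+ (:- r) :* w) :+ (a :* r) :* w)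
    rfl a r (v i m) (v j m)) , (a , p)
   equality-≉ : ∀ {r s} -> ¬ r ≈ s -> equality r s ≐ 0ᴸ
   equality-≉ {r} {s} r≉s = ext \ x -> mk⇔
    (\ { ((u , _ , ((α , p) , (β , q)) , (γ , g) , e) , (ε , h)) -> let
     α≈β : α ≈ β
     α≈β = symm (coord1 i α p (direction1 r i≢j)) >> coord1 i β q (direction1 s i≢j)
     αr≈βs : α * - r ≈ β * - s
     αr≈βs = symm (coord2 α p (direction2 r i≢j)) >> coord2 β q (direction2 s i≢j)
     α≈0 : α ≈ 0#
     α≈0 = dne \ α≉0 -> r≉s (cancel α≉0 (αr≈βs >> *-congʳ (symm α≈β)))
     ε≈0 : ε ≈ 0#
     ε≈0 = symm (coord-≈ i h >> *-congˡ (·-∙ʳ ε (v i) (v i)) >> solve 3 (\ t e n -> t :* (e :* n) := e :* (t :* n)) rfl _ ε _ >> *-congˡ (coord-self i) >> *-identityʳ ε) >> coord-sum i e p g (+-cong (*-congʳ α≈0 >> zeroˡ _) (*-congˡ (coord-other i≢j)) >> +-identityˡ _ >> zeroʳ γ)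
    in \ m -> h m >> *-congʳ ε≈0 >> zeroˡ _ })
    (\ x≈0 -> 0∈' x≈0) where
    coord1 : ∀ k α {u p} -> u ≈ᵛ α ∙ᵛ p -> coord k p ≈ 1# -> coord k u ≈ α
    coord1 k α u≈ eq = coord-∙ k α u≈ eq >> *-identityʳ α
    coord2 : ∀ α {u p y} -> u ≈ᵛ α ∙ᵛ p -> coord j p ≈ y -> coord j u ≈ α * y
    coord2 α = coord-∙ j α
    cancel : ∀ {α} -> ¬ α ≈ 0# -> α * - r ≈ α * - s -> r ≈ s
    cancel {α} α≉0 eq with inverse α α≉0
    ... | y , αy≈1 = solve 1 (\ r -> r := :- (:1 :* (:- r))) rfl r >> -‿cong (*-congʳ (symm (*-comm y α >> αy≈1)) >> *-assoc y α (- r) >> *-congˡ eq >> symm (*-assoc y α (- s)) >> *-congʳ (*-comm y α >> αy≈1)) >> solve 1 (\ r -> :- (:1 :* (:- r)) := r) rfl s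
    0∈' : ∀ {x} -> x ≈ᵛ 0ᵛ -> x ∈ equality r s
    0∈' x≈0 = resp (equality r s) (\ m -> symm (x≈0 m)) (0∈ (equality r s))

module Normalisation
 (em : EM) (R : Ring) (real : FormallyReal R) (d : ℕ) where
 open Classical em
 open FormallyReal real
 open Subspaces R d renaming (⊥ to 0ᴸ; ⊤ to 1ᴸ)
 open Subspace
 open Euclidean em R real d
 open Gadgets em R real d
 open RingLaws R
 open RingSolver R

 completion normal : Subspace -> Subspace -> Subspace -> Subspace
 completion e1 H U = (U ∩ H) ⊕ (e1 ∩ ((U ∩ H) ^⊥))
 normal e1 H U = completion e1 H U ∩ (e1 ⊕ (H ∩ (completion e1 H U ^⊥)))

 normal-cong : ∀ {e e' H H' U U'} -> e ≐ e' -> H ≐ H' -> U ≐ U' -> normal e H U ≐ normal e' H' U'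
 normal-cong p q r = ∩-cong c (⊕-cong p (∩-cong q (^⊥-cong c)))
  where c = ⊕-cong (∩-cong r q) (∩-cong p (^⊥-cong (∩-cong r q)))

 module _ (v : Fin d -> V) (v≉0 : ∀ k -> ¬ v k ≈ᵛ 0ᵛ) (orth : ∀ j k -> j ≢ k -> v j · v k ≈ 0#)
  {i j : Fin d} (i≢j : i ≢ j) where
  open Coordinates v v≉0 orth
  private
   e1 e2 H : Subspace
   e1 = line (v i)
   e2 = line (v j)
   H = e1 ⊕ e2
   n : Fin d -> Carrier
   n k = v k · v k
   combine : ∀ U {x y z} a b -> x ∈ U -> y ∈ U -> z ≈ᵛ (a ∙ᵛ x) +ᵛ (b ∙ᵛ y) -> z ∈ U
   combine U a b x∈ y∈ eq = resp U (\ m -> symm (eq m)) (+-closed U (∙-closed U a x∈) (∙-closed U b y∈))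
   H-coord : ∀ {x} -> x ∈ H -> x ≈ᵛ (coord i x ∙ᵛ v i) +ᵛ (coord j x ∙ᵛ v j)
   H-coord (_ , _ , (a , p) , (b , q) , e) m = e m >> +-cong
    (p m >> *-congʳ (symm (coord-sum i e p q (+-cong (*-congˡ (coord-self i)) (*-congˡ (coord-other i≢j)) >> solve 2 (\ a b -> a :* :1 :+ b :* :0 := a) rfl a b))))
    (q m >> *-congʳ (symm (coord-sum j e p q (+-cong (*-congˡ (coord-other (i≢j ∘ sym))) (*-congˡ (coord-self j)) >> solve 2 (\ a b -> a :* :0 :+ b :* :1 := b) rfl a b))))
   v2∈H : v j ∈ H
   v2∈H = ⊕-intro 0# 1# (\ m -> solve 2 (\ u w -> w := :0 :* u :+ :1 :* w) rfl (v i m) (v j m))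
  module _ (P : Subspace) (P≤H : ∀ {x} -> x ∈ P -> x ∈ H) {r} (dir∈P : dir i j r ∈ P) where
   proper : ¬ v j ∈ P -> P ∩ (e1 ⊕ (H ∩ (P ^⊥))) ≐ point i j r
   proper v2∉P = ext \ x -> mk⇔ (multiple ∘ fst) \ (a , p) -> resp P (\ m -> symm (p m)) (∙-closed P a dir∈P) , resp (e1 ⊕ (H ∩ (P ^⊥))) (\ m -> symm (p m)) (∙-closed (e1 ⊕ (H ∩ (P ^⊥))) a dir∈sum) where
    multiple : ∀ {y} -> y ∈ P -> y ∈ point i j r
    multiple {y} y∈P = a , \ m -> H-coord (P≤H y∈P) m >> solve 5 (\ a b r u w -> a :* u :+ b :* w := (b :+ a :* r) :* w :+ a :* (:1 :* u :+ (:- r) :* w)) rfl a b r (v i m) (v j m) >> +-congʳ (*-congʳ c≈0 >> zeroˡ _) >> +-identityˡ _ where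
     a = coord i y
     b = coord j y
     c≈0 : b + a * r ≈ 0#
     c≈0 = dne \ c≉0 -> let t , ct≈1 = inverse _ c≉0 in
      v2∉P (combine P t (- (t * a)) y∈P dir∈P \ m -> symm (+-congʳ (*-congˡ (H-coord (P≤H y∈P) m)) >> solve 6 (\ a b r t u w -> t :* (a :* u :+ b :* w) :+ (:- (t :* a)) :* (:1 :* u :+ (:- r) :* w)
      := ((b :+ a :* r) :* t) :* w) rfl a b r t (v i m) (v j m) >> *-congʳ ct≈1 >> *-identityˡ _))
    z : V
    z = ((r * n j) ∙ᵛ v i) +ᵛ (n i ∙ᵛ v j)
    z⊥dir : dir i j r · z ≈ 0#
    z⊥dir = ·-linearˡ 1# (- r) z (v i) (v j) >> +-cong (*-congˡ (·-linearʳ (r * n j) (n i) (v i) (v i) (v j) >> +-congˡ (*-congˡ (orth i j i≢j))))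
     (*-congˡ (·-linearʳ (r * n j) (n i) (v j) (v i) (v j) >> +-congʳ (*-congˡ (orth j i (i≢j ∘ sym))))) >> solve 3 (\ r a b -> :1 :* ((r :* b) :* a :+ a :* :0) :+ (:- r) :* ((r :* b) :* :0 :+ a :* b) := :0) rfl r (n i) (n j)
    z∈ : z ∈ (H ∩ (P ^⊥))
    z∈ = ⊕-intro (r * n j) (n i) (\ _ -> rfl) , \ u u∈P -> let a , p = multiple u∈P in
     _>>_ (·-cong {v = z} p (\ _ -> rfl)) (·-comm _ z >> ·-∙ʳ a z (dir i j r) >> *-congˡ (·-comm z _ >> z⊥dir) >> zeroʳ a)
    t = fst (normSquare⁻¹ (v≉0 i))
    nt≈1 = snd (normSquare⁻¹ (v≉0 i))
    dir∈sum : dir i j r ∈ (e1 ⊕ (H ∩ (P ^⊥)))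
    dir∈sum = (1# + (r * t) * (r * n j)) ∙ᵛ v i , (- (r * t)) ∙ᵛ z , (_ , \ _ -> rfl) , ∙-closed (H ∩ (P ^⊥)) _ z∈ , \ m -> symm (solve 6 (\ r t a b u w -> (:1 :+ (r :* t) :* (r :* b)) :* u :+ (:- (r :* t)) :* ((r :* b) :* u :+ a :* w)
     := :1 :* u :+ (:- r) :* ((a :* t) :* w)) rfl r t (n i) (n j) (v i m) (v j m) >> +-congˡ (*-congˡ (*-congʳ nt≈1 >> *-identityˡ _)))
   full : v j ∈ P -> P ∩ (e1 ⊕ (H ∩ (P ^⊥))) ≐ point i j 0#
   full v2∈P = ext \ x -> mk⇔
    (\ { (_ , u , w , (a , p) , (w∈H , w⊥P) , e) -> a , \ m -> e m >> +-cong (p m) (·-definite w (w⊥P w (H≤P w∈H)) m) >> solve 3 (\ a u w -> a :* u :+ :0 := a :* (:1 :* u :+ (:- :0) :* w)) rfl a (v i m) (v j m) })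
    (\ (a , p) -> combine P a 0# v1∈P v2∈P (\ m -> p m >> solve 3 (\ a u w -> a :* (:1 :* u :+ (:- :0) :* w) := a :* u :+ :0 :* w) rfl a (v i m) (v j m)) , a ∙ᵛ v i , 0ᵛ , (a , \ _ -> rfl) , 0∈ (H ∩ (P ^⊥)) , \ m -> p m >>
    solve 3 (\ a u w -> a :* (:1 :* u :+ (:- :0) :* w) := a :* u :+ :0) rfl a (v i m) (v j m)) where
    v1∈P : v i ∈ P
    v1∈P = combine P 1# r dir∈P v2∈P \ m -> solve 3 (\ r u w -> u := :1 :* (:1 :* u :+ (:- r) :* w) :+ r :* w) rfl r (v i m) (v j m)
    H≤P : ∀ {x} -> x ∈ H -> x ∈ P
    H≤P x∈H = combine P _ _ v1∈P v2∈P (H-coord x∈H)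
  private
   completion≤H : ∀ U {x} -> x ∈ completion e1 H U -> x ∈ H
   completion≤H U (_ , _ , (_ , u∈H) , ((a , q) , _) , e) = resp H (\ m -> symm (e m)) (+-closed H u∈H
    (⊕-intro a 0# (\ m -> q m >> solve 3 (\ a u w -> a :* u := a :* u :+ :0 :* w) rfl a (v i m) (v j m))))
   completion-direction : ∀ U -> ∃[ r ] dir i j r ∈ completion e1 H U
   completion-direction U with dec (∃[ x ] x ∈ completion e1 H U × ¬ coord i x ≈ 0#)
   ... | yes (x , x∈ , a≉0) = let t , at≈1 = inverse _ a≉0 in
    - (t * coord j x) , combine (completion e1 H U) t 0# x∈ x∈ \ m -> symm (+-congʳ (*-congˡ (H-coord (completion≤H U x∈) m)) >> solve 6 (\ t a b u w x -> t :* (a :* u :+ b :* w) :+ :0 :* x := (a :* t) :* u :+ (:- (:- (t :* b))) :* w)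
    rfl t (coord i x) (coord j x) (v i m) (v j m) (x m) >> +-congʳ (*-congʳ at≈1))
   ... | no flat = ⊥-elim (flat (v i , v1∈ , \ c≈0 -> 1≉0 (symm (coord-self i) >> c≈0))) where
    v1∈ : v i ∈ completion e1 H U
    v1∈ = 0ᵛ , v i , 0∈ (U ∩ H) , ((1# , \ m -> symm (*-identityˡ _)) , \ u u∈ -> let
      c≈0 = dne \ c≉0 -> flat (u , (u , 0ᵛ , u∈ , 0∈ (e1 ∩ ((U ∩ H) ^⊥)) , \ m -> symm (+-identityʳ _)) , c≉0)
     in _>>_ (·-cong {v = v i} (H-coord (snd u∈)) (\ _ -> rfl)) (·-linearˡ _ _ (v i) (v i) (v j) >> +-cong (*-congʳ c≈0 >> zeroˡ _) (*-congˡ (orth j i (i≢j ∘ sym)) >> zeroʳ _) >> +-identityˡ _)) , \ m -> symm (+-identityˡ _)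
  normal-point : ∀ U -> ∃[ r ] normal e1 H U ≐ point i j r
  normal-point U with completion-direction U | dec (v j ∈ completion e1 H U)
  ... | r , dir∈ | no v2∉ = r , proper (completion e1 H U) (completion≤H U) dir∈ v2∉
  ... | r , dir∈ | yes v2∈ = 0# , full (completion e1 H U) (completion≤H U) dir∈ v2∈
  normal-fixes : ∀ r -> normal e1 H (point i j r) ≐ point i j r
  normal-fixes r = proper (completion e1 H (point i j r)) (completion≤H (point i j r)) dir∈ v2∉ where
   dir∈H : dir i j r ∈ H
   dir∈H = ⊕-intro 1# (- r) (\ _ -> rfl)
   dir∈ : dir i j r ∈ completion e1 H (point i j r)
   dir∈ = dir i j r , 0ᵛ , ((1# , \ m -> symm (*-identityˡ _)) , dir∈H) , 0∈ (e1 ∩ ((point i j r ∩ H) ^⊥)) , \ m -> symm (+-identityʳ _)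
   v2∉ : ¬ v j ∈ completion e1 H (point i j r)
   v2∉ (u , w , ((c , p) , _) , ((a , q) , w⊥) , e) = 1≉0 (symm (coord-self j) >> coord-sum j e p q (+-cong (*-congʳ c≈0 >> zeroˡ _) (*-congˡ (coord-other (i≢j ∘ sym)) >> zeroʳ a) >> +-identityˡ _)) where
    a≈0 : a ≈ 0#
    a≈0 = v∙≈0 {i} (\ m -> symm (q m) >> ·-definite w w·w≈0 m) where
     dir·w : dir i j r · w ≈ 0#
     dir·w = w⊥ _ ((1# , \ m -> symm (*-identityˡ _)) , dir∈H)
     dir·av : dir i j r · (a ∙ᵛ v i) ≈ a * n i
     dir·av = ·-linearˡ 1# (- r) (a ∙ᵛ v i) (v i) (v j) >> +-cong (*-congˡ (·-∙ʳ a (v i) (v i))) (*-congˡ (·-∙ʳ a (v j) (v i) >> *-congˡ (orth j i (i≢j ∘ sym)))) >> solve 3 (\ a r n -> :1 :* (a :* n) :+ (:- r) :* (a :* :0) := a :* n) rfl a r (n i)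
     an≈0 : a * n i ≈ 0#
     an≈0 = symm dir·av >> ·-cong {dir i j r} (\ _ -> rfl) (\ m -> symm (q m)) >> dir·w
     w·w≈0 : w · w ≈ 0#
     w·w≈0 = ·-cong q q >> ·-∙ʳ a (a ∙ᵛ v i) (v i) >> *-congˡ
      (·-comm _ (v i) >> ·-∙ʳ a (v i) (v i) >> an≈0) >> zeroʳ a
    c≈0 : c ≈ 0#
    c≈0 = solve 2 (\ c a -> c := (c :* :1 :+ a :* :1) :- a) rfl c a >> +-cong (symm (coord-sum i e p q (+-cong (*-congˡ (direction1 r i≢j)) (*-congˡ (coord-self i)))) >> coord-other i≢j) (-‿cong a≈0) >> -‿inverseʳ 0#

module Templates (d K : ℕ) where

 open Formula

 data Atom (I : Set) : Set where
  frame link : Fin d -> Atom I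
  unknown    : List I -> Atom I
  constant   : Fin K -> Atom I
  input      : I -> Atom I

 infixr 6 _∧ₜ_
 infixr 5 _∨ₜ_
 infix  8 ¬ₜ_

 -- Uniform families of ortholattice terms;  bit  is 1 or 0 according to a symbol of the input word.
 data Template (k : ℕ) : Set where
  atom      : Atom (Ex k) -> Template k
  _∧ₜ_ _∨ₜ_ : Template k -> Template k -> Template k
  ¬ₜ_       : Template k -> Template k
  0ₜ 1ₜ     : Template k
  bit       : Ex k -> Template k
  ⋀         : Ex k -> Template (suc k) -> Template k -> Template k

 atomAt : ∀ {k} -> Atom (Ex k) -> Vec ℕ k -> Atom ℕ
 atomAt (frame i) ρ = frame i
 atomAt (link i) ρ = link i
 atomAt (unknown es) ρ = unknown (⟦ es ⟧ⁿ ρ)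
 atomAt (constant c) ρ = constant c
 atomAt (input e) ρ = input (⟦ e ⟧e ρ)

 conjunction : ∀ {X} -> (ℕ -> Term X) -> ℕ -> ℕ -> Term X -> Term X
 conjunction f j zero t = t
 conjunction f j (suc c) t = f j ∧ᵗ conjunction f (suc j) c t

 inst : (ℕ -> Bool) -> ∀ {k} -> Template k -> Vec ℕ k -> Term (Atom ℕ)
 inst b (atom x) ρ = var (atomAt x ρ)
 inst b (s ∧ₜ t) ρ = inst b s ρ ∧ᵗ inst b t ρ
 inst b (s ∨ₜ t) ρ = inst b s ρ ∨ᵗ inst b t ρ
 inst b (¬ₜ t) ρ = ¬ᵗ inst b t ρ
 inst b 0ₜ ρ = 0ᵗ
 inst b 1ₜ ρ = 1ᵗ
 inst b (bit e) ρ = if b (⟦ e ⟧e ρ) then 1ᵗ else 0ᵗ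
 inst b (⋀ e t u) ρ = conjunction (\ j -> inst b t (j ∷ ρ)) 0 (⟦ e ⟧e ρ) (inst b u ρ)

 allt anyt : ∀ {k} n -> (Fin n -> Template k) -> Template k
 allt zero f = 1ₜ
 allt (suc n) f = f 0F ∧ₜ allt n (f ∘ fsuc)
 anyt zero f = 0ₜ
 anyt (suc n) f = f 0F ∨ₜ anyt n (f ∘ fsuc)

 infix 4 _⊑_

 _⊑_ disjoint : ∀ {k} -> Template k -> Template k -> Template k
 s ⊑ t = ¬ₜ s ∨ₜ (s ∧ₜ t)
 disjoint s t = ¬ₜ (s ∧ₜ t)

module Encoding (d' K : ℕ) where

 open Formula

 d : ℕ
 d = suc (suc (suc d'))

 open Templates d K public

 i0 i1 i2 : Fin d
 i0 = 0F
 i1 = fsuc 0F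
 i2 = 2F

 module _ {k : ℕ} where
  e l : Fin d -> Template k
  e i = atom (frame i)
  l i = atom (link i) ∧ₜ (e i0 ∨ₜ e i)
  swap12 : Template k
  swap12 = (l i2 ∨ₜ l i1) ∧ₜ (e i2 ∨ₜ e i1)
  -- Lines standing for the scalar r in the planes spanned by e₀, e₂ and by e₂, e₁.
  toₜ02 toₜ21 : Template k -> Template k
  toₜ02 t = (t ∨ₜ swap12) ∧ₜ (e i0 ∨ₜ e i2)
  toₜ21 t = (l i2 ∨ₜ t) ∧ₜ (e i2 ∨ₜ e i1)
  addt mult eqt : Template k -> Template k -> Template k
  addt s t = (((s ∨ₜ e i2) ∧ₜ (l i2 ∨ₜ e i1)) ∨ₜ toₜ21 t) ∧ₜ (e i0 ∨ₜ e i1)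
  mult s t = (toₜ02 s ∨ₜ toₜ21 t) ∧ₜ (e i0 ∨ₜ e i1)
  eqt s t = ((s ∧ₜ t) ∨ₜ e i1) ∧ₜ e i0
  normalt : Template k -> Template k
  normalt t = completiont ∧ₜ (e i0 ∨ₜ ((e i0 ∨ₜ e i1) ∧ₜ ¬ₜ completiont)) where
   completiont : Template k
   completiont = (t ∧ₜ (e i0 ∨ₜ e i1)) ∨ₜ (e i0 ∧ₜ ¬ₜ (t ∧ₜ (e i0 ∨ₜ e i1)))

 orthogonalt : ∀ {k} -> Fin d -> Fin d -> Template k
 orthogonalt j i = if does (j ≟ᶠ i) then 1ₜ else e j ⊑ ¬ₜ e i

 linkedt : ∀ {k} -> Fin (suc (suc d')) -> Template k
 linkedt i = (e i0 ⊑ (e (fsuc i) ∨ₜ atom (link (fsuc i)))) ∧ₜ (e (fsuc i) ⊑ (e i0 ∨ₜ atom (link (fsuc i)))) ∧ₜ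
  disjoint (atom (link (fsuc i))) (e i0) ∧ₜ disjoint (atom (link (fsuc i))) (e (fsuc i))

 framet : ∀ {k} -> Template k
 framet = allt d (\ j -> allt d (orthogonalt j)) ∧ₜ anyt d e ∧ₜ allt (suc (suc d')) linkedt

 module _ (inputt : ∀ {k} -> Ex k -> Template k) where
  tmt : ∀ {k} -> Tm K k -> Template k
  tmt (var es) = normalt (atom (unknown es))
  tmt (inp x) = inputt x
  tmt (con c) = atom (constant c)
  tmt zero = e i0
  tmt one = l i1
  tmt (add s t) = addt (tmt s) (tmt t)
  tmt (mul s t) = mult (tmt s) (tmt t)
  fmt : ∀ {k} -> Fm K k -> Template k
  fmt (equ s t) = eqt (tmt s) (tmt t)
  fmt (and φ ψ) = fmt φ ∧ₜ fmt ψ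
  fmt (not φ) = e i0 ∧ₜ ¬ₜ fmt φ
  fmt (all x φ) = ⋀ x (fmt φ) (e i0)

module EncodingSemantics
 (em : EM) (R : Ring) (real : FormallyReal R) (d' K : ℕ) where
 open Formula
 open FormulaSemantics R
 open Encoding d' K
 open Classical em
 open FormallyReal real
 open Subspaces R d renaming (⊥ to 0ᴸ; ⊤ to 1ᴸ)
 open Subspace
 open Euclidean em R real d
 open Gadgets em R real d
 open Normalisation em R real d
 open RingLaws R
 open import Algebra.Properties.CommutativeMonoid.Sum +-commutativeMonoid using (sum; sum-cong-≋)
 open RingSolver R

 record Basis : Set where
  field
   vector     : Fin d -> V
   nonzero    : ∀ k -> ¬ vector k ≈ᵛ 0ᵛ
   orthogonal : ∀ j k -> j ≢ k -> vector j · vector k ≈ 0#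
  open Coordinates vector nonzero orthogonal public

 Full : Subspace -> Set
 Full U = ∀ x -> x ∈ U

 module _ (b : ℕ -> Bool) (a : Atom ℕ -> Subspace) where
  ⟪_⟫ : ∀ {k} -> Template k -> Vec ℕ k -> Subspace
  ⟪ t ⟫ ρ = eval 𝐋 (inst b t ρ) a
  record InFrame (B : Basis) : Set where
   open Basis B
   field
    frame-line : ∀ k -> a (frame k) ≐ line (vector k)
    link-point : ∀ k -> k ≢ i0 -> a (link k) ∩ (line (vector i0) ⊕ line (vector k)) ≐ point i0 k 1#
  module _ (B : Basis) (inFrame : InFrame B) where
   open Basis B
   open InFrame inFrame
   private
    P : Carrier -> Subspace
    P = point i0 i1
   l-point : ∀ i -> i ≢ i0 -> a (link i) ∩ (a (frame i0) ⊕ a (frame i)) ≐ point i0 i 1#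
   l-point i i≢0 = ≐-trans (∩-cong ≐-refl (⊕-cong (frame-line i0) (frame-line i))) (link-point i i≢0)
   e0-point : a (frame i0) ≐ P 0#
   e0-point = ≐-trans (frame-line i0) (ext \ _ -> mk⇔
    (\ (c , p) -> c , \ m -> p m >> solve 3 (\ c u w -> c :* u := c :* (:1 :* u :+ (:- :0) :* w)) rfl c (vector i0 m) (vector i1 m))
    (\ (c , p) -> c , \ m -> p m >> solve 3 (\ c u w -> c :* (:1 :* u :+ (:- :0) :* w) := c :* u) rfl c (vector i0 m) (vector i1 m)))
   compose : ∀ {i j k r s U W} -> i ≢ j -> j ≢ k -> i ≢ k -> U ≐ point i j r -> W ≐ point j k s -> (U ⊕ W) ∩ (a (frame i) ⊕ a (frame k)) ≐ point i k (r * s)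
   compose {i} {j} {k} i≢j j≢k i≢k p q = ≐-trans (∩-cong (⊕-cong p q) (⊕-cong (frame-line i) (frame-line k))) (point-* _ _ i≢j j≢k i≢k)
   toₜ02-point : ∀ {k} {ρ : Vec ℕ k} {r} t -> ⟪ t ⟫ ρ ≐ P r -> ⟪ toₜ02 t ⟫ ρ ≐ point i0 i2 r
   toₜ02-point t p = ≐-trans (compose (\ ()) (\ ()) (\ ()) p
    (≐-trans (compose (\ ()) (\ ()) (\ ()) (≐-trans (l-point i2 \ ()) (point-flip i0 i2)) (l-point i1 \ ()))
    (≐-trans (point-cong (*-identityʳ 1#)) (point-flip i2 i1))))
    (point-cong (*-identityʳ _))
   toₜ21-point : ∀ {k} {ρ : Vec ℕ k} {r} t -> ⟪ t ⟫ ρ ≐ P r -> ⟪ toₜ21 t ⟫ ρ ≐ point i2 i1 r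
   toₜ21-point t p = ≐-trans (compose (\ ()) (\ ()) (\ ()) (≐-trans (l-point i2 \ ()) (point-flip i0 i2)) p)
    (point-cong (*-identityˡ _))
   Truth : Set -> Subspace -> Set
   Truth A U = (A -> U ≐ line (vector i0)) × (¬ A -> U ≐ 0ᴸ)
   truth-and : ∀ {A A' U U'} -> Truth A U -> Truth A' U' -> Truth (A × A') (U ∩ U')
   truth-and {A} {A'} {U} {U'} (p , q) (p' , q') = (\ (x , y) -> ≐-trans (∩-cong (p x) (p' y)) (ext \ _ -> mk⇔ fst (\ z -> z , z))) , refuted where
    refuted : ¬ (A × A') -> U ∩ U' ≐ 0ᴸ
    refuted h with dec A
    ... | no ¬x = ≐-trans (∩-cong (q ¬x) ≐-refl) (ext \ _ -> mk⇔ fst (\ z -> z , resp U' (\ m -> symm (z m)) (0∈ U')))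
    ... | yes x = ≐-trans (∩-cong ≐-refl (q' (\ y -> h (x , y)))) (ext \ _ -> mk⇔ snd (\ z -> resp U (\ m -> symm (z m)) (0∈ U) , z))
   truth-not : ∀ {A U} -> Truth A U -> Truth (¬ A) (a (frame i0) ∩ (U ^⊥))
   truth-not {A} {U} (p , q) = (\ ¬x -> ≐-trans (∩-cong (frame-line i0) (^⊥-cong (q ¬x)))
    (ext \ y -> mk⇔ fst \ y∈ -> y∈ , \ u u≈0 -> ·-cong {v = y} u≈0 (\ _ -> rfl) >> ·-comm 0ᵛ y >> ·-zeroʳ y)) , \ ¬¬x -> ≐-trans (∩-cong (frame-line i0) (^⊥-cong (p (dne ¬¬x))))
    (ext \ y -> mk⇔ (\ (y∈ , y⊥) -> ·-definite y (y⊥ y y∈)) \ y≈0 -> resp (line (vector i0) ∩ (line (vector i0) ^⊥)) (\ m -> symm (y≈0 m)) (0∈ (line (vector i0) ∩ (line (vector i0) ^⊥))))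
   module _ (κ : Fin K -> Carrier) (w : ℕ -> Carrier) (v : List ℕ -> Carrier)
    (inputt : ∀ {k} -> Ex k -> Template k)
    (input-point : ∀ {k} (x : Ex k) ρ -> ⟪ inputt x ⟫ ρ ≐ P (w (⟦ x ⟧e ρ)))
    (constant-point : ∀ c -> a (constant c) ≐ P (κ c))
    (unknown-point : ∀ is -> normal (line (vector i0)) (line (vector i0) ⊕ line (vector i1)) (a (unknown is)) ≐ P (v is)) where
    tm-point : ∀ {k} (t : Tm K k) ρ -> ⟪ tmt inputt t ⟫ ρ ≐ P (⟦_⟧ᵗ κ w v t ρ)
    tm-point (var es) ρ = ≐-trans (normal-cong (frame-line i0) (⊕-cong (frame-line i0) (frame-line i1)) (≐-refl {a (unknown (⟦ es ⟧ⁿ ρ))})) (unknown-point (⟦ es ⟧ⁿ ρ))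
    tm-point (inp x) ρ = input-point x ρ
    tm-point (con c) ρ = constant-point c
    tm-point zero ρ = e0-point
    tm-point one ρ = l-point i1 \ ()
    tm-point (add s t) ρ = ≐-trans (∩-cong (⊕-cong (∩-cong (⊕-cong (tm-point s ρ) (frame-line i2)) (⊕-cong (l-point i2 \ ()) (frame-line i1)))
     (toₜ21-point (tmt inputt t) (tm-point t ρ))) (⊕-cong (frame-line i0) (frame-line i1)))
     (point-+ _ _ (\ ()) (\ ()) (\ ()))
    tm-point (mul s t) ρ = compose (\ ()) (\ ()) (\ ()) (toₜ02-point (tmt inputt s) (tm-point s ρ)) (toₜ21-point (tmt inputt t) (tm-point t ρ))
    truth : ∀ {k} (φ : Fm K k) ρ -> Truth (Holds κ w v φ ρ) (⟪ fmt inputt φ ⟫ ρ)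
    truth (equ s t) ρ = (\ p -> ≐-trans rewritten (equality-≈ (\ ()) p)) , (\ ¬p -> ≐-trans rewritten (equality-≉ (\ ()) ¬p)) where
     rewritten = ∩-cong (⊕-cong (∩-cong (tm-point s ρ) (tm-point t ρ)) (frame-line i1)) (frame-line i0)
    truth (and φ ψ) ρ = truth-and (truth φ ρ) (truth ψ ρ)
    truth (not φ) ρ = truth-not (truth φ ρ)
    truth (all x φ) ρ = let p , q = go 0 (⟦ x ⟧e ρ) in
     (\ h -> p \ j _ j< -> h j j<) , (\ ¬h -> q \ h -> ¬h \ j j< -> h j z≤n j<) where
     go : ∀ j c -> Truth (∀ m -> j ≤ m -> m < j N.+ c -> Holds κ w v φ (m ∷ ρ))
      (eval 𝐋 (conjunction (\ m -> inst b (fmt inputt φ) (m ∷ ρ)) j c (var (frame i0))) a)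
     go j zero = (\ _ -> frame-line i0) , \ ¬h -> ⊥-elim (¬h \ m j≤m m<j -> ⊥-elim (N.<⇒≱ m<j (subst (_≤ m) (sym (N.+-identityʳ j)) j≤m)))
     go j (suc c) = let p , q = truth-and (truth φ (j ∷ ρ)) (go (suc j) c) in
      (\ h -> p (h j N.≤-refl (N.m<m+n j (s≤s z≤n)) , \ m j<m m< -> h m (N.<⇒≤ j<m) (subst (m <_) (sym (N.+-suc j c)) m<))) , \ ¬h -> q \ (h0 , h) -> ¬h \ m j≤m m< -> case m j≤m m< h0 h (j N.≟ m) where
      case : ∀ m -> j ≤ m -> m < j N.+ suc c -> Holds κ w v φ (j ∷ ρ) -> (∀ m -> suc j ≤ m -> m < suc j N.+ c -> Holds κ w v φ (m ∷ ρ)) -> Dec (j ≡ m) -> Holds κ w v φ (m ∷ ρ)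
      case m j≤m m< h0 h (yes refl) = h0
      case m j≤m m< h0 h (no j≢m) = h m (N.≤∧≢⇒< j≤m j≢m) (subst (m <_) (N.+-suc j c) m<)
    truth-full : ∀ (φ : Fm K 1) ρ -> Full (⟪ ¬ₜ e i0 ∨ₜ fmt inputt φ ⟫ ρ) ⇔ Holds κ w v φ ρ
    truth-full φ ρ = mk⇔
     (\ full -> dne \ ¬h -> refute ¬h (full (vector i0)))
     \ h x -> let u , u' , u∈ , u'∈ , eq = ⊕-complement (line (vector i0)) x in
     u' , u , from (^⊥-cong (frame-line i0)) {u'} u'∈ , from (fst (truth φ ρ) h) {u} u∈ , \ m -> eq m >> +-comm _ _ where
     refute : ¬ Holds κ w v φ ρ -> ¬ vector i0 ∈ ⟪ ¬ₜ e i0 ∨ₜ fmt inputt φ ⟫ ρ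
     refute ¬h (u , u' , u∈ , u'∈ , eq) = nonzero i0 (·-definite (vector i0)
      (·-cong {vector i0} (\ _ -> rfl) (\ m -> eq m >> +-congˡ (to (snd (truth φ ρ) ¬h) u'∈ m) >> +-identityʳ _) >> u∈ (vector i0) (from (frame-line i0) (1# , \ m -> symm (*-identityˡ _)))))
  module _ {k : ℕ} (ρ : Vec ℕ k) where
   full-⊑ : ∀ s t -> Full (⟪ s ⊑ t ⟫ ρ) ⇔ (∀ {x} -> x ∈ ⟪ s ⟫ ρ -> x ∈ ⟪ t ⟫ ρ)
   full-⊑ s t = mk⇔ to' from' where
    S = ⟪ s ⟫ ρ
    T = ⟪ t ⟫ ρ
    to' : Full (⟪ s ⊑ t ⟫ ρ) -> ∀ {x} -> x ∈ S -> x ∈ T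
    to' h {x} x∈s with h x
    ... | y , z , y⊥s , (z∈s , z∈t) , x≈y+z = resp T (\ m -> symm (x≈y+z m >> +-congʳ (·-definite y (y⊥s y y∈s) m) >> +-identityˡ _)) z∈t where
     y∈s : y ∈ S
     y∈s = resp S (\ m -> +-congʳ (*-congˡ (x≈y+z m)) >> solve 2 (\ y z -> :1 :* (y :+ z) :+ (:- :1) :* z := y) rfl (y m) (z m))
      (+-closed S (∙-closed S 1# x∈s) (∙-closed S (- 1#) z∈s))
    from' : (∀ {x} -> x ∈ S -> x ∈ T) -> Full (⟪ s ⊑ t ⟫ ρ)
    from' h x = let u , u' , u∈ , u'∈ , eq = ⊕-complement S x in
     u' , u , u'∈ , (u∈ , h u∈) , \ m -> eq m >> +-comm _ _
   full-disjoint : ∀ s t -> Full (⟪ disjoint s t ⟫ ρ) ⇔ (∀ {x} -> x ∈ ⟪ s ⟫ ρ -> x ∈ ⟪ t ⟫ ρ -> x ≈ᵛ 0ᵛ)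
   full-disjoint s t = mk⇔ (\ h {x} x∈s x∈t -> ·-definite x (h x x (x∈s , x∈t)))
    \ h x u (u∈s , u∈t) -> ·-cong {v = x} (h u∈s u∈t) (\ _ -> rfl) >> ·-comm 0ᵛ x >> ·-zeroʳ x
   full-all : ∀ n (f : Fin n -> Template k) -> Full (⟪ allt n f ⟫ ρ) ⇔ (∀ i -> Full (⟪ f i ⟫ ρ))
   full-all zero f = mk⇔ (\ _ ()) \ _ x _ -> rfl
   full-all (suc n) f = mk⇔
    (\ h -> \ { 0F x -> fst (h x) ; (fsuc i) -> fwd (full-all n (f ∘ fsuc)) (snd ∘ h) i })
    \ h x -> h 0F x , bwd (full-all n (f ∘ fsuc)) (h ∘ fsuc) x
   any-zero : ∀ n (f : Fin n -> Template k) -> (∀ i {x} -> x ∈ ⟪ f i ⟫ ρ -> x ≈ᵛ 0ᵛ) -> ∀ {x} -> x ∈ ⟪ anyt n f ⟫ ρ -> x ≈ᵛ 0ᵛ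
   any-zero zero f h x≈0 = x≈0
   any-zero (suc n) f h (u , w , u∈ , w∈ , e) m = e m >> +-cong (h 0F u∈ m) (any-zero n (f ∘ fsuc) (h ∘ fsuc) w∈ m) >> +-identityˡ 0#
   any-sum : ∀ n (f : Fin n -> Template k) (u : Fin n -> V) -> (∀ i -> u i ∈ ⟪ f i ⟫ ρ) -> (\ m -> sum (\ i -> u i m)) ∈ ⟪ anyt n f ⟫ ρ
   any-sum zero f u h = \ _ -> rfl
   any-sum (suc n) f u h = u 0F , _ , h 0F , any-sum n (f ∘ fsuc) (u ∘ fsuc) (h ∘ fsuc) , \ _ -> rfl
   record FrameLaws : Set where
    field
     e⊥e   : ∀ {i j x y} -> i ≢ j -> x ∈ a (frame i) -> y ∈ a (frame j) -> x · y ≈ 0#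
     total : Full (⟪ anyt d e ⟫ ρ)
     e0≤   : ∀ i {x} -> x ∈ a (frame i0) -> x ∈ (a (frame (fsuc i)) ⊕ a (link (fsuc i)))
     e≤    : ∀ i {x} -> x ∈ a (frame (fsuc i)) -> x ∈ (a (frame i0) ⊕ a (link (fsuc i)))
     l∧e0  : ∀ i {x} -> x ∈ a (link (fsuc i)) -> x ∈ a (frame i0) -> x ≈ᵛ 0ᵛ
     l∧e   : ∀ i {x} -> x ∈ a (link (fsuc i)) -> x ∈ a (frame (fsuc i)) -> x ≈ᵛ 0ᵛ
   frame-laws : Full (⟪ framet ⟫ ρ) ⇔ FrameLaws
   frame-laws = mk⇔ to' from' where
    orth⇒ : ∀ i j -> Full (⟪ orthogonalt j i ⟫ ρ) -> i ≢ j -> ∀ {x y} -> x ∈ a (frame i) -> y ∈ a (frame j) -> x · y ≈ 0#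
    orth⇒ i j h i≢j {x} {y} x∈ y∈ with j ≟ᶠ i
    ... | yes refl = ⊥-elim (i≢j refl)
    ... | no _ = fwd (full-⊑ (e j) (¬ₜ e i)) h {y} y∈ x x∈
    ⇒orth : FrameLaws -> ∀ j i -> Full (⟪ orthogonalt j i ⟫ ρ)
    ⇒orth laws j i with j ≟ᶠ i
    ... | yes _ = \ x m -> rfl
    ... | no j≢i = bwd (full-⊑ (e j) (¬ₜ e i)) \ {x} x∈ u u∈ -> FrameLaws.e⊥e laws (j≢i ∘ sym) u∈ x∈
    to' : Full (⟪ framet ⟫ ρ) -> FrameLaws
    to' h = record
     { e⊥e = \ {i} {j} i≢j x∈ y∈ -> orth⇒ i j (fwd (full-all d (orthogonalt j))
     (fwd (full-all d (\ j -> allt d (orthogonalt j))) (\ x -> fst (h x)) j) i) i≢j x∈ y∈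
     ; total = \ x -> fst (snd (h x))
     ; e0≤ = \ i -> fwd (full-⊑ (e i0) (e (fsuc i) ∨ₜ atom (link (fsuc i)))) (\ x -> fst (rest i x))
     ; e≤ = \ i -> fwd (full-⊑ (e (fsuc i)) (e i0 ∨ₜ atom (link (fsuc i)))) (\ x -> fst (snd (rest i x)))
     ; l∧e0 = \ i -> fwd (full-disjoint (atom (link (fsuc i))) (e i0)) (\ x -> fst (snd (snd (rest i x))))
     ; l∧e = \ i -> fwd (full-disjoint (atom (link (fsuc i))) (e (fsuc i))) (\ x -> snd (snd (snd (rest i x))))
     } where
     rest : ∀ i -> Full (⟪ linkedt i ⟫ ρ)
     rest = fwd (full-all (suc (suc d')) linkedt) (\ x -> snd (snd (h x)))
    from' : FrameLaws -> Full (⟪ framet ⟫ ρ)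
    from' laws x = bwd (full-all d (\ j -> allt d (orthogonalt j)))
     (\ j -> bwd (full-all d (orthogonalt j)) (⇒orth laws j)) x , total x , bwd (full-all (suc (suc d')) linkedt) (\ i x -> bwd (full-⊑ (e i0) (e (fsuc i) ∨ₜ atom (link (fsuc i)))) (e0≤ i) x , bwd (full-⊑ (e (fsuc i)) (e i0 ∨ₜ atom (link (fsuc i)))) (e≤ i) x ,
     bwd (full-disjoint (atom (link (fsuc i))) (e i0)) (l∧e0 i) x , bwd (full-disjoint (atom (link (fsuc i))) (e (fsuc i))) (l∧e i) x) x
     where open FrameLaws laws
   frame-basis : FrameLaws -> Σ Basis InFrame
   frame-basis laws = B , record { frame-line = e≐line ; link-point = l≐point } where
    open FrameLaws laws
    E L : Fin d -> Subspace
    E i = a (frame i)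
    L i = a (link i)
    combine : ∀ U {x y z} α β -> x ∈ U -> y ∈ U -> z ≈ᵛ (α ∙ᵛ x) +ᵛ (β ∙ᵛ y) -> z ∈ U
    combine U α β x∈ y∈ eq = resp U (\ m -> symm (eq m)) (+-closed U (∙-closed U α x∈) (∙-closed U β y∈))
    dropˡ : ∀ {U} {x u w : V} -> x ≈ᵛ u +ᵛ w -> u ≈ᵛ 0ᵛ -> w ∈ U -> x ∈ U
    dropˡ {U} eq u≈0 w∈ = resp U (\ m -> symm (eq m >> +-congʳ (u≈0 m) >> +-identityˡ _)) w∈
    e0-nonzero : ∃[ x ] x ∈ E i0 × ¬ x ≈ᵛ 0ᵛ
    e0-nonzero with dec (∃[ x ] x ∈ E i0 × ¬ x ≈ᵛ 0ᵛ)
    ... | yes found = found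
    ... | no none = ⊥-elim (1≉0 (any-zero d e zeros (total (\ _ -> 1#)) i0)) where
     zero0 : ∀ {x} -> x ∈ E i0 -> x ≈ᵛ 0ᵛ
     zero0 {x} x∈ = dne \ x≉0 -> none (x , x∈ , x≉0)
     zeros : ∀ i {x} -> x ∈ E i -> x ≈ᵛ 0ᵛ
     zeros 0F = zero0
     zeros (fsuc i) x∈ = let u , w , u∈ , w∈ , eq = e≤ i x∈ in l∧e i (dropˡ {L (fsuc i)} eq (zero0 u∈) w∈) x∈
    v0 : V
    v0 = fst e0-nonzero
    v0∈ : v0 ∈ E i0
    v0∈ = fst (snd e0-nonzero)
    split : ∀ i -> v0 ∈ (E (fsuc i) ⊕ L (fsuc i))
    split i = e0≤ i v0∈
    v : Fin d -> V
    v 0F = v0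
    v (fsuc i) = fst (split i)
    v∈ : ∀ i -> v i ∈ E i
    v∈ 0F = v0∈
    v∈ (fsuc i) = fst (snd (snd (split i)))
    v≉0 : ∀ i -> ¬ v i ≈ᵛ 0ᵛ
    v≉0 0F = snd (snd e0-nonzero)
    v≉0 (fsuc i) u≈0 = let u , w , _ , w∈ , eq = split i in
     v≉0 0F (l∧e0 i (dropˡ {L (fsuc i)} eq u≈0 w∈) v0∈)
    B : Basis
    B = record { vector = v ; nonzero = v≉0 ; orthogonal = \ j k j≢k -> e⊥e j≢k (v∈ j) (v∈ k) }
    open Basis B using (coord; coord-≈; coord-linear; coord-self; v∙≈0; point; dir)
    e≐line : ∀ i -> E i ≐ line (v i)
    e≐line i = ext \ x -> mk⇔
     (\ x∈ -> coord i x , \ m -> let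
      y = (1# ∙ᵛ x) +ᵛ ((- coord i x) ∙ᵛ v i)
      y∈ = combine (E i) 1# (- coord i x) x∈ (v∈ i) (\ _ -> rfl)
     in _>>_ (solve 3 (\ x c v -> x := (:1 :* x :+ (:- c) :* v) :+ c :* v) rfl (x m) (coord i x) (v i m))
     (+-congʳ (orthogonalBasis v v≉0 (Basis.orthogonal B) y (perp x y∈) m) >> +-identityˡ _))
     \ (c , p) -> resp (E i) (\ m -> symm (p m)) (∙-closed (E i) c (v∈ i)) where
     perp : ∀ x -> ((1# ∙ᵛ x) +ᵛ ((- coord i x) ∙ᵛ v i)) ∈ E i -> ∀ k -> v k · ((1# ∙ᵛ x) +ᵛ ((- coord i x) ∙ᵛ v i)) ≈ 0#
     perp x y∈ k with k ≟ᶠ i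
     ... | no k≢i = e⊥e k≢i (v∈ k) y∈
     ... | yes refl = ·-linearʳ 1# (- coord i x) (v i) x (v i) >> solve 3 (\ t n x -> :1 :* x :+ (:- (t :* x)) :* n := x :- (n :* t) :* x) rfl _ (v i · v i) (v i · x) >> +-congˡ (-‿cong (*-congʳ (snd (normSquare⁻¹ (v≉0 i))))) >> solve 1 (\ x -> x :- :1 :* x := :0) rfl (v i · x)
    l≐point : ∀ k -> k ≢ i0 -> L k ∩ (line (v i0) ⊕ line (v k)) ≐ point i0 k 1#
    l≐point 0F k≢0 = ⊥-elim (k≢0 refl)
    l≐point (fsuc i) _ = ext \ x -> mk⇔
     (\ { (x∈l , (_ , _ , (α , p) , (β , q) , eq)) -> let
      sum≈0 = v∙≈0 {fsuc i} {α + β} (l∧e i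
       (combine (L (fsuc i)) 1# (- α) x∈l w∈ \ m -> solve 4 (\ α β u w -> (α :+ β) :* w := :1 :* (α :* u :+ β :* w) :+ (:- α) :* (:1 :* u :+ (:- :1) :* w)) rfl α β (v0 m) (v (fsuc i) m) >> +-congʳ (*-congˡ (symm (eq m >> +-cong (p m) (q m)))))
       (∙-closed (E (fsuc i)) (α + β) (v∈ (fsuc i))))
     in α , \ m -> eq m >> +-cong (p m) (q m) >> solve 4 (\ α β u w -> α :* u :+ β :* w := (α :+ β) :* w :+ α :* (:1 :* u :+ (:- :1) :* w)) rfl α β (v0 m) (v (fsuc i) m) >> +-congʳ (*-congʳ sum≈0 >> zeroˡ _) >> +-identityˡ _ })
     \ (α , p) -> resp (L (fsuc i)) (\ m -> symm (p m)) (∙-closed (L (fsuc i)) α w∈) , _ , _ , (α , \ _ -> rfl) , (- α , \ _ -> rfl) , \ m -> p m >> solve 3 (\ α u w -> α :* (:1 :* u :+ (:- :1) :* w) := α :* u :+ (:- α) :* w) rfl α (v0 m) (v (fsuc i) m) where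
     w∈ : dir i0 (fsuc i) 1# ∈ L (fsuc i)
     w∈ = let u , w , _ , w∈ , eq = split i in resp (L (fsuc i)) (\ m -> solve 2 (\ u w -> w := :1 :* (u :+ w) :+ (:- :1) :* u) rfl (u m) (w m) >> +-congʳ (*-congˡ (symm (eq m)))) w∈

module StandardFrame
 (em : EM) (R : Ring) (real : FormallyReal R) (d' K : ℕ) where
 open Formula
 open FormulaSemantics R
 open Encoding d' K
 open FormallyReal real
 open Subspaces R d renaming (⊥ to 0ᴸ; ⊤ to 1ᴸ)
 open Subspace
 open Euclidean em R real d
 open Gadgets em R real d
 open Normalisation em R real d
 open EncodingSemantics em R real d' K
 open RingLaws R
 open import Algebra.Properties.CommutativeMonoid.Sum +-commutativeMonoid using (sum; sum-cong-≋; sum-replicate-zero)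
 open RingSolver R

 module _ (b : ℕ -> Bool) (a : Atom ℕ -> Subspace) (B : Basis)
  (frame≐ : ∀ i -> a (frame i) ≐ line (Basis.vector B i)) (link≐ : ∀ i -> i ≢ i0 -> a (link i) ≐ Basis.point B i0 i 1#) where
  open Basis B renaming (vector to v)
  basis-inFrame : InFrame b a B
  basis-inFrame = record
   { frame-line = frame≐
   ; link-point = \ i i≢0 -> ≐-trans (∩-cong (link≐ i i≢0) ≐-refl) (ext \ _ -> mk⇔ fst \ (c , p) -> (c , p) , ⊕-intro c (- c) \ m -> p m >> solve 3 (\ c u w -> c :* (:1 :* u :+ (:- :1) :* w) := c :* u :+ (:- c) :* w) rfl c (v i0 m) (v i m))
   }
  basis-laws : ∀ {k} (ρ : Vec ℕ k) -> Full (⟪_⟫ b a (anyt d e) ρ) -> FrameLaws b a ρ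
  basis-laws ρ full = record
   { e⊥e = \ {i} {j} {x} {y} i≢j x∈ y∈ -> let c , p = to (frame≐ i) x∈ ; c' , p' = to (frame≐ j) y∈ in
   _>>_ (·-cong {x} {c ∙ᵛ v i} {y} {c' ∙ᵛ v j} p p') (·-∙ʳ c' (c ∙ᵛ v i) (v j) >> *-congˡ (·-comm (c ∙ᵛ v i) (v j) >> ·-∙ʳ c (v j) (v i) >> *-congˡ (orthogonal j i (i≢j ∘ sym)) >> zeroʳ c) >> zeroʳ c')
   ; total = full
   ; e0≤ = \ i x∈ -> let c , p = to (frame≐ i0) x∈ in
   let u = c ∙ᵛ v (fsuc i) ; w = c ∙ᵛ dir i0 (fsuc i) 1# in
   u , w , from (frame≐ (fsuc i)) {u} (c , \ _ -> rfl) , from (link≐ (fsuc i) \ ()) {w} (c , \ _ -> rfl) , \ m -> p m >> solve 3 (\ c u w -> c :* u := c :* w :+ c :* (:1 :* u :+ (:- :1) :* w)) rfl c (v i0 m) (v (fsuc i) m)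
   ; e≤ = \ i x∈ -> let c , p = to (frame≐ (fsuc i)) x∈ in
   let u = c ∙ᵛ v i0 ; w = (- c) ∙ᵛ dir i0 (fsuc i) 1# in
   u , w , from (frame≐ i0) {u} (c , \ _ -> rfl) , from (link≐ (fsuc i) \ ()) {w} (- c , \ _ -> rfl) , \ m -> p m >> solve 3 (\ c u w -> c :* w := c :* u :+ (:- c) :* (:1 :* u :+ (:- :1) :* w)) rfl c (v i0 m) (v (fsuc i) m)
   ; l∧e0 = \ i x∈l x∈e -> let c , p = to (link≐ (fsuc i) \ ()) x∈l ; c' , p' = to (frame≐ i0) x∈e in
   vanish c p (solve 1 (\ c -> c := :- (c :* (:- :1))) rfl c >> -‿cong
   (symm (coord-∙ (fsuc i) c {p = dir i0 (fsuc i) 1#} p (direction2 {i0} {fsuc i} 1# \ ())) >> coord-∙ (fsuc i) c' {p = v i0} p' (coord-other {fsuc i} {i0} \ ()) >> zeroʳ c') >> solve 1 (\ z -> :- :0 := :0) rfl 0#)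
   ; l∧e = \ i x∈l x∈e -> let c , p = to (link≐ (fsuc i) \ ()) x∈l ; c' , p' = to (frame≐ (fsuc i)) x∈e in
   vanish c p (symm (*-identityʳ c) >> symm (coord-∙ i0 c {p = dir i0 (fsuc i) 1#} p (direction1 {i0} {fsuc i} 1# \ ())) >> coord-∙ i0 c' {p = v (fsuc i)} p' (coord-other {i0} {fsuc i} \ ()) >> zeroʳ c')
   } where
   vanish : ∀ {x w} c -> x ≈ᵛ c ∙ᵛ w -> c ≈ 0# -> x ≈ᵛ 0ᵛ
   vanish c p c≈0 m = p m >> *-congʳ c≈0 >> zeroˡ _

 -- The signs make the line of the scalar x the span of δ₀ + x δ₁, so that no entry has to be negated.
 private
  sign : Fin d -> Carrier
  sign 0F = 1#
  sign (fsuc _) = - 1#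
  sign² : ∀ i -> sign i * sign i ≈ 1#
  sign² 0F = *-identityˡ 1#
  sign² (fsuc i) = solve 1 (\ z -> (:- :1) :* (:- :1) := :1) rfl 0#
  v : Fin d -> V
  v i = sign i ∙ᵛ δ i
  v·δ : ∀ i j -> v i · δ j ≈ v i j
  v·δ i j = ·-comm (v i) (δ j) >> sum-δ j (v i)

 standard : Basis
 standard = record
  { vector = v
  ; nonzero = \ i v≈0 -> 1≉0 (symm (sign² i) >> *-congˡ (symm (*-identityʳ _) >> *-congˡ (symm (δ-refl i)) >> v≈0 i) >> zeroʳ _)
  ; orthogonal = \ i j i≢j -> ·-∙ʳ (sign j) (v i) (δ j) >> *-congˡ (v·δ i j >> *-congˡ (δ-≢ i≢j) >> zeroʳ _) >> zeroʳ _
  }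

 standard-total : ∀ b a -> (∀ i -> a (frame i) ≐ line (v i)) -> ∀ {k} (ρ : Vec ℕ k) -> Full (⟪_⟫ b a (anyt d e) ρ)
 standard-total b a frame≐ ρ x = resp (⟪_⟫ b a (anyt d e) ρ) total≈
  (any-sum b a ρ d e (\ i -> (x i * sign i) ∙ᵛ v i) \ i -> from (frame≐ i) {(x i * sign i) ∙ᵛ v i} (x i * sign i , \ _ -> rfl)) where
  total≈ : (\ m -> sum (\ i -> (x i * sign i) * v i m)) ≈ᵛ x
  total≈ m = (sum-cong-≋ \ i -> solve 3 (\ x s δ -> (x :* s) :* (s :* δ) := (s :* s) :* (δ :* x)) rfl (x i) (sign i) (δ i m) >> *-congʳ (sign² i) >> *-identityˡ _ >> *-congʳ (δ-sym i m)) >> sum-δ m x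

 open Basis standard using (point; dir)

 column : V -> Matrix
 column u i 0F = u i
 column u i (fsuc _) = 0#

 range-column : ∀ {u w} -> u ≈ᵛ w -> range (column u) ≐ line w
 range-column {u} {w} u≈w = ext \ x -> mk⇔
  (\ (y , p) -> y 0F , \ m -> p m >> entry m y >> *-comm _ _ >> *-congˡ (u≈w m))
  (\ (c , p) -> (\ _ -> c) , \ m -> p m >> *-congˡ (symm (u≈w m)) >> *-comm _ _ >> symm (entry m (\ _ -> c))) where
  entry : ∀ m (y : V) -> column u m · y ≈ u m * y 0F
  entry m y = +-congˡ (sum-cong-≋ (\ j -> zeroˡ (y (fsuc j))) >> sum-replicate-zero (suc (suc d'))) >> +-identityʳ _

 -- Columns spanning the frame, its links and the line of the scalar x.
 unit linkVector : Fin d -> V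
 unit = δ
 linkVector i m = δ i0 m + δ i m

 scalarVec : Carrier -> V
 scalarVec x 0F = 1#
 scalarVec x 1F = x
 scalarVec x (fsuc (fsuc _)) = 0#

 range-unit : ∀ i -> range (column (unit i)) ≐ line (v i)
 range-unit i = ≐-trans (range-column {δ i} {δ i} (\ _ -> rfl)) (ext \ x -> mk⇔
  (\ (c , p) -> c * sign i , \ m -> p m >> symm (solve 3 (\ c s u -> (c :* s) :* (s :* u) := (s :* s) :* (c :* u)) rfl c (sign i) (δ i m) >> *-congʳ (sign² i) >> *-identityˡ _))
  (\ (c , p) -> c * sign i , \ m -> p m >> symm (*-assoc _ _ _)))

 range-link : ∀ i -> i ≢ i0 -> range (column (linkVector i)) ≐ point i0 i 1#
 range-link 0F i≢0 = ⊥-elim (i≢0 refl)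
 range-link (fsuc i) _ = range-column {linkVector (fsuc i)} {dir i0 (fsuc i) 1#} \ m -> solve 2 (\ u w -> u :+ w := :1 :* (:1 :* u) :+ (:- :1) :* ((:- :1) :* w)) rfl (δ i0 m) (δ (fsuc i) m)

 range-scalar : ∀ x -> range (column (scalarVec x)) ≐ point i0 i1 x
 range-scalar x = range-column {scalarVec x} {dir i0 i1 x} \
  { 0F -> solve 1 (\ x -> :1 := :1 :* (:1 :* :1) :+ (:- x) :* ((:- :1) :* :0)) rfl x
  ; 1F -> solve 1 (\ x -> x := :1 :* (:1 :* :0) :+ (:- x) :* ((:- :1) :* :1)) rfl x
  ; (fsuc (fsuc m)) -> solve 1 (\ x -> :0 := :1 :* (:1 :* :0) :+ (:- x) :* ((:- :1) :* :0)) rfl x }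

 module _ (b : ℕ -> Bool) (a : Atom ℕ -> Subspace) (B : Basis) (inFrame : InFrame b a B)
  (κ : Fin K -> Carrier) (w : ℕ -> Carrier)
  (inputt : ∀ {k} -> Ex k -> Template k)
  (input-point : ∀ {k} (x : Ex k) ρ -> ⟪_⟫ b a (inputt x) ρ ≐ Basis.point B i0 i1 (w (⟦ x ⟧e ρ)))
  (constant-point : ∀ c -> a (constant c) ≐ Basis.point B i0 i1 (κ c)) where
  full⇒holds : ∀ φ ρ -> Full (⟪_⟫ b a (¬ₜ e i0 ∨ₜ fmt inputt φ) ρ) -> ∃[ u ] Holds κ w u φ ρ
  full⇒holds φ ρ full = (\ is -> fst (scalar is)) , fwd (truth-full b a B inFrame κ w _ inputt input-point constant-point (\ is -> snd (scalar is)) φ ρ) full where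
   open Basis B renaming (vector to vᴮ)
   scalar : ∀ is -> ∃[ r ] normal (line (vᴮ i0)) (line (vᴮ i0) ⊕ line (vᴮ i1)) (a (unknown is)) ≐ Basis.point B i0 i1 r
   scalar is = normal-point vᴮ nonzero orthogonal (\ ()) (a (unknown is))
  holds⇒full : ∀ u -> (∀ is -> a (unknown is) ≐ Basis.point B i0 i1 (u is)) -> ∀ φ ρ -> Holds κ w u φ ρ -> Full (⟪_⟫ b a (¬ₜ e i0 ∨ₜ fmt inputt φ) ρ)
  holds⇒full u unknown≐ φ ρ = bwd (truth-full b a B inFrame κ w u inputt input-point constant-point
   (\ is -> ≐-trans (normal-cong (≐-refl {line (vᴮ i0)}) (≐-refl {line (vᴮ i0) ⊕ line (vᴮ i1)}) (unknown≐ is)) (normal-fixes vᴮ nonzero orthogonal (\ ()) (u is))) φ ρ)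
   where open Basis B renaming (vector to vᴮ)

 -- The input symbols appear as the constants 0 and 1 of the term.
 bitt : ∀ {k} -> Ex k -> Template k
 bitt x = (bit x ∧ₜ l i1) ∨ₜ (¬ₜ bit x ∧ₜ e i0)

 bit-point : ∀ b a B -> InFrame b a B -> ∀ {k} (x : Ex k) ρ -> ⟪_⟫ b a (bitt x) ρ ≐ Basis.point B i0 i1 (if b (⟦ x ⟧e ρ) then 1# else 0#)
 bit-point b a B inFrame x ρ with b (⟦ x ⟧e ρ)
 ... | true = ≐-trans (ext \ y -> mk⇔
  (\ { (u , w , (_ , u∈) , (w∈ , _) , p) -> resp L (\ m -> symm (p m >> +-congˡ (·-definite w (w∈ w (\ _ -> rfl)) m) >> +-identityʳ _)) u∈ })
  (\ y∈ -> y , 0ᵛ , ((\ _ -> rfl) , y∈) , ((\ u _ -> ·-zeroʳ u) , 0∈ (a (frame i0))) , \ m -> symm (+-identityʳ _)))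
  (l-point b a B inFrame i1 \ ())
  where L = a (link i1) ∩ (a (frame i0) ⊕ a (frame i1))
 ... | false = ≐-trans (ext \ y -> mk⇔
  (\ { (u , w , (u≈0 , _) , (_ , w∈) , p) -> resp (a (frame i0)) (\ m -> symm (p m >> +-congʳ (u≈0 m) >> +-identityˡ _)) w∈ })
  (\ y∈ -> 0ᵛ , y , ((\ _ -> rfl) , 0∈ L) , ((\ u u≈0 -> ·-cong {v = y} u≈0 (\ _ -> rfl) >> ·-comm 0ᵛ y >> ·-zeroʳ y) , y∈) , \ m -> symm (+-identityˡ _)))
  (e0-point b a B inFrame)
  where L = a (link i1) ∩ (a (frame i0) ⊕ a (frame i1))

module CounterPrograms where

 open import Data.Vec using (_[_]≔_)
 open Formula

 -- Counter programs over an abstract store; each instruction decrements, increments or tests a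
 -- counter, or acts on the store.  Counters introduced by  new  start and have to end at zero.
 data Cmd (A : ℕ -> Set) (k : ℕ) : Set where
  skip  : Cmd A k
  act   : A k -> Cmd A k
  inc   : Fin k -> Cmd A k
  _⨾_   : Cmd A k -> Cmd A k -> Cmd A k
  while : Fin k -> Cmd A k -> Cmd A k
  ifz   : Fin k -> Cmd A k -> Cmd A k -> Cmd A k
  new   : Cmd A (suc k) -> Cmd A k

 infixr 5 _⨾_

 data Instr (A : ℕ -> Set) (L : Set) : Set where
  nop : L -> Instr A L
  act : ∀ {k} -> A k -> L -> Instr A L
  inc : ℕ -> L -> Instr A L
  tst : ℕ -> (zero pos : L) -> Instr A L

 Point : ∀ {A k} -> Cmd A k -> Set
 Point skip = ⊤
 Point (act _) = ⊤
 Point (inc _) = ⊤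
 Point (C ⨾ D) = Point C ⊎ Point D
 Point (while _ C) = ⊤ ⊎ Point C
 Point (ifz _ C D) = ⊤ ⊎ (Point C ⊎ Point D)
 Point (new C) = Point C

 entry : ∀ {A k} (C : Cmd A k) -> Point C
 entry skip = tt
 entry (act _) = tt
 entry (inc _) = tt
 entry (C ⨾ D) = inl (entry C)
 entry (while _ C) = inl tt
 entry (ifz _ C D) = inl tt
 entry (new C) = entry C

 -- Counters are numbered by nesting depth.
 level : ∀ {k} -> Fin k -> ℕ
 level {suc k} 0F = k
 level {suc k} (fsuc i) = level i

 levels : ∀ {k} -> Vec ℕ k -> ℕ -> ℕ
 levels [] y = 0
 levels {suc k} (v ∷ ρ) y = if does (y N.≟ k) then v else levels ρ y

 code : ∀ {A L k} (C : Cmd A k) -> (Point C -> L) -> L -> Point C -> Instr A L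
 code skip ι x _ = nop x
 code (act α) ι x _ = act α x
 code (inc i) ι x _ = inc (level i) x
 code (C ⨾ D) ι x (inl p) = code C (ι ∘ inl) (ι (inr (entry D))) p
 code (C ⨾ D) ι x (inr p) = code D (ι ∘ inr) x p
 code (while i C) ι x (inl _) = tst (level i) x (ι (inr (entry C)))
 code (while i C) ι x (inr p) = code C (ι ∘ inr) (ι (inl tt)) p
 code (ifz i C D) ι x (inl _) = tst (level i) (ι (inr (inl (entry C)))) (ι (inr (inr (entry D))))
 code (ifz i C D) ι x (inr (inl p)) = code C (ι ∘ inr ∘ inl) x p
 code (ifz i C D) ι x (inr (inr p)) = code D (ι ∘ inr ∘ inr) x p
 code (new C) ι x p = code C ι x p

 depth : ∀ {A k} -> Cmd A k -> ℕ
 depth {k = k} skip = k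
 depth {k = k} (act _) = k
 depth {k = k} (inc _) = k
 depth (C ⨾ D) = depth C N.⊔ depth D
 depth {k = k} (while _ C) = k N.⊔ depth C
 depth {k = k} (ifz _ C D) = k N.⊔ (depth C N.⊔ depth D)
 depth (new C) = depth C

 level< : ∀ {k} (i : Fin k) -> level i < k
 level< 0F = N.≤-refl
 level< (fsuc i) = N.m<n⇒m<1+n (level< i)

 if-≡ : ∀ {a} {A : Set a} {x y : A} {m n : ℕ} -> m ≡ n -> (if does (m N.≟ n) then x else y) ≡ x
 if-≡ {x = x} {y} {m} {n} eq = cong (\ b -> if b then x else y) (dec-true (m N.≟ n) eq)

 if-≢ : ∀ {a} {A : Set a} {x y : A} {m n : ℕ} -> m ≢ n -> (if does (m N.≟ n) then x else y) ≡ y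
 if-≢ {x = x} {y} {m} {n} neq = cong (\ b -> if b then x else y) (dec-false (m N.≟ n) neq)

 levels-≥ : ∀ {k} (ρ : Vec ℕ k) {y} -> k ≤ y -> levels ρ y ≡ 0
 levels-≥ [] _ = refl
 levels-≥ {suc k} (v ∷ ρ) {y} k<y = if-≢ (N.<⇒≢ k<y ∘ sym) ~> levels-≥ ρ (N.<⇒≤ k<y)

 levels-lookup : ∀ {k} (ρ : Vec ℕ k) i -> levels ρ (level i) ≡ lookup ρ i
 levels-lookup {suc k} (v ∷ ρ) 0F = if-≡ {m = k} refl
 levels-lookup {suc k} (v ∷ ρ) (fsuc i) = if-≢ (N.<⇒≢ (level< i)) ~> levels-lookup ρ i

 levels-update : ∀ {k} (ρ : Vec ℕ k) i v y -> levels (ρ [ i ]≔ v) y ≡ (if does (y N.≟ level i) then v else levels ρ y)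
 levels-update {suc k} (u ∷ ρ) 0F v y with y N.≡ᵇ k
 ... | true = refl
 ... | false = refl
 levels-update {suc k} (u ∷ ρ) (fsuc i) v y = case (y N.≟ k) where
  case : Dec (y ≡ k) -> levels (u ∷ (ρ [ i ]≔ v)) y ≡ (if does (y N.≟ level i) then v else levels (u ∷ ρ) y)
  case (yes y≡k) = if-≡ y≡k ~> sym ((if-≢ \ y≡i -> N.<-irrefl (sym y≡i ~> y≡k) (level< i)) ~> if-≡ y≡k)
  case (no y≢k) = if-≢ y≢k ~> levels-update ρ i v y ~> cong (\ w -> if does (y N.≟ level i) then v else w) (sym (if-≢ y≢k))

 levels-new : ∀ {k} (ρ : Vec ℕ k) y -> levels (0 ∷ ρ) y ≡ levels ρ y
 levels-new {k} ρ y = case (y N.≟ k) where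
  case : Dec (y ≡ k) -> levels (0 ∷ ρ) y ≡ levels ρ y
  case (yes refl) = if-≡ {m = y} refl ~> sym (levels-≥ ρ N.≤-refl)
  case (no y≢k) = if-≢ y≢k

 module Execution (A : ℕ -> Set) (S : Set) (⟦_⟧ᵃ : ∀ {k} -> A k -> Vec ℕ k -> S -> S -> Set) where
  Effect : Set₁
  Effect = S -> S -> Set
  infixr 5 _▸_
  _▸_ : Effect -> Effect -> Effect
  (E ▸ F) s u = ∃[ t ] E s t × F t u
  infix 4 _≃_
  record _≃_ (E F : Effect) : Set where
   constructor equivalent
   field apply : ∀ {s t} -> E s t ⇔ F s t
  -- The effect on the counters and the number of steps do not depend on the store.
  data _⊢_⇒[_,_]_ : ∀ {k} -> Cmd A k -> Vec ℕ k -> ℕ -> Effect -> Vec ℕ k -> Set₁ where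
   skip : ∀ {k} {ρ : Vec ℕ k} -> skip ⊢ ρ ⇒[ 1 , _≡_ ] ρ
   act  : ∀ {k} {α : A k} {ρ} -> act α ⊢ ρ ⇒[ 1 , ⟦ α ⟧ᵃ ρ ] ρ
   inc  : ∀ {k} {i : Fin k} {ρ} -> inc i ⊢ ρ ⇒[ 1 , _≡_ ] (ρ [ i ]≔ suc (lookup ρ i))
   seq  : ∀ {k} {C D : Cmd A k} {ρ σ τ m n E F} -> C ⊢ ρ ⇒[ m , E ] σ -> D ⊢ σ ⇒[ n , F ] τ -> (C ⨾ D) ⊢ ρ ⇒[ m N.+ n , E ▸ F ] τ
   while-zero : ∀ {k i} {C : Cmd A k} {ρ} -> lookup ρ i ≡ 0 -> while i C ⊢ ρ ⇒[ 1 , _≡_ ] ρ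
   while-suc : ∀ {k i} {C : Cmd A k} {ρ σ τ v m n E F} -> lookup ρ i ≡ suc v -> C ⊢ ρ [ i ]≔ v ⇒[ m , E ] σ -> while i C ⊢ σ ⇒[ n , F ] τ -> while i C ⊢ ρ ⇒[ suc (m N.+ n) , E ▸ F ] τ
   ifz-zero : ∀ {k i} {C D : Cmd A k} {ρ σ m E} -> lookup ρ i ≡ 0 -> C ⊢ ρ ⇒[ m , E ] σ -> ifz i C D ⊢ ρ ⇒[ suc m , E ] σ
   ifz-suc : ∀ {k i} {C D : Cmd A k} {ρ σ v m E} -> lookup ρ i ≡ suc v -> D ⊢ ρ [ i ]≔ v ⇒[ m , E ] σ -> ifz i C D ⊢ ρ ⇒[ suc m , E ] σ
   new  : ∀ {k} {C : Cmd A (suc k)} {ρ σ m E} -> C ⊢ 0 ∷ ρ ⇒[ m , E ] (0 ∷ σ) -> new C ⊢ ρ ⇒[ m , E ] σ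
   conv : ∀ {k} {C : Cmd A k} {ρ σ m E F} -> E ≃ F -> C ⊢ ρ ⇒[ m , E ] σ -> C ⊢ ρ ⇒[ m , F ] σ
  -- What a machine has to provide in order to run counter programs:  Leads c n G T  says that n steps
  -- lead from c to configurations satisfying  T s  for the outcomes  s  in  G.
  record Interpreter (L Conf : Set) : Set₁ where
   field
    At      : L -> (ℕ -> ℕ) -> S -> Conf -> Set
    At-cong : ∀ {l f g s c} -> (∀ y -> f y ≡ g y) -> At l f s c -> At l g s c
    Leads   : Conf -> ℕ -> (S -> Set) -> (S -> Conf -> Set) -> Set
    bind    : ∀ {c m n} {G : S -> Set} {H : S -> S -> Set} {T U : S -> Conf -> Set} -> Leads c m G T -> (∀ {s c} -> G s -> T s c -> Leads c n (H s) U) -> Leads c (m N.+ n) (\ u -> ∃[ s ] G s × H s u) U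
    convert : ∀ {c n} {G H : S -> Set} {T U : S -> Conf -> Set} -> (∀ {s} -> G s ⇔ H s) -> (∀ {s c} -> T s c -> U s c) -> Leads c n G T -> Leads c n H U
    program : L -> Maybe (Instr A L)
    stepCost maxDepth : ℕ
    step-nop : ∀ {l x f s c} -> program l ≡ just (nop x) -> At l f s c -> Leads c stepCost (s ≡_) (At x f)
    step-act : ∀ {k l x s c} {α : A k} {ρ} -> program l ≡ just (act α x) -> k ≤ maxDepth -> At l (levels ρ) s c -> Leads c stepCost (⟦ α ⟧ᵃ ρ s) (At x (levels ρ))
    step-inc : ∀ {l x r f s c} -> program l ≡ just (inc r x) -> r < maxDepth -> At l f s c -> Leads c stepCost (s ≡_) (At x (\ y -> if does (y N.≟ r) then suc (f r) else f y))
    step-zero : ∀ {l z p r f s c} -> program l ≡ just (tst r z p) -> r < maxDepth -> f r ≡ 0 -> At l f s c -> Leads c stepCost (s ≡_) (At z f)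
    step-suc : ∀ {l z p r v f s c} -> program l ≡ just (tst r z p) -> r < maxDepth -> f r ≡ suc v -> At l f s c -> Leads c stepCost (s ≡_) (At p (\ y -> if does (y N.≟ r) then v else f y))
   private
    bound1 : ∀ {m n} -> m N.⊔ n ≤ maxDepth -> m ≤ maxDepth
    bound1 = N.m⊔n≤o⇒m≤o _ _
    bound2 : ∀ m {n} -> m N.⊔ n ≤ maxDepth -> n ≤ maxDepth
    bound2 m = N.m⊔n≤o⇒n≤o m _
    split-cost : ∀ m n {c G T} -> Leads c (stepCost N.* m N.+ stepCost N.* n) G T -> Leads c (stepCost N.* (m N.+ n)) G T
    split-cost m n {c} {G} {T} = subst (\ k -> Leads c k G T) (sym (N.*-distribˡ-+ stepCost m n))
    one-step : ∀ {c G T} -> Leads c stepCost G T -> Leads c (stepCost N.* 1) G T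
    one-step {c} {G} {T} = subst (\ k -> Leads c k G T) (sym (N.*-identityʳ stepCost))
    prefixed : ∀ m {c s H T U} -> Leads c stepCost (s ≡_) T -> (∀ {c} -> T s c -> Leads c (stepCost N.* m) H U) -> Leads c (stepCost N.* suc m) H U
    prefixed m {c} {s} {H} {T} {U} first next = subst (\ k -> Leads c k H U) (sym (N.*-suc stepCost m))
     (convert {G = \ u -> ∃[ t ] (s ≡ t) × H u} {H} {U} {U} (mk⇔ (\ (_ , _ , h) -> h) \ h -> s , refl , h) id
     (bind {G = s ≡_} {H = \ _ -> H} {T} {U} first \ { refl t -> next t }))
   execute : ∀ {k} {C : Cmd A k} {ρ σ n E} -> C ⊢ ρ ⇒[ n , E ] σ -> depth C ≤ maxDepth -> ∀ ι x -> (∀ p -> program (ι p) ≡ just (code C ι x p)) -> ∀ {s c} -> At (ι (entry C)) (levels ρ) s c -> Leads c (stepCost N.* n) (E s) (At x (levels σ))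
   execute skip d ι x eq at = one-step (step-nop (eq tt) at)
   execute act d ι x eq at = one-step (step-act (eq tt) d at)
   execute (inc {i = i} {ρ}) d ι x eq at = one-step (convert {G = _ ≡_} (mk⇔ id id)
    (At-cong {g = levels (ρ [ i ]≔ suc (lookup ρ i))} \ y -> sym (levels-update ρ i _ y ~> cong (\ v -> if does (y N.≟ level i) then suc v else levels ρ y) (sym (levels-lookup ρ i))))
    (step-inc (eq tt) (level< i ▹ d) at))
   execute (seq {m = m} {n} C D) d ι x eq at = split-cost m n
    (bind (execute C (bound1 d) (ι ∘ inl) _ (eq ∘ inl) at) \ _ -> execute D (bound2 _ d) (ι ∘ inr) x (eq ∘ inr))
   execute (while-zero {i = i} {ρ = ρ} r≡0) d ι x eq at = one-step (step-zero (eq (inl tt)) (level< i ▹ bound1 d) (levels-lookup ρ i ~> r≡0) at)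
   execute (while-suc {i = i} {ρ = ρ} {m = m} {n} r≡ C W) d ι x eq at = prefixed (m N.+ n)
    (step-suc (eq (inl tt)) (level< i ▹ bound1 d) (levels-lookup ρ i ~> r≡) at)
    \ at' -> split-cost m n (bind (execute C (bound2 _ d) (ι ∘ inr) _ (eq ∘ inr) (At-cong {g = levels (ρ [ i ]≔ _)} (\ y -> sym (levels-update ρ i _ y)) at'))
    \ _ -> execute W d ι x eq)
   execute (ifz-zero {k = k} {i = i} {C = C0} {D0} {ρ} {m = m} r≡0 C) d ι x eq at = prefixed m
    (step-zero (eq (inl tt)) (level< i ▹ bound1 d) (levels-lookup ρ i ~> r≡0) at)
    (execute C (bound1 {depth C0} {depth D0} (bound2 k d)) (ι ∘ inr ∘ inl) x (eq ∘ inr ∘ inl))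
   execute (ifz-suc {k = k} {i = i} {C = C0} {ρ = ρ} {m = m} r≡ D) d ι x eq at = prefixed m
    (step-suc (eq (inl tt)) (level< i ▹ bound1 d) (levels-lookup ρ i ~> r≡) at)
    \ at' -> execute D (bound2 (depth C0) (bound2 k d)) (ι ∘ inr ∘ inr) x (eq ∘ inr ∘ inr) (At-cong {g = levels (ρ [ i ]≔ _)} (\ y -> sym (levels-update ρ i _ y)) at')
   execute (new {ρ = ρ} {σ} {E = E} C) d ι x eq at = convert {G = E _} (mk⇔ id id) (At-cong {f = levels (0 ∷ σ)} {levels σ} (levels-new σ))
    (execute C d ι x eq (At-cong {f = levels ρ} {levels (0 ∷ ρ)} (\ y -> sym (levels-new ρ y)) at))
   execute (conv {E = E} {F} E≃F C) d ι x eq at = convert {G = E _} {F _} (_≃_.apply E≃F) id (execute C d ι x eq at)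

module Polynomials where

 open Formula
 open import Data.Nat using (_+_; _*_; _^_)

 Bounded : ∀ {k} -> (Vec ℕ k -> ℕ) -> Set
 Bounded f = ∃[ c ] ∀ M ρ -> (∀ i -> lookup ρ i ≤ M) -> f ρ ≤ (2 + M) ^ c

 1≤^ : ∀ M c -> 1 ≤ (2 + M) ^ c
 1≤^ M c = N.m^n>0 (2 + M) c

 ^-mono : ∀ M {a b} -> a ≤ b -> (2 + M) ^ a ≤ (2 + M) ^ b
 ^-mono M = N.^-monoʳ-≤ (2 + M)

 bounded-≤ : ∀ {k} {f g : Vec ℕ k -> ℕ} -> (∀ ρ -> f ρ ≤ g ρ) -> Bounded g -> Bounded f
 bounded-≤ f≤g (c , h) = c , \ M ρ ρ≤ -> f≤g ρ ▹ h M ρ ρ≤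

 n≤2^n : ∀ n -> n ≤ 2 ^ n
 n≤2^n zero = z≤n
 n≤2^n (suc n) = N.+-mono-≤ (N.m^n>0 2 n) (n≤2^n n ▹ N.m≤m+n (2 ^ n) 0)

 bounded-lit : ∀ {k} n -> Bounded {k} (\ _ -> n)
 bounded-lit n = n , \ M _ _ -> n≤2^n n ▹ N.^-monoˡ-≤ n (N.m≤m+n 2 M)

 bounded-var : ∀ {k} (i : Fin k) -> Bounded (\ ρ -> lookup ρ i)
 bounded-var i = 1 , \ M ρ ρ≤ -> ρ≤ i ▹ N.m≤n+m M 2 ▹ N.≤-reflexive (sym (N.*-identityʳ (2 + M)))

 sum≤ : ∀ M a b {x y} -> x ≤ (2 + M) ^ a -> y ≤ (2 + M) ^ b -> x + y ≤ (2 + M) ^ suc (a + b)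
 sum≤ M a b {x} {y} p q = N.+-mono-≤ (p ▹ ^-mono M (N.m≤m+n a b)) (q ▹ ^-mono M (N.m≤n+m b a)) ▹ N.≤-reflexive (cong ((2 + M) ^ (a + b) +_) (sym (N.+-identityʳ _))) ▹ N.*-monoˡ-≤ ((2 + M) ^ (a + b)) (N.m≤m+n 2 M)

 bounded-+ : ∀ {k} {f g : Vec ℕ k -> ℕ} -> Bounded f -> Bounded g -> Bounded (\ ρ -> f ρ + g ρ)
 bounded-+ (a , p) (b , q) = suc (a + b) , \ M ρ ρ≤ -> sum≤ M a b (p M ρ ρ≤) (q M ρ ρ≤)

 bounded-* : ∀ {k} {f g : Vec ℕ k -> ℕ} -> Bounded f -> Bounded g -> Bounded (\ ρ -> f ρ * g ρ)
 bounded-* (a , p) (b , q) = a + b , \ M ρ ρ≤ -> N.*-mono-≤ (p M ρ ρ≤) (q M ρ ρ≤) ▹ N.≤-reflexive (sym (N.^-distribˡ-+-* (2 + M) a b))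

 bounded-Ex : ∀ {k} (e : Ex k) -> Bounded ⟦ e ⟧e
 bounded-Ex (lit n) = bounded-lit n
 bounded-Ex (# i) = bounded-var i
 bounded-Ex (a ⊹ b) = bounded-+ (bounded-Ex a) (bounded-Ex b)
 bounded-Ex (a ✶ b) = bounded-* (bounded-Ex a) (bounded-Ex b)

 bounded-body : ∀ {k} {f : Vec ℕ (suc k) -> ℕ} {g : Vec ℕ k -> ℕ} -> Bounded g -> Bounded f -> ∃[ c ] ∀ M ρ -> (∀ i -> lookup ρ i ≤ M) -> ∀ j -> j ≤ g ρ -> f (j ∷ ρ) ≤ (2 + M) ^ c
 bounded-body {f = f} (a , p) (b , q) = suc (suc a) * b , \ M ρ ρ≤ j j≤ -> let
   N = (2 + M) ^ suc a
   2≤N : 2 ≤ N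
   2≤N = N.*-mono-≤ (N.m≤m+n 2 M) (1≤^ M a)
   extended : ∀ i -> lookup (j ∷ ρ) i ≤ N
   extended = \ { 0F -> j≤ ▹ p M ρ ρ≤ ▹ ^-mono M (N.n≤1+n a)
    ; (fsuc i) -> ρ≤ i ▹ N.m≤n+m M 2 ▹ N.m≤m*n (2 + M) ((2 + M) ^ a) {{N.>-nonZero (1≤^ M a)}} }
  in N.≤-trans (q N (j ∷ ρ) extended) (N.^-monoˡ-≤ b
  (N.+-monoˡ-≤ N 2≤N ▹ N.≤-reflexive (cong (N +_) (sym (N.+-identityʳ N))) ▹ N.*-monoˡ-≤ N (N.m≤m+n 2 M)) ▹ N.≤-reflexive (N.^-*-assoc (2 + M) (suc (suc a)) b))

 bounded-let : ∀ {k} {f : Vec ℕ (suc k) -> ℕ} {g : Vec ℕ k -> ℕ} -> Bounded g -> Bounded f -> Bounded (\ ρ -> f (g ρ ∷ ρ))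
 bounded-let p q = let c , h = bounded-body p q in c , \ M ρ ρ≤ -> h M ρ ρ≤ _ N.≤-refl

 bounded⇒bound : (f : Vec ℕ 1 -> ℕ) -> Bounded f -> ∃[ b ] ∀ n -> f (n ∷ []) ≤ bound b n
 bounded⇒bound f (c , h) = b , \ n -> h n (n ∷ []) (\ { 0F -> N.≤-refl }) ▹ power n where
  b = 3 ^ c + c
  power : ∀ n -> (2 + n) ^ c ≤ bound b n
  power zero = N.^-monoˡ-≤ c (N.n≤1+n 2) ▹ N.m≤m+n (3 ^ c) c ▹ N.m≤n+m b (b * 0 ^ b)
  power n@(suc m) = N.^-monoˡ-≤ c 2+n≤3n ▹ N.≤-reflexive (power-* c) ▹ N.*-mono-≤ (N.m≤m+n (3 ^ c) c) (N.^-monoʳ-≤ n (N.m≤n+m c (3 ^ c))) ▹ N.m≤m+n _ b where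
   2+n≤3n : 2 + n ≤ 3 * n
   2+n≤3n = N.≤-reflexive (N.+-comm 2 n) ▹ N.+-monoʳ-≤ n
    (N.*-monoʳ-≤ 2 (s≤s z≤n))
   power-* : ∀ c -> (3 * n) ^ c ≡ 3 ^ c * n ^ c
   power-* zero = refl
   power-* (suc c) = cong (3 * n *_) (power-* c) ~> N.[m*n]*[o*p]≡[m*o]*[n*p] 3 n (3 ^ c) (n ^ c)

module Programs
 (A : ℕ -> Set) (S : Set) (⟦_⟧ᵃ : ∀ {k} -> A k -> Vec ℕ k -> S -> S -> Set)
 (rename : ∀ {k m} -> (Fin k -> Fin m) -> A k -> A m)
 (rename-effect : ∀ {k m} (σ : Fin k -> Fin m) (α : A k) ρ env -> (∀ i -> lookup ρ (σ i) ≡ lookup env i) -> ∀ {s t} -> ⟦ rename σ α ⟧ᵃ ρ s t ⇔ ⟦ α ⟧ᵃ env s t)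
 (emit : Bool -> ∀ {k} -> A k) (emits : Bool -> S -> S -> Set)
 (emit-effect : ∀ b {k} (ρ : Vec ℕ k) {s t} -> ⟦ emit b ⟧ᵃ ρ s t ⇔ emits b s t) where
 open import Data.Vec using (_[_]≔_)
 open import Data.Nat.Binary as Bin using (ℕᵇ; 2[1+_]; 1+[2_])
 import Data.Nat.Binary.Properties as Bin
 open Formula
 open CounterPrograms
 open Execution A S ⟦_⟧ᵃ

 -- The loop variable of  for  runs upwards from 0;  digits  emits the code of an index.
 data Prog (k : ℕ) : Set where
  skip   : Prog k
  act    : A k -> Prog k
  _⨾_    : Prog k -> Prog k -> Prog k
  for    : Ex k -> Prog (suc k) -> Prog k
  letE   : Ex k -> Prog (suc k) -> Prog k
  digits : Ex k -> Prog k

 infixr 5 _⨾_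

 iterate : (ℕ -> Effect) -> ℕ -> ℕ -> Effect
 iterate E j zero = _≡_
 iterate E j (suc c) = E j ▸ iterate E (suc j) c

 emitDigits : ℕᵇ -> Effect
 emitDigits Bin.zero = emits false
 emitDigits 2[1+ b ] = emits true ▸ emits false ▸ emitDigits b
 emitDigits 1+[2 b ] = emits true ▸ emits true ▸ emitDigits b

 effect : ∀ {k} -> Prog k -> Vec ℕ k -> Effect
 effect skip ρ = _≡_
 effect (act α) ρ = ⟦ α ⟧ᵃ ρ
 effect (P ⨾ Q) ρ = effect P ρ ▸ effect Q ρ
 effect (for e P) ρ = iterate (\ j -> effect P (j ∷ ρ)) 0 (⟦ e ⟧e ρ)
 effect (letE e P) ρ = effect P (⟦ e ⟧e ρ ∷ ρ)
 effect (digits e) ρ = emitDigits (Bin.fromℕ (⟦ e ⟧e ρ))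

 private
  incs : ∀ {m} -> ℕ -> Fin m -> Cmd A m
  incs zero z = skip
  incs (suc n) z = inc z ⨾ incs n z
  addTo : ∀ {k m} -> (Fin k -> Fin m) -> Ex k -> Fin m -> Cmd A m
  addTo σ (lit n) z = incs n z
  addTo σ (# i) z = new (while (fsuc (σ i)) (inc 0F ⨾ inc (fsuc z)) ⨾ while 0F (inc (fsuc (σ i))))
  addTo σ (a ⊹ b) z = addTo σ a z ⨾ addTo σ b z
  addTo σ (a ✶ b) z = new (addTo (fsuc ∘ σ) a 0F ⨾ while 0F (addTo (fsuc ∘ σ) b (fsuc z)))
  extend : ∀ {k m} -> (Fin k -> Fin m) -> Fin (suc k) -> Fin (suc m)
  extend σ 0F = 0F
  extend σ (fsuc i) = fsuc (σ i)
  under : ∀ {k m} -> (Fin k -> Fin m) -> Fin (suc k) -> Fin (suc (suc m))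
  under σ 0F = 0F
  under σ (fsuc i) = fsuc (fsuc (σ i))
  halve : ∀ {m} -> Cmd A (suc (suc (suc m)))
  halve = while 2F (ifz 2F (inc 0F) (inc 1F))
  digitLoop : ∀ {m} -> Cmd A (suc m)
  digitLoop = while 0F (act (emit true) ⨾ new (new (halve ⨾ ifz 0F (act (emit true)) (act (emit false)) ⨾
   while 1F (inc 2F))))

 command : ∀ {k m} -> (Fin k -> Fin m) -> Prog k -> Cmd A m
 command σ skip = skip
 command σ (act α) = act (rename σ α)
 command σ (P ⨾ Q) = command σ P ⨾ command σ Q
 command σ (for e P) = new (addTo (fsuc ∘ σ) e 0F ⨾
  new (while 1F (command (under σ) P ⨾ inc 0F) ⨾ while 0F skip))
 command σ (letE e P) = new (addTo (fsuc ∘ σ) e 0F ⨾ command (extend σ) P ⨾ while 0F skip)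
 command σ (digits e) = new (addTo (fsuc ∘ σ) e 0F ⨾ digitLoop ⨾ act (emit false))

 private
  addCost : ∀ {k} -> Ex k -> Vec ℕ k -> ℕ
  addCost (lit n) ρ = suc n
  addCost (# i) ρ = suc (lookup ρ i N.* 3) N.+ suc (lookup ρ i N.* 2)
  addCost (a ⊹ b) ρ = addCost a ρ N.+ addCost b ρ
  addCost (a ✶ b) ρ = addCost a ρ N.+ suc (⟦ a ⟧e ρ N.* suc (addCost b ρ))
  loopCost : (ℕ -> ℕ) -> ℕ -> ℕ -> ℕ
  loopCost f j zero = 1
  loopCost f j (suc c) = suc ((f j N.+ 1) N.+ loopCost f (suc j) c)
  halveCost : ℕ -> ℕ -> ℕ
  halveCost n h = suc (1 N.+ (suc (n N.* 3) N.+ (2 N.+ suc (h N.* 2))))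
  digitsCost : ℕᵇ -> ℕ
  digitsCost Bin.zero = 1
  digitsCost 2[1+ b ] = halveCost (suc (Bin.toℕ b)) (Bin.toℕ b) N.+ digitsCost b
  digitsCost 1+[2 b ] = halveCost (Bin.toℕ b) (Bin.toℕ b) N.+ digitsCost b

 cost : ∀ {k} -> Prog k -> Vec ℕ k -> ℕ
 cost skip ρ = 1
 cost (act α) ρ = 1
 cost (P ⨾ Q) ρ = cost P ρ N.+ cost Q ρ
 cost (for e P) ρ = addCost e ρ N.+ (loopCost (\ j -> cost P (j ∷ ρ)) 0 (⟦ e ⟧e ρ) N.+ suc (⟦ e ⟧e ρ N.* 2))
 cost (letE e P) ρ = addCost e ρ N.+ (cost P (⟦ e ⟧e ρ ∷ ρ) N.+ suc (⟦ e ⟧e ρ N.* 2))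
 cost (digits e) ρ = addCost e ρ N.+ (digitsCost (Bin.fromℕ (⟦ e ⟧e ρ)) N.+ 1)

 private
  Pure : ∀ {m} -> Cmd A m -> Vec ℕ m -> ℕ -> Vec ℕ m -> Set₁
  Pure C ρ n σ = C ⊢ ρ ⇒[ n , _≡_ ] σ
  idˡ : ∀ {E : Effect} -> (_≡_ ▸ E) ≃ E
  idˡ = equivalent (mk⇔ (\ { (_ , refl , e) -> e }) (\ e -> _ , refl , e))
  idʳ : ∀ {E : Effect} -> (E ▸ _≡_) ≃ E
  idʳ = equivalent (mk⇔ (\ { (_ , e , refl) -> e }) (\ e -> _ , e , refl))
  seqˡ : ∀ {m} {C D : Cmd A m} {ρ σ τ a b E} -> Pure C ρ a σ -> D ⊢ σ ⇒[ b , E ] τ -> (C ⨾ D) ⊢ ρ ⇒[ a N.+ b , E ] τ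
  seqˡ c d = conv idˡ (seq c d)
  seqʳ : ∀ {m} {C D : Cmd A m} {ρ σ τ a b E} -> C ⊢ ρ ⇒[ a , E ] σ -> Pure D σ b τ -> (C ⨾ D) ⊢ ρ ⇒[ a N.+ b , E ] τ
  seqʳ c d = conv idʳ (seq c d)
  while-pure : ∀ {m i} {C : Cmd A m} {ρ σ τ v a b} -> lookup ρ i ≡ suc v -> Pure C (ρ [ i ]≔ v) a σ -> Pure (while i C) σ b τ -> Pure (while i C) ρ (suc (a N.+ b)) τ
  while-pure r c w = conv idˡ (while-suc r c w)
  result : ∀ {m} {C : Cmd A m} {ρ σ τ a b E} -> a ≡ b -> σ ≡ τ -> C ⊢ ρ ⇒[ a , E ] σ -> C ⊢ ρ ⇒[ b , E ] τ
  result refl refl c = c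
  start : ∀ {m} {C : Cmd A m} {ρ ρ' σ a E} -> ρ ≡ ρ' -> C ⊢ ρ ⇒[ a , E ] σ -> C ⊢ ρ' ⇒[ a , E ] σ
  start refl c = c
  Reads : ∀ {k m} -> (Fin k -> Fin m) -> Vec ℕ m -> Vec ℕ k -> Set
  Reads σ ρ env = ∀ i -> lookup ρ (σ i) ≡ lookup env i
  reads-update : ∀ {k m} {σ : Fin k -> Fin m} {ρ env z v} -> (∀ i -> σ i ≢ z) -> Reads σ ρ env -> Reads σ (ρ [ z ]≔ v) env
  reads-update {σ = σ} {ρ} σ≢z reads i = Vec.lookup∘update′ (σ≢z i) ρ _ ~> reads i
  clear : ∀ {m} v (ρ : Vec ℕ m) -> Pure (while 0F skip) (v ∷ ρ) (suc (v N.* 2)) (0 ∷ ρ)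
  clear zero ρ = while-zero refl
  clear (suc v) ρ = while-pure refl skip (clear v ρ)
  incs-correct : ∀ {m} n (z : Fin m) ρ -> Pure (incs n z) ρ (suc n) (ρ [ z ]≔ (lookup ρ z N.+ n))
  incs-correct zero z ρ = result refl
   (sym (cong (ρ [ z ]≔_) (N.+-identityʳ _) ~> Vec.[]≔-lookup ρ z)) skip
  incs-correct (suc n) z ρ = result refl
   (Vec.[]≔-idempotent ρ z ~> cong (ρ [ z ]≔_) (cong (N._+ n) (Vec.lookup∘update z ρ _) ~> sym (N.+-suc _ n)))
   (seqˡ inc (incs-correct n z _))
  drain : ∀ {m} v t (x z : Fin m) ρ -> x ≢ z -> lookup ρ x ≡ v -> Pure (while (fsuc x) (inc 0F ⨾ inc (fsuc z))) (t ∷ ρ) (suc (v N.* 3)) ((v N.+ t) ∷ ((ρ [ z ]≔ (lookup ρ z N.+ v)) [ x ]≔ 0))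
  drain zero t x z ρ x≢z x≡0 = result refl (cong (t ∷_) (sym (cong (_[ x ]≔ 0) (cong (ρ [ z ]≔_) (N.+-identityʳ _) ~> Vec.[]≔-lookup ρ z) ~> cong (ρ [ x ]≔_) (sym x≡0) ~> Vec.[]≔-lookup ρ x)))
   (while-zero x≡0)
  drain (suc v) t x z ρ x≢z x≡ = result refl (cong₂ _∷_ (N.+-suc v t) update)
   (while-pure x≡ (seqˡ inc inc) (drain v (suc t) x z ρ″ x≢z (Vec.lookup∘update′ x≢z ρ' _ ~> Vec.lookup∘update x ρ v))) where
   ρ' = ρ [ x ]≔ v
   ρ″ = ρ' [ z ]≔ suc (lookup ρ' z)
   total : lookup ρ″ z N.+ v ≡ lookup ρ z N.+ suc v
   total = cong (N._+ v) (Vec.lookup∘update z ρ' _ ~> cong suc (Vec.lookup∘update′ (x≢z ∘ sym) ρ v)) ~> sym (N.+-suc _ v)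
   update : (ρ″ [ z ]≔ (lookup ρ″ z N.+ v)) [ x ]≔ 0 ≡ (ρ [ z ]≔ (lookup ρ z N.+ suc v)) [ x ]≔ 0
   update = cong (_[ x ]≔ 0) (Vec.[]≔-idempotent ρ' z ~> cong (ρ' [ z ]≔_) total ~> Vec.[]≔-commutes ρ x z x≢z) ~> Vec.[]≔-idempotent (ρ [ z ]≔ (lookup ρ z N.+ suc v)) x
  refill : ∀ {m} t (x : Fin m) ρ -> Pure (while 0F (inc (fsuc x))) (t ∷ ρ) (suc (t N.* 2)) (0 ∷ (ρ [ x ]≔ (lookup ρ x N.+ t)))
  refill zero x ρ = result refl (cong (0 ∷_) (sym (cong (ρ [ x ]≔_) (N.+-identityʳ _) ~> Vec.[]≔-lookup ρ x))) (while-zero refl)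
  refill (suc t) x ρ = result refl (cong (0 ∷_) (Vec.[]≔-idempotent ρ x ~> cong (ρ [ x ]≔_) (cong (N._+ t) (Vec.lookup∘update x ρ _) ~> sym (N.+-suc _ t))))
   (while-pure refl inc (refill t x _))
  addTo-correct : ∀ {k m} (σ : Fin k -> Fin m) (e : Ex k) z ρ env -> (∀ i -> σ i ≢ z) -> Reads σ ρ env -> Pure (addTo σ e z) ρ (addCost e env) (ρ [ z ]≔ (lookup ρ z N.+ ⟦ e ⟧e env))
  addTo-correct σ (lit n) z ρ env σ≢z reads = incs-correct n z ρ
  addTo-correct σ (# i) z ρ env σ≢z reads with lookup env i | reads i
  ... | v | x≡v = new (result refl (cong (0 ∷_) update)
   (seqˡ (result refl (cong (\ t -> t ∷ ρ1) (N.+-identityʳ v)) (drain v 0 (σ i) z ρ (σ≢z i) x≡v)) (refill v (σ i) ρ1))) where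
   ρ0 = ρ [ z ]≔ (lookup ρ z N.+ v)
   ρ1 = ρ0 [ σ i ]≔ 0
   update : ρ1 [ σ i ]≔ (lookup ρ1 (σ i) N.+ v) ≡ ρ0
   update = Vec.[]≔-idempotent ρ0 (σ i) ~> cong (ρ0 [ σ i ]≔_)
    (cong (N._+ v) (Vec.lookup∘update (σ i) ρ0 0) ~> sym (Vec.lookup∘update′ (σ≢z i) ρ _ ~> x≡v)) ~> Vec.[]≔-lookup ρ0 (σ i)
  addTo-correct σ (a ⊹ b) z ρ env σ≢z reads = result refl (Vec.[]≔-idempotent ρ z ~> cong (ρ [ z ]≔_)
   (cong (N._+ ⟦ b ⟧e env) (Vec.lookup∘update z ρ _) ~> N.+-assoc (lookup ρ z) _ _))
   (seqˡ (addTo-correct σ a z ρ env σ≢z reads) (addTo-correct σ b z _ env σ≢z (reads-update {ρ = ρ} {env} σ≢z reads)))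
  addTo-correct {m = m} σ (a ✶ b) z ρ env σ≢z reads = new (seqˡ
   (addTo-correct (fsuc ∘ σ) a 0F (0 ∷ ρ) env (\ _ ()) reads) (times (⟦ a ⟧e env) ρ reads)) where
   times : ∀ c ρ -> Reads σ ρ env -> Pure (while 0F (addTo (fsuc ∘ σ) b (fsuc z))) (c ∷ ρ)
    (suc (c N.* suc (addCost b env))) (0 ∷ (ρ [ z ]≔ (lookup ρ z N.+ c N.* ⟦ b ⟧e env)))
   times zero ρ reads = result refl (cong (0 ∷_) (sym (cong (ρ [ z ]≔_) (N.+-identityʳ _) ~> Vec.[]≔-lookup ρ z))) (while-zero refl)
   times (suc c) ρ reads = result (cong suc (N.+-suc (addCost b env) (c N.* suc (addCost b env)))) (cong (0 ∷_) (Vec.[]≔-idempotent ρ z ~> cong (ρ [ z ]≔_)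
    (cong (N._+ c N.* ⟦ b ⟧e env) (Vec.lookup∘update z ρ _) ~> N.+-assoc (lookup ρ z) _ _)))
    (while-pure refl (addTo-correct (fsuc ∘ σ) b (fsuc z) (c ∷ ρ) env (\ i -> σ≢z i ∘ Fin.suc-injective) reads)
    (times c _ (reads-update {ρ = ρ} {env} σ≢z reads)))
  halve-even : ∀ {m} n p h (ρ : Vec ℕ m) -> Pure halve (p ∷ h ∷ (n N.+ n) ∷ ρ) (suc (n N.* 3)) (p ∷ (h N.+ n) ∷ 0 ∷ ρ)
  halve-even zero p h ρ = result refl (cong (\ v -> p ∷ v ∷ 0 ∷ ρ) (sym (N.+-identityʳ h))) (while-zero refl)
  halve-even (suc n) p h ρ = result refl (cong (\ v -> p ∷ v ∷ 0 ∷ ρ) (sym (N.+-suc h n)))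
   (while-pure refl (ifz-suc (N.+-suc n n) inc) (halve-even n p (suc h) ρ))
  halve-odd : ∀ {m} n p h (ρ : Vec ℕ m) -> Pure halve (p ∷ h ∷ suc (n N.+ n) ∷ ρ) (suc (suc n N.* 3)) (suc p ∷ (h N.+ n) ∷ 0 ∷ ρ)
  halve-odd zero p h ρ = result refl (cong (\ v -> suc p ∷ v ∷ 0 ∷ ρ) (sym (N.+-identityʳ h)))
   (while-pure refl (ifz-zero refl inc) (while-zero refl))
  halve-odd (suc n) p h ρ = result refl (cong (\ v -> suc p ∷ v ∷ 0 ∷ ρ) (sym (N.+-suc h n)))
   (while-pure refl (ifz-suc refl inc) (start (cong (\ v -> p ∷ suc h ∷ v ∷ ρ) (sym (N.+-suc n n))) (halve-odd n p (suc h) ρ)))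
  move : ∀ {m} h p c (ρ : Vec ℕ m) -> Pure (while 1F (inc 2F)) (p ∷ h ∷ c ∷ ρ) (suc (h N.* 2)) (p ∷ 0 ∷ (h N.+ c) ∷ ρ)
  move zero p c ρ = while-zero refl
  move (suc h) p c ρ = result refl (cong (\ v -> p ∷ 0 ∷ v ∷ ρ) (N.+-suc h c)) (while-pure refl inc (move h p (suc c) ρ))
  emit-correct : ∀ b {m} {ρ : Vec ℕ m} -> act (emit b) ⊢ ρ ⇒[ 1 , emits b ] ρ
  emit-correct b {ρ = ρ} = conv (equivalent (emit-effect b ρ)) act
  assoc : ∀ {E F G : Effect} -> ((E ▸ F) ▸ G) ≃ (E ▸ F ▸ G)
  assoc = equivalent (mk⇔ (\ (_ , (_ , e , f) , g) -> _ , e , _ , f , g) (\ (_ , e , _ , f , g) -> _ , (_ , e , f) , g))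
  digitEffect : ℕᵇ -> Effect
  digitEffect Bin.zero = _≡_
  digitEffect 2[1+ b ] = emits true ▸ emits false ▸ digitEffect b
  digitEffect 1+[2 b ] = emits true ▸ emits true ▸ digitEffect b
  digitEffect-end : ∀ b -> (digitEffect b ▸ emits false) ≃ emitDigits b
  digitEffect-end Bin.zero = idˡ
  digitEffect-end 2[1+ b ] = equivalent (mk⇔
   (\ (_ , (_ , e , _ , f , g) , h) -> _ , e , _ , f , fwd (_≃_.apply (digitEffect-end b)) (_ , g , h))
   (\ (_ , e , _ , f , g) -> let _ , g' , h = bwd (_≃_.apply (digitEffect-end b)) g in _ , (_ , e , _ , f , g') , h))
  digitEffect-end 1+[2 b ] = equivalent (mk⇔
   (\ (_ , (_ , e , _ , f , g) , h) -> _ , e , _ , f , fwd (_≃_.apply (digitEffect-end b)) (_ , g , h))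
   (\ (_ , e , _ , f , g) -> let _ , g' , h = bwd (_≃_.apply (digitEffect-end b)) g in _ , (_ , e , _ , f , g') , h))
  digitLoop-correct : ∀ {m} b (ρ : Vec ℕ m) -> digitLoop ⊢ Bin.toℕ b ∷ ρ ⇒[ digitsCost b , digitEffect b ] (0 ∷ ρ)
  digitLoop-correct Bin.zero ρ = while-zero refl
  digitLoop-correct 1+[2 b ] ρ = conv assoc (while-suc refl
   (seq (emit-correct true) (new (new (seqˡ
   (start (cong (\ v -> 0 ∷ 0 ∷ v ∷ ρ) (cong (h N.+_) (sym (N.+-identityʳ h)))) (halve-even h 0 0 ρ))
   (seqʳ (ifz-zero refl (emit-correct true)) (result refl (cong (\ v -> 0 ∷ 0 ∷ v ∷ ρ) (N.+-identityʳ h)) (move h 0 0 ρ)))))))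
   (digitLoop-correct b ρ))
   where h = Bin.toℕ b
  digitLoop-correct 2[1+ b ] ρ = conv assoc (while-suc refl
   (seq (emit-correct true) (new (new (seqˡ
   (start (cong (\ v -> 0 ∷ 0 ∷ v ∷ ρ) (sym (cong (h N.+_) (cong suc (N.+-identityʳ h)) ~> N.+-suc h h))) (halve-odd h 0 0 ρ))
   (seqʳ (ifz-suc refl (emit-correct false)) (result refl (cong (\ v -> 0 ∷ 0 ∷ v ∷ ρ) (N.+-identityʳ h)) (move h 0 0 ρ)))))))
   (digitLoop-correct b ρ))
   where h = Bin.toℕ b

 correct : ∀ {k m} (σ : Fin k -> Fin m) (P : Prog k) ρ env -> (∀ i -> lookup ρ (σ i) ≡ lookup env i) -> command σ P ⊢ ρ ⇒[ cost P env , effect P env ] ρ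
 correct σ skip ρ env reads = skip
 correct σ (act α) ρ env reads = conv (equivalent (rename-effect σ α ρ env reads)) act
 correct σ (P ⨾ Q) ρ env reads = seq (correct σ P ρ env reads) (correct σ Q ρ env reads)
 correct σ (for e P) ρ env reads = new (seqˡ (addTo-correct (fsuc ∘ σ) e 0F (0 ∷ ρ) env (\ _ ()) reads)
  (new (seqʳ (loop 0 n) (start (cong (\ v -> v ∷ 0 ∷ ρ) (sym (N.+-identityʳ n))) (clear n (0 ∷ ρ)))))) where
  n = ⟦ e ⟧e env
  loop : ∀ j c -> while 1F (command (under σ) P ⨾ inc 0F) ⊢ j ∷ c ∷ ρ
   ⇒[ loopCost (\ j -> cost P (j ∷ env)) j c , iterate (\ j -> effect P (j ∷ env)) j c ] ((c N.+ j) ∷ 0 ∷ ρ)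
  loop j zero = while-zero refl
  loop j (suc c) = result refl (cong (\ v -> v ∷ 0 ∷ ρ) (N.+-suc c j)) (while-suc refl
   (seqʳ (correct (under σ) P (j ∷ c ∷ ρ) (j ∷ env) \ { 0F -> refl ; (fsuc i) -> reads i }) inc) (loop (suc j) c))
 correct σ (letE e P) ρ env reads = new (seqˡ (addTo-correct (fsuc ∘ σ) e 0F (0 ∷ ρ) env (\ _ ()) reads)
  (seqʳ (correct (extend σ) P (n ∷ ρ) (n ∷ env) \ { 0F -> refl ; (fsuc i) -> reads i }) (clear n ρ)))
  where n = ⟦ e ⟧e env
 correct σ (digits e) ρ env reads = new (seqˡ (addTo-correct (fsuc ∘ σ) e 0F (0 ∷ ρ) env (\ _ ()) reads)
  (conv (digitEffect-end (Bin.fromℕ n)) (seq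
  (start (cong (_∷ ρ) (Bin.toℕ-fromℕ n))
  (digitLoop-correct (Bin.fromℕ n) ρ))
  (emit-correct false))))
  where n = ⟦ e ⟧e env

 private
  open Polynomials
  bounded-add : ∀ {k} (e : Ex k) -> Bounded (addCost e)
  bounded-add (lit n) = bounded-lit (suc n)
  bounded-add (# i) = bounded-+ (bounded-+ (bounded-lit 1) (bounded-* (bounded-var i) (bounded-lit 3)))
   (bounded-+ (bounded-lit 1) (bounded-* (bounded-var i) (bounded-lit 2)))
  bounded-add (a ⊹ b) = bounded-+ (bounded-add a) (bounded-add b)
  bounded-add (a ✶ b) = bounded-+ (bounded-add a)
   (bounded-+ (bounded-lit 1) (bounded-* (bounded-Ex a) (bounded-+ (bounded-lit 1) (bounded-add b))))
  loopCost≤ : ∀ f j c F -> (∀ i -> i < j N.+ c -> f i ≤ F) -> loopCost f j c ≤ suc (c N.* (2 N.+ F))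
  loopCost≤ f j zero F h = s≤s z≤n
  loopCost≤ f j (suc c) F h = s≤s (N.+-mono-≤ (N.+-monoˡ-≤ 1 (h j (N.m<m+n j (s≤s z≤n))))
   (loopCost≤ f (suc j) c F \ i i< -> h i (subst (i <_) (sym (N.+-suc j c)) i<))) ▹ N.≤-reflexive (arrange c F) where
   arrange : ∀ c F -> suc (F N.+ 1 N.+ suc (c N.* (2 N.+ F))) ≡ suc ((2 N.+ F) N.+ c N.* (2 N.+ F))
   arrange = solve-∀
  digitsCost≤ : ∀ b -> digitsCost b ≤ 9 N.* suc (Bin.toℕ b)
  digitsCost≤ Bin.zero = s≤s z≤n
  digitsCost≤ 2[1+ b ] = N.+-monoʳ-≤ (halveCost (suc h) h) (digitsCost≤ b) ▹ N.m≤m+n _ (9 N.+ 4 N.* h) ▹ N.≤-reflexive (arrange h) where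
   h = Bin.toℕ b
   arrange : ∀ h -> suc (1 N.+ (suc (suc h N.* 3) N.+ (2 N.+ suc (h N.* 2)))) N.+ 9 N.* suc h N.+ (9 N.+ 4 N.* h)
    ≡ 9 N.* suc (2 N.* suc h)
   arrange = solve-∀
  digitsCost≤ 1+[2 b ] = N.+-monoʳ-≤ (halveCost h h) (digitsCost≤ b) ▹ N.m≤m+n _ (3 N.+ 4 N.* h) ▹ N.≤-reflexive (arrange h) where
   h = Bin.toℕ b
   arrange : ∀ h -> suc (1 N.+ (suc (h N.* 3) N.+ (2 N.+ suc (h N.* 2)))) N.+ 9 N.* suc h N.+ (3 N.+ 4 N.* h)
    ≡ 9 N.* suc (suc (2 N.* h))
   arrange = solve-∀
  bounded-clear : ∀ {k} (e : Ex k) -> Bounded (\ ρ -> suc (⟦ e ⟧e ρ N.* 2))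
  bounded-clear e = bounded-+ (bounded-lit 1) (bounded-* (bounded-Ex e) (bounded-lit 2))

 bounded-cost : ∀ {k} (P : Prog k) -> Bounded (cost P)
 bounded-cost skip = bounded-lit 1
 bounded-cost (act α) = bounded-lit 1
 bounded-cost (P ⨾ Q) = bounded-+ (bounded-cost P) (bounded-cost Q)
 bounded-cost (for e P) = bounded-+ (bounded-add e) (bounded-+ loop (bounded-clear e)) where
  body = bounded-body (bounded-Ex e) (bounded-cost P)
  c = fst body
  loop : Bounded (\ ρ -> loopCost (\ j -> cost P (j ∷ ρ)) 0 (⟦ e ⟧e ρ))
  loop = let b , h = bounded-Ex e in suc (b N.+ suc (1 N.+ c)) , \ M ρ ρ≤ -> (loopCost≤ _ 0 (⟦ e ⟧e ρ) ((2 N.+ M) N.^ c) \ i i< -> snd body M ρ ρ≤ i (N.<⇒≤ i<)) ▹ sum≤ M 0 (b N.+ suc (1 N.+ c)) (s≤s z≤n) (N.*-mono-≤ (h M ρ ρ≤)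
   (sum≤ M 1 c (N.m≤m+n 2 M ▹ N.≤-reflexive (sym (N.*-identityʳ (2 N.+ M)))) N.≤-refl) ▹ N.≤-reflexive (sym (N.^-distribˡ-+-* (2 N.+ M) b (suc (1 N.+ c)))))
 bounded-cost (letE e P) = bounded-+ (bounded-add e) (bounded-+ (bounded-let (bounded-Ex e) (bounded-cost P)) (bounded-clear e))
 bounded-cost (digits e) = bounded-+ (bounded-add e) (bounded-+
  (bounded-≤ {g = \ ρ -> 9 N.* suc (⟦ e ⟧e ρ)} (\ ρ -> subst (\ v -> digitsCost (Bin.fromℕ (⟦ e ⟧e ρ)) ≤ 9 N.* suc v) (Bin.toℕ-fromℕ (⟦ e ⟧e ρ)) (digitsCost≤ (Bin.fromℕ (⟦ e ⟧e ρ))))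
  (bounded-* (bounded-lit 9) (bounded-+ (bounded-lit 1) (bounded-Ex e))))
  (bounded-lit 1))

record Finite (L : Set) : Set where
 field
  size    : ℕ
  to      : L -> Fin (suc size)
  from    : Fin (suc size) -> L
  from-to : ∀ l -> from (to l) ≡ l

module Finiteness where

 open CounterPrograms

 finite-⊤ : Finite ⊤
 finite-⊤ = record { size = 0 ; to = \ _ -> 0F ; from = \ _ -> tt ; from-to = \ _ -> refl }

 finite-Fin : ∀ n -> Finite (Fin (suc n))
 finite-Fin n = record { size = n ; to = id ; from = id ; from-to = \ _ -> refl }

 finite-⊎ : ∀ {L M} -> Finite L -> Finite M -> Finite (L ⊎ M)
 finite-⊎ A B = record
  { size = A.size N.+ suc B.size
  ; to = \ { (inl l) -> A.to l Fin.↑ˡ suc B.size ; (inr m) -> suc A.size Fin.↑ʳ B.to m }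
  ; from = \ i -> Data.Sum.map A.from B.from (Fin.splitAt (suc A.size) i)
  ; from-to = \
  { (inl l) -> cong (Data.Sum.map A.from B.from) (Fin.splitAt-↑ˡ (suc A.size) (A.to l) (suc B.size)) ~> cong inl (A.from-to l)
  ; (inr m) -> cong (Data.Sum.map A.from B.from) (Fin.splitAt-↑ʳ (suc A.size) (suc B.size) (B.to m)) ~> cong inr (B.from-to m) }
  } where
  module A = Finite A
  module B = Finite B
  import Data.Sum
  import Data.Fin as Fin

 finite-× : ∀ {L M} -> Finite L -> Finite M -> Finite (L × M)
 finite-× A B = record
  { size = B.size N.+ A.size N.* suc B.size
  ; to = \ (l , m) -> Fin.combine (A.to l) (B.to m)
  ; from = \ i -> let j , k = Fin.remQuot {suc A.size} (suc B.size) i in A.from j , B.from k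
  ; from-to = \ (l , m) -> cong (\ (j , k) -> A.from j , B.from k) (Fin.remQuot-combine (A.to l) (B.to m)) ~> cong₂ _,_ (A.from-to l) (B.from-to m)
  } where
  module A = Finite A
  module B = Finite B
  import Data.Fin as Fin

 finite-Point : ∀ {A k} (C : Cmd A k) -> Finite (Point C)
 finite-Point skip = finite-⊤
 finite-Point (act _) = finite-⊤
 finite-Point (inc _) = finite-⊤
 finite-Point (C ⨾ D) = finite-⊎ (finite-Point C) (finite-Point D)
 finite-Point (while _ C) = finite-⊎ finite-⊤ (finite-Point C)
 finite-Point (ifz _ C D) = finite-⊎ finite-⊤ (finite-⊎ (finite-Point C) (finite-Point D))
 finite-Point (new C) = finite-Point C

 clamp : ∀ m -> ℕ -> Fin (suc m)
 clamp zero _ = 0F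
 clamp (suc m) zero = 0F
 clamp (suc m) (suc y) = fsuc (clamp m y)

 clamp-inj : ∀ m {x y} -> x ≤ m -> y ≤ m -> clamp m x ≡ clamp m y -> x ≡ y
 clamp-inj zero z≤n z≤n _ = refl
 clamp-inj (suc m) {zero} {zero} _ _ _ = refl
 clamp-inj (suc m) {suc x} {suc y} (s≤s p) (s≤s q) eq = cong suc (clamp-inj m p q (Fin.suc-injective eq))
 clamp-inj (suc m) {zero} {suc y} _ _ ()
 clamp-inj (suc m) {suc x} {zero} _ _ ()

 if-≡ᶠ : ∀ {n} {A : Set} {x y : A} {i j : Fin n} -> i ≡ j -> (if does (i ≟ᶠ j) then x else y) ≡ x
 if-≡ᶠ {x = x} {y} {i} {j} eq = cong (\ b -> if b then x else y) (dec-true (i ≟ᶠ j) eq)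

 if-≢ᶠ : ∀ {n} {A : Set} {x y : A} {i j : Fin n} -> i ≢ j -> (if does (i ≟ᶠ j) then x else y) ≡ y
 if-≢ᶠ {x = x} {y} {i} {j} neq = cong (\ b -> if b then x else y) (dec-false (i ≟ᶠ j) neq)

module MachineSteps (R : Ring) (M : BSS.Machine R) where

 open CommutativeRing R using (_≈_)
 open BSS R
 open Machine M
 open Semantics M
 open Config renaming (node to label)

 Next : Node #addresses #nodes -> Config -> Config -> Set
 Next (compute op t x y n) (config p a m) c = ∃[ z ] Result op (m (a x)) (m (a y)) z × c ≡ config n a (m [ a t ≔ z ])
 Next (constant z t n) (config p a m) c = c ≡ config n a (m [ a t ≔ z ])
 Next (guess t n) (config p a m) c = ∃[ z ] c ≡ config n a (m [ a t ≔ z ])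
 Next (test x y n n') (config p a m) c = (m (a x) ≈ m (a y) × c ≡ config n a m) ⊎ (¬ m (a x) ≈ m (a y) × c ≡ config n' a m)
 Next (move e t n) (config p a m) c = c ≡ config n (a [ t ≔ᵃ address e a ]) m
 Next (testAddress i j n n') (config p a m) c = (a i ≡ a j × c ≡ config n a m) ⊎ (¬ a i ≡ a j × c ≡ config n' a m)
 Next accept c c' = ⊥
 Next reject c c' = ⊥

 next⇒ : ∀ {c c'} -> c ⟶ c' -> Next (code (label c)) c c'
 next⇒ (compute eq r) rewrite eq = _ , r , refl
 next⇒ (constant eq) rewrite eq = refl
 next⇒ (guess z eq) rewrite eq = z , refl
 next⇒ (equal eq p) rewrite eq = inl (p , refl)
 next⇒ (unequal eq p) rewrite eq = inr (p , refl)
 next⇒ (move eq) rewrite eq = refl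
 next⇒ (equalAddress eq p) rewrite eq = inl (p , refl)
 next⇒ (unequalAddress eq p) rewrite eq = inr (p , refl)

 next⇐ : ∀ nd {c c'} -> code (label c) ≡ nd -> Next nd c c' -> c ⟶ c'
 next⇐ (compute op t x y n) eq (z , r , refl) = compute eq r
 next⇐ (constant z t n) eq refl = constant eq
 next⇐ (guess t n) eq (z , refl) = guess z eq
 next⇐ (test x y n n') eq (inl (p , refl)) = equal eq p
 next⇐ (test x y n n') eq (inr (p , refl)) = unequal eq p
 next⇐ (move e t n) eq refl = move eq
 next⇐ (testAddress i j n n') eq (inl (p , refl)) = equalAddress eq p
 next⇐ (testAddress i j n n') eq (inr (p , refl)) = unequalAddress eq p

 run-++ : ∀ {m n c d e} -> Run m c d -> Run n d e -> Run (m N.+ n) c e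
 run-++ done r = r
 run-++ (next s r) r' = next s (run-++ r r')

module BSSCompiler (R : Ring) where

 open CommutativeRing R hiding (zero; refl; sym) renaming (trans to infixr 5 _>>_)
 private module R = CommutativeRing R
 open BSS R
 open CounterPrograms
 open Finiteness
 open RingSolver R

 -- Operands are counters, or the output pointer for  nothing .
 Operand : ℕ -> Set
 Operand k = Maybe (Fin k)

 data Act (g : Bool) (Ok : Carrier -> Set) (k : ℕ) : Set where
  put      : ∀ z -> Ok z -> Act g Ok k
  bump     : Act g Ok k
  constant : ∀ z -> Ok z -> Operand k -> Act g Ok k
  compute  : Operation -> (t x y : Operand k) -> Act g Ok k
  guess    : g ≡ true -> Operand k -> Act g Ok k
  same     : (t x y : Operand k) -> Act g Ok k

 -- The output pointer and the memory.
 Store : Set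
 Store = ℕ × (ℕ -> Carrier)

 write : (ℕ -> Carrier) -> ℕ -> Carrier -> ℕ -> Carrier
 write m i z j = if does (j N.≟ i) then z else m j

 write-same : ∀ m i z -> write m i z i ≡ z
 write-same m i z = if-≡ {m = i} refl

 write-other : ∀ m i z {j} -> j ≢ i -> write m i z j ≡ m j
 write-other m i z = if-≢

 place : ∀ {k} -> Vec ℕ k -> ℕ -> Operand k -> ℕ
 place ρ o (just i) = lookup ρ i
 place ρ o nothing = o

 module _ {g : Bool} {Ok : Carrier -> Set} where
  ⟦_⟧ᵃ : ∀ {k} -> Act g Ok k -> Vec ℕ k -> Store -> Store -> Set
  ⟦ put z _ ⟧ᵃ ρ (o , m) t = t ≡ (suc o , write m o z)
  ⟦ bump ⟧ᵃ ρ (o , m) t = t ≡ (suc o , m)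
  ⟦ constant z _ x ⟧ᵃ ρ (o , m) t = t ≡ (o , write m (place ρ o x) z)
  ⟦ compute op x y y' ⟧ᵃ ρ (o , m) t = ∃[ z ] Result op (m (place ρ o y)) (m (place ρ o y')) z × t ≡ (o , write m (place ρ o x) z)
  ⟦ guess _ x ⟧ᵃ ρ (o , m) t = ∃[ z ] t ≡ (o , write m (place ρ o x) z)
  ⟦ same x y y' ⟧ᵃ ρ (o , m) t = (m (place ρ o y) ≈ m (place ρ o y') × t ≡ (o , write m (place ρ o x) 1#)) ⊎
   (¬ m (place ρ o y) ≈ m (place ρ o y') × t ≡ (o , write m (place ρ o x) 0#))

 open Execution

 module _ {g : Bool} {Ok : Carrier -> Set} where
  private
   record Grows (n o o' : ℕ) : Set where
    constructor grows
    field
     lower : o ≤ o'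
     upper : o' ≤ n N.+ o
   still : ∀ {o} -> Grows 1 o o
   still = grows N.≤-refl (N.n≤1+n _)
   act-grows : ∀ {k} (α : Act g Ok k) ρ {s t} -> ⟦ α ⟧ᵃ ρ s t -> Grows 1 (fst s) (fst t)
   act-grows (put z _) ρ refl = grows (N.n≤1+n _) N.≤-refl
   act-grows bump ρ refl = grows (N.n≤1+n _) N.≤-refl
   act-grows (constant z _ x) ρ refl = still
   act-grows (compute op x y y') ρ (_ , _ , refl) = still
   act-grows (guess _ x) ρ (_ , refl) = still
   act-grows (same x y y') ρ (inl (_ , refl)) = still
   act-grows (same x y y') ρ (inr (_ , refl)) = still
   grows-trans : ∀ {m n o o' o″} -> Grows m o o' -> Grows n o' o″ -> Grows (m N.+ n) o o″
   grows-trans {m} {n} {o} (grows p q) (grows p' q') = grows (p ▹ p') (q' ▹ N.+-monoʳ-≤ n q ▹ N.≤-reflexive (sym (N.+-assoc n m o) ~> cong (N._+ o) (N.+-comm n m)))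
   grows-suc : ∀ {n o o'} -> Grows n o o' -> Grows (suc n) o o'
   grows-suc (grows p q) = grows p (N.m≤n⇒m≤1+n q)
   grown : ∀ {k} {C : Cmd (Act g Ok) k} {ρ σ n E} -> _⊢_⇒[_,_]_ (Act g Ok) Store ⟦_⟧ᵃ C ρ n E σ -> ∀ {s t} -> E s t -> Grows n (fst s) (fst t)
   grown skip refl = still
   grown (act {α = α} {ρ}) e = act-grows α ρ e
   grown inc refl = still
   grown (seq C D) (_ , e , f) = grows-trans (grown C e) (grown D f)
   grown (while-zero _) refl = still
   grown (while-suc _ C D) (_ , e , f) = grows-suc (grows-trans (grown C e) (grown D f))
   grown (ifz-zero _ C) e = grows-suc (grown C e)
   grown (ifz-suc _ C) e = grows-suc (grown C e)
   grown (new C) e = grown C e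
   grown (conv E≃F C) e = grown C (bwd (_≃_.apply E≃F) e)
  output-grows : ∀ {k} {C : Cmd (Act g Ok) k} {ρ σ n E} -> _⊢_⇒[_,_]_ (Act g Ok) Store ⟦_⟧ᵃ C ρ n E σ -> ∀ {s t} -> E s t -> fst s ≤ fst t × fst t ≤ n N.+ fst s
  output-grows C e = let grows p q = grown C e in p , q

 module Compile {g : Bool} {Ok : Carrier -> Set} (C : Cmd (Act g Ok) 1)
  (admit0 : Ok 0#) (admit1 : Ok 1#) where
  Lab : Set
  Lab = ⊤ ⊎ ((Point C × Fin 3) ⊎ Fin 7)
  finite : Finite Lab
  finite = finite-⊎ finite-⊤ (finite-⊎ (finite-× (finite-Point C) (finite-Fin 2)) (finite-Fin 6))
  open Finite finite
  pattern start = inl tt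
  pattern at p i = inr (inl (p , i))
  pattern stage i = inr (inr i)
  q extra #registers : ℕ
  q = suc size
  extra = depth C
  #registers = suc (suc (suc (suc (suc extra))))
  -- Registers: the counter of level 0, a constant zero, the output pointer, the target of the
  -- final shift, and the other counters.
  reg : ℕ -> Fin #registers
  reg zero = 0F
  reg (suc y) = fsuc (fsuc (fsuc (fsuc (clamp extra y))))
  reg-injective : ∀ {x y} -> x ≤ extra -> y ≤ extra -> reg x ≡ reg y -> x ≡ y
  reg-injective {zero} {zero} _ _ _ = refl
  reg-injective {suc x} {suc y} p q eq = cong suc (clamp-inj extra (N.<⇒≤ p) (N.<⇒≤ q)
   (Fin.suc-injective (Fin.suc-injective (Fin.suc-injective (Fin.suc-injective eq)))))
  operand : ∀ {k} -> Operand k -> Fin #registers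
  operand (just i) = reg (level i)
  operand nothing = 2F
  pass : Lab -> Node #registers q
  pass l = move (copy 1F) 1F (to l)
  exit : Maybe (Point C) -> Lab
  exit (just p) = at p 0F
  exit nothing = stage 0F
  actNode : ∀ {k} -> Act g Ok k -> Point C -> Lab -> Fin 3 -> Node #registers q
  actNode (put z _) p x 0F = constant z 2F (to (at p 1F))
  actNode (put z _) p x 1F = move (incr 2F) 2F (to x)
  actNode bump p x 0F = move (incr 2F) 2F (to (at p 1F))
  actNode (constant z _ t) p x 0F = constant z (operand t) (to (at p 1F))
  actNode (compute op t y y') p x 0F = compute op (operand t) (operand y) (operand y') (to (at p 1F))
  actNode (guess _ t) p x 0F = guess (operand t) (to (at p 1F))
  actNode (same t y y') p x 0F = test (operand y) (operand y') (to (at p 1F)) (to (at p 2F))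
  actNode (same t y y') p x 1F = constant 1# (operand t) (to x)
  actNode (same t y y') p x 2F = constant 0# (operand t) (to x)
  actNode _ p x 1F = pass x
  actNode _ p x 2F = reject
  instrNode : Instr (Act g Ok) (Maybe (Point C)) -> Point C -> Fin 3 -> Node #registers q
  instrNode (nop x) p 0F = pass (at p 1F)
  instrNode (nop x) p 1F = pass (exit x)
  instrNode (nop x) p 2F = reject
  instrNode (act α x) p i = actNode α p (exit x) i
  instrNode (inc r x) p 0F = move (incr (reg r)) (reg r) (to (at p 1F))
  instrNode (inc r x) p 1F = pass (exit x)
  instrNode (inc r x) p 2F = reject
  instrNode (tst r z s) p 0F = testAddress (reg r) 1F (to (at p 1F)) (to (at p 2F))
  instrNode (tst r z s) p 1F = pass (exit z)
  instrNode (tst r z s) p 2F = move (decr (reg r)) (reg r) (to (exit s))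
  -- The output is produced behind the input and finally shifted to the front.
  node : Lab -> Node #registers q
  node start = move (copy 0F) 2F (to (at (entry C) 0F))
  node (at p i) = instrNode (code C just nothing p) p i
  node (stage 0F) = constant 0# 2F (to (stage 1F))
  node (stage 1F) = testAddress 0F 2F (to (stage 5F)) (to (stage 2F))
  node (stage 2F) = compute add 3F 0F 2F (to (stage 3F))
  node (stage 3F) = move (incr 3F) 3F (to (stage 4F))
  node (stage 4F) = move (incr 0F) 0F (to (stage 1F))
  node (stage 5F) = move (copy 3F) 0F (to (stage 6F))
  node (stage 6F) = accept
  machine : Machine
  machine = record { extraAddresses = suc (suc (suc (suc extra))) ; extraNodes = size ; code = node ∘ from }
  open Semantics machine
  open Config renaming (node to label)
  open Machine machine using () renaming (code to nodes)
  Fine : Node #registers q -> Set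
  Fine (constant z t n) = Ok z
  Fine (guess t n) = g ≡ true
  Fine _ = ⊤
  fine-act : ∀ {k} (α : Act g Ok k) p x i -> Fine (actNode α p x i)
  fine-act (put z h) p x 0F = h
  fine-act (put z h) p x 1F = tt
  fine-act (put z h) p x 2F = tt
  fine-act bump p x 0F = tt
  fine-act bump p x 1F = tt
  fine-act bump p x 2F = tt
  fine-act (constant z h t) p x 0F = h
  fine-act (constant z h t) p x 1F = tt
  fine-act (constant z h t) p x 2F = tt
  fine-act (compute op t y y') p x 0F = tt
  fine-act (compute op t y y') p x 1F = tt
  fine-act (compute op t y y') p x 2F = tt
  fine-act (guess h t) p x 0F = h
  fine-act (guess h t) p x 1F = tt
  fine-act (guess h t) p x 2F = tt
  fine-act (same t y y') p x 0F = tt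
  fine-act (same t y y') p x 1F = admit1
  fine-act (same t y y') p x 2F = admit0
  fine-instr : ∀ I p i -> Fine (instrNode I p i)
  fine-instr (nop x) p 0F = tt
  fine-instr (nop x) p 1F = tt
  fine-instr (nop x) p 2F = tt
  fine-instr (inc r x) p 0F = tt
  fine-instr (inc r x) p 1F = tt
  fine-instr (inc r x) p 2F = tt
  fine-instr (tst r z s) p 0F = tt
  fine-instr (tst r z s) p 1F = tt
  fine-instr (tst r z s) p 2F = tt
  fine-instr (act α x) p i = fine-act α p (exit x) i
  fine : ∀ l -> Fine (node l)
  fine start = tt
  fine (at p i) = fine-instr (code C just nothing p) p i
  fine (stage 0F) = admit0
  fine (stage 1F) = tt
  fine (stage 2F) = tt
  fine (stage 3F) = tt
  fine (stage 4F) = tt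
  fine (stage 5F) = tt
  fine (stage 6F) = tt
  deterministic : g ≡ false -> Deterministic
  deterministic refl p eq with subst Fine eq (fine (from p))
  ... | ()
  constants-admissible : ∀ p {z t n} -> nodes p ≡ constant z t n -> Ok z
  constants-admissible p eq = subst Fine eq (fine (from p))
  open MachineSteps R machine
  record Leads (c : Config) (n : ℕ) (G : Store -> Set) (T : Store -> Config -> Set) : Set where
   constructor leads
   field
    reach : ∀ {s} -> G s -> ∃[ c' ] T s c' × Run n c c'
    trace : ∀ {k e} -> Run k c e -> (k < n × ¬ Accepting e) ⊎
     ∃[ s ] ∃[ c' ] ∃[ k' ] G s × T s c' × Run k' c' e × k ≡ n N.+ k'
  open Leads
  leads-bind : ∀ {c m n} {G : Store -> Set} {H : Store -> Store -> Set} {T U : Store -> Config -> Set} -> Leads c m G T -> (∀ {s c} -> G s -> T s c -> Leads c n (H s) U) -> Leads c (m N.+ n) (\ u -> ∃[ s ] G s × H s u) U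
  leads-bind {c} {m} {n} {G} {H} {T} {U} L K = leads
   (\ (s , g , h) -> let c , t , r = reach L g ; d , u , r' = reach (K g t) h in d , u , run-++ r r') split where
   split : ∀ {k e} -> Run k c e -> (k < m N.+ n × ¬ Accepting e) ⊎
    ∃[ u ] ∃[ d ] ∃[ k' ] (∃[ s ] G s × H s u) × U u d × Run k' d e × k ≡ m N.+ n N.+ k'
   split r with trace L r
   ... | inl (k< , ¬acc) = inl (N.<-≤-trans k< (N.m≤m+n m n) , ¬acc)
   ... | inr (s , c' , k' , gs , t , r' , refl) with trace (K gs t) r'
   ...   | inl (k< , ¬acc) = inl (N.+-monoʳ-< m k< , ¬acc)
   ...   | inr (u , d , k″ , h , x , r″ , refl) = inr (u , d , k″ , (s , gs , h) , x , r″ , sym (N.+-assoc m n k″))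
  leads-convert : ∀ {c n} {G H : Store -> Set} {T U : Store -> Config -> Set} -> (∀ {s} -> G s ⇔ H s) -> (∀ {s c} -> T s c -> U s c) -> Leads c n G T -> Leads c n H U
  leads-convert G⇔H T⇒U L = leads
   (\ h -> let c , t , r = reach L (bwd G⇔H h) in c , T⇒U t , r)
   \ r -> Data.Sum.map₂ (\ (s , c , k , g , t , r , eq) -> s , c , k , fwd G⇔H g , T⇒U t , r , eq) (trace L r)
   where import Data.Sum
  node-to : ∀ l -> nodes (to l) ≡ node l
  node-to l = cong node (from-to l)
  single : ∀ l nd {a m G T} -> node l ≡ nd -> nd ≢ accept -> (∀ {s} -> G s -> ∃[ c ] T s c × Next nd (config (to l) a m) c) -> (∀ {c} -> Next nd (config (to l) a m) c -> ∃[ s ] G s × T s c) -> Leads (config (to l) a m) 1 G T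
  single l nd {a} {m} {G} {T} refl nd≢ f b = leads
   (\ g -> let c , t , n = f g in c , t , next (next⇐ (node l) (node-to l) n) done) back where
   back : ∀ {k e} -> Run k (config (to l) a m) e -> (k < 1 × ¬ Accepting e) ⊎ ∃[ s ] ∃[ c' ] ∃[ k' ] G s × T s c' × Run k' c' e × k ≡ 1 N.+ k'
   back done = inl (s≤s z≤n , \ acc -> nd≢ (sym (node-to l) ~> acc))
   back (next {c′ = c'} st r) = let s , g , t = b (subst (\ x -> Next x (config (to l) a m) c') (node-to l) (next⇒ st)) in
    inr (s , c' , _ , g , t , r , refl)
  record Matches (f : ℕ -> ℕ) (s : Store) (a : Fin #registers -> ℕ) (m : ℕ -> Carrier) : Set where
   constructor matches
   field
    counters : ∀ {y} -> y ≤ extra -> a (reg y) ≡ f y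
    null     : a 1F ≡ 0
    out      : a 2F ≡ fst s
    target   : a 3F ≡ 0
    cells    : ∀ i -> m i ≈ snd s i
  open Matches
  data AtLabel (l : Lab) (f : ℕ -> ℕ) (s : Store) : Config -> Set where
   here : ∀ {a m} -> Matches f s a m -> AtLabel l f s (config (to l) a m)
  result-cong : ∀ op {x x' y y' z} -> x ≈ x' -> y ≈ y' -> Result op x y z -> Result op x' y' z
  result-cong add p q r = r >> +-cong p q
  result-cong sub p q r = r >> +-cong p (-‿cong q)
  result-cong mul p q r = r >> *-cong p q
  result-cong div p q (y≉0 , r) = (\ y'≈0 -> y≉0 (q >> y'≈0)) , *-congˡ (R.sym q) >> r >> p
  private
   reg-other : ∀ y -> (reg y ≢ 1F) × (reg y ≢ 2F) × (reg y ≢ 3F)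
   reg-other zero = (\ ()) , (\ ()) , \ ()
   reg-other (suc y) = (\ ()) , (\ ()) , \ ()
   setNull : ∀ {f s a m} -> Matches f s a m -> Matches f s (a [ 1F ≔ᵃ a 1F ]) m
   setNull {a = a} M = matches (\ {y} p -> if-≢ᶠ (fst (reg-other y)) ~> counters M p) (null M) (out M) (target M) (cells M)
   setCounter : ∀ {f s a m r v v'} -> Matches f s a m -> r ≤ extra -> v ≡ v' -> Matches (\ y -> if does (y N.≟ r) then v' else f y) s (a [ reg r ≔ᵃ v ]) m
   setCounter {f} {s} {a} {m} {r} {v} {v'} M r≤ refl = matches (\ {y} -> look y) (other 1F (null M) (fst (reg-other r)))
    (other 2F (out M) (fst (snd (reg-other r)))) (other 3F (target M) (snd (snd (reg-other r)))) (cells M) where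
    other : ∀ i {u} -> a i ≡ u -> reg r ≢ i -> (a [ reg r ≔ᵃ v ]) i ≡ u
    other i eq r≢i = if-≢ᶠ (r≢i ∘ sym) ~> eq
    look : ∀ y -> y ≤ extra -> (a [ reg r ≔ᵃ v ]) (reg y) ≡ (if does (y N.≟ r) then v else f y)
    look y y≤ with y N.≟ r
    ... | yes refl = if-≡ᶠ {i = reg y} refl ~> sym (if-≡ {m = y} refl)
    ... | no y≢r = if-≢ᶠ (y≢r ∘ reg-injective y≤ r≤) ~> counters M y≤ ~> sym (if-≢ y≢r)
   setCell : ∀ {f o mem a m i z} -> Matches f (o , mem) a m -> ∀ j -> a j ≡ i -> Matches f (o , write mem i z) a (m [ a j ≔ z ])
   setCell {f} {o} {mem} {a} {m} {i} {z} M j refl = matches (counters M) (null M) (out M) (target M) look where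
    look : ∀ x -> (m [ a j ≔ z ]) x ≈ write mem (a j) z x
    look x with does (x N.≟ a j)
    ... | true = R.refl
    ... | false = cells M x
   bumpOut : ∀ {f o mem a m} -> Matches f (o , mem) a m -> Matches f (suc o , mem) (a [ 2F ≔ᵃ suc (a 2F) ]) m
   bumpOut M = matches (\ {y} p -> if-≢ᶠ (fst (snd (reg-other y))) ~> counters M p) (null M) (cong suc (out M)) (target M) (cells M)
  moves : ∀ l l' {e t f f' s s' c} -> node l ≡ move e t (to l') -> AtLabel l f s c -> (∀ {a m} -> Matches f s a m -> Matches f' s' (a [ t ≔ᵃ address e a ]) m) -> Leads c 1 (s' ≡_) (AtLabel l' f')
  moves l l' {e} {t} {s' = s'} eq (here {a} {m} M) h = single l (move e t (to l')) eq (\ ())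
   (\ { refl -> config (to l') (a [ t ≔ᵃ address e a ]) m , here (h M) , refl }) \ { refl -> s' , refl , here (h M) }
  passes : ∀ l l' {f s c} -> node l ≡ pass l' -> AtLabel l f s c -> Leads c 1 (s ≡_) (AtLabel l' f)
  passes l l' eq h = moves l l' eq h setNull
  constants : ∀ l l' {z j i f o mem c} -> node l ≡ constant z j (to l') -> AtLabel l f (o , mem) c -> (∀ {a m} -> Matches f (o , mem) a m -> a j ≡ i) -> Leads c 1 (_≡ (o , write mem i z)) (AtLabel l' f)
  constants l l' {z} {j} {i} {o = o} {mem} eq (here {a} {m} M) h = single l (constant z j (to l')) eq (\ ())
   (\ { {s} refl -> config (to l') a (m [ a j ≔ z ]) , here (setCell M j (h M)) , refl })
   \ { refl -> (o , write mem i z) , refl , here (setCell M j (h M)) }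
  private
   after : ∀ {c G} l l' {f} -> node l ≡ pass l' -> Leads c 1 G (AtLabel l f) -> Leads c 2 G (AtLabel l' f)
   after l l' eq L = leads-convert (mk⇔ (\ { (_ , g , refl) -> g }) (\ g -> _ , g , refl)) id (leads-bind L \ _ -> passes l l' eq)
   followed : ∀ {c s0 G H} {T U : Store -> Config -> Set} -> Leads c 1 G T -> (∀ {s} -> G s -> s ≡ s0) -> G s0 -> (∀ {c} -> T s0 c -> Leads c 1 H U) -> Leads c 2 H U
   followed {s0 = s0} {G} {H} {T} {U} L unique g K = leads-convert {G = \ u -> ∃[ s ] G s × H u} {U = U} (mk⇔ (\ (_ , _ , h) -> h) \ h -> s0 , g , h) id
    (leads-bind {H = \ _ -> H} L \ {_} {c} g' t -> K (subst (\ s -> T s c) (unique g') t))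
   operand-place : ∀ {k} (ρ : Vec ℕ k) {o mem a m} -> k ≤ suc extra -> Matches (levels ρ) (o , mem) a m -> ∀ x -> a (operand x) ≡ place ρ o x
   operand-place ρ k≤ M (just i) = counters M (N.≤-pred (level< i ▹ k≤)) ~> levels-lookup ρ i
   operand-place ρ k≤ M nothing = out M
   read : ∀ {k} (ρ : Vec ℕ k) {o mem a m} -> k ≤ suc extra -> Matches (levels ρ) (o , mem) a m -> ∀ x -> m (a (operand x)) ≈ mem (place ρ o x)
   read ρ {mem = mem} k≤ M x = cells M _ >> R.reflexive (cong mem (operand-place ρ k≤ M x))
  prog : Maybe (Point C) -> Maybe (Instr (Act g Ok) (Maybe (Point C)))
  prog nothing = nothing
  prog (just p) = just (code C just nothing p)
  At : Maybe (Point C) -> (ℕ -> ℕ) -> Store -> Config -> Set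
  At l = AtLabel (exit l)
  private
   instr : ∀ {p I} i -> just (code C just nothing p) ≡ just I -> node (at p i) ≡ instrNode I p i
   instr {p} i eq = cong (\ I -> instrNode I p i) (just-injective eq)
    where open import Data.Maybe.Properties using (just-injective)
  step-nop : ∀ {l x f s c} -> prog l ≡ just (nop x) -> At l f s c -> Leads c 2 (s ≡_) (At x f)
  step-nop {just p} {x} eq at' = after (at p 1F) (exit x) (instr 1F eq) (passes (at p 0F) (at p 1F) (instr 0F eq) at')
  step-inc : ∀ {l x r f s c} -> prog l ≡ just (inc r x) -> r < suc extra -> At l f s c -> Leads c 2 (s ≡_) (At x (\ y -> if does (y N.≟ r) then suc (f r) else f y))
  step-inc {just p} {x} eq (s≤s r≤) at' = after (at p 1F) (exit x) (instr 1F eq)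
   (moves (at p 0F) (at p 1F) (instr 0F eq) at' \ M -> setCounter M r≤ (cong suc (counters M r≤)))
  branch : ∀ p r v {f σ c} -> node (at p 0F) ≡ testAddress (reg r) 1F (to (at p 1F)) (to (at p 2F)) -> r ≤ extra -> f r ≡ v -> AtLabel (at p 0F) f σ c -> Leads c 1 (σ ≡_) (AtLabel (at p (if does (v N.≟ 0) then 1F else 2F)) f)
  branch p r zero {σ = σ} eq r≤ fr (here {a} {m} M) = single (at p 0F) _ eq (\ ())
   (\ { refl -> config (to (at p 1F)) a m , here M , inl (zeros , refl) })
   \ { (inl (_ , refl)) -> σ , refl , here M ; (inr (neq , _)) -> ⊥-elim (neq zeros) } where
   zeros : a (reg r) ≡ a 1F
   zeros = counters M r≤ ~> fr ~> sym (null M)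
  branch p r (suc v) {σ = σ} eq r≤ fr (here {a} {m} M) = single (at p 0F) _ eq (\ ())
   (\ { refl -> config (to (at p 2F)) a m , here M , inr (nonzero , refl) })
   \ { (inl (e , _)) -> ⊥-elim (nonzero e) ; (inr (_ , refl)) -> σ , refl , here M } where
   nonzero : ¬ a (reg r) ≡ a 1F
   nonzero e with trans (sym fr) (sym (counters M r≤) ~> e ~> null M)
   ... | ()
  step-zero : ∀ {l z p r f s c} -> prog l ≡ just (tst r z p) -> r < suc extra -> f r ≡ 0 -> At l f s c -> Leads c 2 (s ≡_) (At z f)
  step-zero {just p} {z} {s} {r} eq (s≤s r≤) fr at' = after (at p 1F) (exit z) (instr 1F eq) (branch p r 0 (instr 0F eq) r≤ fr at')
  step-suc : ∀ {l z p r v f s c} -> prog l ≡ just (tst r z p) -> r < suc extra -> f r ≡ suc v -> At l f s c -> Leads c 2 (s ≡_) (At p (\ y -> if does (y N.≟ r) then v else f y))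
  step-suc {just p} {z} {s} {r} {v} eq (s≤s r≤) fr at' = followed (branch p r (suc v) (instr 0F eq) r≤ fr at') sym refl \ at″ -> moves (at p 2F) (exit s) (instr 2F eq) at″ \ M -> setCounter M r≤ (cong pred (counters M r≤) ~> cong pred fr)
  step-act : ∀ {k l x s c} {α : Act g Ok k} {ρ} -> prog l ≡ just (act α x) -> k ≤ suc extra -> At l (levels ρ) s c -> Leads c 2 (⟦ α ⟧ᵃ ρ s) (At x (levels ρ))
  step-act {l = just p} {x} {o , mem} {α = put z h} eq k≤ at' = followed (constants (at p 0F) (at p 1F) (instr 0F eq) at' out) id refl
   \ at″ -> leads-convert (mk⇔ sym sym) id (moves (at p 1F) (exit x) (instr 1F eq) at″ bumpOut)
  step-act {l = just p} {x} {o , mem} {α = bump} eq k≤ at' = leads-convert (mk⇔ sym sym) id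
   (after (at p 1F) (exit x) (instr 1F eq) (moves (at p 0F) (at p 1F) (instr 0F eq) at' bumpOut))
  step-act {l = just p} {x} {o , mem} {α = constant z h t} {ρ} eq k≤ at' = after (at p 1F) (exit x) (instr 1F eq)
   (constants (at p 0F) (at p 1F) (instr 0F eq) at' \ M -> operand-place ρ k≤ M t)
  step-act {l = just p} {x} {o , mem} {α = compute op t y y'} {ρ} eq k≤ (here M) = after (at p 1F) (exit x) (instr 1F eq)
   (single (at p 0F) _ (instr 0F eq) (\ ())
   (\ { (z , r , refl) -> _ , here (setCell M (operand t) (operand-place ρ k≤ M t)) , z , result-cong op (R.sym (read ρ k≤ M y)) (R.sym (read ρ k≤ M y')) r , refl })
   \ { (z , r , refl) -> _ , (z , result-cong op (read ρ k≤ M y) (read ρ k≤ M y') r , refl) , here (setCell M (operand t) (operand-place ρ k≤ M t)) })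
  step-act {l = just p} {x} {o , mem} {α = guess h t} {ρ} eq k≤ (here M) = after (at p 1F) (exit x) (instr 1F eq)
   (single (at p 0F) _ (instr 0F eq) (\ ())
   (\ { (z , refl) -> _ , here (setCell M (operand t) (operand-place ρ k≤ M t)) , z , refl })
   \ { (z , refl) -> _ , (z , refl) , here (setCell M (operand t) (operand-place ρ k≤ M t)) })
  step-act {l = just p} {x} {o , mem} {α = same t y y'} {ρ} eq k≤ (here {a} {m} M) = leads forward backward where
   agree : m (a (operand y)) ≈ m (a (operand y')) ⇔ mem (place ρ o y) ≈ mem (place ρ o y')
   agree = mk⇔ (\ e -> R.sym (read ρ k≤ M y) >> e >> read ρ k≤ M y')
    (\ e -> read ρ k≤ M y >> e >> R.sym (read ρ k≤ M y'))
   n0 = node-to (at p 0F) ~> instr 0F eq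
   second : ∀ i z -> node (at p i) ≡ constant z (operand t) (to (exit x)) -> Leads (config (to (at p i)) a m) 1 (_≡ (o , write mem (place ρ o t) z)) (AtLabel (exit x) (levels ρ))
   second i z eq = constants (at p i) (exit x) eq (here M) \ M -> operand-place ρ k≤ M t
   forward : ∀ {u} -> ⟦_⟧ᵃ {g} {Ok} (same t y y') ρ (o , mem) u -> ∃[ c ] AtLabel (exit x) (levels ρ) u c × Run 2 (config (to (at p 0F)) a m) c
   forward (inl (e , eq')) = let c , t , r = reach (second 1F 1# (instr {I = act (same t y y') x} 1F eq)) eq' in c , t , next (equal n0 (bwd agree e)) r
   forward (inr (e , eq')) = let c , t , r = reach (second 2F 0# (instr 2F eq)) eq' in c , t , next (unequal n0 (e ∘ fwd agree)) r
   backward : ∀ {k e} -> Run k (config (to (at p 0F)) a m) e -> (k < 2 × ¬ Accepting e) ⊎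
    ∃[ s ] ∃[ c' ] ∃[ k' ] ⟦_⟧ᵃ {g} {Ok} (same t y y') ρ (o , mem) s × AtLabel (exit x) (levels ρ) s c' × Run k' c' e × k ≡ 2 N.+ k'
   backward done = inl (s≤s z≤n , \ acc -> contra (sym n0 ~> acc)) where
    contra : ∀ {w x y z} -> ¬ test w x y z ≡ accept
    contra ()
   backward (next {c′ = c'} st r) with subst (\ nd -> Next nd _ c') n0 (next⇒ st)
   backward (next st r) | inl (e , refl) with trace (second 1F 1# (instr 1F eq)) r
   ... | inl (k< , ¬acc) = inl (s≤s k< , ¬acc)
   ... | inr (s , c' , k' , eq' , t , r' , refl) = inr (s , c' , k' , inl (fwd agree e , eq') , t , r' , refl)
   backward (next st r) | inr (e , refl) with trace (second 2F 0# (instr 2F eq)) r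
   ... | inl (k< , ¬acc) = inl (s≤s k< , ¬acc)
   ... | inr (s , c' , k' , eq' , t , r' , refl) = inr (s , c' , k' , inr ((\ e' -> e (bwd agree e')) , eq') , t , r' , refl)
  interpreter : Interpreter (Act g Ok) Store ⟦_⟧ᵃ (Maybe (Point C)) Config
  interpreter = record
   { At = At
   ; At-cong = \ { f≗g (here M) -> here (matches (\ {y} p -> counters M p ~> f≗g y) (null M) (out M) (target M) (cells M)) }
   ; Leads = Leads ; bind = leads-bind ; convert = leads-convert ; program = prog ; stepCost = 2 ; maxDepth = suc extra
   ; step-nop = step-nop ; step-act = step-act ; step-inc = step-inc ; step-zero = step-zero ; step-suc = step-suc }
  private
   data On (l : Lab) (P : (Fin #registers -> ℕ) -> (ℕ -> Carrier) -> Set) : Config -> Set where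
    on : ∀ {a m} -> P a m -> On l P (config (to l) a m)
   steps : ∀ l nd {P Q l' c s} -> node l ≡ nd -> nd ≢ accept -> (∀ {a m} -> P a m -> ∃[ c ] Next nd (config (to l) a m) c) -> (∀ {a m} -> P a m -> ∀ {c} -> Next nd (config (to l) a m) c -> On l' Q c) -> On l P c -> Leads c 1 (s ≡_) (\ _ -> On l' Q)
   steps l nd {s = s} eq nd≢ f b (on p) = single l nd eq nd≢ (\ _ -> let c , n = f p in c , b p n , n) \ n -> s , refl , b p n
   chain : ∀ {c m n s} {T U : Store -> Config -> Set} -> Leads c m (s ≡_) T -> (∀ {c} -> T s c -> Leads c n (s ≡_) U) -> Leads c (m N.+ n) (s ≡_) U
   chain {s = s} {T} {U} L K = leads-convert {G = \ u -> ∃[ t ] s ≡ t × s ≡ u} {U = U} (mk⇔ (\ { (_ , refl , refl) -> refl }) \ { refl -> _ , refl , refl }) id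
    (leads-bind {T = T} {U} L \ { refl t -> K t })
   module Shift (n : ℕ) (s : Store) where
    o = fst s
    M = snd s
    record Shifted (k e d : ℕ) (a : Fin #registers -> ℕ) (m : ℕ -> Carrier) : Set where
     constructor shifted
     field
      source  : a 0F ≡ n N.+ k
      end     : a 2F ≡ o
      goal    : a 3F ≡ d
      moved   : ∀ i -> i < e -> m i ≈ M (n N.+ i)
      unmoved : ∀ i -> n N.+ e ≤ i -> i < o -> m i ≈ M i
      blank   : m o ≈ 0#
    record Final (a : Fin #registers -> ℕ) (m : ℕ -> Carrier) : Set where
     constructor final
     field
      size≡ : n N.+ a 0F ≡ o
      moved : ∀ i -> i < a 0F -> m i ≈ M (n N.+ i)
    shift : ∀ j k {c} -> n N.+ k N.+ j ≡ o -> On (stage 1F) (Shifted k k k) c -> Leads c (2 N.+ j N.* 4) (s ≡_) (\ _ -> On (stage 6F) Final)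
    shift zero k eq h = chain
     (steps (stage 1F) _ {Q = Shifted k k k} {stage 5F} refl (\ ())
     (\ S -> _ , inl (same' S , refl))
     (\ { S (inl (_ , refl)) -> on S ; S (inr (neq , _)) -> ⊥-elim (neq (same' S)) }) h)
     \ h -> steps (stage 5F) _ {Q = Final} {stage 6F} refl (\ ()) (\ _ -> _ , refl)
     (\ { {a} {m} (shifted source end goal moved unmoved blank) refl -> on (final
     (cong (n N.+_) goal ~> sym (N.+-identityʳ _) ~> eq)
     \ i i< -> moved i (subst (i <_) goal i<)) }) h where
     same' : ∀ {a m} -> Shifted k k k a m -> a 0F ≡ a 2F
     same' S = Shifted.source S ~> (sym (N.+-identityʳ _) ~> eq) ~> sym (Shifted.end S)
    shift (suc j) k eq h = chain (chain (chain (chain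
     (steps (stage 1F) _ {Q = Shifted k k k} {stage 2F} refl (\ ())
     (\ S -> _ , inr (differ S , refl))
     (\ { S (inl (e , _)) -> ⊥-elim (differ S e) ; S (inr (_ , refl)) -> on S }) h)
     (steps (stage 2F) _ {Q = Shifted k (suc k) k} {stage 3F} refl (\ ()) (\ {a} {m} _ -> _ , m (a 0F) + m (a 2F) , R.refl , refl)
     \ { {a} {m} S (z , r , refl) -> on (copied S z r) }))
     (steps (stage 3F) _ {Q = Shifted k (suc k) (suc k)} {stage 4F} refl (\ ()) (\ _ -> _ , refl)
     \ { (shifted source end goal moved unmoved blank) refl -> on (shifted source end (cong suc goal) moved unmoved blank) }))
     (steps (stage 4F) _ {Q = Shifted (suc k) (suc k) (suc k)} {stage 1F} refl (\ ()) (\ _ -> _ , refl)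
     \ { (shifted source end goal moved unmoved blank) refl -> on (shifted (cong suc source ~> sym (N.+-suc n k)) end goal moved unmoved blank) }))
     (shift j (suc k) (cong (N._+ j) (N.+-suc n k) ~> sym (N.+-suc (n N.+ k) j) ~> eq)) where
     n+k<o : n N.+ k < o
     n+k<o = subst (n N.+ k <_) eq (N.m<m+n (n N.+ k) (s≤s z≤n))
     differ : ∀ {a m} -> Shifted k k k a m -> ¬ a 0F ≡ a 2F
     differ S e = N.<-irrefl (sym (Shifted.source S) ~> e ~> Shifted.end S) n+k<o
     copied : ∀ {a m} -> Shifted k k k a m -> ∀ z -> z ≈ m (a 0F) + m (a 2F) -> Shifted k (suc k) k a (m [ a 3F ≔ z ])
     copied {a} {m} (shifted source end refl moved unmoved blank) z r = shifted source end refl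
      front rest (R.reflexive (if-≢ (\ e -> N.<-irrefl (sym e) (N.≤-<-trans (N.m≤n+m k n) n+k<o))) >> blank) where
      value : z ≈ M (n N.+ k)
      value = r >> +-cong (R.reflexive (cong m source) >> unmoved (n N.+ k) N.≤-refl n+k<o)
       (R.reflexive (cong m end) >> blank) >> +-identityʳ _
      front : ∀ i -> i < suc k -> (m [ k ≔ z ]) i ≈ M (n N.+ i)
      front i (s≤s i≤k) with i N.≟ k
      ... | yes refl = R.reflexive (if-≡ {m = i} refl) >> value
      ... | no i≢k = R.reflexive (if-≢ i≢k) >> moved i (N.≤∧≢⇒< i≤k i≢k)
      rest : ∀ i -> n N.+ suc k ≤ i -> i < o -> (m [ k ≔ z ]) i ≈ M i
      rest i ≤i i<o = R.reflexive (if-≢ (\ e -> N.<-irrefl (sym e) (N.m≤n+m (suc k) n ▹ ≤i))) >> unmoved i (N.+-monoʳ-≤ n (N.n≤1+n k) ▹ ≤i) i<o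
    finish : ∀ {c f} -> f 0 ≡ n -> ∀ j -> n N.+ j ≡ o -> AtLabel (stage 0F) f s c -> Leads c (3 N.+ j N.* 4) (s ≡_) (\ _ -> On (stage 6F) Final)
    finish f0 j eq (here {a} {m} Ms) = chain
     (steps (stage 0F) _ {Matches _ s} {Shifted 0 0 0} {stage 1F} refl (\ ()) (\ _ -> _ , refl)
     (\ { {a} {m} (matches counters null out target cells) refl -> on (shifted
     (counters z≤n ~> f0 ~> sym (N.+-identityʳ n)) out target (\ _ ())
     (\ i _ i<o -> R.reflexive (if-≢ \ e -> N.<-irrefl (e ~> out) i<o) >> cells i)
     (R.reflexive (if-≡ (sym out)))) }) (on Ms))
     (shift j 0 (cong (N._+ j) (N.+-identityʳ n) ~> eq))
  open Formula
  open FormulaSemantics R using (nth)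
  load≡nth : ∀ w i -> load w i ≡ nth w i
  load≡nth [] i = refl
  load≡nth (x ∷ w) zero = refl
  load≡nth (x ∷ w) (suc i) = load≡nth w i
  module Correct (N : ℕ -> ℕ) (E : ℕ -> Store -> Store -> Set)
   (derivation : ∀ n -> _⊢_⇒[_,_]_ (Act g Ok) Store ⟦_⟧ᵃ C (n ∷ []) (N n) (E n) (n ∷ [])) where
   initial : List Carrier -> Store
   initial w = length w , nth w
   private
    computation : ∀ w -> let n = length w in Leads (init w) (1 N.+ 2 N.* N n) (E n (initial w)) (AtLabel (stage 0F) (levels (n ∷ [])))
    computation w = leads-convert {G = \ u -> ∃[ s ] initial w ≡ s × E n (initial w) u} (mk⇔ (\ { (_ , refl , e) -> e }) \ e -> _ , refl , e) id
     (leads-bind {G = initial w ≡_} {H = \ _ -> E n (initial w)} {T = AtLabel (at (entry C) 0F) (levels (n ∷ []))} (single start _ refl (\ ())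
     (\ { refl -> _ , here M0 , refl }) \ { refl -> _ , refl , here M0 })
     \ { refl h -> Interpreter.execute interpreter (derivation n) (N.n≤1+n _) just nothing (\ _ -> refl) h }) where
     n = length w
     M0 : Matches (levels (n ∷ [])) (initial w) _ (load w)
     M0 = matches (\ { {zero} _ -> refl ; {suc y} _ -> refl }) refl refl refl (\ i -> R.reflexive (load≡nth w i))
    final-stage : ∀ w {s c} -> E (length w) (initial w) s -> AtLabel (stage 0F) (levels (length w ∷ [])) s c -> Leads c (3 N.+ (fst s N.∸ length w) N.* 4) (s ≡_) (\ _ -> On (stage 6F) (Shift.Final (length w) s))
    final-stage w {s} e h = Shift.finish (length w) s refl (fst s N.∸ length w)
     (N.m+[n∸m]≡n (fst (output-grows (derivation (length w)) e))) h
    halts : ∀ {P k c e} -> On (stage 6F) P c -> Run k c e -> k ≡ 0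
    halts (on _) done = refl
    halts (on {a} {m} _) (next {c′ = c'} st _) = ⊥-elim (subst (\ nd -> Next nd (config (to (stage 6F)) a m) c') (node-to (stage 6F)) (next⇒ st))
   -- The result of an outcome (o , m) is the word at the cells from the input length up to o.
   result : ∀ w {s} -> E (length w) (initial w) s -> ∃[ k ] ∃[ e ] Run k (init w) e × Accepting e ×
    (length w N.+ addresses e 0F ≡ fst s) × (∀ i -> i < addresses e 0F -> memory e i ≈ snd s (length w N.+ i))
   result w e with reach (computation w) e
   ... | c , t , r with reach (final-stage w e t) refl
   ... | d , on (Shift.final size≡ moved) , r' = _ , d , run-++ r r' , node-to (stage 6F) , size≡ , moved
   outcome : ∀ w -> Accepts w -> ∃[ s ] E (length w) (initial w) s
   outcome w (k , e , r , acc) with trace (computation w) r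
   ... | inl (_ , ¬acc) = ⊥-elim (¬acc acc)
   ... | inr (s , _ , _ , es , _) = s , es
   runs-within : ∀ {w k e} -> Run k (init w) e -> k ≤ 4 N.+ 6 N.* N (length w)
   runs-within {w} r with trace (computation w) r
   ... | inl (k< , _) = (N.<⇒≤ k<) ▹ N.+-mono-≤ {1} {4} (s≤s z≤n) (N.*-monoˡ-≤ (N (length w)) (N.m≤m+n 2 4))
   ... | inr (s , c , k' , es , t , r' , refl) = N.+-monoʳ-≤ (1 N.+ 2 N.* N n) tail≤ ▹ N.≤-reflexive (arrange (N n)) where
    n = length w
    emitted : fst s N.∸ n ≤ N n
    emitted = N.∸-monoˡ-≤ n (snd (output-grows (derivation n) es)) ▹ N.≤-reflexive (N.m+n∸n≡m (N n) n)
    stage≤ : 3 N.+ (fst s N.∸ n) N.* 4 ≤ 3 N.+ N n N.* 4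
    stage≤ = N.+-monoʳ-≤ 3 (N.*-monoˡ-≤ 4 emitted)
    tail≤ : k' ≤ 3 N.+ N n N.* 4
    tail≤ with trace (final-stage w es t) r'
    ... | inl (k< , _) = (N.<⇒≤ k<) ▹ stage≤
    ... | inr (_ , _ , k″ , _ , t' , r″ , refl) with halts t' r″
    ...   | refl = N.≤-reflexive (N.+-identityʳ _) ▹ stage≤
    arrange : ∀ x -> 1 N.+ 2 N.* x N.+ (3 N.+ x N.* 4) ≡ 4 N.+ 6 N.* x
    arrange = solve-∀

module TuringCompiler where

 open Turing hiding (PolynomialTime; _≤ᵖ_)
 open Tape
 open CounterPrograms
 open Finiteness
 open import Data.List using (reverse; replicate)
 open import Data.Vec using (_[_]≔_)

 data Act (k : ℕ) : Set where
  put             : Bool -> Act k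
  left right copy : Act k

 -- The input to the left and to the right of the reading head, and the reversed output.
 Store : Set
 Store = List Bool × List Bool × List Bool

 ⟦_⟧ᵃ : ∀ {k} -> Act k -> Vec ℕ k -> Store -> Store -> Set
 ⟦ put b ⟧ᵃ ρ (ls , rs , o) t = t ≡ (ls , rs , b ∷ o)
 ⟦ left ⟧ᵃ ρ s t = ∃[ b ] ∃[ ls ] ∃[ rs ] ∃[ o ] s ≡ (b ∷ ls , rs , o) × t ≡ (ls , b ∷ rs , o)
 ⟦ right ⟧ᵃ ρ s t = ∃[ b ] ∃[ ls ] ∃[ rs ] ∃[ o ] s ≡ (ls , b ∷ rs , o) × t ≡ (b ∷ ls , rs , o)
 ⟦ copy ⟧ᵃ ρ s t = ∃[ b ] ∃[ ls ] ∃[ rs ] ∃[ o ] s ≡ (ls , b ∷ rs , o) × t ≡ (ls , b ∷ rs , b ∷ o)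

 open Execution Act Store ⟦_⟧ᵃ

 written : Store -> ℕ
 written (_ , _ , o) = length o

 private
  compose≤ : ∀ m n {x y z} -> y ≤ m N.+ x -> z ≤ n N.+ y -> z ≤ (m N.+ n) N.+ x
  compose≤ m n {x} p q = q ▹ N.+-monoʳ-≤ n p ▹ N.≤-reflexive (sym (N.+-assoc n m x) ~> cong (N._+ x) (N.+-comm n m))

 written≤ : ∀ {k} {C : Cmd Act k} {ρ σ n E} -> C ⊢ ρ ⇒[ n , E ] σ -> ∀ {s t} -> E s t -> written t ≤ n N.+ written s
 written≤ skip refl = N.n≤1+n _
 written≤ (act {α = put b}) refl = N.≤-refl
 written≤ (act {α = left}) (_ , _ , _ , _ , refl , refl) = N.n≤1+n _
 written≤ (act {α = right}) (_ , _ , _ , _ , refl , refl) = N.n≤1+n _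
 written≤ (act {α = copy}) (_ , _ , _ , _ , refl , refl) = N.≤-refl
 written≤ inc refl = N.n≤1+n _
 written≤ (seq {m = m} {n} C D) (_ , e , f) = compose≤ m n (written≤ C e) (written≤ D f)
 written≤ (while-zero _) refl = N.n≤1+n _
 written≤ (while-suc {m = m} {n} _ C D) (_ , e , f) = N.m≤n⇒m≤1+n (compose≤ m n (written≤ C e) (written≤ D f))
 written≤ (ifz-zero _ C) e = N.m≤n⇒m≤1+n (written≤ C e)
 written≤ (ifz-suc _ C) e = N.m≤n⇒m≤1+n (written≤ C e)
 written≤ (new C) e = written≤ C e
 written≤ (conv E≃F C) e = written≤ C (bwd (_≃_.apply E≃F) e)

 Sym : Set
 Sym = Symbol 0

 data Blanks : List Sym -> Set where
  []  : Blanks []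
  _∷_ : ∀ {x xs} -> x ≡ blank -> Blanks xs -> Blanks (x ∷ xs)

 -- Up to blanks, the tape holds ls (reversed) before and rs from the head on; a counter of value n
 -- is a tape with n marks before the head.
 data Holding (ls : List Bool) : List Bool -> Tape 0 -> Set where
  empty : ∀ {l bl bs} -> l ≡ map bit ls ++ bl -> Blanks bl -> Blanks bs -> Holding ls [] (tape l blank bs)
  found : ∀ {l bl bs b rs as} -> l ≡ map bit ls ++ bl -> Blanks bl -> Blanks bs -> as ≡ map bit rs ++ bs -> Holding ls (b ∷ rs) (tape l (bit b) as)

 data Off (rs : List Bool) : Tape 0 -> Set where
  off : ∀ {bl x bs as} -> Blanks bl -> Blanks bs -> x ∷ as ≡ map bit rs ++ bs -> Off rs (tape bl blank (x ∷ as))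

 private
  arrive : ∀ {ls rs l bl bs as x} z -> x ∷ l ≡ map bit ls ++ bl -> Blanks bl -> Blanks bs -> as ≡ map bit rs ++ bs -> Holding ls rs (write (x , right) (tape l z as))
  arrive {rs = []} {as = []} z eq bl bs refl = empty eq bl []
  arrive {rs = []} {as = x ∷ as} z eq bl (refl ∷ bs) refl = empty eq bl bs
  arrive {rs = r ∷ rs} z eq bl bs refl = found eq bl bs refl

 push : ∀ {ls rs t} b -> Holding ls (b ∷ rs) t -> Holding (b ∷ ls) rs (write (bit b , right) t)
 push b (found refl bl bs eq) = arrive _ refl bl bs eq

 append : ∀ {ls t} b -> Holding ls [] t -> Holding (b ∷ ls) [] (write (bit b , right) t)
 append b (empty refl bl bs) = arrive _ refl bl bs refl

 erase : ∀ {b rs t} -> Holding [] (b ∷ rs) t -> Holding [] rs (write (blank , right) t)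
 erase (found refl bl bs eq) = arrive {ls = []} _ refl (refl ∷ bl) bs eq

 pull : ∀ {b ls rs t} -> Holding (b ∷ ls) rs t -> Holding ls (b ∷ rs) (write (scanned t , left) t)
 pull (empty refl bl bs) = found refl bl (refl ∷ bs) refl
 pull (found refl bl bs refl) = found refl bl bs refl

 leave : ∀ {rs t} -> Holding [] rs t -> Off rs (write (scanned t , left) t)
 leave (empty refl [] bs) = off [] (refl ∷ bs) refl
 leave (empty refl (refl ∷ bl) bs) = off bl (refl ∷ bs) refl
 leave (found refl [] bs refl) = off [] bs refl
 leave (found refl (refl ∷ bl) bs refl) = off bl bs refl

 return : ∀ {rs t} -> Off rs t -> Holding [] rs (write (blank , right) t)
 return (off bl bs eq) = arrive {ls = []} blank refl (refl ∷ bl) bs eq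

 dropMark : ∀ {b ls t} -> Holding (b ∷ ls) [] t -> Holding ls [] (write (blank , stay) (write (blank , left) t))
 dropMark (empty refl bl bs) = empty refl bl (refl ∷ bs)

 holding-blank : ∀ {ls t} -> Holding ls [] t -> scanned t ≡ blank
 holding-blank (empty _ _ _) = refl

 holding-bit : ∀ {ls b rs t} -> Holding ls (b ∷ rs) t -> scanned t ≡ bit b
 holding-bit (found _ _ _ _) = refl

 off-blank : ∀ {rs t} -> Off rs t -> scanned t ≡ blank
 off-blank (off _ _ _) = refl

 Marks : ℕ -> Tape 0 -> Set
 Marks n = Holding (replicate n true) []

 -- The state of a tape that is being rewound, after a move to the left.
 Rewinding : List Bool -> List Bool -> Tape 0 -> Set
 Rewinding [] rs = Off rs
 Rewinding (b ∷ ls) rs = Holding ls (b ∷ rs)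

 rewinding : ∀ {ls rs t} -> Holding ls rs t -> Rewinding ls rs (write (scanned t , left) t)
 rewinding {[]} h = leave h
 rewinding {b ∷ ls} h = pull h

 module Compile (C : Cmd Act 1) where
  limit : ℕ
  limit = depth C
  Lab : Set
  Lab = ⊤ ⊎ ((Point C × Fin 2) ⊎ Fin 4)
  open Finite (finite-⊎ finite-⊤ (finite-⊎ (finite-× (finite-Point C) (finite-Fin 1)) (finite-Fin 3)))
  pattern start = inl tt
  pattern at p i = inr (inl (p , i))
  pattern stage i = inr (inr i)
  exit : Maybe (Point C) -> Lab
  exit (just p) = at p 0F
  exit nothing = stage 1F
  Write : Set
  Write = Sym × Move
  #counters : ℕ
  #counters = suc limit
  stays : ∀ {n} -> Vec Sym n -> Vec Write n
  stays = Vec.map (\ x -> x , stay)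
  reg : ℕ -> Fin #counters
  reg = clamp limit
  Action : Set
  Action = Lab × Write × Write × Vec Write #counters
  idle : Lab -> Sym -> Sym -> Vec Sym #counters -> Action
  idle l x y zs = l , (x , stay) , (y , stay) , stays zs
  counting : Lab -> ℕ -> Write -> Sym -> Sym -> Vec Sym #counters -> Action
  counting l r a x y zs = l , (x , stay) , (y , stay) , stays zs [ reg r ]≔ a
  perform : ∀ {k} -> Act k -> Lab -> Sym -> Sym -> Vec Sym #counters -> Action
  perform (put b) l x y zs = l , (bit b , right) , (y , stay) , stays zs
  perform left l x y zs = l , (x , stay) , (y , left) , stays zs
  perform right l x y zs = l , (x , stay) , (y , right) , stays zs
  perform copy l x y zs = l , (y , right) , (y , stay) , stays zs
  instr : Instr Act (Maybe (Point C)) -> Point C -> Fin 2 -> Sym -> Sym -> Vec Sym #counters -> Action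
  instr (act α l) p 0F x y zs = perform α (at p 1F) x y zs
  instr (inc r l) p 0F x y zs = counting (at p 1F) r (bit true , right) x y zs
  instr (tst r z s) p 0F x y zs = counting (at p 1F) r (blank , left) x y zs
  instr (tst r z s) p 1F x y zs with lookup zs (reg r)
  ... | bit _ = counting (exit s) r (blank , stay) x y zs
  ... | _     = counting (exit z) r (blank , right) x y zs
  instr (nop l) p 0F x y zs = idle (at p 1F) x y zs
  instr (nop l) p 1F x y zs = idle (exit l) x y zs
  instr (act α l) p 1F x y zs = idle (exit l) x y zs
  instr (inc r l) p 1F x y zs = idle (exit l) x y zs
  -- The input is moved to the second tape and counted; in the end the output is rewound.
  delta : Lab -> Sym -> Sym -> Vec Sym #counters -> Maybe Action
  delta start (bit b) y zs = just (start , (blank , right) , (bit b , right) , stays zs [ reg 0 ]≔ (bit true , right))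
  delta start x y zs = just (stage 0F , (x , stay) , (y , left) , stays zs)
  delta (stage 0F) x (bit b) zs = just (stage 0F , (x , stay) , (bit b , left) , stays zs)
  delta (stage 0F) x y zs = just (at (entry C) 0F , (x , stay) , (blank , right) , stays zs)
  delta (at p i) x y zs = just (instr (code C just nothing p) p i x y zs)
  delta (stage 1F) x y zs = just (stage 2F , (x , left) , (y , stay) , stays zs)
  delta (stage 2F) (bit b) y zs = just (stage 2F , (bit b , left) , (y , stay) , stays zs)
  delta (stage 2F) x y zs = just (stage 3F , (blank , right) , (y , stay) , stays zs)
  delta (stage 3F) x y zs = nothing
  encode : Action -> Fin (suc size) × Vec Write (suc (suc #counters))
  encode (l , a , b , cs) = to l , a ∷ b ∷ cs
  machine : Machine
  machine = record
   { workTapes = suc #counters ; extraStates = size ; extraSymbols = 0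
   ; transition = \ { q (x ∷ y ∷ zs) -> Data.Maybe.map encode (delta (from q) x y zs) } }
   where import Data.Maybe
  open Machine machine hiding (State; Sym)
  step-delta : ∀ l t1 t2 ts {l' a b cs} -> delta l (scanned t1) (scanned t2) (Vec.map scanned ts) ≡ just (l' , a , b , cs) -> step (to l , t1 ∷ t2 ∷ ts) ≡ just (to l' , write a t1 ∷ write b t2 ∷ Vec.zipWith write cs ts)
  step-delta l t1 t2 ts eq rewrite from-to l | eq = refl
  data Steps : ℕ -> Config -> Config -> Set where
   done : ∀ {c} -> Steps 0 c c
   next : ∀ {k c c' e} -> step c ≡ just c' -> Steps k c' e -> Steps (suc k) c e
  steps-++ : ∀ {m n c d e} -> Steps m c d -> Steps n d e -> Steps (m N.+ n) c e
  steps-++ done s = s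
  steps-++ (next eq r) s = next eq (steps-++ r s)
  steps-halt : ∀ {k c e} -> Steps k c e -> step e ≡ nothing -> HaltsAfter k c e
  steps-halt done eq = halted eq
  steps-halt (next st r) eq = next st (steps-halt r eq)
  stays-id : ∀ {n} (ts : Vec (Tape 0) n) -> Vec.zipWith write (stays (Vec.map scanned ts)) ts ≡ ts
  stays-id [] = refl
  stays-id (t ∷ ts) = cong (t ∷_) (stays-id ts)
  stays-update : ∀ {n} (ts : Vec (Tape 0) n) i a -> Vec.zipWith write (stays (Vec.map scanned ts) [ i ]≔ a) ts ≡ ts [ i ]≔ write a (lookup ts i)
  stays-update (t ∷ ts) 0F a = cong (write a t ∷_) (stays-id ts)
  stays-update (t ∷ ts) (fsuc i) a = cong (t ∷_) (stays-update ts i a)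
  Counters : (ℕ -> ℕ) -> Vec (Tape 0) #counters -> Set
  Counters f ts = ∀ {y} -> y ≤ limit -> Marks (f y) (lookup ts (reg y))
  data AtLabel (l : Lab) (f : ℕ -> ℕ) : Store -> Config -> Set where
   here : ∀ {ls rs o t1 t2 ts} -> Holding o [] t1 -> Holding ls rs t2 -> Counters f ts -> AtLabel l f (ls , rs , o) (to l , t1 ∷ t2 ∷ ts)
  record Leads (c : Config) (n : ℕ) (G : Store -> Set) (T : Store -> Config -> Set) : Set where
   constructor leads
   field reach : ∀ {s} -> G s -> ∃[ c' ] T s c' × Steps n c c'
  open Leads
  update-counter : ∀ {f r v t ts} -> Counters f ts -> r ≤ limit -> Marks v t -> Counters (\ y -> if does (y N.≟ r) then v else f y) (ts [ reg r ]≔ t)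
  update-counter {f} {r} {v} {t} {ts} cs r≤ m {y} y≤ with y N.≟ r
  ... | yes refl = subst₂ Marks (sym (if-≡ {m = y} refl)) (sym (Vec.lookup∘update (reg y) ts t)) m
  ... | no y≢r = subst₂ Marks (sym (if-≢ y≢r)) (sym (Vec.lookup∘update′ (y≢r ∘ clamp-inj limit y≤ r≤) ts t)) (cs y≤)
  one : ∀ l t1 t2 ts {l' a b t1' t2'} -> delta l (scanned t1) (scanned t2) (Vec.map scanned ts) ≡ just (l' , a , b , stays (Vec.map scanned ts)) -> write a t1 ≡ t1' -> write b t2 ≡ t2' -> Steps 1 (to l , t1 ∷ t2 ∷ ts) (to l' , t1' ∷ t2' ∷ ts)
  one l t1 t2 ts {l'} {a} {b} eq refl refl = next (step-delta l t1 t2 ts eq ~> cong (\ ts -> just (to l' , write a t1 ∷ write b t2 ∷ ts)) (stays-id ts)) done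
  one-counter : ∀ l t1 t2 ts {l' a b r c} -> delta l (scanned t1) (scanned t2) (Vec.map scanned ts) ≡ just (l' , a , b , stays (Vec.map scanned ts) [ r ]≔ c) -> Steps 1 (to l , t1 ∷ t2 ∷ ts) (to l' , write a t1 ∷ write b t2 ∷ (ts [ r ]≔ write c (lookup ts r)))
  one-counter l t1 t2 ts {l'} {a} {b} {r} {c} eq = next (step-delta l t1 t2 ts eq ~> cong (\ ts -> just (to l' , write a t1 ∷ write b t2 ∷ ts)) (stays-update ts r c)) done
  count-step : ∀ l t1 t2 ts {l' r c} -> delta l (scanned t1) (scanned t2) (Vec.map scanned ts) ≡ just (counting l' r c (scanned t1) (scanned t2) (Vec.map scanned ts)) -> Steps 1 (to l , t1 ∷ t2 ∷ ts) (to l' , t1 ∷ t2 ∷ (ts [ reg r ]≔ write c (lookup ts (reg r))))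
  count-step l t1 t2 ts eq = one-counter l t1 t2 ts {a = scanned t1 , stay} {scanned t2 , stay} eq
  prog : Maybe (Point C) -> Maybe (Instr Act (Maybe (Point C)))
  prog nothing = nothing
  prog (just p) = just (code C just nothing p)
  At : Maybe (Point C) -> (ℕ -> ℕ) -> Store -> Config -> Set
  At l = AtLabel (exit l)
  private
   instr≡ : ∀ {p I} i -> just (code C just nothing p) ≡ just I -> ∀ {x y zs} -> delta (at p i) x y zs ≡ just (instr I p i x y zs)
   instr≡ {p} i eq {x} {y} {zs} = cong (\ I -> just (instr I p i x y zs)) (just-injective eq)
    where open import Data.Maybe.Properties using (just-injective)
  step-nop : ∀ {l x f s c} -> prog l ≡ just (nop x) -> At l f s c -> Leads c 2 (s ≡_) (At x f)
  step-nop {just p} eq (here {t1 = t1} {t2} {ts} h1 h2 cs) = leads \ { refl -> _ , here h1 h2 cs , steps-++ (one (at p 0F) t1 t2 ts (instr≡ 0F eq) refl refl) (one (at p 1F) t1 t2 ts (instr≡ 1F eq) refl refl) }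
  step-inc : ∀ {l x r f s c} -> prog l ≡ just (inc r x) -> r < #counters -> At l f s c -> Leads c 2 (s ≡_) (At x (\ y -> if does (y N.≟ r) then suc (f r) else f y))
  step-inc {just p} {r = r} eq (s≤s r≤) (here {t1 = t1} {t2} {ts} h1 h2 cs) = leads \ { refl -> _ , here h1 h2 (update-counter {ts = ts} cs r≤ (append true (cs r≤))) , steps-++ (count-step (at p 0F) t1 t2 ts (instr≡ 0F eq)) (one (at p 1F) t1 t2 _ (instr≡ 1F eq) refl refl) }
  private
   second : ∀ {p r z s} -> prog (just p) ≡ just (tst r z s) -> ∀ t1 t2 ts (t : Tape 0) -> let ts' = ts [ reg r ]≔ t in
    (scanned t ≡ blank -> Steps 1 (to (at p 1F) , t1 ∷ t2 ∷ ts') (to (exit z) , t1 ∷ t2 ∷ (ts [ reg r ]≔ write (blank , right) t))) ×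
    (scanned t ≡ bit true -> Steps 1 (to (at p 1F) , t1 ∷ t2 ∷ ts') (to (exit s) , t1 ∷ t2 ∷ (ts [ reg r ]≔ write (blank , stay) t)))
   second {p} {r} {z} {s} eq t1 t2 ts t = (\ b -> subst (\ u -> Steps 1 (to (at p 1F) , t1 ∷ t2 ∷ ts') (to (exit z) , t1 ∷ t2 ∷ u)) (again (blank , right))
    (count-step (at p 1F) t1 t2 ts' (instr≡ 1F eq ~> cong just (zero-case (look ~> b))))) , (\ b -> subst (\ u -> Steps 1 (to (at p 1F) , t1 ∷ t2 ∷ ts') (to (exit s) , t1 ∷ t2 ∷ u)) (again (blank , stay))
    (count-step (at p 1F) t1 t2 ts' (instr≡ 1F eq ~> cong just (suc-case (look ~> b))))) where
    ts' = ts [ reg r ]≔ t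
    again : ∀ a -> ts' [ reg r ]≔ write a (lookup ts' (reg r)) ≡ ts [ reg r ]≔ write a t
    again a = cong (\ u -> ts' [ reg r ]≔ write a u) (Vec.lookup∘update (reg r) ts t) ~> Vec.[]≔-idempotent ts (reg r)
    look : lookup (Vec.map scanned ts') (reg r) ≡ scanned t
    look = Vec.lookup-map (reg r) scanned ts' ~> cong scanned (Vec.lookup∘update (reg r) ts t)
    zero-case : ∀ {x y zs} -> lookup zs (reg r) ≡ blank -> instr (tst r z s) p 1F x y zs ≡ counting (exit z) r (blank , right) x y zs
    zero-case eq rewrite eq = refl
    suc-case : ∀ {x y zs} -> lookup zs (reg r) ≡ bit true -> instr (tst r z s) p 1F x y zs ≡ counting (exit s) r (blank , stay) x y zs
    suc-case eq rewrite eq = refl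
  step-zero : ∀ {l z p r f s c} -> prog l ≡ just (tst r z p) -> r < #counters -> f r ≡ 0 -> At l f s c -> Leads c 2 (s ≡_) (At z f)
  step-zero {just p} {r = r} {f} eq (s≤s r≤) f≡ (here {t1 = t1} {t2} {ts} h1 h2 cs) = leads \ { refl -> _ , here h1 h2 (\ {y} y≤ -> subst (\ v -> Marks v _) (unchanged y) (update-counter {ts = ts} cs r≤ (return off') y≤)) ,
   steps-++ (count-step (at p 0F) t1 t2 ts (instr≡ 0F eq)) (fst (second {p} {r} eq t1 t2 ts _) (off-blank off')) } where
   off' : Off [] (write (blank , left) (lookup ts (reg r)))
   off' = let m = subst (\ v -> Marks v (lookup ts (reg r))) f≡ (cs r≤) in
    subst (\ x -> Off [] (write (x , left) (lookup ts (reg r)))) (holding-blank m) (leave m)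
   unchanged : ∀ y -> (if does (y N.≟ r) then 0 else f y) ≡ f y
   unchanged y with y N.≟ r
   ... | yes refl = if-≡ {m = y} refl ~> sym f≡
   ... | no y≢r = if-≢ y≢r
  step-suc : ∀ {l z p r v f s c} -> prog l ≡ just (tst r z p) -> r < #counters -> f r ≡ suc v -> At l f s c -> Leads c 2 (s ≡_) (At p (\ y -> if does (y N.≟ r) then v else f y))
  step-suc {just p} {r = r} {v} eq (s≤s r≤) f≡ (here {t1 = t1} {t2} {ts} h1 h2 cs) = leads \ { refl -> _ , here h1 h2 (update-counter {ts = ts} cs r≤ (dropMark m)) ,
   steps-++ (count-step (at p 0F) t1 t2 ts (instr≡ 0F eq)) (snd (second {p} {r} eq t1 t2 ts _) (holding-bit pulled)) } where
   m : Marks (suc v) (lookup ts (reg r))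
   m = subst (\ v -> Marks v (lookup ts (reg r))) f≡ (cs r≤)
   pulled : Holding (replicate v true) (true ∷ []) (write (blank , left) (lookup ts (reg r)))
   pulled = subst (\ x -> Holding _ _ (write (x , left) (lookup ts (reg r)))) (holding-blank m) (pull m)
  step-act : ∀ {k l x s c} {α : Act k} {ρ} -> prog l ≡ just (act α x) -> k ≤ #counters -> At l (levels ρ) s c -> Leads c 2 (⟦ α ⟧ᵃ ρ s) (At x (levels ρ))
  step-act {l = just p} {α = put b} eq k≤ (here {t1 = t1} {t2} {ts} h1 h2 cs) = leads \ { refl -> _ , here (append b h1) h2 cs , steps-++ (one (at p 0F) t1 t2 ts (instr≡ 0F eq) refl refl) (one (at p 1F) _ t2 ts (instr≡ 1F eq) refl refl) }
  step-act {l = just p} {α = left} eq k≤ (here {t1 = t1} {t2} {ts} h1 h2 cs) = leads \ { (_ , _ , _ , _ , refl , refl) -> _ , here h1 (pull h2) cs , steps-++ (one (at p 0F) t1 t2 ts (instr≡ 0F eq) refl refl) (one (at p 1F) t1 _ ts (instr≡ 1F eq) refl refl) }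
  step-act {l = just p} {α = right} eq k≤ (here {t1 = t1} {t2} {ts} h1 h2 cs) = leads \ { (b , _ , _ , _ , refl , refl) -> _ , here h1 (push b h2) cs ,
   steps-++ (one (at p 0F) t1 t2 ts (instr≡ 0F eq) refl (cong (\ x -> write (x , right) t2) (holding-bit h2))) (one (at p 1F) t1 _ ts (instr≡ 1F eq) refl refl) }
  step-act {l = just p} {α = copy} eq k≤ (here {t1 = t1} {t2} {ts} h1 h2 cs) = leads \ { (b , _ , _ , _ , refl , refl) -> _ , here (append b h1) h2 cs ,
   steps-++ (one (at p 0F) t1 t2 ts (instr≡ 0F eq) (cong (\ x -> write (x , right) t1) (holding-bit h2)) refl) (one (at p 1F) _ t2 ts (instr≡ 1F eq) refl refl) }
  interpreter : Interpreter (Maybe (Point C)) Config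
  interpreter = record
   { At = At
   ; At-cong = \ { f≗g (here h1 h2 cs) -> here h1 h2 \ {y} y≤ -> subst (\ v -> Marks v _) (f≗g y) (cs y≤) }
   ; Leads = Leads
   ; bind = \ L K -> leads \ (s , g , h) -> let c , t , r = reach L g ; d , u , r' = reach (K g t) h in d , u , steps-++ r r'
   ; convert = \ G⇔H T⇒U L -> leads \ h -> let c , t , r = reach L (bwd G⇔H h) in c , T⇒U t , r
   ; program = prog ; stepCost = 2 ; maxDepth = #counters
   ; step-nop = step-nop ; step-act = \ {_} {l} {x} {s} {c} {α} {ρ} -> step-act {l = l} {x} {s} {c} {α} {ρ} ; step-inc = step-inc ; step-zero = step-zero ; step-suc = step-suc }
  private
   rewind-input : ∀ ls {rs t1 t2 ts} -> Holding [] [] t1 -> Rewinding ls rs t2 -> ∃[ t ] Holding [] (reverse ls ++ rs) t ×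
    Steps (suc (length ls)) (to (stage 0F) , t1 ∷ t2 ∷ ts) (to (at (entry C) 0F) , t1 ∷ t ∷ ts)
   rewind-input [] {t1 = t1} {t2} {ts} h1 h = _ , return h , one (stage 0F) t1 t2 ts (blank-case (off-blank h)) refl refl where
    blank-case : ∀ {x y zs} -> y ≡ blank -> delta (stage 0F) x y zs ≡ just (at (entry C) 0F , (x , stay) , (blank , right) , stays zs)
    blank-case refl = refl
   rewind-input (b ∷ ls) {rs} {t1} {t2} {ts} h1 h = let t , h' , r = rewind-input ls h1 (subst (\ x -> Rewinding ls (b ∷ rs) (write (x , left) t2)) (holding-bit h) (rewinding h)) in
    t , subst (\ u -> Holding [] u t) (sym (List.++-assoc (reverse ls) (b ∷ []) rs) ~> cong (_++ rs) (sym (List.unfold-reverse b ls))) h' , steps-++ (one (stage 0F) t1 t2 ts (bit-case (holding-bit h)) refl refl) r where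
    bit-case : ∀ {x y zs} -> y ≡ bit b -> delta (stage 0F) x y zs ≡ just (stage 0F , (x , stay) , (bit b , left) , stays zs)
    bit-case refl = refl
   rewind-output : ∀ ls {rs t1 t2 ts} -> Rewinding ls rs t1 -> ∃[ t ] Holding [] (reverse ls ++ rs) t ×
    Steps (suc (length ls)) (to (stage 2F) , t1 ∷ t2 ∷ ts) (to (stage 3F) , t ∷ t2 ∷ ts)
   rewind-output [] {t1 = t1} {t2} {ts} h = _ , return h , one (stage 2F) t1 t2 ts (blank-case (off-blank h)) refl refl where
    blank-case : ∀ {x y zs} -> x ≡ blank -> delta (stage 2F) x y zs ≡ just (stage 3F , (blank , right) , (y , stay) , stays zs)
    blank-case refl = refl
   rewind-output (b ∷ ls) {rs} {t1} {t2} {ts} h = let t , h' , r = rewind-output ls (subst (\ x -> Rewinding ls (b ∷ rs) (write (x , left) t1)) (holding-bit h) (rewinding h)) in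
    t , subst (\ u -> Holding [] u t) (sym (List.++-assoc (reverse ls) (b ∷ []) rs) ~> cong (_++ rs) (sym (List.unfold-reverse b ls))) h' , steps-++ (one (stage 2F) t1 t2 ts (bit-case (holding-bit h)) refl refl) r where
    bit-case : ∀ {x y zs} -> x ≡ bit b -> delta (stage 2F) x y zs ≡ just (stage 2F , (bit b , left) , (y , stay) , stays zs)
    bit-case refl = refl
   bits-holding : ∀ {rs} t -> Holding [] rs t -> bits (scanned t ∷ after t) ≡ rs
   bits-holding _ (empty _ _ _) = refl
   bits-holding _ (found {bs = bs} {b} {rs} _ _ blanks refl) = cong (b ∷_) (go rs blanks) where
    go : ∀ rs {bs} -> Blanks bs -> bits (map bit rs ++ bs) ≡ rs
    go [] [] = refl
    go [] (refl ∷ _) = refl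
    go (r ∷ rs) bl = cong (r ∷_) (go rs bl)
   count : ∀ rs {ls n t1 t2 ts} -> Holding [] rs t1 -> Holding ls [] t2 -> Counters (levels (n ∷ [])) ts -> ∃[ t ] ∃[ t' ] ∃[ ts' ] Holding [] [] t × Rewinding (reverse rs ++ ls) [] t' × Counters (levels ((length rs N.+ n) ∷ [])) ts' ×
    Steps (suc (length rs)) (to start , t1 ∷ t2 ∷ ts) (to (stage 0F) , t ∷ t' ∷ ts')
   count [] {ls} {t1 = t1} {t2} {ts} h1 h2 cs = _ , _ , _ , h1 , rewinding h2 , cs , one start t1 t2 ts (blank-case (holding-blank h1)) refl refl where
    blank-case : ∀ {x y zs} -> x ≡ blank -> delta start x y zs ≡ just (stage 0F , (x , stay) , (y , left) , stays zs)
    blank-case refl = refl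
   count (b ∷ rs) {ls} {n} {t1} {t2} {ts} h1 h2 cs = let t , t' , ts' , a1 , a2 , a3 , r = count rs {b ∷ ls} {suc n} (erase h1) (append b h2) counted in
    t , t' , ts' , a1 , subst (\ u -> Rewinding u [] t') (sym (List.++-assoc (reverse rs) (b ∷ []) ls) ~> cong (_++ ls) (sym (List.unfold-reverse b rs))) a2 , subst (\ v -> Counters (levels (v ∷ [])) ts') (N.+-suc (length rs) n) a3 ,
    steps-++ (one-counter start t1 t2 ts (bit-case (holding-bit h1))) r where
    bit-case : ∀ {x y zs} -> x ≡ bit b -> delta start x y zs ≡ just (start , (blank , right) , (bit b , right) , stays zs [ reg 0 ]≔ (bit true , right))
    bit-case refl = refl
    counted : Counters (levels (suc n ∷ [])) (ts [ reg 0 ]≔ write (bit true , right) (lookup ts (reg 0)))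
    counted {y} y≤ = subst (\ v -> Marks v _) (value y) (update-counter {ts = ts} cs z≤n (append true (cs {0} z≤n)) y≤) where
     value : ∀ y -> (if does (y N.≟ 0) then suc n else levels (n ∷ []) y) ≡ levels (suc n ∷ []) y
     value zero = refl
     value (suc y) = refl
  module Correct (N : ℕ -> ℕ) (E : ℕ -> Store -> Store -> Set)
   (derivation : ∀ n -> C ⊢ n ∷ [] ⇒[ N n , E n ] (n ∷ [])) where
   halts : ∀ w {ls rs o} -> E (length w) ([] , w , []) (ls , rs , o) -> ∃[ k ] ∃[ e ] k ≤ 4 N.+ 2 N.* length w N.+ 3 N.* N (length w) × HaltsAfter k (init w) e × output e ≡ reverse o
   halts w {o = o} e with count w {[]} {0} (loaded w) (empty {bl = []} refl [] []) counters where
    loaded : ∀ w -> Holding [] w (load w)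
    loaded [] = empty {bl = []} refl [] []
    loaded (b ∷ w) = found {bl = []} {bs = []} refl [] [] (sym (List.++-identityʳ (map bit w)))
    counters : Counters (levels (0 ∷ [])) (Vec.replicate #counters emptyTape)
    counters {y} _ = subst₂ Marks (zeros y) (sym (Vec.lookup-replicate (reg y) emptyTape)) (empty {bl = []} refl [] []) where
     zeros : ∀ y -> 0 ≡ levels (0 ∷ []) y
     zeros zero = refl
     zeros (suc y) = refl
   ... | t , t' , ts , h1 , h2 , cs , r1 with rewind-input (reverse w ++ []) {ts = ts} h1 h2
   ... | t″ , h3 , r2 with reach (Interpreter.execute interpreter (derivation (length w)) (N.n≤1+n _) just nothing (\ _ -> refl)
    (here h1 (subst (\ u -> Holding [] u t″) restored h3) (subst (\ v -> Counters (levels (v ∷ [])) ts) (N.+-identityʳ (length w)) cs))) e where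
    restored : reverse (reverse w ++ []) ++ [] ≡ w
    restored = List.++-identityʳ _ ~> cong reverse (List.++-identityʳ (reverse w)) ~> List.reverse-involutive w
   ... | _ , here {t1 = u1} {u2} {us} k1 k2 _ , r3 with rewind-output o {[]} {ts = us} (rewinding k1)
   ... | u , k3 , r4 = _ , _ , bounded , steps-halt (steps-++ r1 (steps-++ r2 (steps-++ r3
    (steps-++ (one (stage 1F) u1 u2 us refl refl refl) r4)))) stopped , bits-holding u k3 ~> List.++-identityʳ (reverse o) where
    stopped : step (to (stage 3F) , u ∷ u2 ∷ us) ≡ nothing
    stopped rewrite from-to (stage 3F) = refl
    bounded : suc (length w) N.+ (suc (length (reverse w ++ [])) N.+ (2 N.* N (length w) N.+ (1 N.+ suc (length o))))
     ≤ 4 N.+ 2 N.* length w N.+ 3 N.* N (length w)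
    bounded = subst (\ m -> suc (length w) N.+ (suc m N.+ (2 N.* N (length w) N.+ (1 N.+ suc (length o)))) ≤ 4 N.+ 2 N.* length w N.+ 3 N.* N (length w))
     (sym (cong length (List.++-identityʳ (reverse w)) ~> List.length-reverse w)) (N.≤-reflexive (arrange (length w) (N (length w)) (length o)) ▹ N.+-monoʳ-≤ (4 N.+ 2 N.* length w N.+ 2 N.* N (length w)) (written≤ (derivation (length w)) e ▹ N.≤-reflexive (N.+-identityʳ _)) ▹
     N.≤-reflexive (arrange' (length w) (N (length w)))) where
     arrange : ∀ n N o -> suc n N.+ (suc n N.+ (2 N.* N N.+ (1 N.+ suc o))) ≡ 4 N.+ 2 N.* n N.+ 2 N.* N N.+ o
     arrange = solve-∀
     arrange' : ∀ n N -> 4 N.+ 2 N.* n N.+ 2 N.* N N.+ N ≡ 4 N.+ 2 N.* n N.+ 3 N.* N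
     arrange' = solve-∀

module Codes where

 open import Data.Nat.Binary as Bin using (ℕᵇ; 2[1+_]; 1+[2_])
 import Data.Nat.Binary.Properties as Bin
 import Data.Sum as Sum
 open Finiteness using (clamp)

 digitCode : ℕᵇ -> List Bool
 digitCode Bin.zero   = false ∷ []
 digitCode 2[1+ b ] = true ∷ false ∷ digitCode b
 digitCode 1+[2 b ] = true ∷ true ∷ digitCode b

 numberCode : ℕ -> List Bool
 numberCode n = digitCode (Bin.fromℕ n)

 fromℕ-toℕ : ∀ b -> Bin.fromℕ (Bin.toℕ b) ≡ b
 fromℕ-toℕ b = Bin.toℕ-injective (Bin.toℕ-fromℕ (Bin.toℕ b))

 indexCode≡ : ∀ {n} (i : Fin n) -> indexCode i ≡ numberCode (toℕ i)
 indexCode≡ {n} i = go i (Bin.fromℕ (toℕ i)) refl where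
  smaller : ∀ (i : Fin n) b -> Bin.toℕ b ≤ toℕ i -> ∃[ j ] Bin.fromℕ (toℕ {n} j) ≡ b
  smaller i b b≤i = Fin.fromℕ< b<n , cong Bin.fromℕ (Fin.toℕ-fromℕ< b<n) ~> fromℕ-toℕ b where
   import Data.Fin as Fin
   b<n = N.≤-<-trans b≤i (Fin.toℕ<n i)
  below : ∀ (i : Fin n) {b} c -> Bin.fromℕ (toℕ i) ≡ b -> Bin.toℕ c ≤ Bin.toℕ b -> Bin.toℕ c ≤ toℕ i
  below i {b} c eq c≤b = c≤b ▹ N.≤-reflexive (cong Bin.toℕ (sym eq) ~> Bin.toℕ-fromℕ (toℕ i))
  go : ∀ (i : Fin n) b -> Bin.fromℕ (toℕ i) ≡ b -> indexCode i ≡ digitCode b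
  go i Bin.zero eq rewrite eq = refl
  go i 2[1+ b ] eq with smaller i b (below i b eq (N.n≤1+n (Bin.toℕ b) ▹ N.m≤n*m (suc (Bin.toℕ b)) 2))
  ... | j , eq' with go j b eq'
  ...   | ih rewrite eq | eq' = cong (\ u -> true ∷ false ∷ u) ih
  go i 1+[2 b ] eq with smaller i b (below i b eq (N.m≤n*m (Bin.toℕ b) 2 ▹ N.n≤1+n _))
  ... | j , eq' with go j b eq'
  ...   | ih rewrite eq | eq' = cong (\ u -> true ∷ true ∷ u) ih

 PrefixFree : {X : Set} -> (X -> List Bool) -> Set
 PrefixFree c = ∀ x y u v -> c x ++ u ≡ c y ++ v -> x ≡ y × u ≡ v

 private
  ∷-cancel : ∀ {a b : Bool} {u v : List Bool} -> _≡_ {A = List Bool} (a ∷ b ∷ u) (a ∷ b ∷ v) -> u ≡ v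
  ∷-cancel refl = refl

 digitCode-free : PrefixFree digitCode
 digitCode-free Bin.zero Bin.zero u v refl = refl , refl
 digitCode-free Bin.zero 2[1+ c ] u v ()
 digitCode-free Bin.zero 1+[2 c ] u v ()
 digitCode-free 2[1+ b ] Bin.zero u v ()
 digitCode-free 2[1+ b ] 2[1+ c ] u v eq = let p , q = digitCode-free b c u v (∷-cancel eq) in cong 2[1+_] p , q
 digitCode-free 2[1+ b ] 1+[2 c ] u v ()
 digitCode-free 1+[2 b ] Bin.zero u v ()
 digitCode-free 1+[2 b ] 2[1+ c ] u v ()
 digitCode-free 1+[2 b ] 1+[2 c ] u v eq = let p , q = digitCode-free b c u v (∷-cancel eq) in cong 1+[2_] p , q

 numberCode-free : PrefixFree numberCode
 numberCode-free m n u v eq = let p , q = digitCode-free (Bin.fromℕ m) (Bin.fromℕ n) u v eq in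
  trans (sym (Bin.toℕ-fromℕ m)) (cong Bin.toℕ p ~> Bin.toℕ-fromℕ n) , q

 pairCode : ℕ ⊎ ℕ -> List Bool
 pairCode (inl i) = false ∷ numberCode i
 pairCode (inr j) = true ∷ numberCode j

 pairCode-free : PrefixFree pairCode
 pairCode-free (inl i) (inl j) u v eq = let p , q = numberCode-free i j u v (List.∷-injectiveʳ eq) in cong inl p , q
 pairCode-free (inl i) (inr j) u v ()
 pairCode-free (inr i) (inl j) u v ()
 pairCode-free (inr i) (inr j) u v eq = let p , q = numberCode-free i j u v (List.∷-injectiveʳ eq) in cong inr p , q

 sumCode≡ : ∀ {n m} (x : Fin n ⊎ Fin m) -> sumCode x ≡ pairCode (Sum.map toℕ toℕ x)
 sumCode≡ (inl i) = cong (false ∷_) (indexCode≡ i)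
 sumCode≡ (inr j) = cong (true ∷_) (indexCode≡ j)

 module _ {X : Set} (c : X -> List Bool) (free : PrefixFree c) where
  readable : PrefixFree (\ t -> ⟨ t ⟩ c)
  readable2 : ∀ s s' t t' u v -> (⟨ s ⟩ c ++ ⟨ s' ⟩ c) ++ u ≡ (⟨ t ⟩ c ++ ⟨ t' ⟩ c) ++ v -> (s ≡ t × s' ≡ t') × u ≡ v
  readable2 s s' t t' u v eq = let
    p , eq' = readable s t (⟨ s' ⟩ c ++ u) (⟨ t' ⟩ c ++ v)
     (sym (List.++-assoc (⟨ s ⟩ c) _ u) ~> eq ~> List.++-assoc (⟨ t ⟩ c) _ v)
    p' , q = readable s' t' u v eq' in (p , p') , q
  readable (var x) (var y) u v eq = let p , q = free x y u v (∷-cancel eq) in cong var p , q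
  readable (¬ᵗ s) (¬ᵗ t) u v eq = let p , q = readable s t u v (∷-cancel eq) in cong ¬ᵗ_ p , q
  readable (s ∧ᵗ s') (t ∧ᵗ t') u v eq = let (p , p') , q = readable2 s s' t t' u v (List.∷-injectiveʳ (∷-cancel eq)) in cong₂ _∧ᵗ_ p p' , q
  readable (s ∨ᵗ s') (t ∨ᵗ t') u v eq = let (p , p') , q = readable2 s s' t t' u v (List.∷-injectiveʳ (∷-cancel eq)) in cong₂ _∨ᵗ_ p p' , q
  readable 0ᵗ 0ᵗ u v refl = refl , refl
  readable 1ᵗ 1ᵗ u v refl = refl , refl
  readable (var _) (¬ᵗ _) u v ()
  readable (var _) (_ ∧ᵗ _) u v ()
  readable (var _) (_ ∨ᵗ _) u v ()
  readable (var _) 0ᵗ u v ()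
  readable (var _) 1ᵗ u v ()
  readable (¬ᵗ _) (var _) u v ()
  readable (¬ᵗ _) (_ ∧ᵗ _) u v ()
  readable (¬ᵗ _) (_ ∨ᵗ _) u v ()
  readable (¬ᵗ _) 0ᵗ u v ()
  readable (¬ᵗ _) 1ᵗ u v ()
  readable (_ ∧ᵗ _) (var _) u v ()
  readable (_ ∧ᵗ _) (¬ᵗ _) u v ()
  readable (_ ∧ᵗ _) (_ ∨ᵗ _) u v ()
  readable (_ ∧ᵗ _) 0ᵗ u v ()
  readable (_ ∧ᵗ _) 1ᵗ u v ()
  readable (_ ∨ᵗ _) (var _) u v ()
  readable (_ ∨ᵗ _) (¬ᵗ _) u v ()
  readable (_ ∨ᵗ _) (_ ∧ᵗ _) u v ()
  readable (_ ∨ᵗ _) 0ᵗ u v ()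
  readable (_ ∨ᵗ _) 1ᵗ u v ()
  readable 0ᵗ (var _) u v ()
  readable 0ᵗ (¬ᵗ _) u v ()
  readable 0ᵗ (_ ∧ᵗ _) u v ()
  readable 0ᵗ (_ ∨ᵗ _) u v ()
  readable 0ᵗ 1ᵗ u v ()
  readable 1ᵗ (var _) u v ()
  readable 1ᵗ (¬ᵗ _) u v ()
  readable 1ᵗ (_ ∧ᵗ _) u v ()
  readable 1ᵗ (_ ∨ᵗ _) u v ()
  readable 1ᵗ 0ᵗ u v ()

 mapTerm : ∀ {X Y} -> (X -> Y) -> Term X -> Term Y
 mapTerm f (var x) = var (f x)
 mapTerm f (s ∧ᵗ t) = mapTerm f s ∧ᵗ mapTerm f t
 mapTerm f (s ∨ᵗ t) = mapTerm f s ∨ᵗ mapTerm f t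
 mapTerm f (¬ᵗ t) = ¬ᵗ mapTerm f t
 mapTerm f 0ᵗ = 0ᵗ
 mapTerm f 1ᵗ = 1ᵗ

 nthOr : ∀ {X : Set} -> X -> List X -> ℕ -> X
 nthOr z []       _       = z
 nthOr z (x ∷ xs) zero    = x
 nthOr z (x ∷ xs) (suc j) = nthOr z xs j

 Everywhere : ∀ {X : Set} -> (X -> Set) -> Term X -> Set
 Everywhere P (var x) = P x
 Everywhere P (s ∧ᵗ t) = Everywhere P s × Everywhere P t
 Everywhere P (s ∨ᵗ t) = Everywhere P s × Everywhere P t
 Everywhere P (¬ᵗ t) = Everywhere P t
 Everywhere P 0ᵗ = ⊤
 Everywhere P 1ᵗ = ⊤

 every-map : ∀ {X} {P Q : X -> Set} -> (∀ x -> P x -> Q x) -> ∀ t -> Everywhere P t -> Everywhere Q t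
 every-map h (var x) p = h x p
 every-map h (s ∧ᵗ t) (p , q) = every-map h s p , every-map h t q
 every-map h (s ∨ᵗ t) (p , q) = every-map h s p , every-map h t q
 every-map h (¬ᵗ t) p = every-map h t p
 every-map h 0ᵗ p = tt
 every-map h 1ᵗ p = tt

 everywhere : ∀ {X} {P : X -> Set} -> (∀ x -> P x) -> ∀ t -> Everywhere P t
 everywhere h (var x) = h x
 everywhere h (s ∧ᵗ t) = everywhere h s , everywhere h t
 everywhere h (s ∨ᵗ t) = everywhere h s , everywhere h t
 everywhere h (¬ᵗ t) = everywhere h t
 everywhere h 0ᵗ = tt
 everywhere h 1ᵗ = tt

 code-map : ∀ {X Y} (f : X -> Y) {c : X -> List Bool} {c' : Y -> List Bool} (t : Term X) -> Everywhere (\ x -> c x ≡ c' (f x)) t -> ⟨ t ⟩ c ≡ ⟨ mapTerm f t ⟩ c'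
 code-map f (var x) h = cong (\ u -> true ∷ true ∷ u) h
 code-map f (s ∧ᵗ t) (h , h') = cong₂ (\ u v -> false ∷ true ∷ true ∷ u ++ v) (code-map f s h) (code-map f t h')
 code-map f (s ∨ᵗ t) (h , h') = cong₂ (\ u v -> false ∷ true ∷ false ∷ u ++ v) (code-map f s h) (code-map f t h')
 code-map f (¬ᵗ t) h = cong (\ u -> true ∷ false ∷ u) (code-map f t h)
 code-map f 0ᵗ h = refl
 code-map f 1ᵗ h = refl

 code-cong : ∀ {X} {c c' : X -> List Bool} -> (∀ x -> c x ≡ c' x) -> ∀ t -> ⟨ t ⟩ c ≡ ⟨ t ⟩ c'
 code-cong h (var x) = cong (\ u -> true ∷ true ∷ u) (h x)
 code-cong h (s ∧ᵗ t) = cong₂ (\ u v -> false ∷ true ∷ true ∷ u ++ v) (code-cong h s) (code-cong h t)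
 code-cong h (s ∨ᵗ t) = cong₂ (\ u v -> false ∷ true ∷ false ∷ u ++ v) (code-cong h s) (code-cong h t)
 code-cong h (¬ᵗ t) = cong (\ u -> true ∷ false ∷ u) (code-cong h t)
 code-cong h 0ᵗ = refl
 code-cong h 1ᵗ = refl

 every-mapTerm : ∀ {X Y} {P : Y -> Set} (f : X -> Y) t -> Everywhere (P ∘ f) t -> Everywhere P (mapTerm f t)
 every-mapTerm f (var x) h = h
 every-mapTerm f (s ∧ᵗ t) (h , h') = every-mapTerm f s h , every-mapTerm f t h'
 every-mapTerm f (s ∨ᵗ t) (h , h') = every-mapTerm f s h , every-mapTerm f t h'
 every-mapTerm f (¬ᵗ t) h = every-mapTerm f t h
 every-mapTerm f 0ᵗ h = tt
 every-mapTerm f 1ᵗ h = tt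

 every-zip : ∀ {X} {P Q S : X -> Set} -> (∀ x -> P x -> Q x -> S x) -> ∀ t -> Everywhere P t -> Everywhere Q t -> Everywhere S t
 every-zip h (var x) p q = h x p q
 every-zip h (s ∧ᵗ t) (p , p') (q , q') = every-zip h s p q , every-zip h t p' q'
 every-zip h (s ∨ᵗ t) (p , p') (q , q') = every-zip h s p q , every-zip h t p' q'
 every-zip h (¬ᵗ t) p q = every-zip h t p q
 every-zip h 0ᵗ p q = tt
 every-zip h 1ᵗ p q = tt

 preimage-of : ∀ {X Y} (f : Y -> X) t -> Everywhere (\ x -> ∃[ y ] f y ≡ x) t -> ∃[ s ] mapTerm f s ≡ t
 preimage-of f (var x) (y , p) = var y , cong var p
 preimage-of f (s ∧ᵗ t) (h , h') = let s' , p = preimage-of f s h ; t' , q = preimage-of f t h' in s' ∧ᵗ t' , cong₂ _∧ᵗ_ p q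
 preimage-of f (s ∨ᵗ t) (h , h') = let s' , p = preimage-of f s h ; t' , q = preimage-of f t h' in s' ∨ᵗ t' , cong₂ _∨ᵗ_ p q
 preimage-of f (¬ᵗ t) h = let t' , p = preimage-of f t h in ¬ᵗ t' , cong ¬ᵗ_ p
 preimage-of f 0ᵗ h = 0ᵗ , refl
 preimage-of f 1ᵗ h = 1ᵗ , refl

 toℕ-clamp : ∀ m {y} -> y ≤ m -> toℕ (clamp m y) ≡ y
 toℕ-clamp zero z≤n = refl
 toℕ-clamp (suc m) {zero} _ = refl
 toℕ-clamp (suc m) {suc y} (s≤s p) = cong suc (toℕ-clamp m p)

 clamp-toℕ : ∀ m (i : Fin (suc m)) -> clamp m (toℕ i) ≡ i
 clamp-toℕ zero 0F = refl
 clamp-toℕ (suc m) 0F = refl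
 clamp-toℕ (suc m) (fsuc i) = cong fsuc (clamp-toℕ m i)

 bounded-by : ∀ {X} (size : X -> ℕ) (t : Term X) -> ∃[ n ] Everywhere (\ x -> size x ≤ n) t
 bounded-by size (var x) = size x , N.≤-refl
 bounded-by size (s ∧ᵗ t) = let m , p = bounded-by size s ; n , q = bounded-by size t in
  m N.⊔ n , every-map (\ _ h -> N.m≤n⇒m≤n⊔o n h) s p , every-map (\ _ h -> N.m≤n⇒m≤o⊔n m h) t q
 bounded-by size (s ∨ᵗ t) = let m , p = bounded-by size s ; n , q = bounded-by size t in
  m N.⊔ n , every-map (\ _ h -> N.m≤n⇒m≤n⊔o n h) s p , every-map (\ _ h -> N.m≤n⇒m≤o⊔n m h) t q
 bounded-by size (¬ᵗ t) = bounded-by size t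
 bounded-by size 0ᵗ = 0 , tt
 bounded-by size 1ᵗ = 0 , tt

 -- A tuple of naturals names the variable whose index has the bijective binary digits
 -- 1…12 1…12 …, one block for each component.
 ones : ℕ -> ℕᵇ -> ℕᵇ
 ones zero b = b
 ones (suc u) b = 1+[2 ones u b ]

 tupleᵇ : List ℕ -> ℕᵇ
 tupleᵇ [] = Bin.zero
 tupleᵇ (u ∷ us) = ones u 2[1+ tupleᵇ us ]

 tuple : List ℕ -> ℕ
 tuple us = Bin.toℕ (tupleᵇ us)

 private
  tail : ℕᵇ -> ℕᵇ
  tail Bin.zero = Bin.zero
  tail 2[1+ b ] = b
  tail 1+[2 b ] = b

 tupleᵇ-inj : ∀ us vs -> tupleᵇ us ≡ tupleᵇ vs -> us ≡ vs
 tupleᵇ-inj [] [] _ = refl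
 tupleᵇ-inj [] (zero ∷ vs) ()
 tupleᵇ-inj [] (suc v ∷ vs) ()
 tupleᵇ-inj (zero ∷ us) [] ()
 tupleᵇ-inj (suc u ∷ us) [] ()
 tupleᵇ-inj (zero ∷ us) (zero ∷ vs) eq = cong (0 ∷_) (tupleᵇ-inj us vs (cong tail eq))
 tupleᵇ-inj (zero ∷ us) (suc v ∷ vs) ()
 tupleᵇ-inj (suc u ∷ us) (zero ∷ vs) ()
 tupleᵇ-inj (suc u ∷ us) (suc v ∷ vs) eq with tupleᵇ-inj (u ∷ us) (v ∷ vs) (cong tail eq)
 ... | refl = refl

 tuple-injective : ∀ us vs -> tuple us ≡ tuple vs -> us ≡ vs
 tuple-injective us vs eq = tupleᵇ-inj us vs (Bin.toℕ-injective eq)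

 -- A function on names becomes a function on natural numbers.
 extend : ∀ {ℓ} -> EM -> {X : Set} {Y : Set ℓ} (f : X -> ℕ) -> (∀ {x x'} -> f x ≡ f x' -> x ≡ x') -> Y -> (g : X -> Y) -> Σ (ℕ -> Y) \ h -> ∀ x -> h (f x) ≡ g x
 extend em {X} {Y} f injective y0 g = (\ n -> choose (named n)) , \ x -> chosen x (named (f x)) where
  named : ∀ n -> Dec (∃[ x ] f x ≡ n)
  named n = Classical.dec em (∃[ x ] f x ≡ n)
  choose : ∀ {n} -> Dec (∃[ x ] f x ≡ n) -> Y
  choose (yes (x , _)) = g x
  choose (no _) = y0
  chosen : ∀ x (q : Dec (∃[ x' ] f x' ≡ f x)) -> choose q ≡ g x
  chosen x (yes (x' , p)) = cong g (injective p)
  chosen x (no ¬p) = ⊥-elim (¬p (x , refl))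

 module _ (L : RawOrtholattice) where
  private module L = RawOrtholattice L
  eval-map : ∀ {X Y} (f : X -> Y) t (a : Y -> L.Carrier) -> eval L (mapTerm f t) a ≡ eval L t (a ∘ f)
  eval-map f (var x) a = refl
  eval-map f (s ∧ᵗ t) a = cong₂ L._∧_ (eval-map f s a) (eval-map f t a)
  eval-map f (s ∨ᵗ t) a = cong₂ L._∨_ (eval-map f s a) (eval-map f t a)
  eval-map f (¬ᵗ t) a = cong L._ᶜ (eval-map f t a)
  eval-map f 0ᵗ a = refl
  eval-map f 1ᵗ a = refl
  eval-cong : ∀ {X} {a b : X -> L.Carrier} t -> (∀ x -> a x ≡ b x) -> eval L t a ≡ eval L t b
  eval-cong (var x) h = h x
  eval-cong (s ∧ᵗ t) h = cong₂ L._∧_ (eval-cong s h) (eval-cong t h)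
  eval-cong (s ∨ᵗ t) h = cong₂ L._∨_ (eval-cong s h) (eval-cong t h)
  eval-cong (¬ᵗ t) h = cong L._ᶜ (eval-cong t h)
  eval-cong 0ᵗ h = refl
  eval-cong 1ᵗ h = refl
  SAT⇔ : ∀ {w} -> SAT L w ⇔ (∃[ t ] w ≡ ⟨ t ⟩ numberCode × ∃[ a ] eval L t a L.≈ L.1#)
  SAT⇔ {w} = mk⇔ to' from' where
   to' : SAT L w -> ∃[ t ] w ≡ ⟨ t ⟩ numberCode × ∃[ a ] eval L t a L.≈ L.1#
   to' (n , t , eq , a , h) = mapTerm toℕ t , eq ~> code-map toℕ t (everywhere indexCode≡ t) , α n a , subst (\ x -> x L.≈ L.1#) (sym (eval-map toℕ t (α n a) ~> eval-cong t (α-toℕ n a))) h where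
    α : ∀ n -> (Fin n -> L.Carrier) -> ℕ -> L.Carrier
    α zero a _ = L.0#
    α (suc n) a x = a (clamp n x)
    α-toℕ : ∀ n (a : Fin n -> L.Carrier) i -> α n a (toℕ i) ≡ a i
    α-toℕ (suc n) a i = cong a (clamp-toℕ n i)
   from' : (∃[ t ] w ≡ ⟨ t ⟩ numberCode × ∃[ a ] eval L t a L.≈ L.1#) -> SAT L w
   from' (t , eq , a , h) = suc n , t' , eq ~> cong (\ t -> ⟨ t ⟩ numberCode) (sym same) ~> sym (code-map toℕ t' (everywhere indexCode≡ t')) , a ∘ toℕ , subst (\ x -> x L.≈ L.1#) (cong (\ t -> eval L t a) (sym same) ~> eval-map toℕ t' a) h where
    n = fst (bounded-by id t)
    lifted = preimage-of toℕ t (every-map (\ x x≤n -> clamp n x , toℕ-clamp n x≤n) t (snd (bounded-by id t)))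
    t' : Term (Fin (suc n))
    t' = fst lifted
    same : mapTerm toℕ t' ≡ t
    same = snd lifted

module Output (B : Set) (bit : Bool -> B) where

 open Formula
 open Codes

 data Out (k : ℕ) : Set where
  []  : Out k
  lit : B -> Out k
  _⊕_ : Out k -> Out k -> Out k
  rep : Ex k -> Out (suc k) -> Out k
  inp : Ex k -> Out k
  num : Ex k -> Out k

 infixr 5 _⊕_

 repeat : (ℕ -> List B) -> ℕ -> ℕ -> List B
 repeat f j zero = []
 repeat f j (suc c) = f j ++ repeat f (suc j) c

 output : (ℕ -> B) -> ∀ {k} -> Out k -> Vec ℕ k -> List B
 output w [] ρ = []
 output w (lit b) ρ = b ∷ []
 output w (o ⊕ p) ρ = output w o ρ ++ output w p ρ
 output w (rep e o) ρ = repeat (\ j -> output w o (j ∷ ρ)) 0 (⟦ e ⟧e ρ)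
 output w (inp e) ρ = w (⟦ e ⟧e ρ) ∷ []
 output w (num e) ρ = map bit (numberCode (⟦ e ⟧e ρ))

 Below : ℕ -> ∀ {k} -> Out k -> Vec ℕ k -> Set
 Below n [] ρ = ⊤
 Below n (lit b) ρ = ⊤
 Below n (o ⊕ p) ρ = Below n o ρ × Below n p ρ
 Below n (rep e o) ρ = ∀ j -> j < ⟦ e ⟧e ρ -> Below n o (j ∷ ρ)
 Below n (inp e) ρ = ⟦ e ⟧e ρ < n
 Below n (num e) ρ = ⊤

 bits : ∀ {k} -> List Bool -> Out k
 bits [] = []
 bits (b ∷ bs) = lit (bit b) ⊕ bits bs

 output-bits : ∀ w {k} bs (ρ : Vec ℕ k) -> output w (bits bs) ρ ≡ map bit bs
 output-bits w [] ρ = refl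
 output-bits w (b ∷ bs) ρ = cong (bit b ∷_) (output-bits w bs ρ)

 below-bits : ∀ n {k} bs (ρ : Vec ℕ k) -> Below n (bits bs) ρ
 below-bits n [] ρ = tt
 below-bits n (b ∷ bs) ρ = tt , below-bits n bs ρ

module Emission
 (A : ℕ -> Set) (S : Set) (⟦_⟧ᵃ : ∀ {k} -> A k -> Vec ℕ k -> S -> S -> Set)
 (rename : ∀ {k m} -> (Fin k -> Fin m) -> A k -> A m)
 (rename-effect : ∀ {k m} (σ : Fin k -> Fin m) (α : A k) ρ env -> (∀ i -> lookup ρ (σ i) ≡ lookup env i) -> ∀ {s t} -> ⟦ rename σ α ⟧ᵃ ρ s t ⇔ ⟦ α ⟧ᵃ env s t)
 (emit : Bool -> ∀ {k} -> A k) (emits : Bool -> S -> S -> Set)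
 (emit-effect : ∀ b {k} (ρ : Vec ℕ k) {s t} -> ⟦ emit b ⟧ᵃ ρ s t ⇔ emits b s t)
 (B : Set) (bit : Bool -> B) where
 open Formula
 open Codes
 open Output B bit
 open Programs A S ⟦_⟧ᵃ rename rename-effect emit emits emit-effect
 open import Data.Nat.Binary as Bin using (ℕᵇ; 2[1+_]; 1+[2_])

 module _ (symbol : B -> ∀ {k} -> Prog k) (input : ∀ {k} -> Ex k -> Prog k) where
  emission : ∀ {k} -> Out k -> Prog k
  emission [] = skip
  emission (lit b) = symbol b
  emission (o ⊕ p) = emission o ⨾ emission p
  emission (rep e o) = for e (emission o)
  emission (inp e) = input e
  emission (num e) = digits e
  -- Represents xs s : the store s holds the output xs produced so far.
  module _ (Rep : List B -> S -> Set) (n : ℕ) (w : ℕ -> B)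
   (symbol-emits : ∀ b {k} (ρ : Vec ℕ k) {xs s} -> Rep xs s -> ∃[ t ] effect (symbol b) ρ s t × Rep (xs ++ b ∷ []) t)
   (bit-emits : ∀ b {xs s} -> Rep xs s -> ∃[ t ] emits b s t × Rep (xs ++ bit b ∷ []) t)
   (input-emits : ∀ {k} (e : Ex k) ρ -> ⟦ e ⟧e ρ < n -> ∀ {xs s} -> Rep xs s -> ∃[ t ] effect (input e) ρ s t × Rep (xs ++ w (⟦ e ⟧e ρ) ∷ []) t) where
   private
    regroup : ∀ xs {ys zs t} -> Rep ((xs ++ ys) ++ zs) t -> Rep (xs ++ ys ++ zs) t
    regroup xs {ys} {zs} {t} = subst (\ l -> Rep l t) (List.++-assoc xs ys zs)
    done : ∀ {xs t} -> Rep xs t -> Rep (xs ++ []) t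
    done {xs} {t} = subst (\ l -> Rep l t) (sym (List.++-identityʳ xs))
    digits-emits : ∀ b {xs s} -> Rep xs s -> ∃[ t ] emitDigits b s t × Rep (xs ++ map bit (digitCode b)) t
    digits-emits Bin.zero r = bit-emits false r
    digits-emits 2[1+ b ] {xs} r = let t , e , r1 = bit-emits true r ; u , f , r2 = bit-emits false r1 ; v , g , r3 = digits-emits b r2 in
     v , (t , e , u , f , g) , regroup xs (regroup (xs ++ bit true ∷ []) r3)
    digits-emits 1+[2 b ] {xs} r = let t , e , r1 = bit-emits true r ; u , f , r2 = bit-emits true r1 ; v , g , r3 = digits-emits b r2 in
     v , (t , e , u , f , g) , regroup xs (regroup (xs ++ bit true ∷ []) r3)
   emission-emits : ∀ {k} (o : Out k) ρ -> Below n o ρ -> ∀ {xs s} -> Rep xs s -> ∃[ t ] effect (emission o) ρ s t × Rep (xs ++ output w o ρ) t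
   emission-emits [] ρ _ r = _ , refl , done r
   emission-emits (lit b) ρ _ r = symbol-emits b ρ r
   emission-emits (o ⊕ p) ρ (h , h') {xs} r = let t , e , r1 = emission-emits o ρ h r ; u , f , r2 = emission-emits p ρ h' r1 in u , (t , e , f) , regroup xs r2
   emission-emits (rep e o) ρ h {xs} {s} = go 0 (⟦ e ⟧e ρ) (\ i _ -> h i) where
    go : ∀ j c -> (∀ i -> j ≤ i -> i < j N.+ c -> Below n o (i ∷ ρ)) -> ∀ {xs s} -> Rep xs s -> ∃[ t ] iterate (\ j -> effect (emission o) (j ∷ ρ)) j c s t × Rep (xs ++ repeat (\ j -> output w o (j ∷ ρ)) j c) t
    go j zero h r = _ , refl , done r
    go j (suc c) h {xs} r = let
      t , e , r1 = emission-emits o (j ∷ ρ) (h j N.≤-refl (N.m<m+n j (s≤s z≤n))) r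
      u , f , r2 = go (suc j) c (\ i j<i i< -> h i (N.<⇒≤ j<i) (subst (i <_) (sym (N.+-suc j c)) i<)) r1
     in u , (t , e , f) , regroup xs r2
   emission-emits (inp e) ρ h r = input-emits e ρ h r
   emission-emits (num e) ρ _ r = digits-emits (Bin.fromℕ (⟦ e ⟧e ρ)) r

module TuringEmission where

 open Formula
 open CounterPrograms
 open TuringCompiler
 open Turing using (PolynomialTime)
 open Output Bool id
 open import Data.List using (reverse; _ʳ++_)

 private
  rename : ∀ {k m} -> (Fin k -> Fin m) -> Act k -> Act m
  rename σ (put b) = put b
  rename σ left = left
  rename σ right = right
  rename σ copy = copy
  rename-effect : ∀ {k m} (σ : Fin k -> Fin m) (α : Act k) ρ env -> (∀ i -> lookup ρ (σ i) ≡ lookup env i) -> ∀ {s t} -> ⟦ rename σ α ⟧ᵃ ρ s t ⇔ ⟦ α ⟧ᵃ env s t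
  rename-effect σ (put b) ρ env reads = mk⇔ id id
  rename-effect σ left ρ env reads = mk⇔ id id
  rename-effect σ right ρ env reads = mk⇔ id id
  rename-effect σ copy ρ env reads = mk⇔ id id
  emits : Bool -> Store -> Store -> Set
  emits b (ls , rs , o) t = t ≡ (ls , rs , b ∷ o)
  emit-effect : ∀ b {k} (ρ : Vec ℕ k) {s t} -> ⟦ put b ⟧ᵃ ρ s t ⇔ emits b s t
  emit-effect b ρ = mk⇔ id id

 open Programs Act Store ⟦_⟧ᵃ rename rename-effect (\ b -> put b) emits emit-effect
 open Emission Act Store ⟦_⟧ᵃ rename rename-effect (\ b -> put b) emits emit-effect Bool id
 open Polynomials

 inputAt : ∀ {k} -> Ex k -> Prog k
 inputAt e = for e (act right) ⨾ act copy ⨾ for e (act left)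

 symbol : Bool -> ∀ {k} -> Prog k
 symbol b = act (put b)

 bitAt : List Bool -> ℕ -> Bool
 bitAt [] i = false
 bitAt (b ∷ w) zero = b
 bitAt (b ∷ w) (suc i) = bitAt w i

 private
  splitAt : ∀ w i -> i < length w -> ∃[ us ] ∃[ rs ] w ≡ us ++ bitAt w i ∷ rs × length us ≡ i
  splitAt (b ∷ w) zero _ = [] , w , refl , refl
  splitAt (b ∷ w) (suc i) (s≤s i<) = let us , rs , eq , len = splitAt w i i< in b ∷ us , rs , cong (b ∷_) eq , cong suc len
  moving : (∀ {k} -> Act k) -> ∀ {k} -> Vec ℕ k -> ℕ -> ℕ -> Store -> Store -> Set
  moving α ρ = iterate (\ j -> effect (act α) (j ∷ ρ))
  rights : ∀ {k} (ρ : Vec ℕ k) us ls rs o j -> moving right ρ j (length us) (ls , us ++ rs , o) (us ʳ++ ls , rs , o)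
  rights ρ [] ls rs o j = refl
  rights ρ (b ∷ us) ls rs o j = (b ∷ ls , us ++ rs , o) , (b , ls , us ++ rs , o , refl , refl) , rights ρ us (b ∷ ls) rs o (suc j)
  lefts : ∀ {k} (ρ : Vec ℕ k) vs ls rs o j -> moving left ρ j (length vs) (vs ++ ls , rs , o) (ls , vs ʳ++ rs , o)
  lefts ρ [] ls rs o j = refl
  lefts ρ (b ∷ vs) ls rs o j = (vs ++ ls , b ∷ rs , o) , (b , vs ++ ls , rs , o , refl , refl) , lefts ρ vs ls (b ∷ rs) o (suc j)
  reading : ∀ {k} (e : Ex k) ρ us b rs o -> length us ≡ ⟦ e ⟧e ρ -> effect (inputAt e) ρ ([] , us ++ b ∷ rs , o) ([] , us ++ b ∷ rs , b ∷ o)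
  reading e ρ us b rs o eq = (us ʳ++ [] , b ∷ rs , o) , subst (\ n -> moving right ρ 0 n ([] , us ++ b ∷ rs , o) (us ʳ++ [] , b ∷ rs , o)) eq (rights ρ us [] (b ∷ rs) o 0) , (us ʳ++ [] , b ∷ rs , b ∷ o) , (b , us ʳ++ [] , rs , o , refl , refl) ,
   subst (\ n -> moving left ρ 0 n (us ʳ++ [] , b ∷ rs , b ∷ o) ([] , us ++ b ∷ rs , b ∷ o)) (List.length-reverse us ~> eq)
   (subst₂ (\ v v' -> moving left ρ 0 (length (reverse us)) (v , b ∷ rs , b ∷ o) ([] , v' , b ∷ o))
   (List.++-identityʳ (reverse us)) (List.ʳ++-defn (reverse us) ~> cong (_++ b ∷ rs) (List.reverse-involutive us))
   (lefts ρ (reverse us) [] (b ∷ rs) (b ∷ o) 0))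
  Rep : List Bool -> List Bool -> Store -> Set
  Rep w xs s = s ≡ ([] , w , reverse xs)
  appended : ∀ (xs : List Bool) (b : Bool) -> b ∷ reverse xs ≡ reverse (xs ++ b ∷ [])
  appended xs b = sym (List.reverse-++ xs (b ∷ []))
  symbol-emits : ∀ w b {k} (ρ : Vec ℕ k) {xs s} -> Rep w xs s -> ∃[ t ] effect (symbol b) ρ s t × Rep w (xs ++ b ∷ []) t
  symbol-emits w b ρ {xs} refl = ([] , w , b ∷ reverse xs) , refl , cong (\ o -> [] , w , o) (appended xs b)
  input-emits : ∀ w {k} (e : Ex k) ρ -> ⟦ e ⟧e ρ < length w -> ∀ {xs s} -> Rep w xs s -> ∃[ t ] effect (inputAt e) ρ s t × Rep w (xs ++ bitAt w (⟦ e ⟧e ρ) ∷ []) t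
  input-emits w e ρ i< {xs} refl = let i = ⟦ e ⟧e ρ ; us , rs , eq , len = splitAt w i i< in
   ([] , w , bitAt w i ∷ reverse xs) , subst (\ u -> effect (inputAt e) ρ ([] , u , reverse xs) ([] , u , bitAt w i ∷ reverse xs)) (sym eq) (reading e ρ us (bitAt w i) rs (reverse xs) len) , cong (\ o -> [] , w , o) (appended xs (bitAt w i))

 outputTime : (o : Out 1) -> (∀ w -> Below (length w) o (length w ∷ [])) -> PolynomialTime (\ w -> output (bitAt w) o (length w ∷ []))
 outputTime o below = machine , fst time , \ w -> let
   t , e , r = emission-emits symbol inputAt (Rep w) (length w) (bitAt w) (\ b ρ {xs} -> symbol-emits w b ρ {xs})
    (\ b {xs} -> symbol-emits w b [] {xs}) (\ e ρ i< {xs} -> input-emits w e ρ i< {xs}) o (length w ∷ []) (below w) {[]} refl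
   k , c , k≤ , run , out = halts w (subst (E (length w) ([] , w , [])) r e)
  in k , c , k≤ ▹ snd time (length w) , run , out ~> List.reverse-involutive _ where
  P : Prog 1
  P = emission symbol inputAt o
  E : ℕ -> Store -> Store -> Set
  E n = effect P (n ∷ [])
  open Compile (command id P)
  open Correct (\ n -> cost P (n ∷ [])) E (\ n -> correct id P (n ∷ []) (n ∷ []) (\ _ -> refl))
  time : ∃[ b ] ∀ n -> 4 N.+ 2 N.* n N.+ 3 N.* cost P (n ∷ []) ≤ bound b n
  time = bounded⇒bound (\ ρ -> 4 N.+ 2 N.* lookup ρ 0F N.+ 3 N.* cost P (lookup ρ 0F ∷ []))
   (bounded-+ (bounded-+ (bounded-lit 4) (bounded-* (bounded-lit 2) (bounded-var 0F)))
   (bounded-* {g = \ ρ -> cost P (lookup ρ 0F ∷ [])} (bounded-lit 3) (bounded-≤ {f = \ ρ -> cost P (lookup ρ 0F ∷ [])} {cost P} (\ { (n ∷ []) -> N.≤-refl }) (bounded-cost P))))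

module BSSPrograms (R : Ring) (g : Bool) (Ok : CommutativeRing.Carrier R -> Set)
 (admissible : ∀ b -> Ok (if b then CommutativeRing.1# R else CommutativeRing.0# R)) where
 open CommutativeRing R hiding (zero; refl; sym) renaming (trans to infixr 5 _>>_)
 open BSSCompiler R
 import Data.Maybe as Maybe

 bit : Bool -> Carrier
 bit b = if b then 1# else 0#

 rename : ∀ {k m} -> (Fin k -> Fin m) -> Act g Ok k -> Act g Ok m
 rename σ (put z h) = put z h
 rename σ bump = bump
 rename σ (constant z h t) = constant z h (Maybe.map σ t)
 rename σ (compute op t x y) = compute op (Maybe.map σ t) (Maybe.map σ x) (Maybe.map σ y)
 rename σ (guess h t) = guess h (Maybe.map σ t)
 rename σ (same t x y) = same (Maybe.map σ t) (Maybe.map σ x) (Maybe.map σ y)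

 private
  place-map : ∀ {k m} {σ : Fin k -> Fin m} {ρ env} -> (∀ i -> lookup ρ (σ i) ≡ lookup env i) -> ∀ o x -> place ρ o (Maybe.map σ x) ≡ place env o x
  place-map reads o (just i) = reads i
  place-map reads o nothing = refl

 rename-effect : ∀ {k m} (σ : Fin k -> Fin m) (α : Act g Ok k) ρ env -> (∀ i -> lookup ρ (σ i) ≡ lookup env i) -> ∀ {s t} -> ⟦ rename σ α ⟧ᵃ ρ s t ⇔ ⟦ α ⟧ᵃ env s t
 rename-effect σ (put z h) ρ env reads = mk⇔ id id
 rename-effect σ bump ρ env reads = mk⇔ id id
 rename-effect {m = m} σ (constant z h t) ρ env reads {o , mem} rewrite place-map {σ = σ} {ρ} {env} reads o t = mk⇔ id id
 rename-effect σ (compute op t x y) ρ env reads {o , mem}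
  rewrite place-map {σ = σ} {ρ} {env} reads o t | place-map {σ = σ} {ρ} {env} reads o x | place-map {σ = σ} {ρ} {env} reads o y = mk⇔ id id
 rename-effect σ (guess h t) ρ env reads {o , mem} rewrite place-map {σ = σ} {ρ} {env} reads o t = mk⇔ id id
 rename-effect σ (same t x y) ρ env reads {o , mem}
  rewrite place-map {σ = σ} {ρ} {env} reads o t | place-map {σ = σ} {ρ} {env} reads o x | place-map {σ = σ} {ρ} {env} reads o y = mk⇔ id id

 emits : Bool -> Store -> Store -> Set
 emits b (o , m) t = t ≡ (suc o , write m o (bit b))

 emit-effect : ∀ b {k} (ρ : Vec ℕ k) {s t} -> ⟦_⟧ᵃ {g} {Ok} (put (bit b) (admissible b)) ρ s t ⇔ emits b s t
 emit-effect b ρ = mk⇔ id id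

 open Programs (Act g Ok) Store ⟦_⟧ᵃ rename rename-effect (\ b -> put (bit b) (admissible b)) emits emit-effect public
 open Emission (Act g Ok) Store ⟦_⟧ᵃ rename rename-effect (\ b -> put (bit b) (admissible b)) emits emit-effect Carrier bit public

module BSSEmission (R : Ring) where

 open CommutativeRing R hiding (zero; refl; sym) renaming (trans to infixr 5 _>>_)
 private module R = CommutativeRing R
 open BSS R
 open Formula
 open FormulaSemantics R using (nth)
 open BSSCompiler R
 open BSSPrograms R false (\ _ -> ⊤) (\ _ -> tt)
 open Output Carrier bit
 open RingSolver R
 open Polynomials
 open import Data.List.Relation.Binary.Pointwise as Pointwise using (Pointwise; []; _∷_)

 inputAt : ∀ {k} -> Ex k -> Prog k
 inputAt e = letE e (act (compute sub nothing (just 0F) (just 0F)) ⨾ act (compute add nothing nothing (just 0F)) ⨾ act bump)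

 symbol : Carrier -> ∀ {k} -> Prog k
 symbol z = act (put z tt)

 nth-++ˡ : ∀ xs {ys} i -> i < length xs -> nth (xs ++ ys) i ≡ nth xs i
 nth-++ˡ (x ∷ xs) zero _ = refl
 nth-++ˡ (x ∷ xs) (suc i) (s≤s i<) = nth-++ˡ xs i i<

 nth-++ʳ : ∀ xs {ys} i -> nth (xs ++ ys) (length xs N.+ i) ≡ nth ys i
 nth-++ʳ [] i = refl
 nth-++ʳ (x ∷ xs) i = nth-++ʳ xs i

 private
  record Rep (w : List Carrier) (xs : List Carrier) (s : Store) : Set where
   constructor represents
   field
    pointer : fst s ≡ length w N.+ length xs
    inputs  : ∀ i -> i < length w -> snd s i ≈ nth w i
    outputs : ∀ i -> i < length xs -> snd s (length w N.+ i) ≈ nth xs i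
  extended : ∀ {w xs o m} z {m'} -> Rep w xs (o , m) -> (∀ i -> i ≢ o -> m' i ≈ m i) -> m' o ≈ z -> Rep w (xs ++ z ∷ []) (suc o , m')
  extended {w} {xs} {o} {m} z {m'} (represents refl inputs outputs) others new = represents
   (sym (N.+-suc n (length xs)) ~> cong (n N.+_) (N.+-comm 1 (length xs) ~> sym (List.length-++ xs)))
   (\ i i< -> others i (N.<⇒≢ (N.<-≤-trans i< (N.m≤m+n n (length xs)))) >> inputs i i<)
   \ i i< -> out i (N.≤-pred (subst (i <_) (List.length-++ xs ~> N.+-comm (length xs) 1) i<)) (i N.≟ length xs) where
   n = length w
   out : ∀ i -> i ≤ length xs -> Dec (i ≡ length xs) -> m' (n N.+ i) ≈ nth (xs ++ z ∷ []) i
   out i _ (yes refl) = new >> R.reflexive (sym (cong (nth (xs ++ z ∷ [])) (sym (N.+-identityʳ (length xs))) ~> nth-++ʳ xs 0))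
   out i i≤ (no i≢) = let i< = N.≤∧≢⇒< i≤ i≢ in R.trans (others (n N.+ i) (i≢ ∘ N.+-cancelˡ-≡ n _ _))
    (outputs i i< >> R.reflexive (sym (nth-++ˡ xs i i<)))
  symbol-emits : ∀ w z {k} (ρ : Vec ℕ k) {xs s} -> Rep w xs s -> ∃[ t ] effect (symbol z) ρ s t × Rep w (xs ++ z ∷ []) t
  symbol-emits w z ρ {s = o , m} r = _ , refl , extended z r (\ i i≢ -> R.reflexive (write-other m o z i≢)) (R.reflexive (write-same m o z))
  input-emits : ∀ w {k} (e : Ex k) ρ -> ⟦ e ⟧e ρ < length w -> ∀ {xs s} -> Rep w xs s -> ∃[ t ] effect (inputAt e) ρ s t × Rep w (xs ++ nth w (⟦ e ⟧e ρ) ∷ []) t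
  input-emits w e ρ i< {xs} {o , m} r = (suc o , write m1 o z) , ((o , m1) , (x - x , R.refl , refl) , (o , write m1 o z) , (z , R.refl , refl) , refl) , extended (nth w i) r (\ j j≢ -> R.reflexive (write-other m1 o z j≢) >> R.reflexive (write-other m o (x - x) j≢))
   (R.reflexive (write-same m1 o z) >> +-cong (R.reflexive (write-same m o (x - x))) (R.reflexive (write-other m o (x - x) i≢o)) >> solve 1 (\ x -> (x :- x) :+ x := x) R.refl x >> Rep.inputs r i i<) where
   i = ⟦ e ⟧e ρ
   x = m i
   m1 = write m o (x - x)
   z = m1 o + m1 i
   i≢o : i ≢ o
   i≢o refl = N.<⇒≱ i< (N.m≤m+n (length w) (length xs) ▹ N.≤-reflexive (sym (Rep.pointer r)))
  tabulated : ∀ xs (m : ℕ -> Carrier) -> (∀ i -> i < length xs -> m i ≈ nth xs i) -> Pointwise _≈_ (applyUpTo m (length xs)) xs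
  tabulated [] m h = []
  tabulated (x ∷ xs) m h = h 0 (s≤s z≤n) ∷ tabulated xs (m ∘ suc) (\ i i< -> h (suc i) (s≤s i<))

 outputTime : (o : Out 1) -> (∀ w -> Below (length w) o (length w ∷ [])) -> PolynomialTime (\ w -> output (nth w) o (length w ∷ []))
 outputTime o below = machine , deterministic refl , (fst time , \ {w} run -> runs-within {w} run ▹ snd time (length w)) , \ w -> let
   n = length w
   xs = output (nth w) o (n ∷ [])
   t , e , r = emission-emits symbol inputAt (Rep w) n (nth w) (\ b ρ {xs} -> symbol-emits w b ρ {xs})
    (\ b {xs} -> symbol-emits w (bit b) [] {xs}) (\ e ρ i< {xs} -> input-emits w e ρ i< {xs}) o (n ∷ []) (below w)
    {[]} (represents (sym (N.+-identityʳ n)) (\ i _ -> R.refl) \ _ ())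
   k , c , run , acc , size≡ , cells = result w e
   len = N.+-cancelˡ-≡ n _ _ (size≡ ~> Rep.pointer r)
  in k , c , run , acc , subst (\ l -> Pointwise _≈_ (applyUpTo (Semantics.Config.memory c) l) xs) (sym len)
  (tabulated xs (Semantics.Config.memory c) \ i i< -> cells i (subst (i <_) (sym len) i<) >> Rep.outputs r i i<) where
  P : Prog 1
  P = emission symbol inputAt o
  open Compile (command id P) tt tt
  open Correct (\ n -> cost P (n ∷ [])) (\ n -> effect P (n ∷ [])) (\ n -> correct id P (n ∷ []) (n ∷ []) (\ _ -> refl))
  time : ∃[ b ] ∀ n -> 4 N.+ 6 N.* cost P (n ∷ []) ≤ bound b n
  time = bounded⇒bound (\ ρ -> 4 N.+ 6 N.* cost P (lookup ρ 0F ∷ [])) (bounded-+ (bounded-lit 4)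
   (bounded-* {g = \ ρ -> cost P (lookup ρ 0F ∷ [])} (bounded-lit 6) (bounded-≤ {f = \ ρ -> cost P (lookup ρ 0F ∷ [])} {cost P} (\ { (n ∷ []) -> N.≤-refl }) (bounded-cost P))))

module TermOutput (d' K : ℕ) where

 open Formula
 open Codes
 open Encoding d' K
 open import Data.Nat.Binary using (2[1+_])

 module _ {P : Atom ℕ -> Set} {Q : ℕ -> Set} where
  Within : ∀ {k} -> Template k -> Vec ℕ k -> Set
  Within (atom x) ρ = P (atomAt x ρ)
  Within (s ∧ₜ t) ρ = Within s ρ × Within t ρ
  Within (s ∨ₜ t) ρ = Within s ρ × Within t ρ
  Within (¬ₜ t) ρ = Within t ρ
  Within 0ₜ ρ = ⊤
  Within 1ₜ ρ = ⊤
  Within (bit e) ρ = Q (⟦ e ⟧e ρ)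
  Within (⋀ e t u) ρ = (∀ j -> j < ⟦ e ⟧e ρ -> Within t (j ∷ ρ)) × Within u ρ
  within-every : ∀ b {k} (t : Template k) ρ -> Within t ρ -> Everywhere P (inst b t ρ)
  within-every b (atom x) ρ h = h
  within-every b (s ∧ₜ t) ρ (h , h') = within-every b s ρ h , within-every b t ρ h'
  within-every b (s ∨ₜ t) ρ (h , h') = within-every b s ρ h , within-every b t ρ h'
  within-every b (¬ₜ t) ρ h = within-every b t ρ h
  within-every b 0ₜ ρ h = tt
  within-every b 1ₜ ρ h = tt
  within-every b (bit e) ρ h with b (⟦ e ⟧e ρ)
  ... | true = tt
  ... | false = tt
  within-every b (⋀ e t u) ρ (h , h') = go 0 (⟦ e ⟧e ρ) (\ i _ -> h i) where
   go : ∀ j c -> (∀ i -> j ≤ i -> i < j N.+ c -> Within t (i ∷ ρ)) -> Everywhere P (conjunction (\ j -> inst b t (j ∷ ρ)) j c (inst b u ρ))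
   go j zero h = within-every b u ρ h'
   go j (suc c) h = within-every b t (j ∷ ρ) (h j N.≤-refl (N.m<m+n j (s≤s z≤n))) , go (suc j) c (\ i j<i i< -> h i (N.<⇒≤ j<i) (subst (i <_) (sym (N.+-suc j c)) i<))
  module _ (frames : ∀ i -> P (frame i)) (links : ∀ i -> P (link i)) (unknowns : ∀ is -> P (unknown is)) (constants : ∀ c -> P (constant c)) where
   private
    within-l : ∀ {k} i (ρ : Vec ℕ k) -> Within (l i) ρ
    within-l i ρ = links i , frames i0 , frames i
    within-H : ∀ {k} i j (ρ : Vec ℕ k) -> Within (e i ∨ₜ e j) ρ
    within-H i j ρ = frames i , frames j
    within-all : ∀ n {k} (f : Fin n -> Template k) ρ -> (∀ i -> Within (f i) ρ) -> Within (allt n f) ρ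
    within-all zero f ρ h = tt
    within-all (suc n) f ρ h = h 0F , within-all n (f ∘ fsuc) ρ (h ∘ fsuc)
    within-any : ∀ n {k} (f : Fin n -> Template k) ρ -> (∀ i -> Within (f i) ρ) -> Within (anyt n f) ρ
    within-any zero f ρ h = tt
    within-any (suc n) f ρ h = h 0F , within-any n (f ∘ fsuc) ρ (h ∘ fsuc)
   within-frame : ∀ {k} (ρ : Vec ℕ k) -> Within framet ρ
   within-frame ρ = within-all d (\ j -> allt d (orthogonalt j)) ρ (\ j -> within-all d (orthogonalt j) ρ (orthogonal j)) , within-any d e ρ frames , within-all (suc (suc d')) linkedt ρ \ i ->
    (frames i0 , frames i0 , frames (fsuc i) , links (fsuc i)) , (frames (fsuc i) , frames (fsuc i) , frames i0 , links (fsuc i)) , (links (fsuc i) , frames i0) , links (fsuc i) , frames (fsuc i) where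
    orthogonal : ∀ j i -> Within (orthogonalt j i) ρ
    orthogonal j i with does (j ≟ᶠ i)
    ... | true = tt
    ... | false = frames j , frames j , frames i
   module _ (inputt : ∀ {k} -> Ex k -> Template k) (InputOK : ℕ -> Set)
    (within-input : ∀ {k} (x : Ex k) ρ -> InputOK (⟦ x ⟧e ρ) -> Within (inputt x) ρ) where
    within-tm : ∀ {k} (t : Tm K k) ρ -> TmInputs InputOK t ρ -> Within (tmt inputt t) ρ
    within-tm (var is) ρ h = completion , frames i0 , within-H i0 i1 ρ , completion
     where completion = (unknowns _ , within-H i0 i1 ρ) , frames i0 , unknowns _ , within-H i0 i1 ρ
    within-tm (inp x) ρ h = within-input x ρ h
    within-tm (con c) ρ h = constants c
    within-tm zero ρ h = frames i0
    within-tm one ρ h = within-l i1 ρ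
    within-tm (add s t) ρ (h , h') = (((within-tm s ρ h , frames i2) , within-l i2 ρ , frames i1) , (within-l i2 ρ , within-tm t ρ h') , within-H i2 i1 ρ) , within-H i0 i1 ρ
    within-tm (mul s t) ρ (h , h') = (((within-tm s ρ h , (within-l i2 ρ , within-l i1 ρ) , within-H i2 i1 ρ) , within-H i0 i2 ρ) , (within-l i2 ρ , within-tm t ρ h') , within-H i2 i1 ρ) , within-H i0 i1 ρ
    within-fm : ∀ {k} (φ : Fm K k) ρ -> FmInputs InputOK φ ρ -> Within (fmt inputt φ) ρ
    within-fm (equ s t) ρ (h , h') = ((within-tm s ρ h , within-tm t ρ h') , frames i1) , frames i0
    within-fm (and φ ψ) ρ (h , h') = within-fm φ ρ h , within-fm ψ ρ h'
    within-fm (not φ) ρ h = frames i0 , within-fm φ ρ h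
    within-fm (all x φ) ρ h = (\ j j< -> within-fm φ (j ∷ ρ) (h j j<)) , frames i0

 module _ (B : Set) (β : Bool -> B) where
  open Output B β
  module _ (atomOut : ∀ {k} -> Atom (Ex k) -> Out k) (bitOut : ∀ {k} -> Ex k -> Out k) where
   termOut : ∀ {k} -> Template k -> Out k
   termOut (atom x) = bits (true ∷ true ∷ []) ⊕ atomOut x
   termOut (s ∧ₜ t) = bits (false ∷ true ∷ true ∷ []) ⊕ termOut s ⊕ termOut t
   termOut (s ∨ₜ t) = bits (false ∷ true ∷ false ∷ []) ⊕ termOut s ⊕ termOut t
   termOut (¬ₜ t) = bits (true ∷ false ∷ []) ⊕ termOut t
   termOut 0ₜ = bits (false ∷ false ∷ false ∷ [])
   termOut 1ₜ = bits (false ∷ false ∷ true ∷ [])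
   termOut (bit e) = bits (false ∷ false ∷ []) ⊕ bitOut e
   termOut (⋀ e t u) = rep e (bits (false ∷ true ∷ true ∷ []) ⊕ termOut t) ⊕ termOut u
   output-term : ∀ w b (c : Atom ℕ -> List Bool) -> (∀ {k} (x : Atom (Ex k)) ρ -> output w (atomOut x) ρ ≡ map β (c (atomAt x ρ))) -> (∀ {k} (e : Ex k) ρ -> output w (bitOut e) ρ ≡ β (b (⟦ e ⟧e ρ)) ∷ []) ->
    ∀ {k} (t : Template k) ρ -> output w (termOut t) ρ ≡ map β (⟨ inst b t ρ ⟩ c)
   output-term w b c atoms inputs = go where
    join : ∀ (u v : List Bool) {xs ys} -> xs ≡ map β u -> ys ≡ map β v -> xs ++ ys ≡ map β (u ++ v)
    join u v p q = cong₂ _++_ p q ~> sym (List.map-++ β u v)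
    go : ∀ {k} (t : Template k) ρ -> output w (termOut t) ρ ≡ map β (⟨ inst b t ρ ⟩ c)
    go (atom x) ρ = cong (\ u -> β true ∷ β true ∷ u) (atoms x ρ)
    go (s ∧ₜ t) ρ = cong (\ u -> β false ∷ β true ∷ β true ∷ u) (join (⟨ inst b s ρ ⟩ c) _ (go s ρ) (go t ρ))
    go (s ∨ₜ t) ρ = cong (\ u -> β false ∷ β true ∷ β false ∷ u) (join (⟨ inst b s ρ ⟩ c) _ (go s ρ) (go t ρ))
    go (¬ₜ t) ρ = cong (\ u -> β true ∷ β false ∷ u) (go t ρ)
    go 0ₜ ρ = refl
    go 1ₜ ρ = refl
    go (bit e) ρ with b (⟦ e ⟧e ρ) | inputs e ρ
    ... | true | eq = cong (\ u -> β false ∷ β false ∷ u) eq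
    ... | false | eq = cong (\ u -> β false ∷ β false ∷ u) eq
    go (⋀ e t u) ρ = loop 0 (⟦ e ⟧e ρ) where
     f : ℕ -> Term (Atom ℕ)
     f j = inst b t (j ∷ ρ)
     h : ℕ -> List B
     h j = output w (bits (false ∷ true ∷ true ∷ []) ⊕ termOut t) (j ∷ ρ)
     loop : ∀ j c' -> repeat h j c' ++ output w (termOut u) ρ ≡ map β (⟨ conjunction f j c' (inst b u ρ) ⟩ c)
     loop j zero = go u ρ
     loop j (suc c') = List.++-assoc (h j) (repeat h (suc j) c') _ ~> cong (\ v -> β false ∷ β true ∷ β true ∷ v) (join (⟨ f j ⟩ c) _ (go t (j ∷ ρ)) (loop (suc j) c'))
   below-term : ∀ n {P : Atom ℕ -> Set} {Q : ℕ -> Set} -> (∀ {k} (x : Atom (Ex k)) ρ -> Below n (atomOut x) ρ) -> (∀ {k} (e : Ex k) ρ -> Q (⟦ e ⟧e ρ) -> Below n (bitOut e) ρ) -> ∀ {k} (t : Template k) ρ -> Within {P} {Q} t ρ -> Below n (termOut t) ρ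
   below-term n {P} {Q} atoms inputs = go where
    go : ∀ {k} (t : Template k) ρ -> Within {P} {Q} t ρ -> Below n (termOut t) ρ
    go (atom x) ρ h = below-bits n (true ∷ true ∷ []) ρ , atoms x ρ
    go (s ∧ₜ t) ρ (h , h') = below-bits n (false ∷ true ∷ true ∷ []) ρ , go s ρ h , go t ρ h'
    go (s ∨ₜ t) ρ (h , h') = below-bits n (false ∷ true ∷ false ∷ []) ρ , go s ρ h , go t ρ h'
    go (¬ₜ t) ρ h = below-bits n (true ∷ false ∷ []) ρ , go t ρ h
    go 0ₜ ρ h = below-bits n (false ∷ false ∷ false ∷ []) ρ
    go 1ₜ ρ h = below-bits n (false ∷ false ∷ true ∷ []) ρ
    go (bit e) ρ h = below-bits n (false ∷ false ∷ []) ρ , inputs e ρ h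
    go (⋀ e t u) ρ (h , h') = (\ j j< -> below-bits n (false ∷ true ∷ true ∷ []) (j ∷ ρ) , go t (j ∷ ρ) (h j j<)) , go u ρ h'
  tupleOut : ∀ {k} -> List (Ex k) -> Out k
  tupleOut [] = bits (false ∷ [])
  tupleOut (e ∷ es) = rep e (bits (true ∷ true ∷ [])) ⊕ bits (true ∷ false ∷ []) ⊕ tupleOut es
  output-tuple : ∀ w {k} (es : List (Ex k)) ρ -> output w (tupleOut es) ρ ≡ map β (numberCode (tuple (⟦ es ⟧ⁿ ρ)))
  output-tuple w es ρ = go es ~> cong (map β ∘ digitCode) (sym (fromℕ-toℕ (tupleᵇ (⟦ es ⟧ⁿ ρ)))) where
   go : ∀ es -> output w (tupleOut es) ρ ≡ map β (digitCode (tupleᵇ (⟦ es ⟧ⁿ ρ)))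
   go [] = refl
   go (e ∷ es) = blocks 0 (⟦ e ⟧e ρ) where
    blocks : ∀ j u -> repeat (\ j -> output w (bits (true ∷ true ∷ [])) (j ∷ ρ)) j u ++ output w (bits (true ∷ false ∷ []) ⊕ tupleOut es) ρ
     ≡ map β (digitCode (ones u 2[1+ tupleᵇ (⟦ es ⟧ⁿ ρ) ]))
    blocks j zero = cong (\ v -> β true ∷ β false ∷ v) (go es)
    blocks j (suc u) = cong (\ v -> β true ∷ β true ∷ v) (blocks (suc j) u)
  below-tuple : ∀ n {k} (es : List (Ex k)) ρ -> Below n (tupleOut es) ρ
  below-tuple n [] ρ = below-bits n (false ∷ []) ρ
  below-tuple n (e ∷ es) ρ = (\ j _ -> below-bits n (true ∷ true ∷ []) (j ∷ ρ)) , below-bits n (true ∷ false ∷ []) ρ , below-tuple n es ρ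

module TuringReduction
 (em : EM) (R : Ring) (real : FormallyReal R) (d' : ℕ) where
 open Formula
 open FormulaSemantics R
 open Encoding d' 0
 open Codes
 open Subspaces R d renaming (⊥ to 0ᴸ; ⊤ to 1ᴸ)
 open Gadgets em R real d
 open EncodingSemantics em R real d' 0
 open StandardFrame em R real d' 0
 open RingLaws R
 open BSS R using (embed)
 open TermOutput d' 0
 open Output Bool id
 open TuringEmission using (bitAt; outputTime)

 module _ {I : Set} (number : ℕ -> I) where
  indices : Atom I -> List I
  indices (frame i) = number 0 ∷ number (toℕ i) ∷ []
  indices (link i) = number 1 ∷ number (toℕ i) ∷ []
  indices (unknown is) = number 2 ∷ is
  indices (constant ())
  indices (input i) = number 3 ∷ i ∷ []

 name : Atom ℕ -> ℕ
 name = tuple ∘ indices id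

 name-injective : ∀ {x y} -> name x ≡ name y -> x ≡ y
 name-injective {x} {y} eq = indices-inj x y (tuple-injective (indices id x) (indices id y) eq) where
  indices-inj : ∀ x y -> indices id x ≡ indices id y -> x ≡ y
  indices-inj (frame i) (frame j) eq = cong frame (Fin.toℕ-injective (List.∷-injectiveˡ (List.∷-injectiveʳ eq)))
  indices-inj (link i) (link j) eq = cong link (Fin.toℕ-injective (List.∷-injectiveˡ (List.∷-injectiveʳ eq)))
  indices-inj (unknown is) (unknown js) eq = cong unknown (List.∷-injectiveʳ eq)
  indices-inj (input i) (input j) eq = cong input (List.∷-injectiveˡ (List.∷-injectiveʳ eq))
  indices-inj (frame _) (link _) ()
  indices-inj (frame _) (unknown _) ()
  indices-inj (frame _) (input _) ()
  indices-inj (link _) (frame _) ()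
  indices-inj (link _) (unknown _) ()
  indices-inj (link _) (input _) ()
  indices-inj (unknown _) (frame _) ()
  indices-inj (unknown _) (link _) ()
  indices-inj (unknown _) (input _) ()
  indices-inj (input _) (frame _) ()
  indices-inj (input _) (link _) ()
  indices-inj (input _) (unknown _) ()
  indices-inj (constant ()) _
  indices-inj _ (constant ())

 indicesAt : ∀ {k} (x : Atom (Ex k)) ρ -> ⟦ indices lit x ⟧ⁿ ρ ≡ indices id (atomAt x ρ)
 indicesAt (frame i) ρ = refl
 indicesAt (link i) ρ = refl
 indicesAt (unknown is) ρ = refl
 indicesAt (constant ())
 indicesAt (input i) ρ = refl

 module _ (φ : Fm 0 1) (below : ∀ n -> FmInputs (_< n) φ (n ∷ [])) where
  instancet : Template 1
  instancet = framet ∧ₜ (¬ₜ e i0 ∨ₜ fmt bitt φ)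
  instanceOut : Out 1
  instanceOut = termOut Bool id (\ x -> tupleOut Bool id (indices lit x)) inp instancet
  instanceBelow : ∀ n -> Below n instanceOut (n ∷ [])
  instanceBelow n = below-term Bool id (\ x -> tupleOut Bool id (indices lit x)) inp n {\ _ -> ⊤} {_< n}
   (\ x ρ -> below-tuple Bool id n (indices lit x) ρ) (\ e ρ h -> h) instancet (n ∷ [])
   (within-frame (\ _ -> tt) (\ _ -> tt) (\ _ -> tt) (\ _ -> tt) (n ∷ []) , tt , within-fm (\ _ -> tt) (\ _ -> tt) (\ _ -> tt) (\ _ -> tt) bitt (_< n) (\ x ρ h -> (h , tt , tt , tt) , h , tt) φ (n ∷ []) (below n))
  reduction : List Bool -> List Bool
  reduction w = output (bitAt w) instanceOut (length w ∷ [])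
  reduction-time : Turing.PolynomialTime reduction
  reduction-time = outputTime instanceOut (\ w -> instanceBelow (length w))
  module _ (w : List Bool) where
   private
    b = bitAt w
    T : Term (Atom ℕ)
    T = inst b instancet (length w ∷ [])
    reduced : reduction w ≡ ⟨ mapTerm name T ⟩ numberCode
    reduced = (output-term Bool id (\ x -> tupleOut Bool id (indices lit x)) inp b b (numberCode ∘ name)
     (\ x ρ -> output-tuple Bool id b (indices lit x) ρ ~> cong (\ is -> map id (numberCode (tuple is))) (indicesAt x ρ))
     (\ e ρ -> refl) instancet (length w ∷ []) ~> List.map-id (⟨ T ⟩ (numberCode ∘ name))) ~> code-map name {numberCode ∘ name} {numberCode} T (everywhere {P = \ x -> numberCode (name x) ≡ numberCode (name x)} (\ _ -> refl) T)
    bit-nth : ∀ w i -> (if bitAt w i then 1# else 0#) ≡ nth (embed w) i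
    bit-nth [] i = refl
    bit-nth (b ∷ w) zero = refl
    bit-nth (b ∷ w) (suc i) = bit-nth w i
    input-point : ∀ a B -> InFrame b a B -> ∀ {k} (x : Ex k) ρ -> ⟪_⟫ b a (bitt x) ρ ≐ Basis.point B i0 i1 (nth (embed w) (⟦ x ⟧e ρ))
    input-point a B inFrame x ρ = ≐-trans (bit-point b a B inFrame x ρ) (Basis.point-cong B (eq≈ (bit-nth w (⟦ x ⟧e ρ))))
   reduction-sound : ∀ κ -> SAT 𝐋 (reduction w) -> Solvable κ φ (embed w)
   reduction-sound κ sat = let u , h = solution in
    u , subst (\ n -> Holds κ (nth (embed w)) u φ (n ∷ [])) (sym (List.length-map _ w)) h where
    parsed = fwd (SAT⇔ 𝐋) sat
    T' = fst parsed
    α = fst (snd (snd parsed))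
    a : Atom ℕ -> Subspace
    a = α ∘ name
    T'≡ : T' ≡ mapTerm name T
    T'≡ = fst (readable numberCode numberCode-free T' (mapTerm name T) [] []
     (cong (_++ []) (sym (fst (snd parsed)) ~> reduced)))
    full : Full (eval 𝐋 T a)
    full = subst Full (cong (\ t -> eval 𝐋 t α) T'≡ ~> eval-map 𝐋 name T α)
     (\ x -> bwd (snd (snd (snd parsed)) x) (\ _ -> rfl))
    ρ = length w ∷ []
    framed = frame-basis b a ρ (fwd (frame-laws b a ρ) (\ x -> fst (full x)))
    solution : ∃[ u ] Holds κ (nth (embed w)) u φ ρ
    solution = full⇒holds b a (fst framed) (snd framed) κ (nth (embed w)) bitt (input-point a (fst framed) (snd framed)) (\ ()) φ ρ
     (\ x -> snd (full x))
   reduction-complete : ∀ κ -> Solvable κ φ (embed w) -> SAT 𝐋 (reduction w)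
   reduction-complete κ (u , h) = bwd (SAT⇔ 𝐋) (mapTerm name T , reduced , α , \ x -> mk⇔ (\ _ _ -> rfl) \ _ -> subst Full (sym (eval-map 𝐋 name T α ~> eval-cong 𝐋 T (snd extended))) full x) where
    a : Atom ℕ -> Subspace
    a (frame i) = line (Basis.vector standard i)
    a (link i) = Basis.point standard i0 i 1#
    a (unknown is) = Basis.point standard i0 i1 (u is)
    a _ = 0ᴸ
    extended = extend em name name-injective 0ᴸ a
    α = fst extended
    ρ = length w ∷ []
    inFrame : InFrame b a standard
    inFrame = basis-inFrame b a standard (\ _ -> ≐-refl) (\ _ _ -> ≐-refl)
    full : Full (eval 𝐋 T a)
    full x = bwd (frame-laws b a ρ) (basis-laws b a standard (\ _ -> ≐-refl) (\ _ _ -> ≐-refl) ρ (standard-total b a (\ _ -> ≐-refl) ρ)) x , holds⇒full b a standard inFrame κ (nth (embed w)) bitt (input-point a standard inFrame) (\ ()) u (\ _ -> ≐-refl) φ ρ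
     (subst (\ n -> Holds κ (nth (embed w)) u φ (n ∷ [])) (List.length-map _ w) h) x

module Instances (em : EM) (R : Ring) (1≉0 : ¬ CommutativeRing._≈_ R (CommutativeRing.1# R) (CommutativeRing.0# R)) (d' : ℕ) where

 open Classical em
 open Codes
 open RingLaws R
 open BSS R using (embed)
 open Subspaces R (suc d') renaming (⊥ to 0ᴸ; ⊤ to 1ᴸ)
 import Data.Fin as Fin
 import Data.List as List
 import Data.Sum as Sum
 import Data.Vec.Functional as Vector
 open import Data.List.Relation.Binary.Pointwise as Pointwise using (Pointwise; []; _∷_)
 open import Data.List.Relation.Binary.Equality.Setoid setoid using (_≋_; ≋-refl; ≋-sym; ≋-trans; ≋-reflexive)

 private
  d = suc d'

 matrixAt : List Matrix -> ℕ -> Matrix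
 matrixAt = nthOr (\ _ _ -> 0#)

 blocks : List Matrix -> List Carrier
 blocks = concat ∘ map encodeMatrix

 InRange : ℕ -> ℕ ⊎ ℕ -> Set
 InRange m (inl i) = ⊤
 InRange m (inr j) = j < m

 subspaces : (ℕ -> Matrix) -> (ℕ -> Matrix) -> ℕ ⊎ ℕ -> Subspace
 subspaces α M (inl i) = range (α i)
 subspaces α M (inr j) = range (M j)

 Instance : List Carrier -> Set
 Instance w = Σ (Term (ℕ ⊎ ℕ)) \ t -> Σ (List Matrix) \ Cs -> w ≋ embed (⟨ t ⟩ pairCode) ++ blocks Cs × Everywhere (InRange (length Cs)) t ×
  Σ (ℕ -> Matrix) \ α -> ∀ x -> x ∈ eval 𝐋 t (subspaces α (matrixAt Cs))

 SAT-constants⇔ : ∀ {w} -> SAT-constants w ⇔ Instance w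
 SAT-constants⇔ {w} = mk⇔ to' from' where
  numbers : ∀ {n m} -> Fin n ⊎ Fin m -> ℕ ⊎ ℕ
  numbers = Sum.map toℕ toℕ
  fill : ∀ {n m} (t : Term (Fin n ⊎ Fin m)) α Cs (b : Fin n ⊎ Fin m -> Subspace) -> (∀ v -> v ∈ eval 𝐋 t b ⇔ v ∈ 1ᴸ) -> (∀ i -> range (α (toℕ i)) ≡ b (inl i)) -> (∀ j -> range (matrixAt Cs (toℕ j)) ≡ b (inr j)) -> ∀ v -> v ∈ eval 𝐋 (mapTerm numbers t) (subspaces α (matrixAt Cs))
  fill t α Cs b full h h' v = subst (\ U -> v ∈ U) (sym (eval-map 𝐋 numbers t (subspaces α (matrixAt Cs)) ~> eval-cong 𝐋 t pointwise))
   (bwd (full v) (\ _ -> rfl)) where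
   pointwise : ∀ x -> subspaces α (matrixAt Cs) (numbers x) ≡ b x
   pointwise (inl i) = h i
   pointwise (inr j) = h' j
  empty : ∀ {n m} (t : Term (Fin n ⊎ Fin m)) α Cs (b : Fin n ⊎ Fin m -> Subspace) -> (∀ v -> v ∈ eval 𝐋 (mapTerm numbers t) (subspaces α (matrixAt Cs))) -> (∀ i -> range (α (toℕ i)) ≡ b (inl i)) -> (∀ j -> range (matrixAt Cs (toℕ j)) ≡ b (inr j)) -> ∀ v -> v ∈ eval 𝐋 t b ⇔ v ∈ 1ᴸ
  empty t α Cs b full h h' v = mk⇔ (\ _ _ -> rfl) \ _ -> subst (\ U -> v ∈ U)
   (eval-map 𝐋 numbers t (subspaces α (matrixAt Cs)) ~> eval-cong 𝐋 t pointwise) (full v) where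
   pointwise : ∀ x -> subspaces α (matrixAt Cs) (numbers x) ≡ b x
   pointwise (inl i) = h i
   pointwise (inr j) = h' j
  matrixAt-tab : ∀ {m} (C : Fin m -> Matrix) j -> matrixAt (tabulate C) (toℕ j) ≡ C j
  matrixAt-tab C 0F = refl
  matrixAt-tab C (fsuc j) = matrixAt-tab (C ∘ fsuc) j
  to' : SAT-constants w -> Instance w
  to' (lift (n , m , t , C , eq , A , full)) = mapTerm numbers t , Cs , ≋-trans eq (≋-reflexive code≡) , in-range t , (\ i -> matrixAt (tabulate A) i) ,
   fill t (matrixAt (tabulate A)) Cs _ full (\ i -> cong range {matrixAt (tabulate A) (toℕ i)} {A i} (matrixAt-tab A i)) (\ j -> cong range {matrixAt Cs (toℕ j)} {C j} (matrixAt-tab C j)) where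
   Cs = tabulate C
   code≡ : encodeInstance t C ≡ embed (⟨ mapTerm numbers t ⟩ pairCode) ++ blocks Cs
   code≡ = cong₂ (\ u v -> embed u ++ concat v) (code-map numbers t (everywhere sumCode≡ t)) (sym (List.map-tabulate C encodeMatrix))
   in-range : (t : Term (Fin n ⊎ Fin m)) -> Everywhere (InRange (length Cs)) (mapTerm numbers t)
   in-range t = every-mapTerm numbers t (everywhere (\
    { (inl i) -> tt ; (inr j) -> subst (toℕ j <_) (sym (List.length-tabulate C)) (Fin.toℕ<n j) }) t)
  matrixAt-lookup : ∀ Cs j -> matrixAt Cs (toℕ j) ≡ List.lookup Cs j
  matrixAt-lookup (C ∷ Cs) 0F = refl
  matrixAt-lookup (C ∷ Cs) (fsuc j) = matrixAt-lookup Cs j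
  from' : Instance w -> SAT-constants w
  from' (t , Cs , eq , inRange , α , full) = lift (suc n , length Cs , t' , List.lookup Cs , ≋-trans eq (≋-reflexive code≡) ,
   α ∘ toℕ , empty t' α Cs _ (subst (\ t -> ∀ v -> v ∈ eval 𝐋 t (subspaces α (matrixAt Cs))) (sym same) full) (\ i -> refl) (\ j -> cong range {matrixAt Cs (toℕ j)} {List.lookup Cs j} (matrixAt-lookup Cs j))) where
   size : ℕ ⊎ ℕ -> ℕ
   size = Sum.[ id , (\ _ -> 0) ]
   n = fst (bounded-by size t)
   preimages : ∀ x -> InRange (length Cs) x -> size x ≤ n -> ∃[ y ] numbers {suc n} {length Cs} y ≡ x
   preimages (inl i) _ i≤ = inl (Fin.fromℕ< (s≤s i≤)) , cong inl (Fin.toℕ-fromℕ< (s≤s i≤))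
   preimages (inr j) j< _ = inr (Fin.fromℕ< j<) , cong inr (Fin.toℕ-fromℕ< j<)
   lifted = preimage-of numbers t (every-zip preimages t inRange (snd (bounded-by size t)))
   t' = fst lifted
   same : mapTerm numbers t' ≡ t
   same = snd lifted
   code≡ : embed (⟨ t ⟩ pairCode) ++ blocks Cs ≡ encodeInstance t' (List.lookup Cs)
   code≡ = cong₂ (\ u v -> embed u ++ concat v)
    (cong (\ t -> ⟨ t ⟩ pairCode) (sym same) ~> sym (code-map numbers t' (everywhere sumCode≡ t')))
    (cong (map encodeMatrix) (sym (List.tabulate-lookup Cs)) ~> List.map-tabulate (List.lookup Cs) encodeMatrix)

 unbit : Carrier -> Bool
 unbit x = does (dec (x ≈ 1#))

 unbit-cong : ∀ {x y} -> x ≈ y -> unbit x ≡ unbit y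
 unbit-cong {x} {y} x≈y with dec (x ≈ 1#) | dec (y ≈ 1#)
 ... | yes _ | yes _ = refl
 ... | no _ | no _ = refl
 ... | yes p | no q = ⊥-elim (q (symm x≈y >> p))
 ... | no p | yes q = ⊥-elim (p (x≈y >> q))

 unbit-embed : ∀ u -> map unbit (embed u) ≡ u
 unbit-embed [] = refl
 unbit-embed (true ∷ u) = cong₂ _∷_ (dec-true (dec (1# ≈ 1#)) rfl) (unbit-embed u)
 unbit-embed (false ∷ u) = cong₂ _∷_ (dec-false (dec (0# ≈ 1#)) (1≉0 ∘ symm)) (unbit-embed u)

 unbits : ∀ {u v} -> u ≋ v -> map unbit u ≡ map unbit v
 unbits [] = refl
 unbits (p ∷ ps) = cong₂ _∷_ (unbit-cong p) (unbits ps)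

 terms-readable : ∀ s t {u v} -> embed (⟨ s ⟩ pairCode) ++ u ≋ embed (⟨ t ⟩ pairCode) ++ v -> s ≡ t × u ≋ v
 terms-readable s t {u} {v} eq = same , Pointwise.++-cancelˡ (embed (⟨ t ⟩ pairCode)) (subst (\ s -> embed (⟨ s ⟩ pairCode) ++ u ≋ _) same eq) where
  same : s ≡ t
  same = fst (readable pairCode pairCode-free s t (map unbit u) (map unbit v)
   (sym (unembed s u) ~> unbits eq ~> unembed t v)) where
   unembed : ∀ s u -> map unbit (embed (⟨ s ⟩ pairCode) ++ u) ≡ ⟨ s ⟩ pairCode ++ map unbit u
   unembed s u = List.map-++ unbit (embed (⟨ s ⟩ pairCode)) u ~> cong (_++ map unbit u) (unbit-embed (⟨ s ⟩ pairCode))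

 _≈ᴹ_ : Rel Matrix 0ℓ
 C ≈ᴹ C' = ∀ i j -> C i j ≈ C' i j

 concat-combine : (C : Matrix) -> ∀ i j -> Vector.concat C (Fin.combine i j) ≡ C i j
 concat-combine C i j = cong (\ (i , j) -> C i j) (Fin.remQuot-combine {d} i j)

 length-encodeMatrix : ∀ C -> length (encodeMatrix C) ≡ d N.* d
 length-encodeMatrix C = List.length-tabulate (Vector.concat C)

 blocks-injective : ∀ Cs Cs' -> blocks Cs ≋ blocks Cs' -> Pointwise _≈ᴹ_ Cs Cs'
 blocks-injective [] [] _ = []
 blocks-injective (C ∷ Cs) (C' ∷ Cs') eq = entries (fst parts) ∷ blocks-injective Cs Cs' (snd parts) where
  split : ∀ us us' {vs vs'} -> length us ≡ length us' -> us ++ vs ≋ us' ++ vs' -> us ≋ us' × vs ≋ vs'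
  split [] [] _ eq = [] , eq
  split (u ∷ us) (u' ∷ us') len (p ∷ eq) = let q , r = split us us' (N.suc-injective len) eq in p ∷ q , r
  tabulated : ∀ {n} {f g : Fin n -> Carrier} -> tabulate f ≋ tabulate g -> ∀ i -> f i ≈ g i
  tabulated (p ∷ ps) 0F = p
  tabulated {f = f} {g} (p ∷ ps) (fsuc i) = tabulated {f = f ∘ fsuc} {g ∘ fsuc} ps i
  parts : encodeMatrix C ≋ encodeMatrix C' × blocks Cs ≋ blocks Cs'
  parts = split (encodeMatrix C) (encodeMatrix C') (length-encodeMatrix C ~> sym (length-encodeMatrix C')) eq
  entries : encodeMatrix C ≋ encodeMatrix C' -> C ≈ᴹ C'
  entries eq i j = eq≈ (sym (concat-combine C i j)) >> tabulated {f = Vector.concat C} {Vector.concat C'} eq (Fin.combine i j) >> eq≈ (concat-combine C' i j)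

module Congruence
 (em : EM) (R : Ring) (real : FormallyReal R) (d : ℕ) where
 open Codes
 open Subspaces R d renaming (⊥ to 0ᴸ; ⊤ to 1ᴸ)
 open Gadgets em R real d

 eval-≐ : ∀ {X} t {a a' : X -> Subspace} -> Everywhere (\ x -> a x ≐ a' x) t -> eval 𝐋 t a ≐ eval 𝐋 t a'
 eval-≐ (var x) h = h
 eval-≐ (s ∧ᵗ t) (h , h') = ∩-cong (eval-≐ s h) (eval-≐ t h')
 eval-≐ (s ∨ᵗ t) (h , h') = ⊕-cong (eval-≐ s h) (eval-≐ t h')
 eval-≐ (¬ᵗ t) h = ^⊥-cong (eval-≐ t h)
 eval-≐ 0ᵗ h = ≐-refl
 eval-≐ 1ᵗ h = ≐-refl

module BSSReduction
 (em : EM) (R : Ring) (real : FormallyReal R) (d' K : ℕ) where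
 open Formula
 open FormulaSemantics R
 open Encoding d' K
 open Codes
 open Subspaces R d renaming (⊥ to 0ᴸ; ⊤ to 1ᴸ)
 open Euclidean em R real d using (·-cong)
 open Gadgets em R real d
 open Congruence em R real d
 open EncodingSemantics em R real d' K
 open StandardFrame em R real d' K
 open Instances em R (FormallyReal.1≉0 real) (suc (suc d'))
 open RingLaws R
 open BSS R using (embed; PolynomialTime)
 open TermOutput d' K
 open BSSEmission R using (outputTime)
 import Data.List as List
 import Data.Vec.Functional as Vector
 open import Data.List.Relation.Binary.Pointwise as Pointwise using (Pointwise; []; _∷_)
 open import Data.List.Relation.Binary.Equality.Setoid setoid using (_≋_; ≋-refl; ≋-sym; ≋-trans; ≋-reflexive)

 private
  symbol : Bool -> Carrier
  symbol b = if b then 1# else 0#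

 open Output Carrier symbol renaming (_⊕_ to _⊞_)

 name : Atom ℕ -> ℕ ⊎ ℕ
 name (unknown is) = inl (tuple is)
 name (frame i) = inr (toℕ i)
 name (link i) = inr (d N.+ toℕ i)
 name (constant c) = inr (d N.+ (d N.+ toℕ c))
 name (input i) = inr (d N.+ (d N.+ (K N.+ i)))

 nameOut : ∀ {k} -> Atom (Ex k) -> Out k
 nameOut (unknown is) = lit 0# ⊞ tupleOut Carrier symbol is
 nameOut (frame i) = lit 1# ⊞ num (lit (toℕ i))
 nameOut (link i) = lit 1# ⊞ num (lit (d N.+ toℕ i))
 nameOut (constant c) = lit 1# ⊞ num (lit (d N.+ (d N.+ toℕ c)))
 nameOut (input e) = lit 1# ⊞ num (lit d ⊹ (lit d ⊹ (lit K ⊹ e)))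

 output-name : ∀ w {k} (x : Atom (Ex k)) ρ -> output w (nameOut x) ρ ≡ embed (pairCode (name (atomAt x ρ)))
 output-name w (unknown is) ρ = cong (0# ∷_) (output-tuple Carrier symbol w is ρ)
 output-name w (frame i) ρ = refl
 output-name w (link i) ρ = refl
 output-name w (constant c) ρ = refl
 output-name w (input e) ρ = refl

 below-name : ∀ n {k} (x : Atom (Ex k)) ρ -> Below n (nameOut x) ρ
 below-name n (unknown is) ρ = tt , below-tuple Carrier symbol n is ρ
 below-name n (frame i) ρ = tt , tt
 below-name n (link i) ρ = tt , tt
 below-name n (constant c) ρ = tt , tt
 below-name n (input e) ρ = tt , tt

 sequence : ∀ {k N} -> (Fin N -> Out k) -> Out k
 sequence {N = zero} f = []
 sequence {N = suc N} f = f 0F ⊞ sequence (f ∘ fsuc)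

 output-sequence : ∀ w {k} ρ {N} (f : Fin N -> Out k) g -> (∀ i -> output w (f i) ρ ≡ g i) -> output w (sequence f) ρ ≡ concat (tabulate g)
 output-sequence w ρ {zero} f g h = refl
 output-sequence w ρ {suc N} f g h = cong₂ _++_ (h 0F) (output-sequence w ρ (f ∘ fsuc) (g ∘ fsuc) (h ∘ fsuc))

 below-sequence : ∀ n {k} ρ {N} (f : Fin N -> Out k) -> (∀ i -> Below n (f i) ρ) -> Below n (sequence f) ρ
 below-sequence n ρ {zero} f h = tt
 below-sequence n ρ {suc N} f h = h 0F , below-sequence n ρ (f ∘ fsuc) (h ∘ fsuc)

 matrixOut : ∀ {k} -> (Fin d -> Fin d -> Out k) -> Out k
 matrixOut C = sequence (Vector.concat C)

 output-matrix : ∀ w {k} ρ (C : Fin d -> Fin d -> Out k) M -> (∀ i j -> output w (C i j) ρ ≡ M i j ∷ []) -> output w (matrixOut C) ρ ≡ encodeMatrix M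
 output-matrix w ρ C M h = output-sequence w ρ (Vector.concat C) (\ i -> Vector.concat M i ∷ []) (\ i -> h _ _) ~> singletons (Vector.concat M) where
  singletons : ∀ {N} (g : Fin N -> Carrier) -> concat (tabulate (\ i -> g i ∷ [])) ≡ tabulate g
  singletons {zero} g = refl
  singletons {suc N} g = cong (g 0F ∷_) (singletons (g ∘ fsuc))

 constantOut : ∀ {k} -> Matrix -> Out k
 constantOut M = matrixOut (\ i j -> lit (M i j))

 scalarOut : ∀ {k} -> Ex k -> Fin d -> Fin d -> Out k
 scalarOut e 1F 0F = inp e
 scalarOut e i j = lit (column (scalarVec 0#) i j)

 private
  matrixAt-tab : ∀ {N} (f : Fin N -> Matrix) Ds i -> nthOr (\ _ _ -> 0#) (tabulate f ++ Ds) (toℕ i) ≡ f i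
  matrixAt-tab f Ds 0F = refl
  matrixAt-tab f Ds (fsuc i) = matrixAt-tab (f ∘ fsuc) Ds i
  matrixAt-++ : ∀ {N} (f : Fin N -> Matrix) Ds j -> nthOr (\ _ _ -> 0#) (tabulate f ++ Ds) (N N.+ j) ≡ nthOr (\ _ _ -> 0#) Ds j
  matrixAt-++ {zero} f Ds j = refl
  matrixAt-++ {suc N} f Ds j = matrixAt-++ (f ∘ fsuc) Ds j
  matrixAt-applyUpTo : ∀ (f : ℕ -> Matrix) {i n} -> i < n -> nthOr (\ _ _ -> 0#) (applyUpTo f n) i ≡ f i
  matrixAt-applyUpTo f {zero} {suc n} _ = refl
  matrixAt-applyUpTo f {suc i} {suc n} (s≤s i<) = matrixAt-applyUpTo (f ∘ suc) i<

 module _ {D N} (f g : Fin D -> Matrix) (h : Fin N -> Matrix) (Ds : List Matrix) where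
  private
   list : List Matrix
   list = (tabulate f ++ tabulate g ++ tabulate h) ++ Ds
   list≡ : list ≡ tabulate f ++ tabulate g ++ tabulate h ++ Ds
   list≡ = List.++-assoc (tabulate f) _ Ds ~> cong (tabulate f ++_) (List.++-assoc (tabulate g) _ Ds)
   length-tabulate-++ : ∀ {N} (f : Fin N -> Matrix) Ds -> length (tabulate f ++ Ds) ≡ N N.+ length Ds
   length-tabulate-++ {N} f Ds = List.length-++ (tabulate f) ~> cong (N._+ length Ds) (List.length-tabulate f)
  at1 : ∀ i -> nthOr (\ _ _ -> 0#) list (toℕ i) ≡ f i
  at1 i = cong (\ Cs -> nthOr (\ _ _ -> 0#) Cs (toℕ i)) list≡ ~> matrixAt-tab f _ i
  at2 : ∀ i -> nthOr (\ _ _ -> 0#) list (D N.+ toℕ i) ≡ g i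
  at2 i = cong (\ Cs -> nthOr (\ _ _ -> 0#) Cs (D N.+ toℕ i)) list≡ ~> matrixAt-++ f _ (toℕ i) ~> matrixAt-tab g _ i
  at3 : ∀ i -> nthOr (\ _ _ -> 0#) list (D N.+ (D N.+ toℕ i)) ≡ h i
  at3 i = cong (\ Cs -> nthOr (\ _ _ -> 0#) Cs (D N.+ (D N.+ toℕ i))) list≡ ~> matrixAt-++ f _ (D N.+ toℕ i) ~> matrixAt-++ g _ (toℕ i) ~> matrixAt-tab h _ i
  at4 : ∀ i -> nthOr (\ _ _ -> 0#) list (D N.+ (D N.+ (N N.+ i))) ≡ nthOr (\ _ _ -> 0#) Ds i
  at4 i = cong (\ Cs -> nthOr (\ _ _ -> 0#) Cs (D N.+ (D N.+ (N N.+ i)))) list≡ ~> matrixAt-++ f _ (D N.+ (N N.+ i)) ~> matrixAt-++ g _ (N N.+ i) ~> matrixAt-++ h _ i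
  list-length : length list ≡ D N.+ (D N.+ (N N.+ length Ds))
  list-length = cong length list≡ ~> length-tabulate-++ f _ ~> cong (D N.+_) (length-tabulate-++ g _ ~> cong (D N.+_) (length-tabulate-++ h Ds))

 module _ (κ : Fin K -> Carrier) where
  private
   units links : Fin d -> Matrix
   units = column ∘ unit
   links = column ∘ linkVector
   scalars : Fin K -> Matrix
   scalars = column ∘ scalarVec ∘ κ
   fixedMatrices : List Matrix
   fixedMatrices = tabulate units ++ tabulate links ++ tabulate scalars
   inputs : List Carrier -> List Matrix
   inputs w = applyUpTo (column ∘ scalarVec ∘ nth w) (length w)
  abstract
   matrices : List Carrier -> List Matrix
   matrices w = fixedMatrices ++ inputs w
   matrix-frame : ∀ w i -> nthOr (\ _ _ -> 0#) (matrices w) (toℕ i) ≡ column (unit i)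
   matrix-frame w = at1 units links scalars (inputs w)
   matrix-link : ∀ w i -> nthOr (\ _ _ -> 0#) (matrices w) (d N.+ toℕ i) ≡ column (linkVector i)
   matrix-link w = at2 units links scalars (inputs w)
   matrix-constant : ∀ w c -> nthOr (\ _ _ -> 0#) (matrices w) (d N.+ (d N.+ toℕ c)) ≡ column (scalarVec (κ c))
   matrix-constant w = at3 units links scalars (inputs w)
   matrix-input : ∀ w {i} -> i < length w -> nthOr (\ _ _ -> 0#) (matrices w) (d N.+ (d N.+ (K N.+ i))) ≡ column (scalarVec (nth w i))
   matrix-input w {i} i< = at4 units links scalars (inputs w) i ~> matrixAt-applyUpTo (column ∘ scalarVec ∘ nth w) i<
   matrices-length : ∀ w -> length (matrices w) ≡ d N.+ (d N.+ (K N.+ length w))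
   matrices-length w = list-length units links scalars (inputs w) ~> cong (\ m -> d N.+ (d N.+ (K N.+ m))) (List.length-applyUpTo (column ∘ scalarVec ∘ nth w) (length w))
  fixedOut : Out 1
  fixedOut = sequence (constantOut ∘ column ∘ unit) ⊞ sequence (constantOut ∘ column ∘ linkVector) ⊞ sequence (constantOut ∘ column ∘ scalarVec ∘ κ)
  blocks-++ : ∀ Cs Ds -> blocks (Cs ++ Ds) ≡ blocks Cs ++ blocks Ds
  blocks-++ [] Ds = refl
  blocks-++ (C ∷ Cs) Ds = cong (encodeMatrix C ++_) (blocks-++ Cs Ds) ~> sym (List.++-assoc (encodeMatrix C) (blocks Cs) (blocks Ds))
  output-constants : ∀ w {k} (ρ : Vec ℕ k) {N} (C : Fin N -> Matrix) -> output w (sequence (constantOut ∘ C)) ρ ≡ blocks (tabulate C)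
  output-constants w ρ C = output-sequence w ρ (constantOut ∘ C) (encodeMatrix ∘ C) (\ i -> output-matrix w ρ (\ i' j -> lit (C i i' j)) (C i) (\ _ _ -> refl)) ~> cong concat (sym (List.map-tabulate C encodeMatrix))
  abstract
   output-matrices : ∀ w -> output (nth w) (fixedOut ⊞ rep (# 0F) (matrixOut (scalarOut (# 0F)))) (length w ∷ []) ≡ blocks (matrices w)
   output-matrices w = cong₂ _++_ fixed (scalarBlocks 0 (length w)) ~> sym (blocks-++ fixedMatrices (applyUpTo (column ∘ scalarVec ∘ nth w) (length w))) where
    ρ : Vec ℕ 1
    ρ = length w ∷ []
    fixed : output (nth w) fixedOut ρ ≡ blocks fixedMatrices
    fixed = cong₂ _++_ (output-constants (nth w) ρ (column ∘ unit))
     (cong₂ _++_ (output-constants (nth w) ρ (column ∘ linkVector)) (output-constants (nth w) ρ (column ∘ scalarVec ∘ κ)) ~> sym (blocks-++ (tabulate (column ∘ linkVector)) (tabulate (column ∘ scalarVec ∘ κ)))) ~>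
     sym (blocks-++ (tabulate (column ∘ unit)) (tabulate (column ∘ linkVector) ++ tabulate (column ∘ scalarVec ∘ κ)))
    entry : ∀ j i i' -> output (nth w) (scalarOut {2} (# 0F) i i') (j ∷ ρ) ≡ column (scalarVec (nth w j)) i i' ∷ []
    entry j 0F 0F = refl
    entry j 0F (fsuc i') = refl
    entry j 1F 0F = refl
    entry j 1F (fsuc i') = refl
    entry j (fsuc (fsuc i)) 0F = refl
    entry j (fsuc (fsuc i)) (fsuc i') = refl
    scalarBlocks : ∀ j c -> repeat (\ j -> output (nth w) (matrixOut (scalarOut (# 0F))) (j ∷ ρ)) j c ≡ blocks (applyUpTo (\ i -> column (scalarVec (nth w (j N.+ i)))) c)
    scalarBlocks j zero = refl
    scalarBlocks j (suc c) = cong₂ _++_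
     (output-matrix (nth w) (j ∷ ρ) (scalarOut (# 0F)) (column (scalarVec (nth w j))) (entry j) ~> cong (\ i -> encodeMatrix (column (scalarVec (nth w i)))) (sym (N.+-identityʳ j)))
     (scalarBlocks (suc j) c ~> cong blocks (applyUpTo-cong c \ i -> cong (\ i -> column (scalarVec (nth w i))) (sym (N.+-suc j i)))) where
     applyUpTo-cong : ∀ c {f g : ℕ -> Matrix} -> (∀ i -> f i ≡ g i) -> applyUpTo f c ≡ applyUpTo g c
     applyUpTo-cong zero h = refl
     applyUpTo-cong (suc c) h = cong₂ _∷_ (h 0) (applyUpTo-cong c (h ∘ suc))
  module _ (φ : Fm K 1) (below : ∀ n -> FmInputs (_< n) φ (n ∷ [])) where
   private
    inputt : ∀ {k} -> Ex k -> Template k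
    inputt e = atom (input e)
    P : ℕ -> Atom ℕ -> Set
    P n (input i) = i < n
    P n _ = ⊤
   instancet : Template 1
   instancet = ¬ₜ e i0 ∨ₜ fmt inputt φ
   termPart instanceOut : Out 1
   termPart = termOut Carrier symbol nameOut (\ _ -> lit 0#) instancet
   instanceOut = termPart ⊞ fixedOut ⊞ rep (# 0F) (matrixOut (scalarOut (# 0F)))
   within : ∀ n -> Within {P n} {\ _ -> ⊤} instancet (n ∷ [])
   within n = tt , within-fm {P n} {\ _ -> ⊤} (\ _ -> tt) (\ _ -> tt) (\ _ -> tt) (\ _ -> tt) inputt (_< n) (\ x ρ h -> h) φ (n ∷ []) (below n)
   instanceBelow : ∀ n -> Below n instanceOut (n ∷ [])
   instanceBelow n = below-term Carrier symbol nameOut (\ _ -> lit 0#) n {P n} {\ _ -> ⊤} (below-name n) (\ _ _ _ -> tt) instancet (n ∷ []) (within n) , (constants (column ∘ unit) , constants (column ∘ linkVector) , constants (column ∘ scalarVec ∘ κ)) ,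
    \ j j< -> below-sequence n (j ∷ n ∷ []) (Vector.concat (scalarOut (# 0F))) (\ i -> entry j j< _ _) where
    constants : ∀ {N} (C : Fin N -> Matrix) -> Below n (sequence {1} (constantOut ∘ C)) (n ∷ [])
    constants C = below-sequence n (n ∷ []) (constantOut ∘ C) (\ i -> below-sequence n (n ∷ []) (Vector.concat {m = d} {d} (\ i' j -> lit (C i i' j))) (\ _ -> tt))
    entry : ∀ j -> j < n -> ∀ i i' -> Below n (scalarOut {2} (# 0F) i i') (j ∷ n ∷ [])
    entry j j< 0F 0F = tt
    entry j j< 0F (fsuc i') = tt
    entry j j< 1F 0F = j<
    entry j j< 1F (fsuc i') = tt
    entry j j< (fsuc (fsuc i)) 0F = tt
    entry j j< (fsuc (fsuc i)) (fsuc i') = tt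
   reduction : List Carrier -> List Carrier
   reduction w = output (nth w) instanceOut (length w ∷ [])
   reduction-time : PolynomialTime reduction
   reduction-time = outputTime instanceOut (\ w -> instanceBelow (length w))
   module _ (w : List Carrier) where
    private
     n = length w
     b : ℕ -> Bool
     b _ = false
     ρ : Vec ℕ 1
     ρ = n ∷ []
     T : Term (Atom ℕ)
     T = inst b instancet ρ
     reduced : reduction w ≡ embed (⟨ mapTerm name T ⟩ pairCode) ++ blocks (matrices w)
     reduced = cong₂ _++_
      (output-term Carrier symbol nameOut (\ _ -> lit 0#) (nth w) b (pairCode ∘ name) (output-name (nth w)) (\ _ _ -> refl) instancet ρ ~> cong embed (code-map name {pairCode ∘ name} {pairCode} T (everywhere {P = \ x -> pairCode (name x) ≡ pairCode (name x)} (\ _ -> refl) T)))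
      (output-matrices w)
    -- The assignment meant by the instance, with the unknowns still free.
    meant : (List ℕ -> Subspace) -> Atom ℕ -> Subspace
    meant u (unknown is) = u is
    meant u (frame i) = line (Basis.vector standard i)
    meant u (link i) = range (column (linkVector i))
    meant u (constant c) = Basis.point standard i0 i1 (κ c)
    meant u (input i) = Basis.point standard i0 i1 (nth w i)
    private
     range-cong : ∀ {A A'} -> A ≈ᴹ A' -> range A ≐ range A'
     range-cong {A} {A'} h = ext \ x -> mk⇔
      (\ (y , p) -> y , \ m -> p m >> ·-cong {A m} {A' m} {y} {y} (h m) (\ _ -> rfl))
      (\ (y , p) -> y , \ m -> p m >> ·-cong {A' m} {A m} {y} {y} (\ i -> symm (h m i)) (\ _ -> rfl))
     range-≐ : ∀ A A' U -> A ≈ᴹ A' -> range A' ≐ U -> range A ≐ U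
     range-≐ A A' U h q = ≐-trans (range-cong {A} {A'} h) q
     matrixAt-cong : ∀ {Cs Ds} -> Pointwise _≈ᴹ_ Cs Ds -> ∀ j -> nthOr (\ _ _ -> 0#) Cs j ≈ᴹ nthOr (\ _ _ -> 0#) Ds j
     matrixAt-cong [] j _ _ = rfl
     matrixAt-cong (p ∷ ps) zero = p
     matrixAt-cong (p ∷ ps) (suc j) = matrixAt-cong ps j
    evaluated : ∀ α M -> (∀ j -> nthOr (\ _ _ -> 0#) (matrices w) j ≈ᴹ M j) -> eval 𝐋 (mapTerm name T) (subspaces α M) ≐ eval 𝐋 T (meant (\ is -> range (α (tuple is))))
    evaluated α M same = subst (_≐ eval 𝐋 T (meant u)) (sym (eval-map 𝐋 name T (subspaces α M)))
     (eval-≐ T (every-map atoms T (within-every b instancet ρ (within n)))) where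
     u : List ℕ -> Subspace
     u is = range (α (tuple is))
     matrix : ∀ j A U -> nthOr (\ _ _ -> 0#) (matrices w) j ≡ A -> range A ≐ U -> range (M j) ≐ U
     matrix j A U p = range-≐ (M j) A U (\ i i' -> symm (same j i i') >> eq≈ (cong (\ M -> M i i') p))
     atoms : ∀ x -> P n x -> subspaces α M (name x) ≐ meant u x
     atoms (unknown is) _ = ≐-refl {u is}
     atoms (frame i) _ = matrix (toℕ i) (column (unit i)) (meant u (frame i)) (matrix-frame w i) (range-unit i)
     atoms (link i) _ = matrix (d N.+ toℕ i) (column (linkVector i)) (meant u (link i)) (matrix-link w i) (≐-refl {range (column (linkVector i))})
     atoms (constant c) _ = matrix (d N.+ (d N.+ toℕ c)) (column (scalarVec (κ c))) (meant u (constant c)) (matrix-constant w c) (range-scalar (κ c))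
     atoms (input i) i< = matrix (d N.+ (d N.+ (K N.+ i))) (column (scalarVec (nth w i))) (meant u (input i)) (matrix-input w i<) (range-scalar (nth w i))
    private
     solved : ∀ u -> Full (eval 𝐋 T (meant u)) -> Solvable κ φ w
     solved u = full⇒holds b (meant u) standard (inFrame u) κ (nth w) inputt (\ _ _ -> ≐-refl) (\ _ -> ≐-refl) φ ρ where
      inFrame : ∀ u -> InFrame b (meant u) standard
      inFrame u = basis-inFrame b (meant u) standard (\ _ -> ≐-refl) range-link
    reduction-sound : SAT-constants (reduction w) -> Solvable κ φ w
    reduction-sound sat = sound (fwd SAT-constants⇔ sat) where
     sound : Instance (reduction w) -> Solvable κ φ w
     sound (t , Cs , eq , _ , α , full) = solved (\ is -> range (α (tuple is))) \ x -> to (evaluated α (matrixAt Cs) (matrixAt-cong (blocks-injective (matrices w) Cs (snd parts)))) {x}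
      (subst (\ t -> x ∈ eval 𝐋 t (subspaces α (matrixAt Cs))) (sym (fst parts)) (full x)) where
      parts : mapTerm name T ≡ t × blocks (matrices w) ≋ blocks Cs
      parts = terms-readable (mapTerm name T) t (≋-trans (≋-reflexive (sym reduced)) eq)
    reduction-complete : Solvable κ φ w -> SAT-constants (reduction w)
    reduction-complete (u , h) = bwd SAT-constants⇔ (mapTerm name T , matrices w , ≋-reflexive reduced , every-mapTerm name T (every-map in-range T (within-every b instancet ρ (within n))) , α , \ x -> from (evaluated α (matrixAt (matrices w)) (\ _ _ _ -> rfl)) {x} (full x))
     where
     extended = extend em tuple (\ {is} {js} -> tuple-injective is js) (\ _ _ -> 0#) (\ is -> column (scalarVec (u is)))
     α = fst extended
     points : ∀ is -> range (α (tuple is)) ≐ Basis.point standard i0 i1 (u is)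
     points is = ≐-trans (range-cong {α (tuple is)} {column (scalarVec (u is))} (\ i j -> eq≈ (cong (\ M -> M i j) (snd extended is))))
      (range-scalar (u is))
     full : Full (eval 𝐋 T (meant (\ is -> range (α (tuple is)))))
     full = holds⇒full b (meant (\ is -> range (α (tuple is)))) standard (basis-inFrame b (meant (\ is -> range (α (tuple is)))) standard (\ _ -> ≐-refl) range-link)
      κ (nth w) inputt (\ _ _ -> ≐-refl) (\ _ -> ≐-refl) u points φ ρ h
     in-range : ∀ x -> P n x -> InRange (length (matrices w)) (name x)
     in-range x p = subst (\ m -> InRange m (name x)) (sym (matrices-length w)) (go x p) where
      go : ∀ x -> P n x -> InRange (d N.+ (d N.+ (K N.+ n))) (name x)
      go (unknown is) _ = tt
      go (frame i) _ = N.<-≤-trans (Fin.toℕ<n i) (N.m≤m+n d _)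
      go (link i) _ = N.+-monoʳ-< d (N.<-≤-trans (Fin.toℕ<n i) (N.m≤m+n d _))
      go (constant c) _ = N.+-monoʳ-< d (N.+-monoʳ-< d (N.<-≤-trans (Fin.toℕ<n c) (N.m≤m+n K n)))
      go (input i) i< = N.+-monoʳ-< d (N.+-monoʳ-< d (N.+-monoʳ-< K i<))

module FormulaConnectives (em : EM) (R : Ring) where

 open Formula
 open FormulaSemantics R
 open Classical em
 open CommutativeRing R using (Carrier; _≈_)

 module _ {K k : ℕ} where
  infixr 6 _&_
  infixr 5 _=>_
  infix 7 _==_ _/=_
  _==_ _/=_ : Tm K k -> Tm K k -> Fm K k
  _==_ = equ
  s /= t = not (equ s t)
  _&_ _=>_ : Fm K k -> Fm K k -> Fm K k
  _&_ = and
  φ => ψ = not (and φ (not ψ))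
  trueF falseF : Fm K k
  trueF = equ zero zero
  falseF = not trueF
  each : ∀ N -> (Fin N -> Fm K k) -> Fm K k
  each zero f = trueF
  each (suc N) f = and (f 0F) (each N (f ∘ fsuc))
  oneOf : ∀ N -> (Fin N -> Fm K k) -> Fm K k
  oneOf N f = not (each N (not ∘ f))
  any : Ex k -> Fm K (suc k) -> Fm K k
  any e φ = not (all e (not φ))
  module _ (κ : Fin K -> Carrier) (w : ℕ -> Carrier) (v : List ℕ -> Carrier) (ρ : Vec ℕ k) where
   holds-⇒ : ∀ φ ψ -> Holds κ w v (φ => ψ) ρ ⇔ (Holds κ w v φ ρ -> Holds κ w v ψ ρ)
   holds-⇒ φ ψ = mk⇔ (\ h p -> dne \ ¬q -> h (p , ¬q)) \ h (p , ¬q) -> ¬q (h p)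
   holds-each : ∀ N f -> Holds κ w v (each N f) ρ ⇔ (∀ i -> Holds κ w v (f i) ρ)
   holds-each zero f = mk⇔ (\ _ ()) \ _ -> CommutativeRing.refl R
   holds-each (suc N) f = mk⇔
    (\ (h , h') -> \ { 0F -> h ; (fsuc i) -> fwd (holds-each N (f ∘ fsuc)) h' i })
    \ h -> h 0F , bwd (holds-each N (f ∘ fsuc)) (h ∘ fsuc)
   holds-oneOf : ∀ N f -> Holds κ w v (oneOf N f) ρ ⇔ (∃[ i ] Holds κ w v (f i) ρ)
   holds-oneOf N f = mk⇔ (\ h -> dne \ none -> h (bwd (holds-each N (not ∘ f)) \ i p -> none (i , p)))
    \ (i , p) h -> fwd (holds-each N (not ∘ f)) h i p
   holds-any : ∀ e φ -> Holds κ w v (any e φ) ρ ⇔ (∃[ j ] j < ⟦ e ⟧e ρ × Holds κ w v φ (j ∷ ρ))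
   holds-any e φ = mk⇔ (\ h -> dne \ none -> h \ j j< p -> none (j , j< , p)) \ (j , j< , p) h -> h j j< p

 module StoredInput (c : ℕ) {K : ℕ} where
  storedT : ∀ {k} -> Tm K k -> Tm K k
  storedT (inp e) = var (lit c ∷ e ∷ [])
  storedT (add s t) = add (storedT s) (storedT t)
  storedT (mul s t) = mul (storedT s) (storedT t)
  storedT t = t
  stored : ∀ {k} -> Fm K k -> Fm K k
  stored (equ s t) = equ (storedT s) (storedT t)
  stored (and φ ψ) = and (stored φ) (stored ψ)
  stored (not φ) = not (stored φ)
  stored (all e φ) = all e (stored φ)
  -- The input word is copied to the unknowns tagged c, so that it is read only within its length.
  withInput : Fm K 1 -> Fm K 1
  withInput φ = all (# 0F) (var (lit c ∷ # 0F ∷ []) == inp (# 0F)) & stored φ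
  withInput-inputs : ∀ φ n -> FmInputs (_< n) (withInput φ) (n ∷ [])
  withInput-inputs φ n = (\ i i< -> tt , i<) , fm φ (n ∷ []) where
   tm : ∀ {k} (t : Tm K k) ρ -> TmInputs (_< n) (storedT t) ρ
   tm (var es) ρ = tt
   tm (inp e) ρ = tt
   tm (con i) ρ = tt
   tm zero ρ = tt
   tm one ρ = tt
   tm (add s t) ρ = tm s ρ , tm t ρ
   tm (mul s t) ρ = tm s ρ , tm t ρ
   fm : ∀ {k} (φ : Fm K k) ρ -> FmInputs (_< n) (stored φ) ρ
   fm (equ s t) ρ = tm s ρ , tm t ρ
   fm (and φ ψ) ρ = fm φ ρ , fm ψ ρ
   fm (not φ) ρ = fm φ ρ
   fm (all e φ) ρ j _ = fm φ (j ∷ ρ)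
  ι : (List ℕ -> Carrier) -> ℕ -> Carrier
  ι v i = v (c ∷ i ∷ [])
  withInput⇔ : ∀ κ φ w -> Solvable κ (withInput φ) w ⇔
   (∃[ v ] (∀ i -> i < length w -> ι v i ≈ nth w i) × Holds κ (ι v) v φ (length w ∷ []))
  withInput⇔ κ φ w = mk⇔ (\ (v , h , h') -> v , h , fwd (fm v φ (length w ∷ [])) h') (\ (v , h , h') -> v , h , bwd (fm v φ (length w ∷ [])) h') where
   tm : ∀ v {k} (t : Tm K k) ρ -> ⟦_⟧ᵗ κ (nth w) v (storedT t) ρ ≡ ⟦_⟧ᵗ κ (ι v) v t ρ
   tm v (var es) ρ = refl
   tm v (inp e) ρ = refl
   tm v (con i) ρ = refl
   tm v zero ρ = refl
   tm v one ρ = refl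
   tm v (add s t) ρ = cong₂ (CommutativeRing._+_ R) (tm v s ρ) (tm v t ρ)
   tm v (mul s t) ρ = cong₂ (CommutativeRing._*_ R) (tm v s ρ) (tm v t ρ)
   fm : ∀ v {k} (φ : Fm K k) ρ -> Holds κ (nth w) v (stored φ) ρ ⇔ Holds κ (ι v) v φ ρ
   fm v (equ s t) ρ = mk⇔ (subst₂ _≈_ (tm v s ρ) (tm v t ρ)) (subst₂ _≈_ (sym (tm v s ρ)) (sym (tm v t ρ)))
   fm v (and φ ψ) ρ = mk⇔ (\ (h , h') -> fwd (fm v φ ρ) h , fwd (fm v ψ ρ) h') (\ (h , h') -> bwd (fm v φ ρ) h , bwd (fm v ψ ρ) h')
   fm v (not φ) ρ = mk⇔ (_∘ bwd (fm v φ ρ)) (_∘ fwd (fm v φ ρ))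
   fm v (all e φ) ρ = mk⇔ (\ h j j< -> fwd (fm v φ (j ∷ ρ)) (h j j<)) (\ h j j< -> bwd (fm v φ (j ∷ ρ)) (h j j<))

module CookLevin
 (em : EM) (R : Ring) (real : FormallyReal R)
 (M : BSS.Machine R) (K : ℕ) (κ : Fin K -> CommutativeRing.Carrier R)
 (constantTm : Fin (suc (BSS.Machine.extraNodes M)) -> ∀ {k} -> Formula.Tm K k)
 (constant-value : ∀ p {z t n} -> BSS.Machine.code M p ≡ BSS.constant z t n -> ∀ w v {k} (ρ : Vec ℕ k) -> CommutativeRing._≈_ R (Formula.FormulaSemantics.⟦_⟧ᵗ R κ w v (constantTm p) ρ) z)
 (c : ℕ) where
 open Formula
 open FormulaSemantics R
 open FormulaConnectives em R
 open StoredInput 9 {K} using (withInput; withInput-inputs; withInput⇔; ι)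
 open Classical em
 open Finiteness using (clamp; if-≡ᶠ; if-≢ᶠ)
 open CounterPrograms using (if-≡; if-≢)
 open Codes using (clamp-toℕ)
 open CommutativeRing R hiding (zero; refl; sym) renaming (trans to infixr 5 _>>_)
 private module R = CommutativeRing R
 open Naturals R real
 open BSS R using (add; sub; mul; div; Operation; Result; Node; compute; constant; guess; test; move; testAddress; accept; reject; Address; copy; incr; decr; address)
 open BSS.Machine M
 open BSS.Semantics R M
 open MachineSteps R M using (Next; next⇒)
 open RingSolver R

 module _ {k : ℕ} where
  numeral : ℕ -> Tm K k
  numeral zero = zero
  numeral (suc m) = add one (numeral m)
  node# : Ex k -> Tm K k
  node# t = var (lit 0 ∷ t ∷ [])
  addr# : Fin #addresses -> Ex k -> Tm K k
  addr# j t = var (lit 1 ∷ lit (toℕ j) ∷ t ∷ [])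
  cell : Ex k -> Ex k -> Tm K k
  cell t i = var (lit 2 ∷ t ∷ i ∷ [])
  index : Ex k -> Tm K k
  index i = var (lit 3 ∷ i ∷ [])
  -- The cells read and the value written in a step.
  scratch : ℕ -> Ex k -> Tm K k
  scratch m t = var (lit m ∷ t ∷ [])
  first second written : Ex k -> Tm K k
  first = scratch 4
  second = scratch 5
  written = scratch 6
  power : Ex k -> ℕ -> Ex k
  power n zero = lit 1
  power n (suc e) = n ✶ power n e
  duration size : Ex k -> Ex k
  duration n = lit c ✶ power n c ⊹ lit c
  size n = n ⊹ (duration n ⊹ lit 1)

 private
  i2 t1 : ∀ {k} -> Ex (suc (suc k))
  i2 = # 0F
  t1 = # 1F
  t0 n1 : Ex 2
  t0 = # 0F
  n1 = # 1F
  n2 : Ex 3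
  n2 = # 2F

 keepAddresses keepCells : Fm K 2
 keepAddresses = each #addresses \ j -> addr# j (lit 1 ⊹ t0) == addr# j t0
 keepCells = all (size n1) (cell (lit 1 ⊹ t1) i2 == cell t1 i2)

 readsAt : ℕ -> Fin #addresses -> Fm K 3
 readsAt m x = addr# x t1 == index i2 => scratch m t1 == cell t1 i2

 writesAt : Fin #addresses -> Fm K 3
 writesAt x = (addr# x t1 == index i2 => cell (lit 1 ⊹ t1) i2 == written t1) & (addr# x t1 /= index i2 => cell (lit 1 ⊹ t1) i2 == cell t1 i2)

 reads : ℕ -> Fin #addresses -> Fm K 2
 reads m x = all (size n1) (readsAt m x)

 writes : Fin #addresses -> Fm K 2
 writes x = all (size n1) (writesAt x)

 goes : Fin #nodes -> Fm K 2
 goes n = node# (lit 1 ⊹ t0) == numeral (toℕ n)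

 result : Operation -> Fm K 2
 result add = written t0 == add (first t0) (second t0)
 result sub = add (written t0) (second t0) == first t0
 result mul = written t0 == mul (first t0) (second t0)
 result div = second t0 /= zero & mul (written t0) (second t0) == first t0

 moves : Address #addresses -> Tm K 2 -> Fm K 2
 moves (copy j) x = x == addr# j t0
 moves (incr j) x = x == add one (addr# j t0)
 moves (decr j) x = (addr# j t0 == zero => x == zero) & (addr# j t0 /= zero => add one x == addr# j t0)

 movesAt : Address #addresses -> Fin #addresses -> Fin #addresses -> Fm K 2
 movesAt e t j = if does (j ≟ᶠ t) then moves e (addr# j (lit 1 ⊹ t0)) else addr# j (lit 1 ⊹ t0) == addr# j t0

 stepAt : Fin #nodes -> Node #addresses #nodes -> Fm K 2
 stepAt p (compute o t x y n) = goes n & reads 4 x & reads 5 y & result o & writes t & keepAddresses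
 stepAt p (constant z t n) = goes n & written t0 == constantTm p & writes t & keepAddresses
 stepAt p (guess t n) = goes n & writes t & keepAddresses
 stepAt p (test x y n n') = (reads 4 x & reads 5 y & keepCells & keepAddresses) & (first t0 == second t0 => goes n) & (first t0 /= second t0 => goes n')
 stepAt p (move e t n) = goes n & keepCells & each #addresses (movesAt e t)
 stepAt p (testAddress i j n n') = (keepCells & keepAddresses) & (addr# i t0 == addr# j t0 => goes n) & (addr# i t0 /= addr# j t0 => goes n')
 stepAt p accept = goes p & keepCells & keepAddresses
 stepAt p reject = falseF

 final : ∀ p -> Dec (code p ≡ accept) -> Fm K 1
 final p (yes _) = trueF
 final p (no _) = node# (duration (# 0F)) /= numeral (toℕ p)

 indexing initially steps finally body : Fm K 1
 indexing = index (lit 0) == zero & all (size (# 0F)) (index (lit 1 ⊹ i2) == add one (index i2))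
 initially = node# (lit 0) == zero & addr# 0F (lit 0) == index (# 0F) & each extraAddresses (\ j -> addr# (fsuc j) (lit 0) == zero) & all (# 0F) (cell (lit 0) i2 == inp i2) & all (duration (# 0F) ⊹ lit 1) (cell (lit 0) (t1 ⊹ i2) == zero)
 steps = all (duration (# 0F)) (each #nodes \ p -> node# t0 == numeral (toℕ p) => stepAt p (code p))
 finally = each #nodes \ p -> final p (dec (code p ≡ accept))
 body = indexing & initially & steps & finally

 abstract
  formula : Fm K 1
  formula = withInput body
  formula-inputs : ∀ n -> FmInputs (_< n) formula (n ∷ [])
  formula-inputs = withInput-inputs body
  formula⇔ : ∀ w -> Solvable κ formula w ⇔ Solvable κ (withInput body) w
  formula⇔ w = mk⇔ id id

 pow-value : ∀ {k} (x : Ex k) ρ e -> ⟦ power x e ⟧e ρ ≡ ⟦ x ⟧e ρ N.^ e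
 pow-value x ρ zero = refl
 pow-value x ρ (suc e) = cong (⟦ x ⟧e ρ N.*_) (pow-value x ρ e)

 duration-value : ∀ {k} (x : Ex k) ρ -> ⟦ duration x ⟧e ρ ≡ bound c (⟦ x ⟧e ρ)
 duration-value x ρ = cong (\ m -> c N.* m N.+ c) (pow-value x ρ c)

 module _ (w : List Carrier) where
  private
   n T S : ℕ
   n = length w
   T = bound c n
   S = n N.+ (T N.+ 1)
   size-value : ∀ {k} (x : Ex k) ρ -> ⟦ x ⟧e ρ ≡ n -> ⟦ size x ⟧e ρ ≡ S
   size-value x ρ eq = cong₂ (\ m m' -> m N.+ (m' N.+ 1)) eq (duration-value x ρ ~> cong (bound c) eq)
   load-nth : ∀ w i -> load w i ≡ nth w i
   load-nth [] i = refl
   load-nth (x ∷ w) zero = refl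
   load-nth (x ∷ w) (suc i) = load-nth w i
   nth-end : ∀ w i -> nth w (length w N.+ i) ≡ 0#
   nth-end [] i = refl
   nth-end (x ∷ w) i = nth-end w i
  module _ (v : List ℕ -> Carrier) where
   private
    ⊨ : ∀ {k} -> Fm K k -> Vec ℕ k -> Set
    ⊨ = Holds κ (ι v) v
    ⊨-⇒ : ∀ {k} (φ ψ : Fm K k) ρ -> ⊨ (φ => ψ) ρ -> ⊨ φ ρ -> ⊨ ψ ρ
    ⊨-⇒ φ ψ ρ = fwd (holds-⇒ κ (ι v) v ρ φ ψ)
    ⊨-each : ∀ {k} N f (ρ : Vec ℕ k) -> ⊨ (each N f) ρ -> ∀ i -> ⊨ (f i) ρ
    ⊨-each N f ρ = fwd (holds-each κ (ι v) v ρ N f)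
    below-size : ∀ {k} (x : Ex k) φ ρ -> ⟦ x ⟧e ρ ≡ n -> ⊨ (all (size x) φ) ρ -> ∀ i -> i < S -> ⊨ φ (i ∷ ρ)
    below-size x φ ρ x≡n h i i< = h i (subst (i <_) (sym (size-value x ρ x≡n)) i<)
    numeral-value : ∀ {k} m (ρ : Vec ℕ k) -> ⟦_⟧ᵗ κ (ι v) v (numeral m) ρ ≈ nat m
    numeral-value zero ρ = R.refl
    numeral-value (suc m) ρ = +-congˡ (numeral-value m ρ)
   record Describes (t : ℕ) (s : Config) : Set where
    field
     node≈      : v (0 ∷ t ∷ []) ≈ nat (toℕ (Config.node s))
     addresses≈ : ∀ j -> v (1 ∷ toℕ j ∷ t ∷ []) ≈ nat (Config.addresses s j)
     cells≈     : ∀ i -> i < S -> v (2 ∷ t ∷ i ∷ []) ≈ Config.memory s i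
     reach      : ∀ j -> Config.addresses s j ≤ n N.+ t
   module Sound (given : ∀ i -> i < n -> ι v i ≈ nth w i) (h : ⊨ body (n ∷ [])) where
    private
     index≈ : ∀ i -> i ≤ S -> v (3 ∷ i ∷ []) ≈ nat i
     index≈ zero _ = fst (fst h)
     index≈ (suc i) i< = below-size (# 0F) (index (lit 1 ⊹ i2) == add one (index i2)) (n ∷ []) refl (snd (fst h)) i i< >> +-congˡ (index≈ i (N.<⇒≤ i<))
     start : Describes 0 (init w)
     start = record
      { node≈ = fst (fst (snd h))
      ; addresses≈ = \ { 0F -> fst (snd (fst (snd h))) >> index≈ n (N.m≤m+n n _)
      ; (fsuc j) -> ⊨-each extraAddresses (\ j -> addr# (fsuc j) (lit 0) == zero) (n ∷ []) (fst (snd (snd (fst (snd h))))) j }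
      ; cells≈ = \ i i< -> cell≈ i i< (i N.<? n)
      ; reach = \ { 0F -> N.m≤m+n n 0 ; (fsuc j) -> z≤n }
      } where
      copied = fst (snd (snd (snd (fst (snd h)))))
      blank = snd (snd (snd (snd (fst (snd h)))))
      cell≈ : ∀ i -> i < S -> Dec (i < n) -> v (2 ∷ 0 ∷ i ∷ []) ≈ load w i
      cell≈ i _ (yes i<n) = copied i i<n >> given i i<n >> R.reflexive (sym (load-nth w i))
      cell≈ i i< (no i≮n) = subst (\ i -> v (2 ∷ 0 ∷ i ∷ []) ≈ load w i) (N.m+[n∸m]≡n n≤i)
       (blank j (subst (\ m -> j < m N.+ 1) (sym (duration-value (# 0F) (n ∷ []))) (N.+-cancelˡ-< n j (T N.+ 1) (subst (_< S) (sym (N.m+[n∸m]≡n n≤i)) i<))) >> R.reflexive (sym (load-nth w (n N.+ j) ~> nth-end w j))) where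
       n≤i = N.≮⇒≥ i≮n
       j = i N.∸ n
    module _ (t : ℕ) (t< : t < T) (s : Config) (d : Describes t s) where
     open Describes d
     open Config s
     private
      ρ : Vec ℕ 2
      ρ = t ∷ n ∷ []
      value : Tm K 2 -> Carrier
      value x = ⟦_⟧ᵗ κ (ι v) v x ρ
      inside : ∀ x -> addresses x < S
      inside x = N.≤-<-trans (reach x) (N.+-monoʳ-< n (N.<-≤-trans t< (N.m≤m+n T 1)))
      address-index : ∀ x -> v (1 ∷ toℕ x ∷ t ∷ []) ≈ v (3 ∷ addresses x ∷ [])
      address-index x = addresses≈ x >> R.sym (index≈ (addresses x) (N.<⇒≤ (inside x)))
      read : ∀ m x -> ⊨ (reads m x) ρ -> v (m ∷ t ∷ []) ≈ memory (addresses x)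
      read m x h = (⊨-⇒ (addr# x t1 == index i2) (scratch m t1 == cell t1 i2) (addresses x ∷ ρ) (below-size n1 (readsAt m x) ρ refl h (addresses x) (inside x)) (address-index x)) >> cells≈ (addresses x) (inside x)
      keptCells : ⊨ keepCells ρ -> ∀ i -> i < S -> v (2 ∷ suc t ∷ i ∷ []) ≈ memory i
      keptCells h i i< = below-size n1 (cell (lit 1 ⊹ t1) i2 == cell t1 i2) ρ refl h i i< >> cells≈ i i<
      keptAddresses : ⊨ keepAddresses ρ -> ∀ j -> v (1 ∷ toℕ j ∷ suc t ∷ []) ≈ nat (addresses j)
      keptAddresses h j = ⊨-each #addresses (\ j -> addr# j (lit 1 ⊹ t0) == addr# j t0) ρ h j >> addresses≈ j
      reach' : ∀ j -> addresses j ≤ n N.+ suc t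
      reach' j = reach j ▹ N.+-monoʳ-≤ n (N.n≤1+n t)
      wrote : ∀ x z -> ⊨ (writes x) ρ -> v (6 ∷ t ∷ []) ≈ z -> ∀ i -> i < S -> v (2 ∷ suc t ∷ i ∷ []) ≈ (memory [ addresses x ≔ z ]) i
      wrote x z h z≈ i i< = case (i N.≟ addresses x) (below-size n1 (writesAt x) ρ refl h i i<) where
       case : Dec (i ≡ addresses x) -> ⊨ (writesAt x) (i ∷ ρ) -> v (2 ∷ suc t ∷ i ∷ []) ≈ (memory [ addresses x ≔ z ]) i
       case (yes p) (h1 , _) = (⊨-⇒ (addr# x t1 == index i2) (cell (lit 1 ⊹ t1) i2 == written t1) (i ∷ ρ) h1
        (subst (\ i -> v (1 ∷ toℕ x ∷ t ∷ []) ≈ v (3 ∷ i ∷ [])) (sym p) (address-index x))) >> z≈ >> R.reflexive (sym (if-≡ p))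
       case (no i≢) (_ , h2) = (⊨-⇒ (addr# x t1 /= index i2) (cell (lit 1 ⊹ t1) i2 == cell t1 i2) (i ∷ ρ) h2
        (\ p -> i≢ (sym (nat-inj (R.sym (addresses≈ x) >> p >> index≈ i (N.<⇒≤ i<)))))) >> cells≈ i i< >> R.reflexive (sym (if-≢ i≢))
      went : ∀ m -> ⊨ (goes m) ρ -> v (0 ∷ suc t ∷ []) ≈ nat (toℕ m)
      went m h = h >> numeral-value (toℕ m) ρ
      computed : ∀ o {x y} -> value (first t0) ≈ x -> value (second t0) ≈ y -> ⊨ (result o) ρ -> Result o x y (value (written t0))
      computed add p q h = h >> +-cong p q
      computed sub p q h = solve 2 (\ z y -> z := (z :+ y) :- y) R.refl _ _ >> +-cong (h >> p) (-‿cong q)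
      computed mul p q h = h >> *-cong p q
      computed div p q (h , h') = (\ y≈0 -> h (q >> y≈0)) , *-congˡ (R.sym q) >> h' >> p
      moved : ∀ e j -> ⊨ (moves e (addr# j (lit 1 ⊹ t0))) ρ -> v (1 ∷ toℕ j ∷ suc t ∷ []) ≈ nat (address e addresses)
      moved (copy i) j h = h >> addresses≈ i
      moved (incr i) j h = h >> +-congˡ (addresses≈ i)
      moved (decr i) j (h , h') = go (addresses i) (addresses≈ i) where
       x≈ = addr# j (lit 1 ⊹ t0)
       go : ∀ a -> v (1 ∷ toℕ i ∷ t ∷ []) ≈ nat a -> v (1 ∷ toℕ j ∷ suc t ∷ []) ≈ nat (pred a)
       go zero p = ⊨-⇒ (addr# i t0 == zero) (x≈ == zero) ρ h p
       go (suc a) p = +-cancelˡ 1# _ _ ((⊨-⇒ (addr# i t0 /= zero) (add one x≈ == addr# i t0) ρ h'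
        (\ q -> 1+n≢0 (nat-inj {suc a} {0} (R.sym p >> q)))) >> p) where
        open import Algebra.Properties.Ring ring using (+-cancelˡ)
        1+n≢0 : ¬ suc a ≡ 0
        1+n≢0 ()
      address-reach : ∀ e -> address e addresses ≤ n N.+ suc t
      address-reach (copy i) = reach' i
      address-reach (incr i) = s≤s (reach i) ▹ N.≤-reflexive (sym (N.+-suc n t))
      address-reach (decr i) = N.pred[n]≤n ▹ reach' i
      updated : ∀ e x j -> ⊨ (movesAt e x j) ρ -> v (1 ∷ toℕ j ∷ suc t ∷ []) ≈ nat ((addresses [ x ≔ᵃ address e addresses ]) j) × (addresses [ x ≔ᵃ address e addresses ]) j ≤ n N.+ suc t
      updated e x j h with does (j ≟ᶠ x)
      ... | true = moved e j h , address-reach e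
      ... | false = h >> addresses≈ j , reach' j
     Successor : Set
     Successor = ∃[ s' ] (s' ≡ s ⊎ s ⟶ s') × Describes (suc t) s'
     next-step : ∀ nd -> code node ≡ nd -> ⊨ (stepAt node nd) ρ -> Successor
     next-step (compute o x y z m) eq (g , r1 , r2 , res , wr , k) = config m addresses (memory [ addresses x ≔ v (6 ∷ t ∷ []) ]) , inr (compute eq (computed o (read 4 y r1) (read 5 z r2) res)) ,
      record { node≈ = went m g ; addresses≈ = keptAddresses k ; cells≈ = wrote x _ wr R.refl ; reach = reach' }
     next-step (constant z x m) eq (g , z≈ , wr , k) = config m addresses (memory [ addresses x ≔ z ]) , inr (constant eq) , record { node≈ = went m g ; addresses≈ = keptAddresses k ; cells≈ = wrote x z wr (z≈ >> constant-value node eq (ι v) v ρ) ; reach = reach' }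
     next-step (guess x m) eq (g , wr , k) = config m addresses (memory [ addresses x ≔ v (6 ∷ t ∷ []) ]) , inr (guess _ eq) , record { node≈ = went m g ; addresses≈ = keptAddresses k ; cells≈ = wrote x _ wr R.refl ; reach = reach' }
     next-step (test x y m m') eq ((r1 , r2 , kc , k) , h1 , h2) = branch (dec (memory (addresses x) ≈ memory (addresses y))) where
      branch : Dec (memory (addresses x) ≈ memory (addresses y)) -> Successor
      branch (yes p) = config m addresses memory , inr (equal eq p) , record { node≈ = went m (⊨-⇒ (first t0 == second t0) (goes m) ρ h1
       (read 4 x r1 >> p >> R.sym (read 5 y r2))) ; addresses≈ = keptAddresses k ; cells≈ = keptCells kc ; reach = reach' }
      branch (no ¬p) = config m' addresses memory , inr (unequal eq ¬p) , record { node≈ = went m' (⊨-⇒ (first t0 /= second t0) (goes m') ρ h2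
       (\ p -> ¬p (R.sym (read 4 x r1) >> p >> read 5 y r2))) ; addresses≈ = keptAddresses k ; cells≈ = keptCells kc ; reach = reach' }
     next-step (move e x m) eq (g , kc , u) = config m (addresses [ x ≔ᵃ address e addresses ]) memory , inr (move eq) , record { node≈ = went m g ; addresses≈ = \ j -> fst (updated e x j (⊨-each #addresses (movesAt e x) ρ u j)) ; cells≈ = keptCells kc
      ; reach = \ j -> snd (updated e x j (⊨-each #addresses (movesAt e x) ρ u j)) }
     next-step (testAddress i j m m') eq ((kc , k) , h1 , h2) = branch (addresses i N.≟ addresses j) where
      branch : Dec (addresses i ≡ addresses j) -> Successor
      branch (yes p) = config m addresses memory , inr (equalAddress eq p) , record { node≈ = went m (⊨-⇒ (addr# i t0 == addr# j t0) (goes m) ρ h1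
       (addresses≈ i >> R.reflexive (cong nat p) >> R.sym (addresses≈ j))) ; addresses≈ = keptAddresses k ; cells≈ = keptCells kc ; reach = reach' }
      branch (no ¬p) = config m' addresses memory , inr (unequalAddress eq ¬p) , record { node≈ = went m' (⊨-⇒ (addr# i t0 /= addr# j t0) (goes m') ρ h2
       (\ p -> ¬p (nat-inj (R.sym (addresses≈ i) >> p >> addresses≈ j)))) ; addresses≈ = keptAddresses k ; cells≈ = keptCells kc ; reach = reach' }
     next-step accept eq (g , kc , k) = s , inl refl , record { node≈ = went node g ; addresses≈ = keptAddresses k ; cells≈ = keptCells kc ; reach = reach' }
     next-step reject eq h = ⊥-elim (h R.refl)
     successor : Successor
     successor = next-step (code node) refl (⊨-⇒ (node# t0 == numeral (toℕ node)) (stepAt node (code node)) ρ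
      (⊨-each #nodes (\ p -> node# t0 == numeral (toℕ p) => stepAt p (code p)) ρ
      (fst (snd (snd h)) t (subst (t <_) (sym (duration-value (# 0F) (n ∷ []))) t<)) node)
      (node≈ >> R.sym (numeral-value (toℕ node) ρ)))
    private
     snoc : ∀ {k a b c} -> Run k a b -> b ⟶ c -> Run (suc k) a c
     snoc done s = next s done
     snoc (next s r) s' = next s (snoc r s')
     reached : ∀ t -> t ≤ T -> ∃[ k ] ∃[ s ] Run k (init w) s × Describes t s
     reached zero _ = 0 , init w , done , start
     reached (suc t) t< with reached t (N.<⇒≤ t<)
     ... | k , s , r , d with successor t t< s d
     ...   | s' , inl refl , d' = k , s , r , d'
     ...   | s' , inr st , d' = suc k , s' , snoc r st , d'
    accepts : Accepts w
    accepts with reached T N.≤-refl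
    ... | k , s , r , d = k , s , r , accepting (dec (code (Config.node s) ≡ accept)) (⊨-each #nodes (\ p -> final p (dec (code p ≡ accept))) (n ∷ []) (snd (snd (snd h))) (Config.node s)) where
     at-end : ⊨ (node# (duration (# 0F)) /= numeral (toℕ (Config.node s))) (n ∷ []) -> ⊥
     at-end ¬p = ¬p (subst (\ t -> v (0 ∷ t ∷ []) ≈ nat (toℕ (Config.node s))) (sym (duration-value (# 0F) (n ∷ []))) (Describes.node≈ d) >> R.sym (numeral-value (toℕ (Config.node s)) (n ∷ [])))
     accepting : ∀ a -> ⊨ (final (Config.node s) a) (n ∷ []) -> code (Config.node s) ≡ accept
     accepting (yes p) _ = p
     accepting (no _) h = ⊥-elim (at-end h)
  module _ (run : Accepts w) (within : RunsWithin (bound c)) where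
   private
    at : ∀ {k a e} -> Run k a e -> ℕ -> Config
    at {a = a} done t = a
    at {a = a} (next _ r) zero = a
    at (next _ r) (suc t) = at r t
    Proceeds : Config -> Config -> Set
    Proceeds a b = (a ⟶ b) ⊎ (b ≡ a × code (Config.node a) ≡ accept)
    proceeds : ∀ {k a e} (r : Run k a e) -> Accepting e -> ∀ t -> Proceeds (at r t) (at r (suc t))
    proceeds done acc t = inr (refl , acc)
    proceeds (next s done) acc zero = inl s
    proceeds (next s (next _ _)) acc zero = inl s
    proceeds (next s r) acc (suc t) = proceeds r acc t
    at-end : ∀ {k a e} (r : Run k a e) -> ∀ t -> k ≤ t -> at r t ≡ e
    at-end done t _ = refl
    at-end (next _ r) (suc t) (s≤s k≤) = at-end r t k≤
    start-at : ∀ {k a e} (r : Run k a e) -> at r 0 ≡ a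
    start-at done = refl
    start-at (next _ _) = refl
    k = fst run
    e = fst (snd run)
    r : Run k (init w) e
    r = fst (snd (snd run))
    s : ℕ -> Config
    s = at r
    firstRegister secondRegister target : Node #addresses #nodes -> Fin #addresses
    firstRegister (compute _ _ x _ _) = x
    firstRegister (test x _ _ _) = x
    firstRegister _ = 0F
    secondRegister (compute _ _ _ y _) = y
    secondRegister (test _ y _ _) = y
    secondRegister _ = 0F
    target (compute _ t _ _ _) = t
    target (constant _ t _) = t
    target (guess t _) = t
    target _ = 0F
    pointed : Config -> Config -> (Node #addresses #nodes -> Fin #addresses) -> Carrier
    pointed a b x = Config.memory b (Config.addresses a (x (code (Config.node a))))
    v : List ℕ -> Carrier
    v (0 ∷ t ∷ []) = nat (toℕ (Config.node (s t)))
    v (1 ∷ j ∷ t ∷ []) = nat (Config.addresses (s t) (clamp extraAddresses j))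
    v (2 ∷ t ∷ i ∷ []) = Config.memory (s t) i
    v (3 ∷ i ∷ []) = nat i
    v (4 ∷ t ∷ []) = pointed (s t) (s t) firstRegister
    v (5 ∷ t ∷ []) = pointed (s t) (s t) secondRegister
    v (6 ∷ t ∷ []) = pointed (s t) (s (suc t)) target
    v (9 ∷ i ∷ []) = nth w i
    v _ = 0#
    ⊨ : ∀ {k} -> Fm K k -> Vec ℕ k -> Set
    ⊨ = Holds κ (ι v) v
    ⇒-⊨ : ∀ {k} (φ ψ : Fm K k) ρ -> (⊨ φ ρ -> ⊨ ψ ρ) -> ⊨ (φ => ψ) ρ
    ⇒-⊨ φ ψ ρ = bwd (holds-⇒ κ (ι v) v ρ φ ψ)
    each-⊨ : ∀ {k} N f (ρ : Vec ℕ k) -> (∀ i -> ⊨ (f i) ρ) -> ⊨ (each N f) ρ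
    each-⊨ N f ρ = bwd (holds-each κ (ι v) v ρ N f)
    numeral≈ : ∀ {k} m (ρ : Vec ℕ k) -> ⟦_⟧ᵗ κ (ι v) v (numeral m) ρ ≈ nat m
    numeral≈ zero ρ = R.refl
    numeral≈ (suc m) ρ = +-congˡ (numeral≈ m ρ)
    module _ (t : ℕ) where
     ρ : Vec ℕ 2
     ρ = t ∷ n ∷ []
     private
      a = s t
      b = s (suc t)
      module A = Config a
      module B = Config b
     address≈ : ∀ j t -> v (1 ∷ toℕ j ∷ t ∷ []) ≈ nat (Config.addresses (s t) j)
     address≈ j t = R.reflexive (cong (nat ∘ Config.addresses (s t)) (clamp-toℕ extraAddresses j))
     pointing : ∀ x {i} -> v (1 ∷ toℕ x ∷ t ∷ []) ≈ nat i -> A.addresses x ≡ i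
     pointing x p = nat-inj (R.sym (address≈ x t) >> p)
     went : ∀ {m} -> B.node ≡ m -> ⊨ (goes m) ρ
     went {m} p = R.reflexive (cong (nat ∘ toℕ) p) >> R.sym (numeral≈ (toℕ m) ρ)
     reading : ∀ m x -> v (m ∷ t ∷ []) ≡ A.memory (A.addresses x) -> ⊨ (reads m x) ρ
     reading m x eq i _ = ⇒-⊨ (addr# x t1 == index i2) (scratch m t1 == cell t1 i2) (i ∷ ρ) \ p -> R.reflexive (eq ~> cong A.memory (pointing x p))
     writing : ∀ x z -> B.memory ≡ A.memory [ A.addresses x ≔ z ] -> v (6 ∷ t ∷ []) ≡ B.memory (A.addresses x) -> ⊨ (writes x) ρ
     writing x z eq w≡ i _ = ⇒-⊨ (addr# x t1 == index i2) (cell (lit 1 ⊹ t1) i2 == written t1) (i ∷ ρ) (\ p -> R.reflexive (sym (w≡ ~> cong B.memory (pointing x p)))) , ⇒-⊨ (addr# x t1 /= index i2) (cell (lit 1 ⊹ t1) i2 == cell t1 i2) (i ∷ ρ) (\ p ->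
      R.reflexive (cong (\ m -> m i) eq ~> (if-≢ {m = i} {A.addresses x} \ i≡ -> p (address≈ x t >> R.reflexive (cong nat (sym i≡))))))
     keepingCells : B.memory ≡ A.memory -> ⊨ keepCells ρ
     keepingCells eq i _ = R.reflexive (cong (\ m -> m i) eq)
     keepingAddresses : B.addresses ≡ A.addresses -> ⊨ keepAddresses ρ
     keepingAddresses eq = each-⊨ #addresses (\ j -> addr# j (lit 1 ⊹ t0) == addr# j t0) ρ (\ j -> R.reflexive (cong (\ f -> nat (f (clamp extraAddresses (toℕ j)))) eq))
     resulting : ∀ o {z} -> Result o (v (4 ∷ t ∷ [])) (v (5 ∷ t ∷ [])) z -> v (6 ∷ t ∷ []) ≡ z -> ⊨ (result o) ρ
     resulting add p refl = p
     resulting sub p refl = +-congʳ p >> solve 2 (\ x y -> (x :- y) :+ y := x) R.refl _ _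
     resulting mul p refl = p
     resulting div p refl = p
     moving : ∀ e j -> B.addresses j ≡ address e A.addresses -> ⊨ (moves e (addr# j (lit 1 ⊹ t0))) ρ
     moving (copy i) j eq = address≈ j (suc t) >> R.reflexive (cong nat eq) >> R.sym (address≈ i t)
     moving (incr i) j eq = address≈ j (suc t) >> R.reflexive (cong nat eq) >> +-congˡ (R.sym (address≈ i t))
     moving (decr i) j eq = ⇒-⊨ (addr# i t0 == zero) (addr# j (lit 1 ⊹ t0) == zero) ρ
      (\ p -> address≈ j (suc t) >> R.reflexive (cong nat (eq ~> cong pred (pointing i {0} p)))) , ⇒-⊨ (addr# i t0 /= zero) (add one (addr# j (lit 1 ⊹ t0)) == addr# i t0) ρ
      (\ p -> +-congˡ (address≈ j (suc t) >> R.reflexive (cong nat eq)) >> R.reflexive (cong nat (N.suc-pred (A.addresses i) {{N.≢-nonZero \ q -> p (address≈ i t >> R.reflexive (cong nat q))}})) >> R.sym (address≈ i t))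
     updating : ∀ e x -> B.addresses ≡ A.addresses [ x ≔ᵃ address e A.addresses ] -> ∀ j -> ⊨ (movesAt e x j) ρ
     updating e x eq j = case (j ≟ᶠ x) where
      case : Dec (j ≡ x) -> ⊨ (movesAt e x j) ρ
      case (yes p) = subst (\ φ -> ⊨ φ ρ) (sym (if-≡ᶠ p)) (moving e j (cong (\ f -> f j) eq ~> if-≡ᶠ p))
      case (no p) = subst (\ φ -> ⊨ φ ρ) (sym (if-≢ᶠ p)) (address≈ j (suc t) >> R.reflexive (cong nat (cong (\ f -> f j) eq ~> if-≢ᶠ p)) >> R.sym (address≈ j t))
    module _ (t : ℕ) where
     private
      a = s t
      b = s (suc t)
      module A = Config a
      module B = Config b
      firsts : ∀ {nd} -> code A.node ≡ nd -> v (4 ∷ t ∷ []) ≡ A.memory (A.addresses (firstRegister nd))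
      firsts = cong (\ nd -> A.memory (A.addresses (firstRegister nd)))
      seconds : ∀ {nd} -> code A.node ≡ nd -> v (5 ∷ t ∷ []) ≡ A.memory (A.addresses (secondRegister nd))
      seconds = cong (\ nd -> A.memory (A.addresses (secondRegister nd)))
      targets : ∀ {nd} -> code A.node ≡ nd -> v (6 ∷ t ∷ []) ≡ B.memory (A.addresses (target nd))
      targets = cong (\ nd -> B.memory (A.addresses (target nd)))
      stored : ∀ x {m f z} -> b ≡ config m f (A.memory [ A.addresses x ≔ z ]) -> B.memory (A.addresses x) ≡ z
      stored x b≡ = cong (\ b -> Config.memory b (A.addresses x)) b≡ ~> if-≡ {m = A.addresses x} refl
      Branch : Set -> Fin #nodes -> Fin #nodes -> Set
      Branch P m m' = (P × b ≡ config m A.addresses A.memory) ⊎ (¬ P × b ≡ config m' A.addresses A.memory)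
      branched : ∀ P {m m'} -> Branch P m m' -> ⊨ (keepCells & keepAddresses) (ρ t)
      branched P (inl (_ , b≡)) = keepingCells t (cong Config.memory b≡) , keepingAddresses t (cong Config.addresses b≡)
      branched P (inr (_ , b≡)) = keepingCells t (cong Config.memory b≡) , keepingAddresses t (cong Config.addresses b≡)
      yes-branch : ∀ {P m m'} -> Branch P m m' -> P -> ⊨ (goes m) (ρ t)
      yes-branch (inl (_ , b≡)) _ = went t (cong Config.node b≡)
      yes-branch (inr (¬p , _)) p = ⊥-elim (¬p p)
      no-branch : ∀ {P m m'} -> Branch P m m' -> ¬ P -> ⊨ (goes m') (ρ t)
      no-branch (inl (p , _)) ¬p = ⊥-elim (¬p p)
      no-branch (inr (_ , b≡)) _ = went t (cong Config.node b≡)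
     Step : Node #addresses #nodes -> Set
     Step nd = Next nd a b ⊎ (b ≡ a × nd ≡ accept)
     step-holds : ∀ nd -> code A.node ≡ nd -> Step nd -> ⊨ (stepAt A.node nd) (ρ t)
     step-holds (compute o x y z m) eq (inl (u , res , b≡)) = went t (cong Config.node b≡) , reading t 4 y (firsts eq) , reading t 5 z (seconds eq) , resulting t o (subst₂ (\ x y -> Result o x y u) (sym (firsts eq)) (sym (seconds eq)) res) (targets eq ~> stored x b≡) ,
      writing t x u (cong Config.memory b≡) (targets eq) , keepingAddresses t (cong Config.addresses b≡)
     step-holds (constant z x m) eq (inl b≡) = went t (cong Config.node b≡) , R.reflexive (targets eq ~> stored x b≡) >> R.sym (constant-value A.node eq (ι v) v (ρ t)) , writing t x z (cong Config.memory b≡) (targets eq) , keepingAddresses t (cong Config.addresses b≡)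
     step-holds (guess x m) eq (inl (z , b≡)) = went t (cong Config.node b≡) , writing t x z (cong Config.memory b≡) (targets eq) , keepingAddresses t (cong Config.addresses b≡)
     step-holds (test x y m m') eq (inl br) = (reading t 4 x (firsts eq) , reading t 5 y (seconds eq) , branched _ br) , ⇒-⊨ (first t0 == second t0) (goes m) (ρ t) (\ p -> yes-branch br (subst₂ _≈_ (firsts eq) (seconds eq) p)) ,
      ⇒-⊨ (first t0 /= second t0) (goes m') (ρ t) (\ ¬p -> no-branch br (\ p -> ¬p (subst₂ _≈_ (sym (firsts eq)) (sym (seconds eq)) p)))
     step-holds (move e x m) eq (inl b≡) = went t (cong Config.node b≡) , keepingCells t (cong Config.memory b≡) , each-⊨ #addresses (movesAt e x) (ρ t) (updating t e x (cong Config.addresses b≡))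
     step-holds (testAddress i j m m') eq (inl br) = branched _ br , ⇒-⊨ (addr# i t0 == addr# j t0) (goes m) (ρ t) (\ p -> yes-branch br (pointing t i (p >> address≈ t j t))) ,
      ⇒-⊨ (addr# i t0 /= addr# j t0) (goes m') (ρ t) (\ ¬p -> no-branch br (\ p -> ¬p (address≈ t i t >> R.reflexive (cong nat p) >> R.sym (address≈ t j t))))
     step-holds .accept eq (inr (p , refl)) = went t (cong Config.node p) , keepingCells t (cong Config.memory p) , keepingAddresses t (cong Config.addresses p)
     steps-hold : ∀ p -> ⊨ (node# t0 == numeral (toℕ p) => stepAt p (code p)) (ρ t)
     steps-hold p = ⇒-⊨ (node# t0 == numeral (toℕ p)) (stepAt p (code p)) (ρ t) \ h -> subst (\ p -> ⊨ (stepAt p (code p)) (ρ t)) (Fin.toℕ-injective (nat-inj {toℕ A.node} (h >> numeral≈ (toℕ p) (ρ t))))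
      (step-holds (code A.node) refl (proceeding (proceeds r (snd (snd (snd run))) t))) where
      proceeding : Proceeds a b -> Step (code A.node)
      proceeding (inl st) = inl (next⇒ st)
      proceeding (inr h) = inr h
   satisfied : Solvable κ formula w
   satisfied = bwd (formula⇔ w) (bwd (withInput⇔ κ body w) (v , (\ _ _ -> R.refl) , (R.refl , (\ _ _ -> R.refl)) , (R.reflexive (cong (nat ∘ toℕ ∘ Config.node) (start-at r)) , address≈ 0 0F 0 >> R.reflexive (cong (\ c -> nat (Config.addresses c 0F)) (start-at r)) ,
    each-⊨ extraAddresses (\ j -> addr# (fsuc j) (lit 0) == zero) (n ∷ []) (\ j -> address≈ 0 (fsuc j) 0 >> R.reflexive (cong nat (start-address j))) , (\ i _ -> R.reflexive (start-cell i ~> load-nth w i)) ,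
    \ i _ -> R.reflexive (start-cell (n N.+ i) ~> load-nth w (n N.+ i) ~> nth-end w i)) , (\ t _ -> each-⊨ #nodes (\ p -> node# t0 == numeral (toℕ p) => stepAt p (code p)) (ρ t) (steps-hold t)) ,
    each-⊨ #nodes (\ p -> final p (dec (code p ≡ accept))) (n ∷ []) (\ p -> finals p (dec (code p ≡ accept))))) where
    start-cell : ∀ i -> Config.memory (s 0) i ≡ load w i
    start-cell i = cong (\ c -> Config.memory c i) (start-at r)
    start-address : ∀ j -> Config.addresses (s 0) (fsuc j) ≡ 0
    start-address j = cong (\ c -> Config.addresses c (fsuc j)) (start-at r)
    ended : ∀ p -> v (0 ∷ ⟦ duration (# 0F) ⟧e (n ∷ []) ∷ []) ≈ ⟦_⟧ᵗ κ (ι v) v (numeral (toℕ p)) (n ∷ []) -> code p ≡ accept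
    ended p h = subst (\ p -> code p ≡ accept) (Fin.toℕ-injective (nat-inj (R.reflexive (sym (cong (nat ∘ toℕ ∘ Config.node)
     (cong s (duration-value (# 0F) (n ∷ [])) ~> at-end r T (within {w} r)))) >> h >> numeral≈ (toℕ p) (n ∷ [])))) (snd (snd (snd run)))
    finals : ∀ p a -> ⊨ (final p a) (n ∷ [])
    finals p (yes _) = R.refl
    finals p (no ¬a) h = ¬a (ended p h)
  accepts : Solvable κ formula w -> Accepts w
  accepts s = let v , given , h = fwd (withInput⇔ κ body w) (fwd (formula⇔ w) s) in Sound.accepts v given h

module FormulaEvaluation (em : EM) (R : Ring)
 (1≉0 : ¬ CommutativeRing._≈_ R (CommutativeRing.1# R) (CommutativeRing.0# R)) where
 open Formula
 open FormulaSemantics R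
 open Classical em
 open CommutativeRing R hiding (zero; refl; sym) renaming (trans to infixr 5 _>>_)
 private module R = CommutativeRing R
 open BSS R using (add; sub; mul; div; NP⁰; Operation)
 open BSSCompiler R
 open CounterPrograms using (module Execution)
 open RingSolver R
 open Polynomials
 open import Relation.Binary.Definitions using (tri<; tri≈; tri>)

 private
  Ok : Carrier -> Set
  Ok z = z ≈ 0# ⊎ z ≈ 1#
  admissible : ∀ b -> Ok (if b then 1# else 0#)
  admissible false = inl R.refl
  admissible true = inr R.refl

 open BSSPrograms R true Ok admissible
 open Execution (Act true Ok) Store ⟦_⟧ᵃ using (_▸_)

 wk : ∀ {k} -> Ex k -> Ex (suc k)
 wk (lit m) = lit m
 wk (# i) = # fsuc i
 wk (a ⊹ b) = wk a ⊹ wk b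
 wk (a ✶ b) = wk a ✶ wk b

 wk-value : ∀ {k} (e : Ex k) x ρ -> ⟦ wk e ⟧e (x ∷ ρ) ≡ ⟦ e ⟧e ρ
 wk-value (lit m) x ρ = refl
 wk-value (# i) x ρ = refl
 wk-value (a ⊹ b) x ρ = cong₂ N._+_ (wk-value a x ρ) (wk-value b x ρ)
 wk-value (a ✶ b) x ρ = cong₂ N._*_ (wk-value a x ρ) (wk-value b x ρ)

 codeE : ∀ {k} -> List (Ex k) -> Ex k
 codeE [] = lit 0
 codeE (e ∷ es) = lit 1 ⊹ ((e ⊹ codeE es) ✶ (e ⊹ codeE es) ⊹ e)

 code : List ℕ -> ℕ
 code [] = 0
 code (i ∷ is) = suc ((i N.+ code is) N.* (i N.+ code is) N.+ i)

 code-value : ∀ {k} (es : List (Ex k)) ρ -> ⟦ codeE es ⟧e ρ ≡ code (⟦ es ⟧ⁿ ρ)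
 code-value [] ρ = refl
 code-value (e ∷ es) ρ = cong (\ c -> suc ((⟦ e ⟧e ρ N.+ c) N.* (⟦ e ⟧e ρ N.+ c) N.+ ⟦ e ⟧e ρ)) (code-value es ρ)

 code-inj : ∀ is js -> code is ≡ code js -> is ≡ js
 code-inj [] [] _ = refl
 code-inj [] (_ ∷ _) ()
 code-inj (_ ∷ _) [] ()
 code-inj (i ∷ is) (j ∷ js) eq = cong₂ _∷_ i≡j (code-inj is js (N.+-cancelˡ-≡ i _ _ (sums ~> cong (N._+ code js) (sym i≡j)))) where
  -- The square determines its root because 0 ≤ i ≤ i + c.
  smaller : ∀ i c j d -> i N.+ c < j N.+ d -> (i N.+ c) N.* (i N.+ c) N.+ i < (j N.+ d) N.* (j N.+ d) N.+ j
  smaller i c j d lt = s≤s (N.+-monoʳ-≤ ((i N.+ c) N.* (i N.+ c)) (N.m≤m+n i c)) ▹ (next (i N.+ c) ▹ N.*-mono-≤ lt lt) ▹ N.m≤m+n _ j where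
   square : ∀ x -> suc x N.* suc x ≡ suc (x N.* x N.+ x) N.+ x
   square = solve-∀
   next : ∀ x -> suc (x N.* x N.+ x) ≤ suc x N.* suc x
   next x = N.m≤m+n _ x ▹ N.≤-reflexive (sym (square x))
  sums : i N.+ code is ≡ j N.+ code js
  sums with N.<-cmp (i N.+ code is) (j N.+ code js)
  ... | tri< lt _ _ = ⊥-elim (N.<⇒≢ (smaller i (code is) j (code js) lt) (N.suc-injective eq))
  ... | tri≈ _ p _ = p
  ... | tri> _ _ gt = ⊥-elim (N.<⇒≢ (smaller j (code js) i (code is) gt) (sym (N.suc-injective eq)))
  i≡j : i ≡ j
  i≡j = N.+-cancelˡ-≡ ((i N.+ code is) N.* (i N.+ code is)) i j
   (N.suc-injective eq ~> cong (\ x -> x N.* x N.+ j) (sym sums))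

 -- Beyond the input, unknowns live at even offsets and temporaries at odd ones.
 module _ {k : ℕ} (ν : Ex k) where
  unknownE : List (Ex k) -> Ex k
  unknownE es = ν ⊹ lit 2 ✶ codeE es
  temp : ℕ -> Ex k
  temp j = ν ⊹ lit (suc (2 N.* j))
  set : ℕ -> Bool -> Prog k
  set j b = letE (temp j) (act (constant (bit b) (admissible b) (just 0F)))
  combine : (∀ {m} -> (t x y : Operand m) -> Act true Ok m) -> ℕ -> Ex k -> Prog k
  combine α j e = letE e (letE (wk (temp j)) (act (α (just 0F) (just 0F) (just 1F))))
  load : ℕ -> Ex k -> Prog k
  load j e = set j false ⨾ combine (compute add) j e
  evaluateTm : ℕ -> Tm 0 k -> Prog k
  evaluateTm j (var es) = load j (unknownE es)
  evaluateTm j (inp e) = load j e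
  evaluateTm j (con ())
  evaluateTm j zero = set j false
  evaluateTm j one = set j true
  evaluateTm j (add s t) = evaluateTm j s ⨾ evaluateTm (suc j) t ⨾ combine (compute add) j (temp (suc j))
  evaluateTm j (mul s t) = evaluateTm j s ⨾ evaluateTm (suc j) t ⨾ combine (compute mul) j (temp (suc j))

 evaluateFm : ∀ {k} -> Ex k -> ℕ -> Fm 0 k -> Prog k
 evaluateFm ν j (equ s t) = evaluateTm ν j s ⨾ evaluateTm ν (suc j) t ⨾ combine ν same j (temp ν (suc j))
 evaluateFm ν j (and φ ψ) = evaluateFm ν j φ ⨾ evaluateFm ν (suc j) ψ ⨾ combine ν (compute mul) j (temp ν (suc j))
 evaluateFm ν j (not φ) = set ν j true ⨾ evaluateFm ν (suc j) φ ⨾ combine ν (compute sub) j (temp ν (suc j))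
 evaluateFm ν j (all e φ) = set ν j true ⨾ for e (evaluateFm (wk ν) (suc j) φ ⨾ combine (wk ν) (compute mul) j (temp (wk ν) (suc j)))

 -- Division by the truth value makes the program get stuck unless it is 1.
 verify : Fm 0 1 -> Prog 1
 verify φ = evaluateFm (# 0F) 0 φ ⨾ letE (temp (# 0F) 0) (act (compute div (just 0F) (just 0F) (just 0F)))

 private
  record Does (E : Store -> Store -> Set) (s : Store) (Q : Store -> Set) : Set where
   constructor both
   field
    exists : ∃[ t ] E s t
    every  : ∀ t -> E s t -> Q t
  open Does
  bind : ∀ {E F s Q Q'} -> Does E s Q -> (∀ t -> Q t -> Does F t Q') -> Does (E ▸ F) s Q'
  bind (both (t , e) h) f = both (let u , e' = exists (f t (h t e)) in u , t , e , e') \ { u (t , e , e') -> every (f t (h t e)) u e' }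
  weaken : ∀ {E s Q Q'} -> (∀ t -> Q t -> Q' t) -> Does E s Q -> Does E s Q'
  weaken h (both e f) = both e \ t e -> h t (f t e)
  Truth : Set -> Carrier -> Set
  Truth P x = (P -> x ≈ 1#) × (¬ P -> x ≈ 0#)
  truth-and : ∀ {P P' x y z} -> Truth P x -> Truth P' y -> z ≈ x * y -> Truth (P × P') z
  truth-and {P} {P'} {x} {y} (p , q) (p' , q') eq = (\ (h , h') -> eq >> *-cong (p h) (p' h') >> *-identityˡ 1#) , refuted where
   refuted : ¬ (P × P') -> _ ≈ 0#
   refuted h with dec P
   ... | no ¬p = eq >> *-congʳ (q ¬p) >> zeroˡ y
   ... | yes a = eq >> *-congˡ (q' \ a' -> h (a , a')) >> zeroʳ x

 module _ (n : ℕ) (w : ℕ -> Carrier) (v : List ℕ -> Carrier) where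
  private
   unknownAt : List ℕ -> ℕ
   unknownAt is = n N.+ 2 N.* code is
   tempAt : ℕ -> ℕ
   tempAt j = n N.+ suc (2 N.* j)
   Apart : ℕ -> ℕ -> Set
   Apart j a = ∀ i -> j ≤ i -> a ≢ tempAt i
   input-apart : ∀ {a} j -> a < n -> Apart j a
   input-apart j a< i _ = N.<⇒≢ (N.<-≤-trans a< (N.m≤m+n n _))
   unknown-apart : ∀ is j -> Apart j (unknownAt is)
   unknown-apart is j i _ eq = parity (code is) i (N.+-cancelˡ-≡ n _ _ eq) where
    parity : ∀ a b -> 2 N.* a ≢ suc (2 N.* b)
    parity zero b ()
    parity (suc a) zero eq with trans (sym (N.+-suc a (a N.+ 0))) (N.suc-injective eq)
    ... | ()
    parity (suc a) (suc b) eq = parity a b (N.suc-injective (sym (N.+-suc a (a N.+ 0)) ~> N.suc-injective eq ~> cong suc (N.+-suc b (b N.+ 0))))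
   temp-apart : ∀ j -> Apart (suc j) (tempAt j)
   temp-apart j i j<i eq = N.<⇒≢ j<i (N.*-cancelˡ-≡ j i 2 (N.suc-injective (N.+-cancelˡ-≡ n _ _ eq)))
   weaken-apart : ∀ {j a} -> Apart j a -> Apart (suc j) a
   weaken-apart h i j<i = h i (N.<⇒≤ j<i)
  record Good (s : Store) : Set where
   field
    inputs   : ∀ {i} -> i < n -> snd s i ≈ w i
    unknowns : ∀ is -> snd s (unknownAt is) ≈ v is
  private
   record After (j : ℕ) (Q : Carrier -> Set) (s t : Store) : Set where
    constructor after
    field
     keeps : ∀ {a} -> Apart j a -> snd t a ≡ snd s a
     value : Q (snd t (tempAt j))
   after-good : ∀ {j Q s t} -> Good s -> After j Q s t -> Good t
   after-good {j} g (after keeps _) = record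
    { inputs = \ i< -> R.reflexive (keeps (input-apart j i<)) >> Good.inputs g i<
    ; unknowns = \ is -> R.reflexive (keeps (unknown-apart is j)) >> Good.unknowns g is }
   after-weaken : ∀ {j Q Q' s t} -> (∀ {x} -> Q x -> Q' x) -> After j Q s t -> After j Q' s t
   after-weaken h (after keeps value) = after keeps (h value)
   module _ {k : ℕ} (ν : Ex k) (ρ : Vec ℕ k) (ν≡ : ⟦ ν ⟧e ρ ≡ n) where
    temp≡ : ∀ j -> ⟦ temp ν j ⟧e ρ ≡ tempAt j
    temp≡ j = cong (N._+ suc (2 N.* j)) ν≡
    set-does : ∀ j b s -> Does (effect (set ν j b) ρ) s (After j (_≈ bit b) s)
    set-does j b (o , m) = both (_ , refl) \ { t refl -> subst (\ a -> After j (_≈ bit b) (o , m) (o , write m a (bit b))) (sym (temp≡ j))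
     (after (\ h -> write-other m (tempAt j) (bit b) (h j N.≤-refl)) (R.reflexive (write-same m (tempAt j) (bit b)))) }
    -- Step x y z: the act α replaces x, in the temporary j, by z, given y.
    combine-does : ∀ (α : ∀ {m} -> (t x y : Operand m) -> Act true Ok m) (Step : Carrier -> Carrier -> Carrier -> Set) -> (∀ x y -> ∃[ z ] Step x y z) ->
     (∀ {m} (t x y : Operand m) ρ s u -> ⟦ α t x y ⟧ᵃ ρ s u ⇔ (∃[ z ] Step (snd s (place ρ (fst s) x)) (snd s (place ρ (fst s) y)) z × u ≡ (fst s , write (snd s) (place ρ (fst s) t) z))) ->
     ∀ j e a -> ⟦ e ⟧e ρ ≡ a -> ∀ {Q} {Q″ : Carrier -> Set} s0 s -> After j Q s0 s -> (∀ {x z} -> Q x -> Step x (snd s a) z -> Q″ z) -> Does (effect (combine ν α j e) ρ) s (After j Q″ s0)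
    combine-does α Step total acts j e a refl {Q} {Q″} s0 s@(o , m) (after keeps value) h = both
     (let z , st = total (m c) (m a) in _ , bwd (acts (just 0F) (just 0F) (just 1F) ρ' s _) (z , st , refl))
     \ t e -> finish t (fwd (acts (just 0F) (just 0F) (just 1F) ρ' s t) e) where
     c = ⟦ wk (temp ν j) ⟧e (a ∷ ρ)
     ρ' = c ∷ a ∷ ρ
     c≡ : c ≡ tempAt j
     c≡ = wk-value (temp ν j) a ρ ~> temp≡ j
     finish : ∀ t -> (∃[ z ] Step (m c) (m a) z × t ≡ (o , write m c z)) -> After j Q″ s0 t
     finish t (z , st , refl) rewrite c≡ = after (\ h -> write-other m (tempAt j) z (h j N.≤-refl) ~> keeps h)
      (subst Q″ (sym (write-same m (tempAt j) z)) (h value st))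
    computing : ∀ (op : Operation) (_∙_ : Carrier -> Carrier -> Carrier) -> (∀ x y z -> BSS.Result R op x y z ⇔ (z ≈ x ∙ y)) -> ∀ j e a -> ⟦ e ⟧e ρ ≡ a -> ∀ {Q} {Q″ : Carrier -> Set} s0 s -> After j Q s0 s -> (∀ {x z} -> Q x -> z ≈ x ∙ snd s a -> Q″ z) ->
     Does (effect (combine ν (compute op) j e) ρ) s (After j Q″ s0)
    computing op _∙_ res = combine-does (compute op) (\ x y z -> z ≈ x ∙ y) (\ x y -> x ∙ y , R.refl)
     \ t x y ρ s u -> mk⇔ (\ (z , r , eq) -> z , fwd (res _ _ z) r , eq) (\ (z , r , eq) -> z , bwd (res _ _ z) r , eq)
    adding = computing add _+_ (\ _ _ _ -> mk⇔ id id)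
    multiplying = computing mul _*_ (\ _ _ _ -> mk⇔ id id)
    subtracting = computing sub _-_ (\ _ _ _ -> mk⇔ id id)
    load-does : ∀ j e a x s -> ⟦ e ⟧e ρ ≡ a -> Apart j a -> snd s a ≈ x -> Does (effect (load ν j e) ρ) s (After j (_≈ x) s)
    load-does j e a x s eq apart a≈ = bind (set-does j false s) \ t h -> adding j e a eq s t h \ p q -> q >> +-cong p (R.reflexive (After.keeps h apart) >> a≈) >> +-identityˡ x
    second-value : ∀ {j Q Q' s t} -> After (suc j) Q' s t -> ∀ s0 -> After j Q s0 s -> After j Q s0 t
    second-value {j} {Q} (after keeps' _) s0 (after keeps value) = after (\ h -> keeps' (weaken-apart h) ~> keeps h) (subst Q (sym (keeps' (temp-apart j))) value)
    tm-does : ∀ (κ : Fin 0 -> Carrier) t j s -> TmInputs (_< n) t ρ -> Good s -> Does (effect (evaluateTm ν j t) ρ) s (After j (_≈ ⟦_⟧ᵗ κ w v t ρ) s)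
    tm-does κ (var es) j s _ g = load-does j (unknownE ν es) (unknownAt (⟦ es ⟧ⁿ ρ)) (v (⟦ es ⟧ⁿ ρ)) s
     (cong₂ (\ a b -> a N.+ 2 N.* b) ν≡ (code-value es ρ)) (unknown-apart (⟦ es ⟧ⁿ ρ) j) (Good.unknowns g (⟦ es ⟧ⁿ ρ))
    tm-does κ (inp e) j s i< g = load-does j e (⟦ e ⟧e ρ) (w (⟦ e ⟧e ρ)) s refl (input-apart j i<) (Good.inputs g i<)
    tm-does κ zero j s _ g = set-does j false s
    tm-does κ one j s _ g = set-does j true s
    tm-does κ (add t t') j s (h , h') g = bind (tm-does κ t j s h g) \ s1 a1 -> bind (tm-does κ t' (suc j) s1 h' (after-good g a1)) \ s2 a2 -> adding j (temp ν (suc j)) (tempAt (suc j)) (temp≡ (suc j)) s s2 (second-value a2 s a1) \ p q -> q >> +-cong p (After.value a2)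
    tm-does κ (mul t t') j s (h , h') g = bind (tm-does κ t j s h g) \ s1 a1 -> bind (tm-does κ t' (suc j) s1 h' (after-good g a1)) \ s2 a2 -> multiplying j (temp ν (suc j)) (tempAt (suc j)) (temp≡ (suc j)) s s2 (second-value a2 s a1) \ p q -> q >> *-cong p (After.value a2)
   fm-does : ∀ (κ : Fin 0 -> Carrier) {k} (ν : Ex k) (φ : Fm 0 k) ρ j s -> ⟦ ν ⟧e ρ ≡ n -> FmInputs (_< n) φ ρ -> Good s -> Does (effect (evaluateFm ν j φ) ρ) s (After j (Truth (Holds κ w v φ ρ)) s)
   fm-does κ ν (equ t t') ρ j s eq (h , h') g = bind (tm-does ν ρ eq κ t j s h g) \ s1 a1 -> bind (tm-does ν ρ eq κ t' (suc j) s1 h' (after-good g a1)) \ s2 a2 -> combine-does ν ρ eq same Same (\ x y -> decided x y (dec (x ≈ y))) (\ t x y ρ s u -> mk⇔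
    (\ { (inl (p , e)) -> 1# , inl (p , refl) , e ; (inr (p , e)) -> 0# , inr (p , refl) , e })
    (\ { (_ , inl (p , refl) , e) -> inl (p , e) ; (_ , inr (p , refl) , e) -> inr (p , e) }))
    j (temp ν (suc j)) (tempAt (suc j)) (temp≡ ν ρ eq (suc j)) s s2 (second-value ν ρ eq a2 s a1) (compared (After.value a2)) where
    Same : Carrier -> Carrier -> Carrier -> Set
    Same x y z = (x ≈ y × z ≡ 1#) ⊎ (¬ x ≈ y × z ≡ 0#)
    decided : ∀ x y -> Dec (x ≈ y) -> ∃[ z ] Same x y z
    decided x y (yes p) = 1# , inl (p , refl)
    decided x y (no p) = 0# , inr (p , refl)
    compared : ∀ {x y x0 y0 z} -> y ≈ y0 -> x ≈ x0 -> Same x y z -> Truth (x0 ≈ y0) z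
    compared q p (inl (r , refl)) = (\ _ -> R.refl) , \ ¬r -> ⊥-elim (¬r (R.sym p >> r >> q))
    compared q p (inr (¬r , refl)) = (\ r -> ⊥-elim (¬r (p >> r >> R.sym q))) , \ _ -> R.refl
   fm-does κ ν (and φ ψ) ρ j s eq (h , h') g = bind (fm-does κ ν φ ρ j s eq h g) \ s1 a1 -> bind (fm-does κ ν ψ ρ (suc j) s1 eq h' (after-good g a1)) \ s2 a2 ->
    multiplying ν ρ eq j (temp ν (suc j)) (tempAt (suc j)) (temp≡ ν ρ eq (suc j)) s s2 (second-value ν ρ eq a2 s a1) \ p q -> truth-and p (After.value a2) q
   fm-does κ ν (not φ) ρ j s eq h g = bind (set-does ν ρ eq j true s) \ s1 a1 -> bind (fm-does κ ν φ ρ (suc j) s1 eq h (after-good g a1)) \ s2 a2 ->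
    subtracting ν ρ eq j (temp ν (suc j)) (tempAt (suc j)) (temp≡ ν ρ eq (suc j)) s s2 (second-value ν ρ eq a2 s a1) \ p q -> negated p (After.value a2) q where
    negated : ∀ {P x y z} -> x ≈ 1# -> Truth P y -> z ≈ x - y -> Truth (¬ P) z
    negated p (t , f) q = (\ ¬h -> q >> +-cong p (-‿cong (f ¬h)) >> solve 0 (:1 :- :0 := :1) R.refl) , \ ¬¬h -> q >> +-cong p (-‿cong (t (dne ¬¬h))) >> -‿inverseʳ 1#
   fm-does κ ν (all e φ) ρ j s eq h g = bind (set-does ν ρ eq j true s) \ s1 a1 -> weaken (\ t -> after-weaken \ (p , q) -> (\ h -> p (tt , \ i _ i< -> h i i<)) , \ ¬h -> q \ (_ , h) -> ¬h \ i i< -> h i z≤n i<)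
    (loop 0 (⟦ e ⟧e ρ) ⊤ (\ i _ -> h i) s1 (after-weaken (\ p -> (\ _ -> p) , \ ¬⊤ -> ⊥-elim (¬⊤ tt)) a1)) where
    loop : ∀ i c P -> (∀ m -> i ≤ m -> m < i N.+ c -> FmInputs (_< n) φ (m ∷ ρ)) -> ∀ s' -> After j (Truth P) s s' -> Does (iterate (\ i -> effect (evaluateFm (wk ν) (suc j) φ ⨾ combine (wk ν) (compute mul) j (temp (wk ν) (suc j))) (i ∷ ρ)) i c) s'
     (After j (Truth (P × ∀ m -> i ≤ m -> m < i N.+ c -> Holds κ w v φ (m ∷ ρ))) s)
    loop i zero P h s' a = both (s' , refl) \ { t refl -> after-weaken (\ (p , q) -> (\ (x , _) -> p x) , \ ¬x -> q \ x -> ¬x (x , \ m i≤ m< -> ⊥-elim (N.<⇒≱ m< (subst (_≤ m) (sym (N.+-identityʳ i)) i≤)))) a }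
    loop i (suc c) P h s' a = bind (bind (fm-does κ (wk ν) φ (i ∷ ρ) (suc j) s' eq' (h i N.≤-refl (N.m<m+n i (s≤s z≤n))) (after-good g a)) \ s1 a1 ->
     multiplying (wk ν) (i ∷ ρ) eq' j (temp (wk ν) (suc j)) (tempAt (suc j)) (temp≡ (wk ν) (i ∷ ρ) eq' (suc j)) s s1 (second-value ν ρ eq a1 s a)
     \ p q -> truth-and p (After.value a1) q)
     \ s2 a2 -> weaken (\ t -> after-weaken \ (p , q) -> (\ (x , y) -> p ((x , y i N.≤-refl (N.m<m+n i (s≤s z≤n))) , \ m i< m< -> y m (N.<⇒≤ i<) (subst (m <_) (sym (N.+-suc i c)) m<))) , \ ¬x -> q \ ((x , y0) , y) -> ¬x (x , \ m i≤ m< -> case m i≤ m< y0 y (i N.≟ m)))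
     (loop (suc i) c (P × Holds κ w v φ (i ∷ ρ)) (\ m i< m< -> h m (N.<⇒≤ i<) (subst (m <_) (sym (N.+-suc i c)) m<)) s2 a2) where
     eq' = wk-value ν i ρ ~> eq
     case : ∀ m -> i ≤ m -> m < i N.+ suc c -> Holds κ w v φ (i ∷ ρ) -> (∀ m -> suc i ≤ m -> m < suc i N.+ c -> Holds κ w v φ (m ∷ ρ)) -> Dec (i ≡ m) -> Holds κ w v φ (m ∷ ρ)
     case m i≤ m< y0 y (yes refl) = y0
     case m i≤ m< y0 y (no i≢) = y m (N.≤∧≢⇒< i≤ i≢) (subst (m <_) (N.+-suc i c) m<)
  verified : ∀ φ κ s -> FmInputs (_< n) φ (n ∷ []) -> Good s -> (∃[ t ] effect (verify φ) (n ∷ []) s t) ⇔ Holds κ w v φ (n ∷ [])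
  verified φ κ s h g = mk⇔
   (\ { (_ , s1 , e1 , _ , (nonzero , _) , _) -> dne \ ¬h -> nonzero (snd (After.value (every evaluated s1 e1)) ¬h) })
   \ holds -> let s1 , e1 = exists evaluated ; value = fst (After.value (every evaluated s1 e1)) holds in
   _ , s1 , e1 , 1# , ((\ p -> 1≉0 (R.sym value >> p)) , *-identityˡ _) , refl where
   evaluated = fm-does κ (# 0F) φ (n ∷ []) 0 s refl h g

 TmNames : ∀ {k} -> (List ℕ -> Set) -> Tm 0 k -> Vec ℕ k -> Set
 TmNames P (var es) ρ = P (⟦ es ⟧ⁿ ρ)
 TmNames P (add s t) ρ = TmNames P s ρ × TmNames P t ρ
 TmNames P (mul s t) ρ = TmNames P s ρ × TmNames P t ρ
 TmNames P _ ρ = ⊤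

 FmNames : ∀ {k} -> (List ℕ -> Set) -> Fm 0 k -> Vec ℕ k -> Set
 FmNames P (equ s t) ρ = TmNames P s ρ × TmNames P t ρ
 FmNames P (and φ ψ) ρ = FmNames P φ ρ × FmNames P ψ ρ
 FmNames P (not φ) ρ = FmNames P φ ρ
 FmNames P (all e φ) ρ = ∀ j -> j < ⟦ e ⟧e ρ -> FmNames P φ (j ∷ ρ)

 module _ (κ : Fin 0 -> Carrier) (w : ℕ -> Carrier) {P : List ℕ -> Set} where
  tm-agree : ∀ {v v'} -> (∀ is -> P is -> v is ≈ v' is) -> ∀ {k} (t : Tm 0 k) ρ -> TmNames P t ρ -> ⟦_⟧ᵗ κ w v t ρ ≈ ⟦_⟧ᵗ κ w v' t ρ
  tm-agree h (var es) ρ p = h (⟦ es ⟧ⁿ ρ) p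
  tm-agree h (inp e) ρ p = R.refl
  tm-agree h zero ρ p = R.refl
  tm-agree h one ρ p = R.refl
  tm-agree h (add s t) ρ (p , q) = +-cong (tm-agree h s ρ p) (tm-agree h t ρ q)
  tm-agree h (mul s t) ρ (p , q) = *-cong (tm-agree h s ρ p) (tm-agree h t ρ q)
  fm-agree : ∀ {v v'} -> (∀ is -> P is -> v is ≈ v' is) -> ∀ {k} (φ : Fm 0 k) ρ -> FmNames P φ ρ -> Holds κ w v φ ρ -> Holds κ w v' φ ρ
  fm-agree h (equ s t) ρ (p , q) eq = R.sym (tm-agree h s ρ p) >> eq >> tm-agree h t ρ q
  fm-agree h (and φ ψ) ρ (p , q) (x , y) = fm-agree h φ ρ p x , fm-agree h ψ ρ q y
  fm-agree h (not φ) ρ p ¬x = \ x -> ¬x (fm-agree (\ is -> R.sym ∘ h is) φ ρ p x)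
  fm-agree h (all e φ) ρ p x j j< = fm-agree h φ (j ∷ ρ) (p j j<) (x j j<)

 module _ {m : ℕ} where
  substitute : ∀ {k} -> (Fin k -> Ex m) -> Ex k -> Ex m
  substitute σ (lit n) = lit n
  substitute σ (# i) = σ i
  substitute σ (a ⊹ b) = substitute σ a ⊹ substitute σ b
  substitute σ (a ✶ b) = substitute σ a ✶ substitute σ b
  cons : ∀ {k} -> Ex m -> (Fin k -> Ex m) -> Fin (suc k) -> Ex m
  cons e σ 0F = e
  cons e σ (fsuc i) = σ i
  largestTm : ∀ {k} -> (Fin k -> Ex m) -> Tm 0 k -> Ex m
  largestTm σ (var es) = lit 1 ⊹ substitute σ (codeE es)
  largestTm σ (add s t) = largestTm σ s ⊹ largestTm σ t
  largestTm σ (mul s t) = largestTm σ s ⊹ largestTm σ t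
  largestTm σ _ = lit 0
  -- Exceeds the codes of all unknowns of the formula, where σ bounds the indices.
  largest : ∀ {k} -> (Fin k -> Ex m) -> Fm 0 k -> Ex m
  largest σ (equ s t) = largestTm σ s ⊹ largestTm σ t
  largest σ (and φ ψ) = largest σ φ ⊹ largest σ ψ
  largest σ (not φ) = largest σ φ
  largest σ (all e φ) = largest (cons (substitute σ e) σ) φ
  module _ (τ : Vec ℕ m) (B : ℕ) where
   private
    substitute-≤ : ∀ {k} (σ : Fin k -> Ex m) ρ -> (∀ i -> lookup ρ i ≤ ⟦ σ i ⟧e τ) -> ∀ e -> ⟦ e ⟧e ρ ≤ ⟦ substitute σ e ⟧e τ
    substitute-≤ σ ρ h (lit n) = N.≤-refl
    substitute-≤ σ ρ h (# i) = h i
    substitute-≤ σ ρ h (a ⊹ b) = N.+-mono-≤ (substitute-≤ σ ρ h a) (substitute-≤ σ ρ h b)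
    substitute-≤ σ ρ h (a ✶ b) = N.*-mono-≤ (substitute-≤ σ ρ h a) (substitute-≤ σ ρ h b)
    Small : List ℕ -> Set
    Small is = code is < B
    tm-small : ∀ {k} (σ : Fin k -> Ex m) ρ -> (∀ i -> lookup ρ i ≤ ⟦ σ i ⟧e τ) -> ∀ t -> ⟦ largestTm σ t ⟧e τ ≤ B -> TmNames Small t ρ
    tm-small σ ρ h (var es) le = s≤s (N.≤-reflexive (sym (code-value es ρ)) ▹ substitute-≤ σ ρ h (codeE es)) ▹ le
    tm-small σ ρ h (inp e) le = tt
    tm-small σ ρ h zero le = tt
    tm-small σ ρ h one le = tt
    tm-small σ ρ h (add s t) le = tm-small σ ρ h s (N.m+n≤o⇒m≤o _ le) , tm-small σ ρ h t (N.m+n≤o⇒n≤o (⟦ largestTm σ s ⟧e τ) le)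
    tm-small σ ρ h (mul s t) le = tm-small σ ρ h s (N.m+n≤o⇒m≤o _ le) , tm-small σ ρ h t (N.m+n≤o⇒n≤o (⟦ largestTm σ s ⟧e τ) le)
   fm-small : ∀ {k} (σ : Fin k -> Ex m) ρ -> (∀ i -> lookup ρ i ≤ ⟦ σ i ⟧e τ) -> ∀ φ -> ⟦ largest σ φ ⟧e τ ≤ B -> FmNames Small φ ρ
   fm-small σ ρ h (equ s t) le = tm-small σ ρ h s (N.m+n≤o⇒m≤o _ le) , tm-small σ ρ h t (N.m+n≤o⇒n≤o (⟦ largestTm σ s ⟧e τ) le)
   fm-small σ ρ h (and φ ψ) le = fm-small σ ρ h φ (N.m+n≤o⇒m≤o _ le) , fm-small σ ρ h ψ (N.m+n≤o⇒n≤o (⟦ largest σ φ ⟧e τ) le)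
   fm-small σ ρ h (not φ) le = fm-small σ ρ h φ le
   fm-small σ ρ h (all e φ) le j j< = fm-small (cons (substitute σ e) σ) (j ∷ ρ)
    (\ { 0F -> (N.<⇒≤ j<) ▹ substitute-≤ σ ρ h e ; (fsuc i) -> h i }) φ le

 program-NP⁰ : ∀ P L -> (∀ w -> L w ⇔ (∃[ t ] effect P (length w ∷ []) (length w , nth w) t)) -> NP⁰ L
 program-NP⁰ P L equivalent = machine , constants-admissible , (fst time , \ {w} run -> runs-within {w} run ▹ snd time (length w)) , \ w -> mk⇔ (\ l -> accepting w (fwd (equivalent w) l)) (\ acc -> bwd (equivalent w) (outcome w acc)) where
  open Compile (command id P) (admissible false) (admissible true)
  open Correct (\ n -> cost P (n ∷ [])) (\ n -> effect P (n ∷ [])) (\ n -> correct id P (n ∷ []) (n ∷ []) (\ _ -> refl))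
  accepting : ∀ w -> ∃[ t ] effect P (length w ∷ []) (initial w) t -> BSS.Semantics.Accepts R machine w
  accepting w (t , e) with result w e
  ... | k , c , run , acc , _ = k , c , run , acc
  time : ∃[ b ] ∀ n -> 4 N.+ 6 N.* cost P (n ∷ []) ≤ bound b n
  time = bounded⇒bound (\ ρ -> 4 N.+ 6 N.* cost P (lookup ρ 0F ∷ [])) (bounded-+ (bounded-lit 4)
   (bounded-* {g = \ ρ -> cost P (lookup ρ 0F ∷ [])} (bounded-lit 6) (bounded-≤ {f = \ ρ -> cost P (lookup ρ 0F ∷ [])} {cost P} (\ { (n ∷ []) -> N.≤-refl }) (bounded-cost P))))

 module _ (φ : Fm 0 1) (below : ∀ n -> FmInputs (_< n) φ (n ∷ [])) (κ : Fin 0 -> Carrier) where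
  private
   count : Ex 1
   count = largest #_ φ
   guesses : Prog 1
   guesses = for count (letE (# 1F ⊹ lit 2 ✶ # 0F) (act (guess refl (just 0F))))
   program : Prog 1
   program = guesses ⨾ verify φ
   module _ (n : ℕ) where
    cell : ℕ -> ℕ
    cell i = n N.+ 2 N.* i
    Guess : ℕ -> Store -> Store -> Set
    Guess i (o , m) t = ∃[ z ] t ≡ (o , write m (cell i) z)
    guess-keeps : ∀ j c {s t} -> iterate Guess j c s t -> ∀ {a} -> (∀ i -> j ≤ i -> a ≢ cell i) -> snd t a ≡ snd s a
    guess-keeps j zero refl h = refl
    guess-keeps j (suc c) {s = o , m} (_ , (z , refl) , e) h = guess-keeps (suc j) c e (\ i j<i -> h i (N.<⇒≤ j<i)) ~> write-other m (cell j) z (h j N.≤-refl)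
    guess-reaches : ∀ (g : ℕ -> Carrier) j c s -> ∃[ t ] iterate Guess j c s t × (∀ i -> j ≤ i -> i < j N.+ c -> snd t (cell i) ≡ g i)
    guess-reaches g j zero s = s , refl , \ i j≤ i< -> ⊥-elim (N.<⇒≱ i< (subst (_≤ i) (sym (N.+-identityʳ j)) j≤))
    guess-reaches g j (suc c) (o , m) = let t , e , h = guess-reaches g (suc j) c (o , write m (cell j) (g j)) in
     t , (_ , (g j , refl) , e) , \ i j≤ i< -> case t e h i j≤ i< (j N.≟ i) where
     case : ∀ t -> iterate Guess (suc j) c (o , write m (cell j) (g j)) t -> (∀ i -> suc j ≤ i -> i < suc j N.+ c -> snd t (cell i) ≡ g i) -> ∀ i -> j ≤ i -> i < j N.+ suc c -> Dec (j ≡ i) -> snd t (cell i) ≡ g i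
     case t e h i _ _ (yes refl) = guess-keeps (suc j) c e (\ i' j<i' eq -> N.<⇒≢ j<i' (N.*-cancelˡ-≡ j i' 2 (N.+-cancelˡ-≡ n _ _ eq))) ~> write-same m (cell j) (g j)
     case t e h i j≤ i< (no j≢) = h i (N.≤∧≢⇒< j≤ j≢) (subst (i <_) (N.+-suc j c) i<)
  accepted : ∀ w -> (∃[ t ] effect program (length w ∷ []) (length w , nth w) t) ⇔ Solvable κ φ w
  accepted w = mk⇔ sound complete where
   n = length w
   good : ∀ s -> iterate (Guess n) 0 (⟦ count ⟧e (n ∷ [])) (n , nth w) s -> Good n (nth w) (\ is -> snd s (cell n (code is))) s
   good s e = record { inputs = \ i< -> R.reflexive (guess-keeps n 0 (⟦ count ⟧e (n ∷ [])) {n , nth w} {s} e (\ i _ -> N.<⇒≢ (N.<-≤-trans i< (N.m≤m+n n _)))) ; unknowns = \ _ -> R.refl }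
   sound : (∃[ t ] effect program (n ∷ []) (n , nth w) t) -> Solvable κ φ w
   sound (t , s , e , e') = _ , fwd (verified n (nth w) _ φ κ s (below n) (good s e)) (t , e')
   complete : Solvable κ φ w -> ∃[ t ] effect program (n ∷ []) (n , nth w) t
   complete (v , h) = let t , e' = bwd (verified n (nth w) (\ is -> snd s (cell n (code is))) φ κ s (below n) (good s e)) holds in t , s , e , e' where
    extended = Codes.extend em code (\ {is} {js} -> code-inj is js) 0# v
    guessed = guess-reaches n (fst extended) 0 (⟦ count ⟧e (n ∷ [])) (n , nth w)
    s = fst guessed
    e = fst (snd guessed)
    holds : Holds κ (nth w) (\ is -> snd s (cell n (code is))) φ (n ∷ [])
    holds = fm-agree κ (nth w) (\ is small -> R.reflexive (sym (snd (snd guessed) (code is) z≤n small ~> snd extended is)))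
     φ (n ∷ []) (fm-small (n ∷ []) (⟦ count ⟧e (n ∷ [])) #_ (n ∷ []) (\ _ -> N.≤-refl) φ N.≤-refl) h
  solvable-NP⁰ : ∀ L -> (∀ w -> L w ⇔ Solvable κ φ w) -> NP⁰ L
  solvable-NP⁰ L equivalent = program-NP⁰ program L \ w -> mk⇔
   (\ l -> bwd (accepted w) (fwd (equivalent w) l)) (\ a -> bwd (equivalent w) (fwd (accepted w) a))

module Annihilators
 (em : EM) (R : Ring) (real : FormallyReal R) (d : ℕ) where
 open Subspaces R d renaming (⊥ to 0ᴸ; ⊤ to 1ᴸ)
 open Subspace
 open Euclidean em R real d
 open RingLaws R
 open import Algebra.Properties.CommutativeMonoid.Sum +-commutativeMonoid using (sum; sum-cong-≋)
 open RingSolver R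

 infix 4 _≈ᵐ_
 infixl 7 _⊗_

 _≈ᵐ_ : Rel Matrix 0ℓ
 A ≈ᵐ B = ∀ i j -> A i j ≈ B i j

 _⊗_ : Matrix -> Matrix -> Matrix
 (A ⊗ B) i j = sum (\ k -> A i k * B k j)

 0ᵐ : Matrix
 0ᵐ _ _ = 0#

 comp : Matrix -> Matrix
 comp A i j = δ i j + (- 1#) * A i j

 infix 4 _kills_

 record _kills_ (A : Matrix) (U : Subspace) : Set where
  constructor killing
  field
   symmetric  : Symmetric A
   idempotent : Idempotent A
   kernel     : ∀ x -> x ∈ U ⇔ A $ x ≈ᵛ 0ᵛ

 open _kills_

 private
  matrix-cong : ∀ {A B} -> A ≈ᵐ B -> ∀ x -> A $ x ≈ᵛ B $ x
  matrix-cong {A} {B} p x i = ·-cong {A i} {B i} {x} (p i) (\ _ -> rfl)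
  $-δ : ∀ A j -> A $ δ j ≈ᵛ (\ i -> A i j)
  $-δ A j i = ·-comm (A i) (δ j) >> sum-δ j (A i)
  by-vectors : ∀ {A B} -> (∀ x -> A $ x ≈ᵛ B $ x) -> A ≈ᵐ B
  by-vectors {A} {B} h i j = symm ($-δ A j i) >> h (δ j) i >> $-δ B j i
  comp-$ : ∀ A x i -> (comp A $ x) i ≈ x i - (A $ x) i
  comp-$ A x i = ·-comm (comp A i) x >> ·-cong {x} (\ _ -> rfl) (\ j -> +-congʳ (symm (*-identityˡ (δ i j)))) >> ·-linearʳ 1# (- 1#) x (δ i) (A i) >> +-cong (*-congˡ (·-comm x (δ i) >> sum-δ i x)) (*-congˡ (·-comm x (A i))) >>
   solve 2 (\ x a -> :1 :* x :+ (:- :1) :* a := x :- a) rfl (x i) ((A $ x) i)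
  $-difference : ∀ A x y -> A $ (\ i -> x i - y i) ≈ᵛ (\ i -> (A $ x) i - (A $ y) i)
  $-difference A x y i = ·-cong {A i} (\ _ -> rfl) (\ j -> solve 2 (\ x a -> x :- a := :1 :* x :+ (:- :1) :* a) rfl (x j) (y j)) >> ·-linearʳ 1# (- 1#) (A i) x y >> solve 2 (\ x a -> :1 :* x :+ (:- :1) :* a := x :- a) rfl ((A $ x) i) ((A $ y) i)
  difference-0 : ∀ {x y : Carrier} -> x ≈ y -> x - y ≈ 0#
  difference-0 {x} {y} p = +-congʳ p >> -‿inverseʳ y
  0-difference : ∀ {x y : Carrier} -> x - y ≈ 0# -> x ≈ y
  0-difference {x} {y} p = solve 2 (\ x y -> x := (x :- y) :+ y) rfl x y >> +-congʳ p >> +-identityˡ y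
  $-0 : ∀ A -> A $ 0ᵛ ≈ᵛ 0ᵛ
  $-0 A i = ·-zeroʳ (A i)
  0-· : ∀ {u : V} -> u ≈ᵛ 0ᵛ -> ∀ x -> u · x ≈ 0#
  0-· {u} p x = ·-cong {u} {0ᵛ} {x} p (\ _ -> rfl) >> ·-comm 0ᵛ x >> ·-zeroʳ x
  fixed-part : ∀ {A} -> Idempotent A -> ∀ x -> A $ (\ i -> x i - (A $ x) i) ≈ᵛ 0ᵛ
  fixed-part {A} e x i = $-difference A x (A $ x) i >> difference-0 (symm (idempotent-$ e x i))

 annihilated : ∀ U -> Σ Matrix (_kills U)
 annihilated U = let open Annihilator (annihilator U) renaming (symmetric to s; idempotent to e; kernel to k) in matrix , killing s e k

 annihilates-cong : ∀ {A U W} -> (∀ x -> x ∈ U ⇔ x ∈ W) -> A kills U -> A kills W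
 annihilates-cong h (killing s e k) = killing s e \ x -> mk⇔ (fwd (k x) ∘ bwd (h x)) (fwd (h x) ∘ bwd (k x))

 ≈-projection : ∀ {A B} -> A ≈ᵐ B -> Symmetric A × Idempotent A -> Symmetric B × Idempotent B
 ≈-projection p (s , e) = (\ i j -> symm (p i j) >> s i j >> p j i) , \ i j -> (sum-cong-≋ \ k -> *-cong (symm (p i k)) (symm (p k j))) >> e i j >> p i j

 annihilates-≈ : ∀ {A B U} -> A ≈ᵐ B -> A kills U -> B kills U
 annihilates-≈ {A} {B} p (killing s e k) = killing (fst (≈-projection p (s , e))) (snd (≈-projection p (s , e)))
  \ x -> mk⇔ (\ x∈ i -> symm (matrix-cong p x i) >> fwd (k x) x∈ i) (\ h -> bwd (k x) (\ i -> matrix-cong p x i >> h i))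

 0-annihilates : 0ᵐ kills 1ᴸ
 0-annihilates = killing (\ _ _ -> rfl) (\ i j -> 0-· {0ᵛ} (\ _ -> rfl) (\ _ -> 0#)) \ x -> mk⇔ (\ _ i -> 0-· {0ᵛ} (\ _ -> rfl) x) \ _ _ -> rfl

 δ-annihilates : δ kills 0ᴸ
 δ-annihilates = killing δ-sym (\ i j -> sum-δ i (\ k -> δ k j)) \ x -> mk⇔
  (\ x≈0 i -> sum-δ i x >> x≈0 i) \ h i -> symm (sum-δ i x) >> h i

 comp-projection : ∀ {A} -> Symmetric A -> Idempotent A -> Symmetric (comp A) × Idempotent (comp A)
 comp-projection {A} s e = (\ i j -> +-cong (δ-sym i j) (*-congˡ (s i j))) , by-vectors \ x i -> (⊗-$ (comp A) (comp A) x i) >> comp-$ A (comp A $ x) i >> +-congˡ (-‿cong ($-cong A (comp-$ A x) i >> fixed-part e x i)) >> solve 1 (\ x -> x :- :0 := x) rfl _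

 comp-annihilates : ∀ {A U} -> A kills U -> comp A kills (U ^⊥)
 comp-annihilates {A} {U} (killing s e k) = killing (fst (comp-projection s e)) (snd (comp-projection s e))
  \ y -> mk⇔ (\ y∈ -> ·-definite (comp A $ y) (norm y y∈)) (\ h u u∈ -> ·-cong {u} (\ _ -> rfl) (\ i -> 0-difference (symm (comp-$ A y i) >> h i)) >> symm (symmetric-· s u y) >> 0-· (fwd (k u) u∈) y) where
  norm : ∀ y -> y ∈ (U ^⊥) -> (comp A $ y) · (comp A $ y) ≈ 0#
  norm y y∈ = ·-cong {z} {z} {z} {\ i -> 1# * y i + (- 1#) * (A $ y) i} (\ _ -> rfl) (\ i -> comp-$ A y i >> solve 2 (\ x a -> x :- a := :1 :* x :+ (:- :1) :* a) rfl (y i) ((A $ y) i)) >> ·-linearʳ 1# (- 1#) z y (A $ y) >> +-cong (*-congˡ (y∈ z (bwd (k z) Az≈0)))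
   (*-congˡ (symm (symmetric-· s z y) >> 0-· Az≈0 y)) >> solve 0 (:1 :* :0 :+ (:- :1) :* :0 := :0) rfl where
   z = comp A $ y
   Az≈0 : A $ z ≈ᵛ 0ᵛ
   Az≈0 i = $-cong A (comp-$ A y) i >> fixed-part e y i

 comp-comp : ∀ A -> comp (comp A) ≈ᵐ A
 comp-comp A i j = solve 2 (\ d a -> d :+ (:- :1) :* (d :+ (:- :1) :* a) := a) rfl (δ i j) (A i j)

 ⊗-cong : ∀ {A A' B B'} -> A ≈ᵐ A' -> B ≈ᵐ B' -> A ⊗ B ≈ᵐ A' ⊗ B'
 ⊗-cong p q i j = sum-cong-≋ \ k -> *-cong (p i k) (q k j)

 comp-cong : ∀ {A A'} -> A ≈ᵐ A' -> comp A ≈ᵐ comp A'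
 comp-cong p i j = +-congˡ (*-congˡ (p i j))

 full-zero : ∀ {A U} -> A kills U -> (∀ x -> x ∈ U) -> A ≈ᵐ 0ᵐ
 full-zero a full = by-vectors \ x i -> fwd (kernel a x) (full x) i >> symm (0-· {0ᵛ} (\ _ -> rfl) x)

 -- Certifies that the kernel of C is the intersection of those of A and B.
 Meet : (A B C X Y : Matrix) -> Set
 Meet A B C X Y = A ⊗ C ≈ᵐ A × B ⊗ C ≈ᵐ B × C ≈ᵐ (\ i j -> (A ⊗ X) i j + (B ⊗ Y) i j)

 meet-cong : ∀ {A A' B B' C C' X X' Y Y'} -> A ≈ᵐ A' -> B ≈ᵐ B' -> C ≈ᵐ C' -> X ≈ᵐ X' -> Y ≈ᵐ Y' -> Meet A B C X Y -> Meet A' B' C' X' Y'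
 meet-cong {A} {A'} {B} {B'} {C} {C'} {X} {X'} {Y} {Y'} a b c x y (p , q , r) = (\ i j -> symm (⊗-cong {A} {A'} {C} {C'} a c i j) >> p i j >> a i j) , (\ i j -> symm (⊗-cong {B} {B'} {C} {C'} b c i j) >> q i j >> b i j) ,
  \ i j -> symm (c i j) >> r i j >> +-cong (⊗-cong {A} {A'} {X} {X'} a x i j) (⊗-cong {B} {B'} {Y} {Y'} b y i j)

 meet-sound : ∀ {A B C X Y U W} -> A kills U -> B kills W -> Symmetric C -> Idempotent C -> Meet A B C X Y -> C kills (U ∩ W)
 meet-sound {A} {B} {C} {X} {Y} {U} {W} a b s e (p , q , r) = killing s e \ x -> mk⇔ (\ (u , w) -> ·-definite (C $ x) (vanish x (fwd (kernel a x) u) (fwd (kernel b x) w) (C $ x)))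
  (\ h -> bwd (kernel a x) (\ i -> symm (matrix-cong p x i) >> (⊗-$ A C x i) >> $-cong A h i >> $-0 A i) , bwd (kernel b x) (\ i -> symm (matrix-cong q x i) >> (⊗-$ B C x i) >> $-cong B h i >> $-0 B i)) where
  expand : ∀ y i -> (C $ y) i ≈ 1# * (A $ (X $ y)) i + 1# * (B $ (Y $ y)) i
  expand y i = matrix-cong r y i >> ·-comm (\ j -> (A ⊗ X) i j + (B ⊗ Y) i j) y >> ·-cong {y} (\ _ -> rfl) (\ j -> +-cong (symm (*-identityˡ _)) (symm (*-identityˡ _))) >>
   ·-linearʳ 1# 1# y ((A ⊗ X) i) ((B ⊗ Y) i) >> +-cong (*-congˡ (·-comm y ((A ⊗ X) i) >> (⊗-$ A X y i))) (*-congˡ (·-comm y ((B ⊗ Y) i) >> (⊗-$ B Y y i)))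
  vanish : ∀ x -> A $ x ≈ᵛ 0ᵛ -> B $ x ≈ᵛ 0ᵛ -> ∀ y -> (C $ x) · y ≈ 0#
  vanish x ax bx y = symmetric-· s x y >> ·-cong {x} (\ _ -> rfl) (expand y) >> ·-linearʳ 1# 1# x (A $ (X $ y)) (B $ (Y $ y)) >>
   +-cong (*-congˡ (symm (symmetric-· (symmetric a) x (X $ y)) >> 0-· ax (X $ y))) (*-congˡ (symm (symmetric-· (symmetric b) x (Y $ y)) >> 0-· bx (Y $ y))) >> solve 0 (:1 :* :0 :+ :1 :* :0 := :0) rfl

 private
  orthogonal-part : ∀ z z' x -> x ≈ᵛ z +ᵛ z' -> z' · x ≈ 0# -> z · z' ≈ 0# -> z' ≈ᵛ 0ᵛ
  orthogonal-part z z' x eq p q = ·-definite z' (solve 2 (\ p q -> q := (p :+ q) :- p) rfl (z' · z) (z' · z') >> +-cong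
   (symm (·-+ʳ z' z z') >> ·-cong {z'} (\ _ -> rfl) (\ i -> symm (eq i)) >> p) (-‿cong (·-comm z' z >> q)) >> solve 0 (:0 :- :0 := :0) rfl)

 meet-complete : ∀ {A B C U W} -> A kills U -> B kills W -> C kills (U ∩ W) -> ∃[ X ] ∃[ Y ] Meet A B C X Y
 meet-complete {A} {B} {C} {U} {W} a b c = (\ i j -> fst (decomposed j) i) , (\ i j -> fst (snd (decomposed j)) i) , absorbs a fst , absorbs b snd , \ i j -> symm ($-δ C j i) >> snd (snd (decomposed j)) i where
  absorbs : ∀ {D Z} -> D kills Z -> (∀ {x} -> member U x × member W x -> x ∈ Z) -> D ⊗ C ≈ᵐ D
  absorbs {D} z h = by-vectors \ x i -> (⊗-$ D C x i) >> symm (0-difference (symm ($-difference D x (C $ x) i) >> fwd (kernel z (\ i -> x i - (C $ x) i)) (h (bwd (kernel c (\ i -> x i - (C $ x) i)) (fixed-part (idempotent c) x))) i))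
  S : Subspace
  S = range A ⊕ range B
  left : ∀ t -> (A $ t) ∈ S
  left t = A $ t , 0ᵛ , (t , \ _ -> rfl) , (0ᵛ , \ i -> symm ($-0 B i)) , \ _ -> symm (+-identityʳ _)
  right : ∀ t -> (B $ t) ∈ S
  right t = 0ᵛ , B $ t , (0ᵛ , \ i -> symm ($-0 A i)) , (t , \ _ -> rfl) , \ _ -> symm (+-identityˡ _)
  killed : ∀ {D} z -> z ∈ (S ^⊥) -> Symmetric D -> (∀ t -> (D $ t) ∈ S) -> D $ z ≈ᵛ 0ᵛ
  killed {D} z z⊥ s in-sum = ·-definite (D $ z) (symmetric-· s z (D $ z) >> ·-comm z (D $ (D $ z)) >> z⊥ (D $ (D $ z)) (in-sum (D $ z)))
  -- The component of C x orthogonal to the ranges of A and B is killed by C.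
  rest≈0 : ∀ x z z' -> z ∈ S -> z' ∈ (S ^⊥) -> C $ x ≈ᵛ z +ᵛ z' -> z' ≈ᵛ 0ᵛ
  rest≈0 x z z' z∈ z'⊥ eq = orthogonal-part z z' (C $ x) eq (symm (symmetric-· (symmetric c) z' x) >> 0-· (fwd (kernel c z')
   (bwd (kernel a z') (killed z' z'⊥ (symmetric a) left) , bwd (kernel b z') (killed z' z'⊥ (symmetric b) right))) x) (z'⊥ z z∈)
  decomposed : ∀ j -> ∃[ x ] ∃[ y ] C $ δ j ≈ᵛ (\ i -> (A $ x) i + (B $ y) i)
  decomposed j = parts (⊕-complement S (C $ δ j)) where
   parts : (C $ δ j) ∈ (S ⊕ (S ^⊥)) -> ∃[ x ] ∃[ y ] C $ δ j ≈ᵛ (\ i -> (A $ x) i + (B $ y) i)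
   parts (z , z' , z∈@(u , w , (x , u≈) , (y , w≈) , z≈) , z'⊥ , eq) = x , y , \ i -> eq i >> +-congˡ (rest≈0 (δ j) z z' z∈ z'⊥ eq i) >> +-identityʳ (z i) >> z≈ i >> +-cong (u≈ i) (w≈ i)

 ∩⊥ : ∀ U W x -> x ∈ (((U ^⊥) ∩ (W ^⊥)) ^⊥) ⇔ x ∈ (U ⊕ W)
 ∩⊥ U W x = mk⇔ to' \ { (u , w , u∈ , w∈ , eq) y (y⊥u , y⊥w) -> ·-cong {y} (\ _ -> rfl) eq >> ·-+ʳ y u w >> +-cong (·-comm y u >> y⊥u u u∈) (·-comm y w >> y⊥w w w∈) >> +-identityˡ 0# } where
  to' : x ∈ (((U ^⊥) ∩ (W ^⊥)) ^⊥) -> x ∈ (U ⊕ W)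
  to' h = parts (⊕-complement (U ⊕ W) x) where
   parts : x ∈ ((U ⊕ W) ⊕ ((U ⊕ W) ^⊥)) -> x ∈ (U ⊕ W)
   parts (z , z' , z∈ , z'⊥ , eq) = resp (U ⊕ W) (\ i -> symm (eq i >> +-congˡ (orthogonal-part z z' x eq
    (h z' ((\ u u∈ -> z'⊥ u (u , 0ᵛ , u∈ , 0∈ W , \ _ -> symm (+-identityʳ _))) , \ w w∈ -> z'⊥ w (0ᵛ , w , 0∈ U , w∈ , \ _ -> symm (+-identityˡ _)))) (z'⊥ z z∈) i) >> +-identityʳ (z i))) z∈

 range-sound : ∀ {A C Y} -> Symmetric A -> Idempotent A -> A ⊗ C ≈ᵐ 0ᵐ -> comp A ≈ᵐ C ⊗ Y -> A kills range C
 range-sound {A} {C} {Y} s e p q = killing s e \ x -> mk⇔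
  (\ (y , x≈) i -> $-cong A x≈ i >> symm (⊗-$ A C y i) >> matrix-cong p y i >> 0-· {0ᵛ} (\ _ -> rfl) y)
  \ h -> Y $ x , \ i -> solve 1 (\ x -> x := x :- :0) rfl (x i) >> +-congˡ (-‿cong (symm (h i))) >> symm (comp-$ A x i) >> matrix-cong q x i >> (⊗-$ C Y x i)

 range-complete : ∀ {A C} -> A kills range C -> ∃[ Y ] (A ⊗ C ≈ᵐ 0ᵐ × comp A ≈ᵐ C ⊗ Y)
 range-complete {A} {C} a = (\ i j -> fst (preimage j) i) , by-vectors (\ x i -> (⊗-$ A C x i) >> fwd (kernel a (C $ x)) (x , \ _ -> rfl) i >> symm (0-· {0ᵛ} (\ _ -> rfl) x)) , \ i j -> symm ($-δ (comp A) j i) >> snd (preimage j) i where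
  preimage : ∀ j -> (comp A $ δ j) ∈ range C
  preimage j = bwd (kernel a _) (\ i -> $-cong A (comp-$ A (δ j)) i >> fixed-part (idempotent a) (δ j) i)

 range-comp : ∀ {A B} -> B ≈ᵐ comp A -> Symmetric A -> Idempotent A -> A kills range B
 range-comp {A} {B} p s e = killing s e \ x -> mk⇔
  (\ (y , x≈) i -> $-cong A (\ j -> x≈ j >> matrix-cong p y j >> comp-$ A y j) i >> fixed-part e y i)
  \ h -> x , \ i -> symm (matrix-cong p x i >> comp-$ A x i >> +-congˡ (-‿cong (h i)) >> solve 1 (\ x -> x :- :0 := x) rfl (x i))

 meet-of : ∀ {A B U W} -> A kills U -> B kills W -> Σ Matrix \ C -> C kills (U ∩ W) × Σ (Matrix × Matrix) \ (X , Y) -> Meet A B C X Y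
 meet-of {U = U} {W} a b = let C , c = annihilated (U ∩ W) ; X , Y , h = meet-complete a b c in C , c , (X , Y) , h

 join-of : ∀ {A B U W} -> A kills U -> B kills W -> Σ Matrix \ C -> C kills (U ⊕ W) × Σ (Matrix × Matrix) \ (X , Y) -> Meet (comp A) (comp B) (comp C) X Y
 join-of {U = U} {W} a b = let C , c , (X , Y) , h = meet-of (comp-annihilates a) (comp-annihilates b) in
  comp C , annihilates-cong (∩⊥ U W) (comp-annihilates c) , (X , Y) , meet-cong (\ _ _ -> rfl) (\ _ _ -> rfl) (\ i j -> symm (comp-comp C i j)) (\ _ _ -> rfl) (\ _ _ -> rfl) h

 range-of : ∀ C -> Σ Matrix \ A -> A kills range C × Σ Matrix \ Y -> A ⊗ C ≈ᵐ 0ᵐ × comp A ≈ᵐ C ⊗ Y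
 range-of C = let A , a = annihilated (range C) in A , a , range-complete a

leafCode : {J : Set} -> (J -> ℕ) -> List Bool -> List Bool -> ℕ ⊎ J -> List Bool
leafCode number c0 c1 (inl i) = c0 ++ Codes.numberCode i
leafCode number c0 c1 (inr x) = c1 ++ Codes.numberCode (number x)

module ParseFormula
 (em : EM) (R : Ring) (real : FormallyReal R) (d' : ℕ)
 (J : Set) (number : J -> ℕ) (c0 c1 : List Bool) (free : Codes.PrefixFree (leafCode number c0 c1))
 (mᴱ : Formula.Ex 1) (mᴱ-small : ∀ n -> Formula.⟦_⟧e mᴱ (n ∷ []) ≤ suc n)
 (indices : ∀ {n m} -> m < Formula.⟦_⟧e mᴱ (n ∷ []) -> ∀ j -> j < m -> ∃[ x ] number x ≡ j) where
 open Formula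
 open FormulaSemantics R
 open FormulaConnectives em R
 open StoredInput 0 {0} using (withInput; withInput-inputs; withInput⇔; ι)
 open Classical em
 open Codes
 open Finiteness using (clamp)
 open FormallyReal real using (1≉0)
 open RingLaws R
 open BSS R using (embed)
 open Naturals R real
 open Instances em R 1≉0 d' hiding (_≈ᴹ_; Instance; InRange; subspaces)

 d d² : ℕ
 d = suc d'
 d² = d N.* d

 open Subspaces R d renaming (⊥ to 0ᴸ; ⊤ to 1ᴸ)
 open Euclidean em R real d using (δ; Symmetric; Idempotent; _$_; ·-cong; ·-comm; ·-zeroʳ)
 open Annihilators em R real d
 open import Algebra.Properties.CommutativeMonoid.Sum +-commutativeMonoid using (sum; sum-cong-≋)
 open import Data.List.Relation.Binary.Pointwise using (Pointwise; []; _∷_; Pointwise-length)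
 open import Data.List.Relation.Binary.Equality.Setoid setoid using (_≋_; ≋-refl; ≋-sym; ≋-trans; ≋-reflexive)
 open BSSEmission R using (nth-++ˡ; nth-++ʳ)
 open RingSolver R
 import Data.Fin as Fin
 import Data.Nat.Binary as Bin
 import Data.Nat.Binary.Properties as Bin
 import Data.List as List
 import Data.Vec.Functional as Vector

 X : Set
 X = ℕ ⊎ J

 leaf : X -> List Bool
 leaf = leafCode number c0 c1

 InRange : ℕ -> X -> Set
 InRange m (inl i) = ⊤
 InRange m (inr x) = number x < m

 values : (ℕ -> Matrix) -> (ℕ -> Matrix) -> X -> Subspace
 values α C (inl i) = range (α i)
 values α C (inr x) = range (C (number x))

 Parsed : List Carrier -> Set
 Parsed w = Σ (Term X) \ t -> Σ (List Matrix) \ Cs -> w ≋ embed (⟨ t ⟩ leaf) ++ blocks Cs × length Cs < ⟦ mᴱ ⟧e (length w ∷ []) ×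
  Everywhere (InRange (length Cs)) t × Σ (ℕ -> Matrix) \ α -> ∀ x -> x ∈ eval 𝐋 t (values α (matrixAt Cs))

 module _ {k : ℕ} where
  MatrixT : Set
  MatrixT = Fin d -> Fin d -> Tm 0 k
  at : ℕ -> Ex k -> Tm 0 k
  at c p = var (lit c ∷ p ∷ [])
  -- A p: a term starts at p, ending at TE p. B p: a number starts at p, ending at NE p, with value Val p.
  W A TE B NE Val N : Ex k -> Tm 0 k
  W = at 0
  A = at 1
  TE = at 2
  B = at 3
  NE = at 4
  Val = at 5
  N = at 6
  minusOne : Tm 0 k
  minusOne = var (lit 7 ∷ [])
  matrix : ℕ -> Ex k -> MatrixT
  matrix c p i j = var (lit c ∷ p ∷ lit (toℕ i) ∷ lit (toℕ j) ∷ [])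
  -- V p annihilates the value of the term at p, M p that of the variable with the number at p.
  VT MT XT YT : Ex k -> MatrixT
  VT = matrix 8
  MT = matrix 9
  XT = matrix 10
  YT = matrix 11
  sumT : ∀ n -> (Fin n -> Tm 0 k) -> Tm 0 k
  sumT zero f = zero
  sumT (suc n) f = add (f 0F) (sumT n (f ∘ fsuc))
  mulT : MatrixT -> MatrixT -> MatrixT
  mulT P Q i j = sumT d \ l -> mul (P i l) (Q l j)
  idT 0T : MatrixT
  idT i j = if does (i ≟ᶠ j) then one else zero
  0T i j = zero
  compT : MatrixT -> MatrixT
  compT P i j = add (idT i j) (mul minusOne (P i j))
  equalT : MatrixT -> MatrixT -> Fm 0 k
  equalT P Q = each d \ i -> each d \ j -> P i j == Q i j
  projectionT : MatrixT -> Fm 0 k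
  projectionT P = equalT P (\ i j -> P j i) & equalT (mulT P P) P
  meetT : (P Q S X Y : MatrixT) -> Fm 0 k
  meetT P Q S X Y = equalT (mulT P S) P & equalT (mulT Q S) Q & equalT S (\ i j -> add (mulT P X i j) (mulT Q Y i j))
  spells : List Bool -> Ex k -> Fm 0 k
  spells [] p = trueF
  spells (b ∷ u) p = W p == (if b then one else zero) & spells u (lit 1 ⊹ p)
  natT : ℕ -> Tm 0 k
  natT zero = zero
  natT (suc m) = add one (natT m)

 private
  p4 m4 n4 : Ex 4
  p4 = # 0F
  n4 = # 3F
  m4 = # 2F
  q5 p5 L5 : Ex 5
  q5 = # 0F
  p5 = # 1F
  L5 = # 2F
  L3 m3 n3 : Ex 3
  L3 = # 0F
  m3 = # 1F
  n3 = # 2F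

 constantT : MatrixT {5}
 constantT i j = W (L5 ⊹ (q5 ✶ lit d² ⊹ lit (toℕ (Fin.combine i j))))

 numberRule : Fin 3 -> Fm 0 4
 numberRule 0F = spells (false ∷ []) p4 & NE p4 == N (lit 1 ⊹ p4) & Val p4 == zero
 numberRule 1F = spells (true ∷ false ∷ []) p4 & B (lit 2 ⊹ p4) == one & NE p4 == NE (lit 2 ⊹ p4) & Val p4 == add (add one (Val (lit 2 ⊹ p4))) (add one (Val (lit 2 ⊹ p4)))
 numberRule 2F = spells (true ∷ true ∷ []) p4 & B (lit 2 ⊹ p4) == one & NE p4 == NE (lit 2 ⊹ p4) & Val p4 == add one (add (Val (lit 2 ⊹ p4)) (Val (lit 2 ⊹ p4)))

 secondTerm : (MatrixT {5} -> MatrixT {5}) -> Fm 0 5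
 secondTerm f = TE (lit 3 ⊹ p5) == N q5 & A q5 == one & TE p5 == TE q5 & meetT (f (VT (lit 3 ⊹ p5))) (f (VT q5)) (f (VT p5)) (XT p5) (YT p5)

 binaryRule : List Bool -> (MatrixT {5} -> MatrixT {5}) -> Fm 0 4
 binaryRule u f = spells u p4 & A (lit 3 ⊹ p4) == one & any n4 (secondTerm f)

 constantIndex : Fm 0 5
 constantIndex = Val (lit (length (true ∷ true ∷ c1)) ⊹ p5) == N q5 & equalT (mulT (VT p5) constantT) 0T & equalT (compT (VT p5)) (mulT constantT (YT p5))

 leafEnd : List Bool -> Ex 4
 leafEnd u = lit (length u) ⊹ p4

 termRule : Fin 7 -> Fm 0 4
 termRule 0F = binaryRule (false ∷ true ∷ true ∷ []) id
 termRule 1F = binaryRule (false ∷ true ∷ false ∷ []) compT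
 termRule 2F = spells (true ∷ false ∷ []) p4 & A (lit 2 ⊹ p4) == one & TE p4 == TE (lit 2 ⊹ p4) & equalT (VT p4) (compT (VT (lit 2 ⊹ p4)))
 termRule 3F = spells (false ∷ false ∷ false ∷ []) p4 & TE p4 == N (lit 3 ⊹ p4) & equalT (VT p4) idT
 termRule 4F = spells (false ∷ false ∷ true ∷ []) p4 & TE p4 == N (lit 3 ⊹ p4) & equalT (VT p4) 0T
 termRule 5F = spells (true ∷ true ∷ c0) p4 & B (leafEnd (true ∷ true ∷ c0)) == one & TE p4 == NE (leafEnd (true ∷ true ∷ c0)) & equalT (MT (leafEnd (true ∷ true ∷ c0))) (VT p4)
 termRule 6F = spells (true ∷ true ∷ c1) p4 & B (leafEnd (true ∷ true ∷ c1)) == one & TE p4 == NE (leafEnd (true ∷ true ∷ c1)) & any m4 constantIndex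

 setup numbers terms projections consistency conclusion body : Fm 0 3
 setup = (N (lit 0) == zero & all (lit 4 ⊹ n3) (N (lit 1 ⊹ p4) == add one (N p4))) & all (lit 4) (W (p4 ⊹ n4) == add one one) & add minusOne one == zero
 numbers = all (lit 3 ⊹ n3) (B p4 == one => oneOf 3 numberRule)
 terms = all (lit 3 ⊹ n3) (A p4 == one => oneOf 7 termRule)
 projections = all (lit 3 ⊹ n3) (projectionT (VT p4) & projectionT (MT p4))
 consistency = all (lit 3 ⊹ n3) (all (lit 3 ⊹ n4) ((B p5 == one & B q5 == one & Val p5 == Val q5) => equalT (MT p5) (MT q5)))
 conclusion = A (lit 0) == one & TE (lit 0) == N L3 & equalT (VT (lit 0)) 0T & N n3 == add (N L3) (mul (natT d²) (N m3))
 body = setup & numbers & terms & projections & consistency & conclusion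

 parses : Fm 0 1
 parses = any mᴱ (any (lit 1 ⊹ # fsuc 0F) body)

 abstract
  formula : Fm 0 1
  formula = withInput parses
  formula-inputs : ∀ n -> FmInputs (_< n) formula (n ∷ [])
  formula-inputs = withInput-inputs parses
  unfolded : ∀ κ w -> Solvable κ formula w ⇔ Solvable κ (withInput parses) w
  unfolded κ w = mk⇔ id id

 -- Reads w p u q: the word w has the symbols u from position p up to position q.
 Reads : List Carrier -> ℕ -> List Bool -> ℕ -> Set
 Reads w p [] q = p ≡ q
 Reads w p (b ∷ u) q = (p < length w × nth w p ≈ (if b then 1# else 0#)) × Reads w (suc p) u q

 reads-++ : ∀ {w} p u {q v r} -> Reads w p u q -> Reads w q v r -> Reads w p (u ++ v) r
 reads-++ p [] refl h = h
 reads-++ p (b ∷ u) (x , h) h' = x , reads-++ (suc p) u h h'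

 reads-split : ∀ {w} p u {v r} -> Reads w p (u ++ v) r -> ∃[ q ] Reads w p u q × Reads w q v r
 reads-split p [] h = p , refl , h
 reads-split p (b ∷ u) (x , h) = let q , h1 , h2 = reads-split (suc p) u h in q , (x , h1) , h2

 reads-end : ∀ {w} p u {q} -> Reads w p u q -> q ≡ length u N.+ p
 reads-end p [] h = sym h
 reads-end p (b ∷ u) (_ , h) = reads-end (suc p) u h ~> N.+-suc (length u) p

 reads-bound : ∀ {w} p u {q} -> p ≤ length w -> Reads w p u q -> q ≤ length w
 reads-bound p [] p≤ refl = p≤
 reads-bound p (b ∷ u) _ ((p< , _) , h) = reads-bound (suc p) u p< h

 private
  nat-+ : ∀ a b -> nat (a N.+ b) ≈ nat a + nat b
  nat-+ zero b = symm (+-identityˡ (nat b))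
  nat-+ (suc a) b = +-congˡ (nat-+ a b) >> symm (+-assoc 1# (nat a) (nat b))
  nat-* : ∀ a b -> nat (a N.* b) ≈ nat a * nat b
  nat-* zero b = symm (zeroˡ (nat b))
  nat-* (suc a) b = nat-+ b (a N.* b) >> +-cong (symm (*-identityˡ (nat b))) (nat-* a b) >> symm (distribʳ (nat b) 1# (nat a))
  double : ∀ x -> nat (x N.+ (x N.+ 0)) ≈ nat x + nat x
  double x = nat-+ x (x N.+ 0) >> +-congˡ (eq≈ (cong nat (N.+-identityʳ x)))
  nth-drop : ∀ m xs i -> nth (List.drop m xs) i ≡ nth xs (m N.+ i)
  nth-drop zero xs i = refl
  nth-drop (suc m) [] i = refl
  nth-drop (suc m) (x ∷ xs) i = nth-drop m xs i
  drop-nth : ∀ p w -> p < length w -> List.drop p w ≡ nth w p ∷ List.drop (suc p) w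
  drop-nth zero (x ∷ w) _ = refl
  drop-nth (suc p) (x ∷ w) (s≤s p<) = drop-nth p w p<
  reads-prefix : ∀ {w} p u {q} -> Reads w p u q -> List.drop p w ≋ embed u ++ List.drop q w
  reads-prefix p [] refl = ≋-refl
  reads-prefix {w} p (b ∷ u) ((p< , x) , h) = ≋-trans (≋-reflexive (drop-nth p w p<)) (x ∷ reads-prefix (suc p) u h)
  nth-blocks : ∀ Cs j -> j < length Cs -> ∀ i i' -> nth (blocks Cs) (j N.* d² N.+ toℕ (Fin.combine i i')) ≡ matrixAt Cs j i i'
  nth-blocks (C ∷ Cs) zero _ i i' = nth-tabulate (Vector.concat C) (Fin.combine i i') ~> concat-combine C i i' where
   nth-tabulate : ∀ {N} (f : Fin N -> Carrier) {ys} r -> nth (tabulate f ++ ys) (toℕ r) ≡ f r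
   nth-tabulate f 0F = refl
   nth-tabulate f (fsuc r) = nth-tabulate (f ∘ fsuc) r
  nth-blocks (C ∷ Cs) (suc j) (s≤s j<) i i' = cong (nth (blocks (C ∷ Cs))) (N.+-assoc d² (j N.* d²) (toℕ (Fin.combine i i')) ~> cong (N._+ (j N.* d² N.+ toℕ (Fin.combine i i'))) (sym (length-encodeMatrix C))) ~>
   nth-++ʳ (encodeMatrix C) (j N.* d² N.+ toℕ (Fin.combine i i')) ~> nth-blocks Cs j j< i i'
  unblocks : ∀ m xs -> length xs ≡ m N.* d² -> Σ (List Matrix) \ Cs -> xs ≡ blocks Cs × length Cs ≡ m
  unblocks zero [] _ = [] , refl , refl
  unblocks (suc m) xs len = let Cs , eq , count = unblocks m (List.drop d² xs) (List.length-drop d² xs ~> cong (N._∸ d²) len ~> N.m+n∸m≡n d² (m N.* d²)) in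
   C ∷ Cs , sym (taken d² xs (subst (d² ≤_) (sym len) (N.m≤m+n d² (m N.* d²)))) ~> cong₂ _++_ (sym (List.tabulate-cong entries)) eq , cong suc count where
   C : Matrix
   C i i' = nth xs (toℕ (Fin.combine i i'))
   entries : ∀ r -> Vector.concat C r ≡ nth xs (toℕ r)
   entries r = cong (nth xs ∘ toℕ) (Fin.combine-remQuot {d} d r)
   taken : ∀ D xs -> D ≤ length xs -> tabulate {n = D} (\ r -> nth xs (toℕ r)) ++ List.drop D xs ≡ xs
   taken zero xs _ = refl
   taken (suc D) (x ∷ xs) (s≤s D≤) = cong (x ∷_) (taken D xs D≤)

 module Meaning (κ : Fin 0 -> Carrier) (w : List Carrier) (v : List ℕ -> Carrier) where
  n : ℕ
  n = length w
  ⊨ : ∀ {k} -> Fm 0 k -> Vec ℕ k -> Set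
  ⊨ = Holds κ (ι v) v
  ⟦_⟧m : ∀ {k} -> MatrixT {k} -> Vec ℕ k -> Matrix
  ⟦ P ⟧m ρ i j = ⟦_⟧ᵗ κ (ι v) v (P i j) ρ
  sum-value : ∀ {k} (ρ : Vec ℕ k) m f -> ⟦_⟧ᵗ κ (ι v) v (sumT m f) ρ ≡ sum (\ i -> ⟦_⟧ᵗ κ (ι v) v (f i) ρ)
  sum-value ρ zero f = refl
  sum-value ρ (suc m) f = cong (⟦_⟧ᵗ κ (ι v) v (f 0F) ρ +_) (sum-value ρ m (f ∘ fsuc))
  mul-value : ∀ {k} (ρ : Vec ℕ k) P Q -> ⟦ mulT P Q ⟧m ρ ≈ᵐ ⟦ P ⟧m ρ ⊗ ⟦ Q ⟧m ρ
  mul-value ρ P Q i j = eq≈ (sum-value ρ d (\ l -> mul (P i l) (Q l j)))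
  id-value : ∀ {k} (ρ : Vec ℕ k) -> ⟦ idT ⟧m ρ ≈ᵐ δ
  id-value ρ i j with does (i ≟ᶠ j)
  ... | true = rfl
  ... | false = rfl
  comp-value : v (7 ∷ []) ≈ - 1# -> ∀ {k} (ρ : Vec ℕ k) P -> ⟦ compT P ⟧m ρ ≈ᵐ comp (⟦ P ⟧m ρ)
  comp-value z ρ P i j = +-cong (id-value ρ i j) (*-congʳ z)
  equal⇔ : ∀ {k} (ρ : Vec ℕ k) P Q -> ⊨ (equalT P Q) ρ ⇔ (⟦ P ⟧m ρ ≈ᵐ ⟦ Q ⟧m ρ)
  equal⇔ ρ P Q = mk⇔ (\ h i j -> fwd (entries i) (fwd rows h i) j) (\ h -> bwd rows \ i -> bwd (entries i) (h i)) where
   rows = holds-each κ (ι v) v ρ d (\ i -> each d \ j -> P i j == Q i j)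
   entries : ∀ i -> ⊨ (each d \ j -> P i j == Q i j) ρ ⇔ (∀ j -> ⟦ P ⟧m ρ i j ≈ ⟦ Q ⟧m ρ i j)
   entries i = holds-each κ (ι v) v ρ d (\ j -> P i j == Q i j)
  projection⇔ : ∀ {k} (ρ : Vec ℕ k) P -> ⊨ (projectionT P) ρ ⇔ (Symmetric (⟦ P ⟧m ρ) × Idempotent (⟦ P ⟧m ρ))
  projection⇔ ρ P = mk⇔
   (\ (s , e) -> fwd (equal⇔ ρ P (\ i j -> P j i)) s , \ i j -> symm (mul-value ρ P P i j) >> fwd (equal⇔ ρ (mulT P P) P) e i j)
   (\ (s , e) -> bwd (equal⇔ ρ P (\ i j -> P j i)) s , bwd (equal⇔ ρ (mulT P P) P) \ i j -> mul-value ρ P P i j >> e i j)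
  meet⇔ : ∀ {k} (ρ : Vec ℕ k) P Q S X Y -> ⊨ (meetT P Q S X Y) ρ ⇔ Meet (⟦ P ⟧m ρ) (⟦ Q ⟧m ρ) (⟦ S ⟧m ρ) (⟦ X ⟧m ρ) (⟦ Y ⟧m ρ)
  meet⇔ ρ P Q S X Y = mk⇔
   (\ (a , b , c) -> (\ i j -> symm (mul-value ρ P S i j) >> fwd (equal⇔ ρ (mulT P S) P) a i j) , (\ i j -> symm (mul-value ρ Q S i j) >> fwd (equal⇔ ρ (mulT Q S) Q) b i j) , \ i j -> fwd (equal⇔ ρ S Z) c i j >> +-cong (mul-value ρ P X i j) (mul-value ρ Q Y i j))
   (\ (a , b , c) -> bwd (equal⇔ ρ (mulT P S) P) (\ i j -> mul-value ρ P S i j >> a i j) , bwd (equal⇔ ρ (mulT Q S) Q) (\ i j -> mul-value ρ Q S i j >> b i j) , bwd (equal⇔ ρ S Z) \ i j -> c i j >> symm (+-cong (mul-value ρ P X i j) (mul-value ρ Q Y i j))) where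
   Z : MatrixT
   Z i j = add (mulT P X i j) (mulT Q Y i j)
  natT-value : ∀ {k} (ρ : Vec ℕ k) m -> ⟦_⟧ᵗ κ (ι v) v (natT m) ρ ≈ nat m
  natT-value ρ zero = rfl
  natT-value ρ (suc m) = +-congˡ (natT-value ρ m)
  -- The matrix stored under the tag c at position p.
  Mat : ℕ -> ℕ -> Matrix
  Mat c p i j = v (c ∷ p ∷ toℕ i ∷ toℕ j ∷ [])

 module Sound (κ : Fin 0 -> Carrier) (w : List Carrier) (v : List ℕ -> Carrier) (m L : ℕ) (m< : m < ⟦ mᴱ ⟧e (length w ∷ [])) (L< : L < suc (length w))
  (given : ∀ i -> i < length w -> ι v i ≈ nth w i) (h : Holds κ (ι v) v body (L ∷ m ∷ length w ∷ [])) where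
  open Meaning κ w v
  private
   ρ3 : Vec ℕ 3
   ρ3 = L ∷ m ∷ n ∷ []
   hsetup = fst h
   hnumbers = fst (snd h)
   hterms = fst (snd (snd h))
   hprojections = fst (snd (snd (snd h)))
   hconsistency = fst (snd (snd (snd (snd h))))
   hconclusion = snd (snd (snd (snd (snd h))))
   N≈ : ∀ i -> i ≤ 4 N.+ n -> v (6 ∷ i ∷ []) ≈ nat i
   N≈ zero _ = fst (fst hsetup)
   N≈ (suc i) i< = snd (fst hsetup) i i< >> +-congˡ (N≈ i (N.<⇒≤ i<))
   minus≈ : v (7 ∷ []) ≈ - 1#
   minus≈ = solve 1 (\ z -> z := (z :+ :1) :- :1) rfl _ >> +-congʳ (snd (snd hsetup)) >> +-identityˡ (- 1#)
   symbol : ∀ {p} b -> p < 4 N.+ n -> v (0 ∷ p ∷ []) ≈ (if b then 1# else 0#) -> p < n × nth w p ≈ (if b then 1# else 0#)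
   symbol {p} b p< eq = inside (p N.<? n) where
    1+1 : ∀ b -> ¬ 1# + 1# ≈ (if b then 1# else 0#)
    1+1 true q = distinct (nat-inj {2} {1} (solve 0 (:1 :+ (:1 :+ :0) := :1 :+ :1) rfl >> q >> symm (+-identityʳ 1#))) where
     distinct : ¬ 2 ≡ 1
     distinct ()
    1+1 false q = distinct (nat-inj {2} {0} (solve 0 (:1 :+ (:1 :+ :0) := :1 :+ :1) rfl >> q)) where
     distinct : ¬ 2 ≡ 0
     distinct ()
    inside : Dec (p < n) -> p < n × nth w p ≈ (if b then 1# else 0#)
    inside (yes p<n) = p<n , symm (given p p<n) >> eq
    inside (no p≮n) = ⊥-elim (1+1 b (symm (subst (\ p -> v (0 ∷ p ∷ []) ≈ 1# + 1#) (N.m∸n+n≡m n≤p) (fst (snd hsetup) (p N.∸ n)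
     (N.+-cancelʳ-< n (p N.∸ n) 4 (subst (_< 4 N.+ n) (sym (N.m∸n+n≡m n≤p)) p<)))) >> eq))
     where n≤p = N.≮⇒≥ p≮n
   spelled : ∀ {k} u (p : Ex k) ρ -> ⟦ p ⟧e ρ < 4 N.+ n -> ⊨ (spells u p) ρ -> Reads w (⟦ p ⟧e ρ) u (length u N.+ ⟦ p ⟧e ρ)
   spelled [] p ρ p< _ = refl
   spelled (b ∷ u) p ρ p< (x , h) = found , subst (Reads w (suc (⟦ p ⟧e ρ)) u) (N.+-suc (length u) (⟦ p ⟧e ρ))
    (spelled u (lit 1 ⊹ p) ρ (s≤s (fst found) ▹ N.m≤n+m (suc n) 3) h) where
    bit : ∀ b -> v (0 ∷ ⟦ p ⟧e ρ ∷ []) ≈ ⟦_⟧ᵗ κ (ι v) v (if b then one else zero) ρ -> v (0 ∷ ⟦ p ⟧e ρ ∷ []) ≈ (if b then 1# else 0#)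
    bit true h = h
    bit false h = h
    found = symbol b p< (bit b x)
   near : ∀ {p} -> p < 3 N.+ n -> p < 4 N.+ n
   near p< = N.m≤n⇒m≤1+n p<
   -- After reading at least one symbol from p, the recursion may continue with less fuel.
   further : ∀ {f p} i -> 3 N.+ n ≤ suc f N.+ p -> 3 N.+ n ≤ f N.+ (suc i N.+ p)
   further {f} {p} i le = le ▹ N.≤-reflexive (sym (N.+-suc f p)) ▹ N.+-monoʳ-≤ f (s≤s (N.m≤n+m p i))
   exhausted : ∀ {p} -> 3 N.+ n ≤ p -> ¬ p < 3 N.+ n
   exhausted le p< = N.<⇒≱ p< le
   Number : ℕ -> Set
   Number p = ∃[ k ] ∃[ q ] Reads w p (numberCode k) q × v (4 ∷ p ∷ []) ≈ nat q × v (5 ∷ p ∷ []) ≈ nat k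
   Digits : ℕ -> Set
   Digits p = Σ Bin.ℕᵇ \ b -> ∃[ q ] Reads w p (digitCode b) q × v (4 ∷ p ∷ []) ≈ nat q × v (5 ∷ p ∷ []) ≈ nat (Bin.toℕ b)
   digits-sound : ∀ f p -> 3 N.+ n ≤ f N.+ p -> p < 3 N.+ n -> v (3 ∷ p ∷ []) ≈ 1# -> Digits p
   digits-sound zero p le p< _ = ⊥-elim (exhausted le p<)
   digits-sound (suc f) p le p< Bp = rule (fwd (holds-oneOf κ (ι v) v (p ∷ ρ3) 3 numberRule)
    (fwd (holds-⇒ κ (ι v) v (p ∷ ρ3) (B p4 == one) (oneOf 3 numberRule)) (hnumbers p p<) Bp)) where
    next : ∀ u -> length u ≡ 2 -> Reads w p u (2 N.+ p) -> v (3 ∷ 2 N.+ p ∷ []) ≈ 1# -> Digits (2 N.+ p)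
    next (b ∷ u) _ (( p<n , _) , _) Bq = digits-sound f (2 N.+ p) (further 1 le) (N.+-monoʳ-< 2 (N.m≤n⇒m≤1+n p<n)) Bq
    rule : (∃[ i ] ⊨ (numberRule i) (p ∷ ρ3)) -> Digits p
    rule (0F , s , e , val) = Bin.zero , suc p , spelled (false ∷ []) p4 (p ∷ ρ3) (near p<) s , e >> N≈ (suc p) (near p<) , val
    rule (fsuc 0F , s , Bq , e , val) = let r = spelled (true ∷ false ∷ []) p4 (p ∷ ρ3) (near p<) s ; b , q , r' , e' , val' = next (true ∷ false ∷ []) refl r Bq in
     Bin.2[1+ b ] , q , reads-++ p (true ∷ false ∷ []) r r' , e >> e' , val >> +-cong (+-congˡ val') (+-congˡ val') >> symm (double (suc (Bin.toℕ b)))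
    rule (2F , s , Bq , e , val) = let r = spelled (true ∷ true ∷ []) p4 (p ∷ ρ3) (near p<) s ; b , q , r' , e' , val' = next (true ∷ true ∷ []) refl r Bq in
     Bin.1+[2 b ] , q , reads-++ p (true ∷ true ∷ []) r r' , e >> e' , val >> +-congˡ (+-cong val' val' >> symm (double (Bin.toℕ b)))
   number-sound : ∀ p -> p < 3 N.+ n -> v (3 ∷ p ∷ []) ≈ 1# -> Number p
   number-sound p p< Bp = let b , q , r , e , val = digits-sound (3 N.+ n) p (N.m≤m+n (3 N.+ n) p) p< Bp in
    Bin.toℕ b , q , subst (\ b -> Reads w p (digitCode b) q) (sym (fromℕ-toℕ b)) r , e , val
   projected : ∀ p -> p < 3 N.+ n -> (Symmetric (Mat 8 p) × Idempotent (Mat 8 p)) × (Symmetric (Mat 9 p) × Idempotent (Mat 9 p))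
   projected p p< = let v , m = hprojections p p< in fwd (projection⇔ (p ∷ ρ3) (VT p4)) v , fwd (projection⇔ (p ∷ ρ3) (MT p4)) m
   consistent : ∀ p q -> p < 3 N.+ n -> q < 3 N.+ n -> v (3 ∷ p ∷ []) ≈ 1# -> v (3 ∷ q ∷ []) ≈ 1# -> v (5 ∷ p ∷ []) ≈ v (5 ∷ q ∷ []) -> Mat 9 p ≈ᵐ Mat 9 q
   consistent p q p< q< Bp Bq eq = fwd (equal⇔ (q ∷ p ∷ ρ3) (MT p5) (MT q5))
    (fwd (holds-⇒ κ (ι v) v (q ∷ p ∷ ρ3) (B p5 == one & B q5 == one & Val p5 == Val q5) (equalT (MT p5) (MT q5))) (hconsistency p p< q q<) (Bp , Bq , eq))
   Found : ℕ -> Set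
   Found k = ∃[ p ] p < 3 N.+ n × v (3 ∷ p ∷ []) ≈ 1# × v (5 ∷ p ∷ []) ≈ nat k
   chosen : ∀ k -> Dec (Found k) -> Matrix
   chosen k (yes (p , _)) = comp (Mat 9 p)
   chosen k (no _) = 0ᵐ
   α : ℕ -> Matrix
   α k = chosen k (dec (Found k))
   α-value : ∀ k p -> p < 3 N.+ n -> v (3 ∷ p ∷ []) ≈ 1# -> v (5 ∷ p ∷ []) ≈ nat k -> Σ Matrix \ P -> comp P ≡ α k × P ≈ᵐ Mat 9 p × Symmetric P × Idempotent P
   α-value k p p< Bp val = go (dec (Found k)) where
    go : (f : Dec (Found k)) -> Σ Matrix \ P -> comp P ≡ chosen k f × P ≈ᵐ Mat 9 p × Symmetric P × Idempotent P
    go (yes (p0 , p0< , Bp0 , val0)) = Mat 9 p0 , refl , consistent p0 p p0< p< Bp0 Bp (val0 >> symm val) , snd (projected p0 p0<)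
    go (no none) = ⊥-elim (none (p , p< , Bp , val))
   variable-value : ∀ k p -> p < 3 N.+ n -> v (3 ∷ p ∷ []) ≈ 1# -> v (5 ∷ p ∷ []) ≈ nat k -> Mat 9 p kills range (α k)
   variable-value k p p< Bp val = carry (α k) (Mat 9 p) (α-value k p p< Bp val) where
    carry : ∀ A Q -> (Σ Matrix \ P -> comp P ≡ A × P ≈ᵐ Q × Symmetric P × Idempotent P) -> Q kills range A
    carry A Q (P , eq , same , s , e) = annihilates-≈ {P} {Q} {range A} same (range-comp {P} {A} (\ i j -> eq≈ (cong (\ B -> B i j) (sym eq))) s e)
   length-w : n ≡ L N.+ d² N.* m
   length-w = nat-inj {n} {L N.+ d² N.* m} (symm (N≈ n (N.m≤n+m n 4)) >> snd (snd (snd hconclusion)) >> +-cong (N≈ L (N.≤-pred L< ▹ N.m≤n+m n 4))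
    (*-cong (natT-value ρ3 d²) (N≈ m (N.≤-pred (N.<-≤-trans m< (mᴱ-small n)) ▹ N.m≤n+m n 4))) >> symm (nat-+ L (d² N.* m) >> +-congˡ (nat-* d² m)))
   tail : Σ (List Matrix) \ Cs -> List.drop L w ≡ blocks Cs × length Cs ≡ m
   tail = unblocks m (List.drop L w) (List.length-drop L w ~> cong (N._∸ L) length-w ~> N.m+n∸m≡n L (d² N.* m) ~> N.*-comm d² m)
   Cs : List Matrix
   Cs = fst tail
   constant-value : ∀ j p -> j < m -> ⟦ constantT ⟧m (j ∷ p ∷ ρ3) ≈ᵐ matrixAt Cs j
   constant-value j p j< i i' = given (L N.+ r) inside >> eq≈ (sym (nth-drop L w r) ~> cong (\ xs -> nth xs r) (fst (snd tail)) ~> nth-blocks Cs j (subst (j <_) (sym (snd (snd tail))) j<) i i') where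
    r = j N.* d² N.+ toℕ (Fin.combine i i')
    inside : L N.+ r < n
    inside = subst (L N.+ r <_) (sym (length-w ~> cong (L N.+_) (N.*-comm d² m))) (N.+-monoʳ-< L
     (N.<-≤-trans (N.+-monoʳ-< (j N.* d²) (Fin.toℕ<n (Fin.combine i i'))) (N.≤-reflexive (N.+-comm (j N.* d²) d²) ▹ N.*-monoˡ-≤ d² j<)))
   module Terms (α : ℕ -> Matrix) (variable-value : ∀ k p -> p < 3 N.+ n -> v (3 ∷ p ∷ []) ≈ 1# -> v (5 ∷ p ∷ []) ≈ nat k -> Mat 9 p kills range (α k))
    (C : ℕ -> Matrix) (constant-value : ∀ j p -> j < m -> ⟦ constantT ⟧m (j ∷ p ∷ ρ3) ≈ᵐ C j) where
    Spelled : ℕ -> Set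
    Spelled p = Σ (Term X) \ t -> ∃[ q ] Reads w p (⟨ t ⟩ leaf) q × v (2 ∷ p ∷ []) ≈ nat q × Everywhere (InRange m) t × Mat 8 p kills eval 𝐋 t (values α C)
    term-sound : ∀ f p -> 3 N.+ n ≤ f N.+ p -> p < 3 N.+ n -> v (1 ∷ p ∷ []) ≈ 1# -> Spelled p
    term-sound zero p le p< _ = ⊥-elim (exhausted le p<)
    term-sound (suc f) p le p< Ap = rule (fwd (holds-oneOf κ (ι v) v (p ∷ ρ3) 7 termRule)
     (fwd (holds-⇒ κ (ι v) v (p ∷ ρ3) (A p4 == one) (oneOf 7 termRule)) (hterms p p<) Ap)) where
     ρ4 : Vec ℕ 4
     ρ4 = p ∷ ρ3
     s8 = fst (fst (projected p p<))
     e8 = snd (fst (projected p p<))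
     begun : ∀ b u {q} -> Reads w p (b ∷ u) q -> p < n
     begun b u ((p<n , _) , _) = p<n
     next : ∀ i -> p < n -> i < 3 -> v (1 ∷ suc i N.+ p ∷ []) ≈ 1# -> Spelled (suc i N.+ p)
     next i p<n i<3 = term-sound f (suc i N.+ p) (further i le) (N.+-mono-≤-< i<3 p<n)
     -- The kernel at p is described by the certificate Related of those at the two subterms.
     binary : ∀ b u g (op : Term X -> Term X -> Term X) -> (∀ s t -> ⟨ op s t ⟩ leaf ≡ (b ∷ u) ++ ⟨ s ⟩ leaf ++ ⟨ t ⟩ leaf) -> length u ≡ 2 -> (∀ s t -> Everywhere (InRange m) s -> Everywhere (InRange m) t -> Everywhere (InRange m) (op s t)) ->
      (∀ q s t -> Mat 8 (3 N.+ p) kills eval 𝐋 s (values α C) -> Mat 8 q kills eval 𝐋 t (values α C) -> ⊨ (meetT (g (VT (lit 3 ⊹ p5))) (g (VT q5)) (g (VT p5)) (XT p5) (YT p5)) (q ∷ ρ4) -> Mat 8 p kills eval 𝐋 (op s t) (values α C)) -> ⊨ (binaryRule (b ∷ u) g) ρ4 -> Spelled p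
     binary b u g op coded two in-range related (sp , As , ex) = finish (next 2 (begun b u r) (s≤s (s≤s (s≤s z≤n))) As) (fwd (holds-any κ (ι v) v ρ4 n4 (secondTerm g)) ex) where
      r : Reads w p (b ∷ u) (3 N.+ p)
      r = subst (\ l -> Reads w p (b ∷ u) (suc l N.+ p)) two (spelled (b ∷ u) p4 ρ4 (near p<) sp)
      finish : Spelled (3 N.+ p) -> (∃[ q ] q < n × ⊨ (secondTerm g) (q ∷ ρ4)) -> Spelled p
      finish (s , q1 , rs , es , is , as) (q , q< , e1 , Aq , e2 , mt) = second (term-sound f q (further 2 le ▹ N.+-monoʳ-≤ f q-late) (N.<-≤-trans q< (N.m≤n+m n 3)) Aq) where
       q1≡q : q1 ≡ q
       q1≡q = nat-inj (symm es >> e1 >> N≈ q ((N.<⇒≤ q<) ▹ N.m≤n+m n 4))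
       q-late : 3 N.+ p ≤ q
       q-late = subst (3 N.+ p ≤_) (sym (reads-end (3 N.+ p) (⟨ s ⟩ leaf) rs) ~> q1≡q) (N.m≤n+m (3 N.+ p) _)
       second : Spelled q -> Spelled p
       second (t , q2 , rt , et , it , at') = op s t , q2 , subst (\ u -> Reads w p u q2) (sym (coded s t))
        (reads-++ p (b ∷ u) r (reads-++ (3 N.+ p) (⟨ s ⟩ leaf) rs (subst (\ q -> Reads w q (⟨ t ⟩ leaf) q2) (sym q1≡q) rt))) , e2 >> et , in-range s t is it , related q s t as at' mt
     lookup-number : ∀ u -> u ≢ [] -> ⊨ (spells u p4) ρ4 -> v (3 ∷ length u N.+ p ∷ []) ≈ 1# -> length u N.+ p < 3 N.+ n × Number (length u N.+ p)
     lookup-number u u≢ sp Bq = q< , number-sound (length u N.+ p) q< Bq where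
      p≤n : ∀ u -> u ≢ [] -> Reads w p u (length u N.+ p) -> p ≤ n
      p≤n [] u≢ _ = ⊥-elim (u≢ refl)
      p≤n (b ∷ u) _ ((p<n , _) , _) = N.<⇒≤ p<n
      reads = spelled u p4 ρ4 (near p<) sp
      q< : length u N.+ p < 3 N.+ n
      q< = s≤s (reads-bound p u (p≤n u u≢ reads) reads ▹ N.m≤n+m n 2)
     rule : (∃[ i ] ⊨ (termRule i) ρ4) -> Spelled p
     rule (0F , hr) = binary false (true ∷ true ∷ []) id _∧ᵗ_ (\ _ _ -> refl) refl (\ _ _ -> _,_)
      (\ q s t a b mt -> meet-sound {X = Mat 10 p} {Mat 11 p} a b s8 e8 (fwd (meet⇔ (q ∷ ρ4) (VT (lit 3 ⊹ p5)) (VT q5) (VT p5) (XT p5) (YT p5)) mt)) hr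
     rule (fsuc 0F , hr) = binary false (true ∷ false ∷ []) compT _∨ᵗ_ (\ _ _ -> refl) refl (\ _ _ -> _,_) joined hr where
      joined : ∀ q s t -> Mat 8 (3 N.+ p) kills eval 𝐋 s (values α C) -> Mat 8 q kills eval 𝐋 t (values α C) -> ⊨ (meetT (compT (VT (lit 3 ⊹ p5))) (compT (VT q5)) (compT (VT p5)) (XT p5) (YT p5)) (q ∷ ρ4) -> Mat 8 p kills (eval 𝐋 s (values α C) ⊕ eval 𝐋 t (values α C))
      joined q s t a b mt = annihilates-cong (∩⊥ U Z) (annihilates-≈ (\ i j -> +-congˡ (*-congˡ (comp-value minus≈ ρ5 (VT p5) i j)) >> comp-comp (Mat 8 p) i j)
       (comp-annihilates (meet-sound {X = Mat 10 p} {Mat 11 p} (complemented (VT (lit 3 ⊹ p5)) a) (complemented (VT q5) b) (fst own) (snd own)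
       (fwd (meet⇔ ρ5 (compT (VT (lit 3 ⊹ p5))) (compT (VT q5)) (compT (VT p5)) (XT p5) (YT p5)) mt)))) where
       U = eval 𝐋 s (values α C)
       Z = eval 𝐋 t (values α C)
       ρ5 : Vec ℕ 5
       ρ5 = q ∷ ρ4
       complemented : ∀ P {U} -> ⟦ P ⟧m ρ5 kills U -> ⟦ compT P ⟧m ρ5 kills (U ^⊥)
       complemented P a = annihilates-≈ (\ i j -> symm (comp-value minus≈ ρ5 P i j)) (comp-annihilates a)
       own : Symmetric (⟦ compT (VT p5) ⟧m ρ5) × Idempotent (⟦ compT (VT p5) ⟧m ρ5)
       own = ≈-projection (\ i j -> symm (comp-value minus≈ ρ5 (VT p5) i j)) (comp-projection s8 e8)
     rule (2F , sp , As , e , eq) = let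
       r = spelled (true ∷ false ∷ []) p4 ρ4 (near p<) sp
       s , q , rs , es , is , as = next 1 (begun true (false ∷ []) r) (s≤s (s≤s z≤n)) As in
       (¬ᵗ s) , q , reads-++ p (true ∷ false ∷ []) r rs , e >> es , is , annihilates-≈ (\ i j -> symm (fwd (equal⇔ ρ4 (VT p4) (compT (VT (lit 2 ⊹ p4)))) eq i j >> comp-value minus≈ ρ4 (VT (lit 2 ⊹ p4)) i j)) (comp-annihilates as)
     rule (3F , sp , e , eq) = let r = spelled (false ∷ false ∷ false ∷ []) p4 ρ4 (near p<) sp in
      0ᵗ , 3 N.+ p , r , e >> N≈ (3 N.+ p) (N.+-monoʳ-≤ 3 (N.m≤n⇒m≤1+n (N.<⇒≤ (begun false (false ∷ false ∷ []) r)))) , tt , annihilates-≈ (\ i j -> symm (fwd (equal⇔ ρ4 (VT p4) idT) eq i j >> id-value ρ4 i j)) δ-annihilates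
     rule (4F , sp , e , eq) = let r = spelled (false ∷ false ∷ true ∷ []) p4 ρ4 (near p<) sp in
      1ᵗ , 3 N.+ p , r , e >> N≈ (3 N.+ p) (N.+-monoʳ-≤ 3 (N.m≤n⇒m≤1+n (N.<⇒≤ (begun false (false ∷ true ∷ []) r)))) , tt , annihilates-≈ (\ i j -> symm (fwd (equal⇔ ρ4 (VT p4) 0T) eq i j)) 0-annihilates
     rule (5F , sp , Bq , e , eq) = let u = true ∷ true ∷ c0 ; q< , k , q , rk , ek , val = lookup-number u (\ ()) sp Bq in
      var (inl k) , q , reads-++ p u (spelled u p4 ρ4 (near p<) sp) rk , e >> ek , tt , annihilates-≈ (fwd (equal⇔ ρ4 (MT (leafEnd u)) (VT p4)) eq) (variable-value k (length u N.+ p) q< Bq val)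
     rule (6F , sp , Bq , e , ex) = constant (lookup-number u (\ ()) sp Bq) (fwd (holds-any κ (ι v) v ρ4 m4 constantIndex) ex) where
      u = true ∷ true ∷ c1
      constant : length u N.+ p < 3 N.+ n × Number (length u N.+ p) -> (∃[ j ] j < m × ⊨ constantIndex (j ∷ ρ4)) -> Spelled p
      constant (q< , k , q , rk , ek , val) (j , j< , vj , eq1 , eq2) = indexed (indices m< j j<) where
       ρ5 : Vec ℕ 5
       ρ5 = j ∷ ρ4
       k≡j : k ≡ j
       k≡j = nat-inj (symm val >> vj >> N≈ j ((N.<⇒≤ j<) ▹ N.≤-pred (N.<-≤-trans m< (mᴱ-small n)) ▹ N.m≤n+m n 4))
       killed : Mat 8 p kills range (C j)
       killed = range-sound {Mat 8 p} {C j} {Mat 11 p} s8 e8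
        (\ i i' -> ⊗-cong {Mat 8 p} {Mat 8 p} {C j} {⟦ constantT ⟧m ρ5} (\ _ _ -> rfl) (\ i i' -> symm (constant-value j p j< i i')) i i' >> symm (mul-value ρ5 (VT p5) constantT i i') >> fwd (equal⇔ ρ5 (mulT (VT p5) constantT) 0T) eq1 i i')
        (\ i i' -> symm (comp-value minus≈ ρ5 (VT p5) i i') >> fwd (equal⇔ ρ5 (compT (VT p5)) (mulT constantT (YT p5))) eq2 i i' >> mul-value ρ5 constantT (YT p5) i i' >> ⊗-cong {⟦ constantT ⟧m ρ5} {C j} {Mat 11 p} {Mat 11 p} (constant-value j p j<) (\ _ _ -> rfl) i i')
       indexed : (∃[ x ] number x ≡ j) -> Spelled p
       indexed (x , refl) = var (inr x) , q , reads-++ p u (spelled u p4 ρ4 (near p<) sp) (subst (\ k -> Reads w (length u N.+ p) (numberCode k) q) k≡j rk) , e >> ek , j< , killed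
  parsed : Parsed w
  parsed = finish (term-sound (3 N.+ n) 0 (N.m≤m+n (3 N.+ n) 0) (s≤s z≤n) (fst hconclusion)) where
   open Terms α variable-value (matrixAt Cs) constant-value
   finish : Spelled 0 -> Parsed w
   finish (t , q , r , e , ir , a) = t , Cs , ≋-trans (reads-prefix 0 (⟨ t ⟩ leaf) r) (≋-reflexive (cong (embed (⟨ t ⟩ leaf) ++_) (cong (\ q -> List.drop q w) q≡L ~> fst (snd tail)))) ,
    subst (_< ⟦ mᴱ ⟧e (n ∷ [])) (sym (snd (snd tail))) m< , subst (\ m -> Everywhere (InRange m) t) (sym (snd (snd tail))) ir , α ,
    \ x -> bwd (_kills_.kernel a x) \ i -> ·-cong {Mat 8 0 i} {\ _ -> 0#} {x} (\ j -> fwd (equal⇔ ρ3 (VT (lit 0)) 0T) (fst (snd (snd hconclusion))) i j) (\ _ -> rfl) >> ·-comm 0ᵛ x >> ·-zeroʳ x where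
    q≡L : q ≡ L
    q≡L = nat-inj (symm e >> fst (snd hconclusion) >> N≈ L (N.≤-pred L< ▹ N.m≤n+m n 4))

 private
  begins : ∀ {w} p t {q} -> Reads w p (⟨ t ⟩ leaf) q -> p < length w
  begins p (var x) ((p< , _) , _) = p<
  begins p (s ∧ᵗ t) ((p< , _) , _) = p<
  begins p (s ∨ᵗ t) ((p< , _) , _) = p<
  begins p (¬ᵗ t) ((p< , _) , _) = p<
  begins p 0ᵗ ((p< , _) , _) = p<
  begins p 1ᵗ ((p< , _) , _) = p<
  prefix-reads : ∀ {w} p u {r} -> List.drop p w ≋ embed u ++ r -> Reads w p u (length u N.+ p)
  prefix-reads p [] _ = refl
  prefix-reads {w} p (b ∷ u) {r} eq = reading (p N.<? length w) where
   reading : Dec (p < length w) -> Reads w p (b ∷ u) (suc (length u) N.+ p)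
   reading (no p≮) = ⊥-elim (N.1+n≢0 (sym (Pointwise-length eq) ~> List.length-drop p w ~> N.m≤n⇒m∸n≡0 (N.≮⇒≥ p≮)))
   reading (yes p<) with subst (_≋ embed (b ∷ u) ++ r) (drop-nth p w p<) eq
   ... | x ∷ rest = (p< , x) , subst (Reads w (suc p) u) (N.+-suc (length u) p) (prefix-reads (suc p) u rest)
  reads-bits : ∀ {w} p u {q} -> Reads w p u q -> map unbit (List.drop p w) ≡ u ++ map unbit (List.drop q w)
  reads-bits {w} p u {q} h = unbits (reads-prefix p u h) ~> List.map-++ unbit (embed u) (List.drop q w) ~> cong (_++ map unbit (List.drop q w)) (unbit-embed u)
  reads-unique : ∀ {w} {Y : Set} (c : Y -> List Bool) -> PrefixFree c -> ∀ p x y {q q'} -> Reads w p (c x) q -> Reads w p (c y) q' -> x ≡ y × q ≡ q'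
  reads-unique {w} c fr p x y {q} {q'} h h' = x≡y , reads-end p (c x) h ~> cong (\ x -> length (c x) N.+ p) x≡y ~> sym (reads-end p (c y) h')
   where x≡y = fst (fr x y (map unbit (List.drop q w)) (map unbit (List.drop q' w)) (sym (reads-bits p (c x) h) ~> reads-bits p (c y) h'))

 module Complete (κ : Fin 0 -> Carrier) (w : List Carrier) (t0 : Term X) (m : ℕ) (α C : ℕ -> Matrix) (m< : m < ⟦ mᴱ ⟧e (length w ∷ []))
  (reads0 : Reads w 0 (⟨ t0 ⟩ leaf) (length (⟨ t0 ⟩ leaf))) (in-range0 : Everywhere (InRange m) t0)
  (full : ∀ x -> x ∈ eval 𝐋 t0 (values α C)) (length-w : length w ≡ length (⟨ t0 ⟩ leaf) N.+ d² N.* m)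
  (constants : ∀ j -> j < m -> ∀ i i' -> nth w (length (⟨ t0 ⟩ leaf) N.+ (j N.* d² N.+ toℕ (Fin.combine i i'))) ≈ C j i i') where
  private
   L : ℕ
   L = length (⟨ t0 ⟩ leaf)
   HasTerm HasNumber : ℕ -> Set
   HasTerm p = Σ (Term X) \ t -> ∃[ q ] Reads w p (⟨ t ⟩ leaf) q × Everywhere (InRange m) t
   HasNumber p = ∃[ k ] ∃[ q ] Reads w p (numberCode k) q
   ⟪_⟫ : Term X -> Subspace
   ⟪ t ⟫ = eval 𝐋 t (values α C)
   variable-solution : ∀ k -> Σ Matrix (_kills range (α k))
   variable-solution k = annihilated (range (α k))
   solution : ∀ t -> Σ Matrix (_kills ⟪ t ⟫)
   solution (var (inl k)) = variable-solution k
   solution (var (inr x)) = let A , a , _ = range-of (C (number x)) in A , a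
   solution (s ∧ᵗ t) = let A , a , _ = meet-of (snd (solution s)) (snd (solution t)) in A , a
   solution (s ∨ᵗ t) = let A , a , _ = join-of (snd (solution s)) (snd (solution t)) in A , a
   solution (¬ᵗ t) = comp (fst (solution t)) , comp-annihilates (snd (solution t))
   solution 0ᵗ = δ , δ-annihilates
   solution 1ᵗ = 0ᵐ , 0-annihilates
   variableMatrix : ℕ -> Matrix
   variableMatrix k = fst (variable-solution k)
   termMatrix : Term X -> Matrix
   termMatrix t = fst (solution t)
   Certificate : Term X -> Matrix × Matrix -> Set
   Certificate (s ∧ᵗ t) (Q , Z) = Meet (termMatrix s) (termMatrix t) (termMatrix (s ∧ᵗ t)) Q Z
   Certificate (s ∨ᵗ t) (Q , Z) = Meet (comp (termMatrix s)) (comp (termMatrix t)) (comp (termMatrix (s ∨ᵗ t))) Q Z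
   Certificate (var (inr x)) (Q , Z) = termMatrix (var (inr x)) ⊗ C (number x) ≈ᵐ 0ᵐ × comp (termMatrix (var (inr x))) ≈ᵐ C (number x) ⊗ Z
   Certificate _ _ = ⊤
   cert : ∀ t -> Σ (Matrix × Matrix) (Certificate t)
   cert (s ∧ᵗ t) = snd (snd (meet-of (snd (solution s)) (snd (solution t))))
   cert (s ∨ᵗ t) = snd (snd (join-of (snd (solution s)) (snd (solution t))))
   cert (var (inr x)) = let Z , h = snd (snd (range-of (C (number x)))) in (0ᵐ , Z) , h
   cert (var (inl k)) = (0ᵐ , 0ᵐ) , tt
   cert (¬ᵗ t) = (0ᵐ , 0ᵐ) , tt
   cert 0ᵗ = (0ᵐ , 0ᵐ) , tt
   cert 1ᵗ = (0ᵐ , 0ᵐ) , tt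
   case : ∀ {P Y : Set} -> Dec P -> (P -> Y) -> Y -> Y
   case (yes p) f y = f p
   case (no _) f y = y
   table : ℕ -> ℕ -> Matrix
   table 8 p = case (dec (HasTerm p)) (termMatrix ∘ fst) 0ᵐ
   table 9 p = case (dec (HasNumber p)) (variableMatrix ∘ fst) 0ᵐ
   table 10 p = case (dec (HasTerm p)) (fst ∘ fst ∘ cert ∘ fst) 0ᵐ
   table _ p = case (dec (HasTerm p)) (snd ∘ fst ∘ cert ∘ fst) 0ᵐ
  v : List ℕ -> Carrier
  v (0 ∷ p ∷ []) = case (p N.<? length w) (\ _ -> nth w p) (1# + 1#)
  v (1 ∷ p ∷ []) = case (dec (HasTerm p)) (\ _ -> 1#) 0#
  v (2 ∷ p ∷ []) = case (dec (HasTerm p)) (\ (_ , q , _) -> nat q) 0#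
  v (3 ∷ p ∷ []) = case (dec (HasNumber p)) (\ _ -> 1#) 0#
  v (4 ∷ p ∷ []) = case (dec (HasNumber p)) (\ (_ , q , _) -> nat q) 0#
  v (5 ∷ p ∷ []) = case (dec (HasNumber p)) (\ (k , _) -> nat k) 0#
  v (6 ∷ i ∷ []) = nat i
  v (7 ∷ []) = - 1#
  v (c ∷ p ∷ i ∷ j ∷ []) = table c p (clamp d' i) (clamp d' j)
  v _ = 0#
  open Meaning κ w v
  word : ∀ p -> p < n -> v (0 ∷ p ∷ []) ≈ nth w p
  word p p<n with p N.<? length w
  ... | yes _ = rfl
  ... | no p≮n = ⊥-elim (p≮n p<n)
  private
   ρ3 : Vec ℕ 3
   ρ3 = L ∷ m ∷ n ∷ []
   flagged : ∀ {P : Set} (f : Dec P) -> case f (\ _ -> 1#) 0# ≈ 1# -> P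
   flagged (yes p) _ = p
   flagged (no _) h = ⊥-elim (1≉0 (symm h))
   Mat≈ : ∀ c p -> 8 ≤ c -> ∀ Q -> table c p ≡ Q -> Mat c p ≈ᵐ Q
   Mat≈ (suc (suc (suc (suc (suc (suc (suc (suc c)))))))) p le Q refl i j = eq≈ (cong₂ (table (8 N.+ c) p) (clamp-toℕ d' i) (clamp-toℕ d' j))
   Mat≈ 0 p () Q
   Mat≈ 1 p (s≤s ()) Q
   Mat≈ 2 p (s≤s (s≤s ())) Q
   Mat≈ 3 p (s≤s (s≤s (s≤s ()))) Q
   Mat≈ 4 p (s≤s (s≤s (s≤s (s≤s ())))) Q
   Mat≈ 5 p (s≤s (s≤s (s≤s (s≤s (s≤s ()))))) Q
   Mat≈ 6 p (s≤s (s≤s (s≤s (s≤s (s≤s (s≤s ())))))) Q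
   Mat≈ 7 p (s≤s (s≤s (s≤s (s≤s (s≤s (s≤s (s≤s ()))))))) Q
   module _ {p : ℕ} (t : Term X) {q : ℕ} (r : Reads w p (⟨ t ⟩ leaf) q) (ir : Everywhere (InRange m) t) where
    term-case : ∀ {Y : Set} (f : Term X -> ℕ -> Y) y -> case (dec (HasTerm p)) (\ (t , q , _) -> f t q) y ≡ f t q
    term-case f y = go (dec (HasTerm p)) where
     go : (h : Dec (HasTerm p)) -> case h (\ (t , q , _) -> f t q) y ≡ f t q
     go (yes (t' , q' , r' , _)) = let e , e' = reads-unique (\ t -> ⟨ t ⟩ leaf) (readable leaf free) p t' t r' r in cong₂ f e e'
     go (no none) = ⊥-elim (none (t , q , r , ir))
    starts : v (1 ∷ p ∷ []) ≈ 1#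
    starts = eq≈ (term-case (\ _ _ -> 1#) 0#)
    ends : v (2 ∷ p ∷ []) ≈ nat q
    ends = eq≈ (term-case (\ _ q -> nat q) 0#)
    matrix-of : Mat 8 p ≈ᵐ termMatrix t
    matrix-of = Mat≈ 8 p (N.m≤m+n 8 0) (termMatrix t) (term-case (\ t _ -> termMatrix t) 0ᵐ)
    first-of : Mat 10 p ≈ᵐ fst (fst (cert t))
    first-of = Mat≈ 10 p (N.m≤m+n 8 2) _ (term-case (\ t _ -> fst (fst (cert t))) 0ᵐ)
    second-of : Mat 11 p ≈ᵐ snd (fst (cert t))
    second-of = Mat≈ 11 p (N.m≤m+n 8 3) _ (term-case (\ t _ -> snd (fst (cert t))) 0ᵐ)
   module _ {p : ℕ} (k : ℕ) {q : ℕ} (r : Reads w p (numberCode k) q) where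
    number-case : ∀ {Y : Set} (f : ℕ -> ℕ -> Y) y -> case (dec (HasNumber p)) (\ (k , q , _) -> f k q) y ≡ f k q
    number-case f y = go (dec (HasNumber p)) where
     go : (h : Dec (HasNumber p)) -> case h (\ (k , q , _) -> f k q) y ≡ f k q
     go (yes (k' , q' , r')) = let e , e' = reads-unique numberCode numberCode-free p k' k r' r in cong₂ f e e'
     go (no none) = ⊥-elim (none (k , q , r))
    number-starts : v (3 ∷ p ∷ []) ≈ 1#
    number-starts = eq≈ (number-case (\ _ _ -> 1#) 0#)
    number-ends : v (4 ∷ p ∷ []) ≈ nat q
    number-ends = eq≈ (number-case (\ _ q -> nat q) 0#)
    number-value : v (5 ∷ p ∷ []) ≈ nat k
    number-value = eq≈ (number-case (\ k _ -> nat k) 0#)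
    number-matrix : Mat 9 p ≈ᵐ variableMatrix k
    number-matrix = Mat≈ 9 p (N.m≤m+n 8 1) (variableMatrix k) (number-case (\ k _ -> variableMatrix k) 0ᵐ)
   spell : ∀ {k} u (p : Ex k) ρ {q} -> Reads w (⟦ p ⟧e ρ) u q -> ⊨ (spells u p) ρ
   spell [] p ρ _ = rfl
   spell (true ∷ u) p ρ ((p< , x) , r) = word _ p< >> x , spell u (lit 1 ⊹ p) ρ r
   spell (false ∷ u) p ρ ((p< , x) , r) = word _ p< >> x , spell u (lit 1 ⊹ p) ρ r
   ρ4 : ℕ -> Vec ℕ 4
   ρ4 p = p ∷ ρ3
   implied : ∀ {k} (ρ : Vec ℕ k) φ ψ -> (⊨ φ ρ -> ⊨ ψ ρ) -> ⊨ (φ => ψ) ρ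
   implied ρ φ ψ = bwd (holds-⇒ κ (ι v) v ρ φ ψ)
   equal : ∀ {k} (ρ : Vec ℕ k) P Q -> ⟦ P ⟧m ρ ≈ᵐ ⟦ Q ⟧m ρ -> ⊨ (equalT P Q) ρ
   equal ρ P Q = bwd (equal⇔ ρ P Q)
   complement : ∀ {k} (ρ : Vec ℕ k) P {Q} -> ⟦ P ⟧m ρ ≈ᵐ Q -> ⟦ compT P ⟧m ρ ≈ᵐ comp Q
   complement ρ P {Q} h i j = comp-value rfl ρ P i j >> comp-cong {⟦ P ⟧m ρ} {Q} h i j
   number-holds : ∀ p -> HasNumber p -> ∃[ i ] ⊨ (numberRule i) (ρ4 p)
   number-holds p (k , q , r) = go (Bin.fromℕ k) (Bin.toℕ-fromℕ k) r where
    module _ (b : Bin.ℕᵇ) (r' : Reads w (2 N.+ p) (digitCode b) q) where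
     r″ : Reads w (2 N.+ p) (numberCode (Bin.toℕ b)) q
     r″ = subst (\ b -> Reads w (2 N.+ p) (digitCode b) q) (sym (fromℕ-toℕ b)) r'
     ended : v (4 ∷ p ∷ []) ≈ v (4 ∷ 2 N.+ p ∷ [])
     ended = number-ends k r >> symm (number-ends (Bin.toℕ b) r″)
     value : v (5 ∷ 2 N.+ p ∷ []) ≈ nat (Bin.toℕ b)
     value = number-value (Bin.toℕ b) r″
    go : ∀ b -> Bin.toℕ b ≡ k -> Reads w p (digitCode b) q -> ∃[ i ] ⊨ (numberRule i) (ρ4 p)
    go Bin.zero eq r0@(x , e) = 0F , spell (false ∷ []) p4 (ρ4 p) r0 , number-ends k r >> eq≈ (cong nat (sym e)) , number-value k r >> eq≈ (cong nat (sym eq))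
    go Bin.2[1+ b ] eq (x , y , r') = fsuc 0F , spell (true ∷ false ∷ []) p4 (ρ4 p) (x , y , refl) , number-starts (Bin.toℕ b) (r″ b r') , ended b r' ,
     number-value k r >> eq≈ (cong nat (sym eq)) >> double (suc (Bin.toℕ b)) >> symm (+-cong (+-congˡ (value b r')) (+-congˡ (value b r')))
    go Bin.1+[2 b ] eq (x , y , r') = 2F , spell (true ∷ true ∷ []) p4 (ρ4 p) (x , y , refl) , number-starts (Bin.toℕ b) (r″ b r') , ended b r' , number-value k r >> eq≈ (cong nat (sym eq)) >> +-congˡ (double (Bin.toℕ b) >> symm (+-cong (value b r') (value b r')))
   -- The number of a leaf starts after the prefix u of its code.
   module LeafNumber (p : ℕ) (t : Term X) (u : List Bool) (k q : ℕ) (r : Reads w p (⟨ t ⟩ leaf) q) (ir : Everywhere (InRange m) t) (eq : ⟨ t ⟩ leaf ≡ u ++ numberCode k) where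
    parts = reads-split p u (subst (\ u -> Reads w p u q) eq r)
    prefix : ⊨ (spells u p4) (ρ4 p)
    prefix = spell u p4 (ρ4 p) (fst (snd parts))
    r' : Reads w (length u N.+ p) (numberCode k) q
    r' = subst (\ p -> Reads w p (numberCode k) q) (reads-end p u (fst (snd parts))) (snd (snd parts))
    ended : v (2 ∷ p ∷ []) ≈ v (4 ∷ length u N.+ p ∷ [])
    ended = ends t r ir >> symm (number-ends k r')
   term-holds : ∀ p -> HasTerm p -> ∃[ i ] ⊨ (termRule i) (ρ4 p)
   term-holds p (s ∧ᵗ t , q , r@(x , y , z , rst) , ir) = let q1 , rs , rt = reads-split (3 N.+ p) (⟨ s ⟩ leaf) rst in
    0F , spell (false ∷ true ∷ true ∷ []) p4 (ρ4 p) (x , y , z , refl) , starts s rs (fst ir) , bwd (holds-any κ (ι v) v (ρ4 p) n4 (secondTerm id)) (q1 , begins q1 t rt , ends s rs (fst ir) , starts t rt (snd ir) , ends (s ∧ᵗ t) r ir >> symm (ends t rt (snd ir)) ,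
    bwd (meet⇔ (q1 ∷ ρ4 p) (VT (lit 3 ⊹ p5)) (VT q5) (VT p5) (XT p5) (YT p5))
    (meet-cong (\ i j -> symm (matrix-of s rs (fst ir) i j)) (\ i j -> symm (matrix-of t rt (snd ir) i j)) (\ i j -> symm (matrix-of (s ∧ᵗ t) r ir i j))
    (\ i j -> symm (first-of (s ∧ᵗ t) r ir i j)) (\ i j -> symm (second-of (s ∧ᵗ t) r ir i j)) (snd (cert (s ∧ᵗ t)))))
   term-holds p (s ∨ᵗ t , q , r@(x , y , z , rst) , ir) = let q1 , rs , rt = reads-split (3 N.+ p) (⟨ s ⟩ leaf) rst in
    fsuc 0F , spell (false ∷ true ∷ false ∷ []) p4 (ρ4 p) (x , y , z , refl) , starts s rs (fst ir) , bwd (holds-any κ (ι v) v (ρ4 p) n4 (secondTerm compT)) (q1 , begins q1 t rt , ends s rs (fst ir) , starts t rt (snd ir) , ends (s ∨ᵗ t) r ir >> symm (ends t rt (snd ir)) ,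
    bwd (meet⇔ (q1 ∷ ρ4 p) (compT (VT (lit 3 ⊹ p5))) (compT (VT q5)) (compT (VT p5)) (XT p5) (YT p5))
    (meet-cong (\ i j -> symm (complement (q1 ∷ ρ4 p) (VT (lit 3 ⊹ p5)) (matrix-of s rs (fst ir)) i j)) (\ i j -> symm (complement (q1 ∷ ρ4 p) (VT q5) (matrix-of t rt (snd ir)) i j))
    (\ i j -> symm (complement (q1 ∷ ρ4 p) (VT p5) (matrix-of (s ∨ᵗ t) r ir) i j))
    (\ i j -> symm (first-of (s ∨ᵗ t) r ir i j)) (\ i j -> symm (second-of (s ∨ᵗ t) r ir i j)) (snd (cert (s ∨ᵗ t)))))
   term-holds p (¬ᵗ t , q , r@(x , y , rt) , ir) = 2F , spell (true ∷ false ∷ []) p4 (ρ4 p) (x , y , refl) , starts t rt ir , ends (¬ᵗ t) r ir >> symm (ends t rt ir) ,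
    equal (ρ4 p) (VT p4) (compT (VT (lit 2 ⊹ p4))) (\ i j -> matrix-of (¬ᵗ t) r ir i j >> symm (complement (ρ4 p) (VT (lit 2 ⊹ p4)) (matrix-of t rt ir) i j))
   term-holds p (0ᵗ , q , r , ir) = 3F , spell (false ∷ false ∷ false ∷ []) p4 (ρ4 p) r , ends 0ᵗ r ir >> eq≈ (cong nat (reads-end {w} p (⟨ 0ᵗ {X} ⟩ leaf) r)) , equal (ρ4 p) (VT p4) idT (\ i j -> matrix-of 0ᵗ r ir i j >> symm (id-value (ρ4 p) i j))
   term-holds p (1ᵗ , q , r , ir) = 4F , spell (false ∷ false ∷ true ∷ []) p4 (ρ4 p) r , ends 1ᵗ r ir >> eq≈ (cong nat (reads-end {w} p (⟨ 1ᵗ {X} ⟩ leaf) r)) , equal (ρ4 p) (VT p4) 0T (matrix-of 1ᵗ r ir)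
   term-holds p (var (inl k) , q , r , ir) = 5F , prefix , number-starts k r' , ended , equal (ρ4 p) (MT (leafEnd (true ∷ true ∷ c0))) (VT p4) (\ i j -> number-matrix k r' i j >> symm (matrix-of (var (inl k)) r ir i j))
    where open LeafNumber p (var (inl k)) (true ∷ true ∷ c0) k q r ir refl
   term-holds p (var (inr x) , q , r , ir) = 6F , prefix , number-starts k r' , ended , bwd (holds-any κ (ι v) v (ρ4 p) m4 constantIndex) (k , ir , number-value k r' , equal ρ5 (mulT (VT p5) constantT) 0T (\ i j -> mul-value ρ5 (VT p5) constantT i j >>
    ⊗-cong {Mat 8 p} {T} {⟦ constantT ⟧m ρ5} {C k} own constant≈ i j >> fst (snd (cert (var (inr x)))) i j) , equal ρ5 (compT (VT p5)) (mulT constantT (YT p5)) (\ i j -> complement ρ5 (VT p5) own i j >>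
    snd (snd (cert (var (inr x)))) i j >> symm (mul-value ρ5 constantT (YT p5) i j >> ⊗-cong {⟦ constantT ⟧m ρ5} {C k} {Mat 11 p} {snd (fst (cert (var (inr x))))} constant≈ (second-of (var (inr x)) r ir) i j))) where
    k = number x
    T = termMatrix (var (inr x))
    open LeafNumber p (var (inr x)) (true ∷ true ∷ c1) k q r ir refl
    ρ5 : Vec ℕ 5
    ρ5 = k ∷ ρ4 p
    own : Mat 8 p ≈ᵐ T
    own = matrix-of (var (inr x)) r ir
    constant≈ : ⟦ constantT ⟧m ρ5 ≈ᵐ C k
    constant≈ i i' = word _ (subst (L N.+ (k N.* d² N.+ toℕ (Fin.combine i i')) <_) (sym (length-w ~> cong (L N.+_) (N.*-comm d² m))) (N.+-monoʳ-< L
     (N.<-≤-trans (N.+-monoʳ-< (k N.* d²) (Fin.toℕ<n (Fin.combine i i'))) (N.≤-reflexive (N.+-comm (k N.* d²) d²) ▹ N.*-monoˡ-≤ d² ir)))) >> constants k ir i i'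
   projections-hold : ∀ p -> ⊨ (projectionT (VT p4) & projectionT (MT p4)) (ρ4 p)
   projections-hold p = bwd (projection⇔ (ρ4 p) (VT p4)) (projection 8 (N.m≤m+n 8 0) (term (dec (HasTerm p)))) , bwd (projection⇔ (ρ4 p) (MT p4)) (projection 9 (N.m≤m+n 8 1) (numbered (dec (HasNumber p)))) where
    Projection : Matrix -> Set
    Projection P = Symmetric P × Idempotent P
    projection : ∀ c -> 8 ≤ c -> Projection (table c p) -> Projection (Mat c p)
    projection c le = ≈-projection (\ i j -> symm (Mat≈ c p le (table c p) refl i j))
    zero-projection : Projection 0ᵐ
    zero-projection = _kills_.symmetric 0-annihilates , _kills_.idempotent 0-annihilates
    term : (f : Dec (HasTerm p)) -> Projection (case f (termMatrix ∘ fst) 0ᵐ)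
    term (yes (t , _)) = _kills_.symmetric (snd (solution t)) , _kills_.idempotent (snd (solution t))
    term (no _) = zero-projection
    numbered : (f : Dec (HasNumber p)) -> Projection (case f (variableMatrix ∘ fst) 0ᵐ)
    numbered (yes (k , _)) = let a = snd (variable-solution k) in _kills_.symmetric a , _kills_.idempotent a
    numbered (no _) = zero-projection
   consistent : ∀ p q -> HasNumber p -> HasNumber q -> v (5 ∷ p ∷ []) ≈ v (5 ∷ q ∷ []) -> Mat 9 p ≈ᵐ Mat 9 q
   consistent p q (k , _ , r) (k' , _ , r') eq i j = number-matrix k r i j >> eq≈ (cong (\ k -> variableMatrix k i j) (nat-inj (symm (number-value k r) >> eq >> number-value k' r'))) >> symm (number-matrix k' r' i j)
   blank : ∀ i -> v (0 ∷ i N.+ n ∷ []) ≈ 1# + 1#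
   blank i with i N.+ n N.<? length w
   ... | yes lt = ⊥-elim (N.<⇒≱ lt (N.m≤n+m n i))
   ... | no _ = rfl
  body-holds : ⊨ body ρ3
  body-holds = ((rfl , \ _ _ -> rfl) , (\ i _ -> blank i) , -‿inverseˡ 1#) , (\ p _ -> implied (ρ4 p) (B p4 == one) (oneOf 3 numberRule) \ h -> bwd (holds-oneOf κ (ι v) v (ρ4 p) 3 numberRule) (number-holds p (flagged (dec (HasNumber p)) h))) ,
   (\ p _ -> implied (ρ4 p) (A p4 == one) (oneOf 7 termRule) \ h -> bwd (holds-oneOf κ (ι v) v (ρ4 p) 7 termRule) (term-holds p (flagged (dec (HasTerm p)) h))) , (\ p _ -> projections-hold p) ,
   (\ p _ q _ -> implied (q ∷ ρ4 p) (B p5 == one & B q5 == one & Val p5 == Val q5) (equalT (MT p5) (MT q5)) \ (h , h' , eq) -> equal (q ∷ ρ4 p) (MT p5) (MT q5) (consistent p q (flagged (dec (HasNumber p)) h) (flagged (dec (HasNumber q)) h') eq)) ,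
   starts t0 reads0 in-range0 , ends t0 reads0 in-range0 , equal ρ3 (VT (lit 0)) 0T (\ i j -> matrix-of t0 reads0 in-range0 i j >> full-zero (snd (solution t0)) full i j) , eq≈ (cong nat length-w) >> nat-+ L (d² N.* m) >> +-congˡ (nat-* d² m >> *-congʳ (symm (natT-value ρ3 d²)))

 formula⇔ : ∀ κ w -> Solvable κ formula w ⇔ Parsed w
 formula⇔ κ w = mk⇔ sound complete where
  n = length w
  sound : Solvable κ formula w -> Parsed w
  sound s = let v , given , h = fwd (withInput⇔ κ parses w) (fwd (unfolded κ w) s) in outer v given (fwd (holds-any κ (ι v) v (n ∷ []) mᴱ (any (lit 1 ⊹ # fsuc 0F) body)) h) where
   outer : ∀ v -> (∀ i -> i < n -> ι v i ≈ nth w i) -> ∃[ m ] m < ⟦ mᴱ ⟧e (n ∷ []) × Holds κ (ι v) v (any (lit 1 ⊹ # fsuc 0F) body) (m ∷ n ∷ []) -> Parsed w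
   outer v given (m , m< , h) = let L , L< , h' = fwd (holds-any κ (ι v) v (m ∷ n ∷ []) (lit 1 ⊹ # fsuc 0F) body) h in Sound.parsed κ w v m L m< L< given h'
  complete : Parsed w -> Solvable κ formula w
  complete (t , Cs , eq , m< , ir , α , full) = bwd (unfolded κ w) (bwd (withInput⇔ κ parses w) (C.v , C.word , bwd (holds-any κ (ι C.v) C.v (n ∷ []) mᴱ (any (lit 1 ⊹ # fsuc 0F) body))
   (length Cs , m< , bwd (holds-any κ (ι C.v) C.v (length Cs ∷ n ∷ []) (lit 1 ⊹ # fsuc 0F) body) (length u , s≤s (N.m≤m+n (length u) _ ▹ N.≤-reflexive (sym length-w)) , C.body-holds)))) where
   u = ⟨ t ⟩ leaf
   length-blocks : ∀ Cs -> length (blocks Cs) ≡ length Cs N.* d²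
   length-blocks [] = refl
   length-blocks (C ∷ Cs) = List.length-++ (encodeMatrix C) ~> (cong₂ N._+_ (length-encodeMatrix C) (length-blocks Cs))
   length-w : n ≡ length u N.+ d² N.* length Cs
   length-w = Pointwise-length eq ~> List.length-++ (embed u) ~> (cong₂ N._+_ (List.length-map _ u) (length-blocks Cs ~> N.*-comm (length Cs) d²))
   nth-cong : ∀ {xs ys} -> xs ≋ ys -> ∀ i -> nth xs i ≈ nth ys i
   nth-cong [] i = rfl
   nth-cong (p ∷ ps) zero = p
   nth-cong (p ∷ ps) (suc i) = nth-cong ps i
   constants : ∀ j -> j < length Cs -> ∀ i i' -> nth w (length u N.+ (j N.* d² N.+ toℕ (Fin.combine i i'))) ≈ matrixAt Cs j i i'
   constants j j< i i' = nth-cong eq (length u N.+ r) >> eq≈ (cong (\ l -> nth (embed u ++ blocks Cs) (l N.+ r)) (sym (List.length-map _ u)) ~> nth-++ʳ (embed u) r ~> nth-blocks Cs j j< i i')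
    where r = j N.* d² N.+ toℕ (Fin.combine i i')
   module C = Complete κ w t (length Cs) α (matrixAt Cs) m< (subst (Reads w 0 u) (N.+-identityʳ (length u)) (prefix-reads 0 u eq)) ir full length-w constants

module Completeness
 (em : EM) (R : Ring) (real : FormallyReal R) (d' : ℕ) where
 private
  d : ℕ
  d = suc (suc (suc d'))

 open Formula
 open FormulaSemantics R
 open FormallyReal real using (1≉0)
 open Codes
 open RingLaws R
 open BSS R
 open Subspaces R d renaming (⊥ to 0ᴸ; ⊤ to 1ᴸ)
 open Gadgets em R real d using (_≐_; ext; to; from)
 open Congruence em R real d
 open Annihilators em R real d
 open FormulaEvaluation em R 1≉0 using (solvable-NP⁰)
 open import Data.List.Relation.Binary.Equality.Setoid setoid using (_≋_; ≋-refl; ≋-trans; ≋-reflexive)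
 open import Data.List.Relation.Binary.Pointwise using (Pointwise-length)
 private module I = Instances em R 1≉0 (suc (suc d'))

 private
  pair-free : PrefixFree (leafCode {ℕ} id (false ∷ []) (true ∷ []))
  pair-free (inl i) (inl j) = pairCode-free (inl i) (inl j)
  pair-free (inl i) (inr j) = pairCode-free (inl i) (inr j)
  pair-free (inr i) (inl j) = pairCode-free (inr i) (inl j)
  pair-free (inr i) (inr j) = pairCode-free (inr i) (inr j)
  pair-code : ∀ x -> leafCode {ℕ} id (false ∷ []) (true ∷ []) x ≡ pairCode x
  pair-code (inl i) = refl
  pair-code (inr j) = refl
  module Constants = ParseFormula em R real (suc (suc d')) ℕ id (false ∷ []) (true ∷ []) pair-free (lit 1 ⊹ # 0F) (\ n -> N.≤-refl) (\ _ j _ -> j , refl)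
  noLeaf : {B : Set} -> ⊥ -> B
  noLeaf ()
  number-free : PrefixFree (leafCode {⊥} noLeaf [] [])
  number-free (inl i) (inl j) u v eq = let p , q = numberCode-free i j u v eq in cong inl p , q
  module Plain = ParseFormula em R real (suc (suc d')) ⊥ noLeaf [] [] number-free (lit 1) (\ n -> s≤s z≤n) (\ m< j j< -> ⊥-elim (N.n≮0 (j< ▹ N.≤-pred m<)))
  noConstants : Fin 0 -> Carrier
  noConstants ()

 Constants⇔ : ∀ w -> Constants.Parsed w ⇔ SAT-constants w
 Constants⇔ w = mk⇔ (\ p -> bwd I.SAT-constants⇔ (forth p)) (\ s -> back (fwd I.SAT-constants⇔ s)) where
  same : ∀ α M x -> Constants.values α M x ≡ I.subspaces α M x
  same α M (inl i) = refl
  same α M (inr j) = refl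
  ranged : ∀ m x -> Constants.InRange m x -> I.InRange m x
  ranged m (inl i) h = h
  ranged m (inr j) h = h
  ranged' : ∀ m x -> I.InRange m x -> Constants.InRange m x
  ranged' m (inl i) h = h
  ranged' m (inr j) h = h
  forth : Constants.Parsed w -> I.Instance w
  forth (t , Cs , eq , _ , ir , α , full) = t , Cs , subst (\ u -> w ≋ embed u ++ I.blocks Cs) (code-cong pair-code t) eq , every-map (ranged (length Cs)) t ir , α , \ x -> subst (x ∈_) (eval-cong 𝐋 t (same α (I.matrixAt Cs))) (full x)
  back : I.Instance w -> Constants.Parsed w
  back (t , Cs , eq , ir , α , full) = t , Cs , subst (\ u -> w ≋ embed u ++ I.blocks Cs) (sym (code-cong pair-code t)) eq ,
   s≤s (counted Cs ▹ N.m≤n+m _ (length (embed (⟨ t ⟩ pairCode))) ▹ N.≤-reflexive (sym (List.length-++ (embed (⟨ t ⟩ pairCode))) ~> sym (Pointwise-length eq))) , every-map (ranged' (length Cs)) t ir , α , \ x -> subst (x ∈_) (sym (eval-cong 𝐋 t (same α (I.matrixAt Cs)))) (full x)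
   where
   counted : ∀ Cs -> length Cs ≤ length (I.blocks Cs)
   counted [] = z≤n
   counted (C ∷ Cs) = N.+-mono-≤ (s≤s z≤n ▹ N.≤-reflexive (sym (I.length-encodeMatrix C))) (counted Cs) ▹ N.≤-reflexive (sym (List.length-++ (encodeMatrix C)))

 Plain⇔ : ∀ w -> SAT 𝐋 w ⇔ Plain.Parsed (embed w)
 Plain⇔ w = mk⇔ (\ s -> forth (fwd (SAT⇔ 𝐋) s)) (\ p -> bwd (SAT⇔ 𝐋) (back p)) where
  strip : ℕ ⊎ ⊥ -> ℕ
  strip (inl i) = i
  forth : (∃[ t ] w ≡ ⟨ t ⟩ numberCode × ∃[ a ] (∀ x -> x ∈ eval 𝐋 t a ⇔ x ∈ 1ᴸ)) -> Plain.Parsed (embed w)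
  forth (t , eq , a , full) = mapTerm inl t , [] , ≋-reflexive (cong embed (eq ~> code-map inl {numberCode} {Plain.leaf} t (everywhere {P = \ i -> numberCode i ≡ numberCode i} (\ _ -> refl) t)) ~> sym (List.++-identityʳ _)) ,
   s≤s z≤n , every-mapTerm inl t (everywhere {P = \ _ -> ⊤} (\ _ -> tt) t) , α , \ x -> subst (x ∈_) (sym (eval-map 𝐋 inl t (Plain.values α (I.matrixAt [])))) (from (eval-≐ t (everywhere (\ k -> range-α k) t)) {x} (bwd (full x) (\ _ -> rfl))) where
   α : ℕ -> Matrix
   α k = comp (fst (annihilated (a k)))
   range-α : ∀ k -> range (α k) ≐ a k
   range-α k = range-annihilated (a k) (annihilated (a k)) where
    range-annihilated : ∀ U (s : Σ Matrix (_kills U)) -> range (comp (fst s)) ≐ U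
    range-annihilated U (A , h) = same-kernel {range (comp A)} (range-comp {A} {comp A} (\ _ _ -> rfl) (_kills_.symmetric h) (_kills_.idempotent h)) h where
     same-kernel : ∀ {Z} -> A kills Z -> A kills U -> Z ≐ U
     same-kernel z u = ext \ x -> mk⇔ (bwd (_kills_.kernel u x) ∘ fwd (_kills_.kernel z x))
      (bwd (_kills_.kernel z x) ∘ fwd (_kills_.kernel u x))
  back : Plain.Parsed (embed w) -> ∃[ t ] w ≡ ⟨ t ⟩ numberCode × ∃[ a ] (∀ x -> x ∈ eval 𝐋 t a ⇔ x ∈ 1ᴸ)
  back (t , [] , eq , _ , ir , α , full) = mapTerm strip t , (sym (I.unbit-embed w) ~> I.unbits (≋-trans eq (≋-reflexive (List.++-identityʳ _))) ~> I.unbit-embed (⟨ t ⟩ Plain.leaf)) ~>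
   code-map strip {Plain.leaf} {numberCode} t (everywhere {P = \ x -> Plain.leaf x ≡ numberCode (strip x)} (\ { (inl i) -> refl }) t) ,
   range ∘ α , \ x -> mk⇔ (\ _ _ -> rfl) \ _ -> subst (x ∈_) (sym (eval-map 𝐋 strip t (range ∘ α) ~> (eval-cong 𝐋 t \ { (inl i) -> refl }))) (full x)
  back (t , _ ∷ _ , _ , s≤s () , _)

 SAT∈NP⁰ : BP NP⁰ (SAT 𝐋)
 SAT∈NP⁰ = lifted , solvable-NP⁰ Plain.formula Plain.formula-inputs noConstants lifted solvable⇔ , \ w -> mk⇔ (lift ∘ fwd (Plain⇔ w)) (bwd (Plain⇔ w) ∘ lower) where
  lifted : List Carrier -> Set₁
  lifted w = Lift (lsuc 0ℓ) (Plain.Parsed w)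
  solvable⇔ : ∀ w -> lifted w ⇔ Solvable noConstants Plain.formula w
  solvable⇔ w = mk⇔ (\ p -> bwd (Plain.formula⇔ noConstants w) (lower p)) (\ s -> lift (fwd (Plain.formula⇔ noConstants w) s))

 SAT-constants∈NP : NP SAT-constants
 SAT-constants∈NP = forget (solvable-NP⁰ Constants.formula Constants.formula-inputs noConstants SAT-constants \ w -> mk⇔
  (\ s -> bwd (Constants.formula⇔ noConstants w) (bwd (Constants⇔ w) s))
  (\ s -> fwd (Constants⇔ w) (fwd (Constants.formula⇔ noConstants w) s))) where
  forget : NP⁰ SAT-constants -> NP SAT-constants
  forget (M , _ , decided) = M , decided

 SAT-hard : ∀ A -> BP NP⁰ A -> A Turing.≤ᵖ SAT 𝐋
 SAT-hard A (L , (M , constantFree , (c , within) , decided) , A⇔L) = T.reduction formula formula-inputs , T.reduction-time formula formula-inputs , \ w -> mk⇔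
  (\ a -> T.reduction-complete formula formula-inputs w noConstants (satisfied (embed w) (fwd (decided (embed w)) (fwd (A⇔L w) a)) (\ {w} -> within {w})))
  (\ s -> bwd (A⇔L w) (bwd (decided (embed w)) (accepts (embed w) (T.reduction-sound formula formula-inputs w noConstants s)))) where
  module T = TuringReduction em R real d'
  open Machine M using (code; extraNodes; extraAddresses)
  isOne : ∀ {z} -> z ≈ 0# ⊎ z ≈ 1# -> Bool
  isOne (inl _) = false
  isOne (inr _) = true
  chosen : ∀ p nd -> code p ≡ nd -> Bool
  chosen p (constant z t n) eq = isOne (constantFree p eq)
  chosen p _ eq = false
  constantTm : Fin (suc extraNodes) -> ∀ {k} -> Tm 0 k
  constantTm p = if chosen p (code p) refl then one else zero
  constant-value : ∀ p {z t n} -> code p ≡ constant z t n -> ∀ w v {k} (ρ : Vec ℕ k) -> ⟦_⟧ᵗ noConstants w v (constantTm p) ρ ≈ z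
  constant-value p eq w v ρ = go (code p) refl eq where
   read : ∀ {z} (h : z ≈ 0# ⊎ z ≈ 1#) -> ⟦_⟧ᵗ noConstants w v (if isOne h then one else zero) ρ ≈ z
   read (inl h) = symm h
   read (inr h) = symm h
   go : ∀ nd (e : code p ≡ nd) {z t n} -> nd ≡ constant z t n -> ⟦_⟧ᵗ noConstants w v (if chosen p nd e then one else zero) ρ ≈ z
   go _ e refl = read (constantFree p e)
  open CookLevin em R real M 0 noConstants constantTm constant-value c

 SAT-constants-hard : ∀ A -> NP A -> A ≤ᵖ SAT-constants
 SAT-constants-hard A (M , (c , within) , decided) = B.reduction κ formula formula-inputs , B.reduction-time κ formula formula-inputs , \ w -> mk⇔
  (\ a -> B.reduction-complete κ formula formula-inputs w (satisfied w (fwd (decided w) a) (\ {w} -> within {w})))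
  (\ s -> bwd (decided w) (accepts w (B.reduction-sound κ formula formula-inputs w s))) where
  open Machine M using (code; extraNodes; extraAddresses)
  module B = BSSReduction em R real d' (suc extraNodes)
  valueOf : Node (suc extraAddresses) (suc extraNodes) -> Carrier
  valueOf (constant z _ _) = z
  valueOf _ = 0#
  κ : Fin (suc extraNodes) -> Carrier
  κ p = valueOf (code p)
  open CookLevin em R real M (suc extraNodes) κ (\ p -> con p) (\ p eq w v ρ -> eq≈ (cong valueOf eq)) c

 complete : BP-Complete NP⁰ (SAT 𝐋) × NP-Complete SAT-constants
 complete = (SAT∈NP⁰ , SAT-hard) , SAT-constants∈NP , SAT-constants-hard

complete : EM → (R : Ring) → FormallyReal R → ∀ d → 3 ≤ d →
  let open BSS R
      open Subspaces R d
  in BP-Complete NP⁰ (SAT 𝐋) × NP-Complete SAT-constants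
complete em R real (suc (suc (suc d′))) (s≤s (s≤s (s≤s z≤n))) = Completeness.complete em R real d′

corollary3p1 :
  ExcludedMiddle (lsuc 0ℓ) →
  (F : Subfield) (d : ℕ) → 3 ≤ d →
  let open BSS (subfieldRing F)
      open Subspaces (subfieldRing F) d
  in BP-Complete NP⁰ (SAT 𝐋) × NP-Complete SAT-constants
corollary3p1 em F = complete em (subfieldRing F) record { 1≉0 = 1≉0 ; inverse = inverse ; sumOfSquares = sumOfSquares }
  where open RealField em F using (1≉0; inverse; sumOfSquares)
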